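{- Let $\Gamma$ be a ribbon graph whose underlying graph $G=(V,E,r)$ is connected and planar, and let $\Gamma^\flat_E$ be its blowup with the canonical perfect matching. Then: (a) $\langle\Gamma^\flat_E\rangle_2(1,-1)=2^{|V|}$ if $\Gamma$ is Eulerian, and $\langle\Gamma^\flat_E\rangle_2(1,-1)=0$ otherwise. (b) $\langle\Gamma^\flat_E\rangle_1(1)=\#\{3\text{ -edge colorings of }\Gamma\}$ when $\Gamma$ is trivalent. (c) $\Gamma$ is 4-face colorable if and only if $$\big(Q_4^{+}(\Gamma^\flat_E)-Q_4^{ - }(\Gamma^\flat_E)\big)\big|_{q=1}>0.$$ In particular, the $q$-graded homological condition $Q_4^{+}(\Gamma^\flat_E)>_{\mathrm{cw}}Q_4^{ - }(\Gamma^\flat_E)$ implies that $\Gamma$ is 4-face colorable. Thus proving this coefficientwise positivity condition for every connected planar ribbon graph $\Gamma$ would imply the four color theorem. (d) Given a nonnegative integer $n$ with $n\in2\mathbb{Z}$ or $n\in3\mathbb{Z}$, one has $\langle\Gamma^\flat_E\rangle_n(x)\ge\chi(\Gamma^*,n')$, where $\chi(\Gamma^*,n')$ is the chromatic polynomial, evaluated at $n'$, of the geometric dual $\Gamma^*$ of $\Gamma$, and $(x,n')$ is any of the following pairs: for $n>0$ even, $x=(q,b)=(1,1)$ and $n'=3n$, or $x=(q,b)=(1,-1)$ and $n'=n$; for $n$ odd, $x=q=1$ and $n'=3n$; for $n=0$, $x=(1,-1)$ and $n'=0$.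
   Context: **Ribbon graphs.** Graphs are finite undirected multigraphs $G=(V,E,r)$ with vertex set $V$, nonempty edge set $E$, and $r$ assigning to each edge its unordered pair of endpoints. A ribbon graph $\Gamma$ (always oriented here) is a graph $G$, its underlying graph, embedded in an oriented surface with boundary that deformation retracts onto $G$; equivalently, $G$ with a cyclic order of the half-edges at each vertex. It is represented by a ribbon diagram: a drawing of $G$ in the plane with vertices as dots and edges as curves that may cross, inducing the given cyclic orders. A perfect matching graph $\Gamma_M$ is a ribbon graph with a perfect matching $M$ of its underlying graph (each vertex is incident to exactly one edge of $M$). $\Gamma$ is trivalent if all vertices of $G$ have degree three, and Eulerian if all vertex degrees are even. A 3-edge coloring is a proper coloring of the edges with 3 colors. The faces of $\Gamma$ are the complementary regions of $G$ in the closed surface obtained by attaching discs to the boundary of the surface of $\Gamma$; $\Gamma$ is 4-face colorable if its faces can be colored with 4 colors so that the two sides of every edge have different colors. The geometric dual $\Gamma^*$ has one vertex per face and one edge for each edge of $G$, joining the faces on its two sides. **Blowup.** The blowup $\Gamma^\flat$ is the trivalent ribbon graph obtained by replacing every vertex of degree $d$ by a small circle carrying $d$ vertices, one at the end of each of the $d$ incident half-edges, in their cyclic order. The edges of $G$ form the canonical perfect matching of $\Gamma^\flat$, giving $\Gamma^\flat_E$. **Smoothings, states, $n$-bracket.** Draw a matching edge $e$ of a trivalent perfect matching graph vertically, with the two other half-edges at its top vertex going up-left and up-right, and the two other half-edges at its bottom vertex going down-left and down-right. The 0-smoothing deletes $e$ and its endpoints and joins up-left with down-left and up-right with down-right; the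 1-smoothing joins up-left with down-right and up-right with down-left. For $n\ge1$ the $n$-bracket is determined by $\langle\Gamma_M\rangle_n=\langle\text{0-smoothing at }e\rangle_n-\langle\text{1-smoothing at }e\rangle_n$ for every matching edge $e$, multiplicativity under disjoint union, and the value of a circle (possibly drawn with crossings) $$\langle\text{circle}\rangle_n=\begin{cases}2(2+2q^2+\dots+2q^{n-2}+qb+q^3b+\dots+q^{n-1}b)&n\text{ even},\\3(1+q+\dots+q^{n-1})&n\text{ odd},\end{cases}$$ where $q^n=1$ and (for $n$ even) $b^2=1$; its value is written $\langle\cdot\rangle_n(q,b)$ for $n$ even and $\langle\cdot\rangle_n(q)$ for $n$ odd. By convention $\langle\Gamma^\flat_E\rangle_0(1,-1)=0$. If $M=\{e_1,\dots,e_\ell\}$ and $\alpha\in\{0,1\}^\ell$, the state $\Gamma_\alpha$ is the collection of circles obtained by applying the $\alpha_i$-smoothing at each $e_i$; $k_\alpha$ is its number of circles, $|\alpha|=\sum\alpha_i$. **Möbius homology for even $n$.** Let $R=\mathbb{Z}[\frac1{3n}]$ and $V=R[x,y]/(x^n,y^3-xy)$ (not to be confused with the vertex set), with basis $x^iy^j$ ($0\le i\le n-1$, $0\le j\le2$), graded by $\mathbb{Z}/n\mathbb{Z}\times\mathbb{Z}/2\mathbb{Z}$ with $x^iy^j$ in degree $(2i+j,j)$. Let $\mu_V$ be multiplication, $m_V(v)=v\cdot x^{(n-2)/2}y^2$, and $$\Delta_V(v)=-\tfrac1{3n}\sum_{i+j=n,\ i,j>0}(vx^i)\otimes x^j+\tfrac1{3n}\sum_{i+j=n-1}\big((vx^iy^2)\otimes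 x^j+(vx^iy)\otimes x^jy+(vx^i)\otimes x^jy^2\big).$$ Put $C^{i}(\Gamma_M)=\bigoplus_{|\alpha|=i}V^{\otimes k_\alpha}$, with tensor factors indexed by the circles of $\Gamma_\alpha$. If $\alpha'$ arises from $\alpha$ by changing one entry 0 to 1, $\partial_{\alpha\alpha'}$ is $\mu_V$ if two circles merge, $\Delta_V$ if one circle splits into two, $m_V$ if one circle is changed into one circle, on the affected factors, and the identity on the others. The differential is $\partial^i(v)=\sum_{\alpha'}(-1)^{f_{\alpha\alpha'}}\partial_{\alpha\alpha'}(v)$ for $v\in V^{\otimes k_\alpha}$, where $f_{\alpha\alpha'}$ is the number of entries 1 to the left of the changed entry; it preserves the $\mathbb{Z}/n\mathbb{Z}\times\mathbb{Z}/2\mathbb{Z}$-grading. $MH_n^{i,(a,\epsilon)}(\Gamma_M;R)$ denotes the homology in homological degree $i$ and internal degree $(a,\epsilon)$. **Positive and negative parts.** $Q_n^{+}(\Gamma_M)=\sum q^a\,\mathrm{rank}\,MH_n^{i,(a,\epsilon)}(\Gamma_M;R)$, summed over all $i,a,\epsilon$ with $i+\epsilon\equiv0\bmod2$, and $Q_n^{ - }(\Gamma_M)$ is the same sum over $i+\epsilon\equiv1\bmod2$; both lie in $\mathbb{Z}[q]/(q^n-1)$. For $f,g\in\mathbb{Z}[q]/(q^4-1)$, $f>_{\mathrm{cw}}g$ means that, writing $f-g=c_0+c_1q+c_2q^2+c_3q^3$, all $c_i$ are nonnegative and at least one is positive.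
   Formalization: "Underlying graph connected and planar" is read as: Γ is connected and itself embedded in the sphere (|V|+|F|=|E|+2). With only G planar, (b) fails: the theta graph with equal cyclic orders at both vertices (genus 1) has bracket -6 but 6 three-edge colorings. -}

module Defs where

open import Algebra.Bundles using (CommutativeRing)
open import Algebra.Module.Bundles using (LeftModule)
open import Data.Bool.Base using (Bool; true; false; not; if_then_else_)
open import Data.Empty using (⊥-elim)
open import Data.Fin.Base using (Fin; zero; suc; toℕ; fromℕ<; punchIn; punchOut)
open import Data.Fin.Patterns using (0F; 1F; 2F)
open import Data.Fin.Properties using (_≟_; all?; inj⇒≟; 2↔Bool; +↔⊎; *↔×;
  punchInᵢ≢i; punchOut-injective; punchOut-punchIn; punchOut-cong)
open import Data.Fin.Subset using (Subset; ∣_∣)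
open import Data.Integer.Base using (ℤ; +_)
open import Data.List.Base using (List; []; _∷_; length; filter; concatMap;
  allFin; upTo; cartesianProductWith)
import Data.List.Base as List
open import Data.List.Membership.Propositional using (_∈_)
open import Data.List.Relation.Unary.Any using (here; there)
open import Data.Nat.Base using (ℕ; zero; suc; NonZero; ⌊_/2⌋; _%_)
import Data.Nat.Base as ℕ
import Data.Nat.Properties as ℕₚ
open import Data.Nat.Divisibility using (_∣_)
open import Data.Nat.GeneralisedArithmetic using (fold)
open import Data.Product.Base using (Σ-syntax; ∃; ∃-syntax; _×_; _,_; proj₁; proj₂)
open import Data.Product using (∃!)
open import Data.Product.Function.NonDependent.Propositional using (_×-↔_)
open import Data.Product.Properties using (≡-dec)
open import Data.Rational.Base as ℚ using (ℚ; 0ℚ; 1ℚ; _/_)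
import Data.Rational.Properties as ℚₚ
open import Data.Sum.Base using (_⊎_; inj₁; inj₂)
open import Data.Sum.Function.Propositional using (_⊎-↔_)
open import Data.Vec.Base using (Vec; []; _∷_; lookup; _[_]≔_)
import Data.Vec.Base as Vec
open import Function.Base using (_∘_)
open import Function.Bundles using (_↔_; mk↔ₛ′; module Inverse)
open import Function.Construct.Composition using (_↔-∘_)
open import Function.Construct.Identity using (↔-id)
open import Function.Construct.Symmetry using (↔-sym)
open import Function.Properties.Inverse using (↔⇒↣)
open import Level using (0ℓ)
open import Relation.Binary.Core using (Rel)
open import Relation.Binary.Construct.Closure.Equivalence as EqClosure using (EqClosure)
open import Relation.Binary.Construct.Closure.ReflexiveTransitive using (Star; _◅_; _◅◅_)
  renaming (ε to nil)
open import Relation.Binary.Construct.Closure.Symmetric using (fwd; bwd)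
open import Relation.Binary.Definitions using (DecidableEquality)
open import Relation.Binary.PropositionalEquality
  using (_≡_; _≢_; refl; sym; trans; cong; cong₂; subst; subst₂; isEquivalence)
open import Axiom.UniquenessOfIdentityProofs using (module Decidable⇒UIP)
open import Relation.Nullary using (¬_; Dec; yes; no; does; contradiction)
open import Relation.Nullary.Decidable using (¬?; _→-dec_)
open import Relation.Unary using (Pred)

open Inverse using (to; from; strictlyInverseˡ; strictlyInverseʳ)

record Finite (A : Set) : Set where
  field
    size  : ℕ
    index : A ↔ Fin size

  _≟ᶠ_ : DecidableEquality A
  _≟ᶠ_ = inj⇒≟ (↔⇒↣ index)

  elements : List A
  elements = List.map (from index) (allFin size)

open Finite using (size; index; elements)

finite-Fin : ∀ n → Finite (Fin n)
finite-Fin n = record { size = n ; index = ↔-id _ }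

finite-⊎ : ∀ {A B : Set} → Finite A → Finite B → Finite (A ⊎ B)
finite-⊎ F G = record
  { size  = size F ℕ.+ size G
  ; index = ↔-sym +↔⊎ ↔-∘ (index F ⊎-↔ index G) }

finite-×Bool : ∀ {A : Set} → Finite A → Finite (A × Bool)
finite-×Bool F = record
  { size  = size F ℕ.* 2
  ; index = ↔-sym *↔× ↔-∘ (index F ×-↔ ↔-sym 2↔Bool) }

record Quotient (A : Set) (_~_ : Rel A 0ℓ) : Set where
  field
    size       : ℕ
    class      : A → Fin size
    surjective : ∀ c → ∃[ a ] class a ≡ c
    sound      : ∀ {a b} → a ~ b → class a ≡ class b
    complete   : ∀ {a b} → class a ≡ class b → a ~ b

Linked : ∀ {A : Set} → List (A × A) → Rel A 0ℓ
Linked links = EqClosure (λ a b → (a , b) ∈ links)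

module _ {m} {i j : Fin (suc m)} (i≢j : i ≢ j) where

  merge : Fin (suc m) → Fin m
  merge k with i ≟ k
  ... | yes _  = punchOut i≢j
  ... | no i≢k = punchOut i≢k

  merge-surjective : ∀ c → merge (punchIn i c) ≡ c
  merge-surjective c with i ≟ punchIn i c
  ... | yes i≡ = ⊥-elim (punchInᵢ≢i i c (sym i≡))
  ... | no i≢  = trans (punchOut-cong i refl) (punchOut-punchIn i)

  merge-joins : merge i ≡ merge j
  merge-joins with i ≟ i | i ≟ j
  ... | no i≢i | _       = ⊥-elim (i≢i refl)
  ... | yes _  | yes i≡j = ⊥-elim (i≢j i≡j)
  ... | yes _  | no _    = punchOut-cong i refl

  merge-cases : ∀ {k l} → merge k ≡ merge l →
                k ≡ l ⊎ (k ≡ i × l ≡ j) ⊎ (k ≡ j × l ≡ i)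
  merge-cases {k} {l} eq with i ≟ k | i ≟ l
  ... | yes i≡k | yes i≡l = inj₁ (trans (sym i≡k) i≡l)
  ... | yes i≡k | no i≢l  = inj₂ (inj₁ (sym i≡k , sym (punchOut-injective i≢j i≢l eq)))
  ... | no i≢k  | yes i≡l = inj₂ (inj₂ (punchOut-injective i≢k i≢j eq , sym i≡l))
  ... | no i≢k  | no i≢l  = inj₁ (punchOut-injective i≢k i≢l eq)

quotient : ∀ {A : Set} → Finite A → (links : List (A × A)) → Quotient A (Linked links)
quotient F [] = record
  { size       = size F
  ; class      = to (index F)
  ; surjective = λ c → from (index F) c , strictlyInverseˡ (index F) c
  ; sound      = EqClosure.gfold isEquivalence (to (index F)) λ ()
  ; complete   = λ {a} {b} eq → subst (Linked [] a)
      (trans (sym (strictlyInverseʳ (index F) a))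
        (trans (cong (from (index F)) eq) (strictlyInverseʳ (index F) b))) nil
  }
quotient {A} F ((x , y) ∷ links) = extend (quotient F links)
  where
  weaken : ∀ {a b} → Linked links a b → Linked ((x , y) ∷ links) a b
  weaken = EqClosure.map there

  x~y : Linked ((x , y) ∷ links) x y
  x~y = fwd (here refl) ◅ nil

  y~x : Linked ((x , y) ∷ links) y x
  y~x = bwd (here refl) ◅ nil

  extend : Quotient A (Linked links) → Quotient A (Linked ((x , y) ∷ links))
  extend Q with Quotient.class Q x ≟ Quotient.class Q y
  ... | yes x≡y = record
    { size       = Quotient.size Q
    ; class      = Quotient.class Q
    ; surjective = Quotient.surjective Q
    ; sound      = EqClosure.gfold isEquivalence (Quotient.class Q)
        λ { (here refl) → x≡y ; (there l) → Quotient.sound Q (fwd l ◅ nil) }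
    ; complete   = weaken ∘ Quotient.complete Q
    }
  ... | no x≢y with Q
  ...   | record { size = zero ; class = class } with () ← class x
  ...   | record { size = suc m ; class = class ; surjective = surjective
                 ; sound = sound ; complete = complete } = record
    { size       = m
    ; class      = merge x≢y ∘ class
    ; surjective = λ c → let a , eq = surjective (punchIn (class x) c) in
        a , trans (cong (merge x≢y) eq) (merge-surjective x≢y c)
    ; sound      = EqClosure.gfold isEquivalence (merge x≢y ∘ class)
        λ { (here refl) → merge-joins x≢y
          ; (there l)   → cong (merge x≢y) (sound (fwd l ◅ nil)) }
    ; complete   = λ eq → complete′ (merge-cases x≢y eq)
    }
    where
    complete′ : ∀ {a b} →
      class a ≡ class b ⊎ (class a ≡ class x × class b ≡ class y)
                        ⊎ (class a ≡ class y × class b ≡ class x) →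
      Linked ((x , y) ∷ links) a b
    complete′ (inj₁ a≡b) = weaken (complete a≡b)
    complete′ (inj₂ (inj₁ (a≡x , b≡y))) =
      weaken (complete a≡x) ◅◅ x~y ◅◅ weaken (complete (sym b≡y))
    complete′ (inj₂ (inj₂ (a≡y , b≡x))) =
      weaken (complete a≡y) ◅◅ y~x ◅◅ weaken (complete (sym b≡x))

-- The edge e has the two half-edges (e , false) and (e , true), so that
-- r(e) = {end (e , false) , end (e , true)}.

record Graph : Set₁ where
  field
    V E      : Set
    finV     : Finite V
    finE     : Finite E
    nonempty : NonZero (size finE)
    end      : E × Bool → V

  HalfEdge : Set
  HalfEdge = E × Bool

  flip : HalfEdge → HalfEdge
  flip (e , b) = e , not b

  finH : Finite HalfEdge
  finH = finite-×Bool finE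

  #V : ℕ
  #V = size finV

  #E : ℕ
  #E = size finE

  -- A loop contributes two to the degree of its vertex.
  HasDegree : V → ℕ → Set
  HasDegree v d = (Σ[ h ∈ HalfEdge ] end h ≡ v) ↔ Fin d

  Trivalent : Set
  Trivalent = ∀ v → HasDegree v 3

  Eulerian : Set
  Eulerian = ∀ v → ∃[ d ] HasDegree v d × 2 ∣ d

  Adjacent : Rel V 0ℓ
  Adjacent v w = ∃[ h ] end h ≡ v × end (flip h) ≡ w

  Connected : Set
  Connected = ∀ v w → Star Adjacent v w

  AdjacentOff : E → Rel V 0ℓ
  AdjacentOff e v w = ∃[ h ] proj₁ h ≢ e × end h ≡ v × end (flip h) ≡ w

  -- Used for connected graphs only: no edge disconnects the graph.
  Bridgeless : Set
  Bridgeless = ∀ e v w → Star (AdjacentOff e) v w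

colourings : ∀ k m → List (Vec (Fin k) m)
colourings k zero    = [] ∷ []
colourings k (suc m) = cartesianProductWith _∷_ (allFin k) (colourings k m)

module _ (G : Graph) where
  open Graph G

  ProperVertexColouring : ∀ {k} → Vec (Fin k) #V → Set
  ProperVertexColouring c = ∀ i →
    let e = from (index finE) i in
    lookup c (to (index finV) (end (e , false))) ≢ lookup c (to (index finV) (end (e , true)))

  properVertexColouring? : ∀ {k} (c : Vec (Fin k) #V) → Dec (ProperVertexColouring c)
  properVertexColouring? c = all? λ _ → ¬? (_ ≟ _)

  -- The value of the chromatic polynomial at k is the number of proper
  -- k-colourings; it is 0 if there is a loop.
  χ : ℕ → ℕ
  χ k = length (filter properVertexColouring? (colourings k #V))

  -- Two different half-edges at one vertex get different colours; in
  -- particular a graph with a loop has no proper edge colouring.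
  ProperEdgeColouring : ∀ {k} → Vec (Fin k) #E → Set
  ProperEdgeColouring c = ∀ i j →
    let h = from (index finH) i
        h′ = from (index finH) j in
    i ≢ j → end h ≡ end h′ →
    lookup c (to (index finE) (proj₁ h)) ≢ lookup c (to (index finE) (proj₁ h′))

  properEdgeColouring? : ∀ {k} (c : Vec (Fin k) #E) → Dec (ProperEdgeColouring c)
  properEdgeColouring? c = all? λ i → all? λ j →
    ¬? (i ≟ j) →-dec (Finite._≟ᶠ_ finV _ _ →-dec ¬? (_ ≟ _))

  #edgeColourings : ℕ → ℕ
  #edgeColourings k = length (filter properEdgeColouring? (colourings k #E))

-- `next` is the counterclockwise rotation of the half-edges; `cyclic` says
-- that it permutes the half-edges at each vertex in a single cycle.

record RibbonGraph : Set₁ where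
  field
    graph : Graph

  open Graph graph public

  field
    next     : HalfEdge ↔ HalfEdge
    next-end : ∀ h → end (to next h) ≡ end h
    cyclic   : ∀ {h h′} → end h ≡ end h′ → ∃[ k ] fold h (to next) k ≡ h′

  -- A face is an orbit of `next ∘ flip`: walk along an edge and turn at its
  -- far end.  The two sides of an edge belong to its two half-edges.
  faces : Quotient HalfEdge (Linked (List.map (λ h → h , to next (flip h)) (elements finH)))
  faces = quotient finH _

  #F : ℕ
  #F = Quotient.size faces

  face : HalfEdge → Fin #F
  face = Quotient.class faces

  FaceColourable : ℕ → Set
  FaceColourable k = Σ[ c ∈ (Fin #F → Fin k) ] (∀ e → c (face (e , false)) ≢ c (face (e , true)))

  -- For connected Γ: the closed surface has Euler characteristic 2, i.e. it
  -- is a sphere.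
  Planar : Set
  Planar = #V ℕ.+ #F ≡ #E ℕ.+ 2

  dual : Graph
  dual = record
    { V = Fin #F ; E = E ; finV = finite-Fin #F ; finE = finE
    ; nonempty = nonempty ; end = face }

record PerfectMatching (Γ : RibbonGraph) : Set where
  open RibbonGraph Γ
  field
    -- The matching is M = {e₁ , … , e_#M} with eᵢ = from split (inj₁ i); the
    -- remaining edges are enumerated as well.
    #M #N   : ℕ
    split   : E ↔ (Fin #M ⊎ Fin #N)
    perfect : ∀ v → ∃! _≡_ λ ((i , b) : Fin #M × Bool) → end (from split (inj₁ i) , b) ≡ v

record TrivalentPMGraph : Set₁ where
  field
    ribbon    : RibbonGraph
    trivalent : RibbonGraph.Trivalent ribbon
    matching  : PerfectMatching ribbon

  open RibbonGraph ribbon public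
  open PerfectMatching matching public

  private
    fin3-pigeonhole : (P Q : Fin 3 → Set) →
      (∀ i j → P i → P j → i ≡ j) → (∀ i j → Q i → Q j → i ≡ j) → ¬ (∀ i → P i ⊎ Q i)
    fin3-pigeonhole P Q p q f with f 0F | f 1F | f 2F
    ... | inj₁ a | inj₁ b | _      with () ← p _ _ a b
    ... | inj₁ a | inj₂ _ | inj₁ c with () ← p _ _ a c
    ... | inj₁ _ | inj₂ b | inj₂ c with () ← q _ _ b c
    ... | inj₂ a | inj₂ b | _      with () ← q _ _ a b
    ... | inj₂ a | inj₁ _ | inj₂ c with () ← q _ _ a c
    ... | inj₂ _ | inj₁ b | inj₁ c with () ← p _ _ b c

  next²≢ : ∀ h → to next (to next h) ≢ h
  next²≢ h eq = fin3-pigeonhole (λ i → at i ≡ h) (λ i → at i ≡ to next h)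
    (λ i j p q → at-injective (trans p (sym q)))
    (λ i j p q → at-injective (trans p (sym q)))
    (λ i → let k , e = cyclic (sym (proj₂ (from (trivalent (end h)) i)))
           in subst (λ z → z ≡ h ⊎ z ≡ to next h) e (orbit k))
    where
    at : Fin 3 → HalfEdge
    at i = proj₁ (from (trivalent (end h)) i)

    uip : ∀ {v w : V} (p q : v ≡ w) → p ≡ q
    uip = Decidable⇒UIP.≡-irrelevant (Finite._≟ᶠ_ finV)

    fibre-≡ : ∀ {s t : Σ[ h′ ∈ HalfEdge ] end h′ ≡ end h} → proj₁ s ≡ proj₁ t → s ≡ t
    fibre-≡ {x , p} {.x , q} refl = cong (x ,_) (uip p q)

    at-injective : ∀ {i j} → at i ≡ at j → i ≡ j
    at-injective {i} {j} e =
      trans (sym (strictlyInverseˡ (trivalent (end h)) i))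
        (trans (cong (to (trivalent (end h))) (fibre-≡ e))
          (strictlyInverseˡ (trivalent (end h)) j))

    orbit : ∀ k → fold h (to next) k ≡ h ⊎ fold h (to next) k ≡ to next h
    orbit zero = inj₁ refl
    orbit (suc k) with orbit k
    ... | inj₁ e = inj₂ (cong (to next) e)
    ... | inj₂ e = inj₁ (trans (cong (to next) e) eq)

  next≢ : ∀ h → to next h ≢ h
  next≢ h eq = next²≢ h (trans (cong (to next) eq) eq)

  matched : Fin #M → Bool → HalfEdge
  matched i b = from split (inj₁ i) , b

  unmatched : ∀ i b h → end h ≡ end (matched i b) → h ≢ matched i b →
              ∃[ f ] from split (inj₂ f) ≡ proj₁ h
  unmatched i b h at h≢ with to split (proj₁ h) in eq
  ... | inj₂ f = f , trans (cong (from split) (sym eq)) (strictlyInverseʳ split (proj₁ h))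
  ... | inj₁ j = contradiction h≡ h≢
    where
    same : from split (inj₁ j) ≡ proj₁ h
    same = trans (cong (from split) (sym eq)) (strictlyInverseʳ split (proj₁ h))

    unique : ∀ {p : Fin #M × Bool} → end (matched (proj₁ p) (proj₂ p)) ≡ end (matched i b) →
             proj₁ (perfect (end (matched i b))) ≡ p
    unique = proj₂ (proj₂ (perfect (end (matched i b))))

    j≡i : (j , proj₂ h) ≡ (i , b)
    j≡i = trans (sym (unique (trans (cong (λ e → end (e , proj₂ h)) same) at))) (unique refl)

    h≡ : h ≡ matched i b
    h≡ = trans (cong (_, proj₂ h) (sym same)) (cong (λ (k , c) → matched k c) j≡i)

  -- The two non-matching edges following the matching edge eᵢ, in the
  -- rotation at its end b.
  foot₁ foot₂ : Fin #M → Bool → Fin #N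
  foot₁ i b = proj₁ (unmatched i b (to next m) (next-end m) (next≢ m))
    where m = matched i b
  foot₂ i b = proj₁ (unmatched i b (to next (to next m))
                (trans (next-end _) (next-end m)) (next²≢ m))
    where m = matched i b

  -- For a vertical matching edge, foot₁ and foot₂ at its top vertex point
  -- up-right and up-left, and at its bottom vertex down-left and down-right.
  smoothing : Bool → Fin #M → List (Fin #N × Fin #N)
  smoothing false i = (foot₂ i true , foot₁ i false) ∷ (foot₁ i true , foot₂ i false) ∷ []
  smoothing true  i = (foot₂ i true , foot₂ i false) ∷ (foot₁ i true , foot₁ i false) ∷ []

  -- Every circle of a state runs along at least one non-matching edge, so
  -- circles are classes of non-matching edges.
  State : Set
  State = Subset #M

  circles : (α : State) →
    Quotient (Fin #N) (Linked (concatMap (λ i → smoothing (lookup α i) i) (allFin #M)))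
  circles α = quotient (finite-Fin #N) _

  #circles : State → ℕ
  #circles α = Quotient.size (circles α)

  circle : (α : State) → Fin #N → Fin (#circles α)
  circle α = Quotient.class (circles α)

-- The vertex of the blowup at the end of the half-edge h is called h, and
-- the arc inj₂ h runs from h to next h along the small circle.  An isolated
-- vertex leaves nothing behind; connected graphs with an edge have none.

module _ (Γ : RibbonGraph) where
  open RibbonGraph Γ

  private
    V♭ E♭ H♭ : Set
    V♭ = HalfEdge
    E♭ = E ⊎ HalfEdge
    H♭ = E♭ × Bool

    end♭ : H♭ → V♭
    end♭ (inj₁ e , b)     = e , b
    end♭ (inj₂ h , false) = h
    end♭ (inj₂ h , true)  = to next h

    outward toNext fromPrev : V♭ → H♭
    outward (e , b) = inj₁ e , b
    toNext h        = inj₂ h , false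
    fromPrev h      = inj₂ (from next h) , true

    rotate rotate⁻¹ : H♭ → H♭
    rotate (inj₁ e , b)     = toNext (e , b)
    rotate (inj₂ h , false) = fromPrev h
    rotate (inj₂ h , true)  = outward (to next h)
    rotate⁻¹ (inj₁ e , b)     = fromPrev (e , b)
    rotate⁻¹ (inj₂ h , false) = outward h
    rotate⁻¹ (inj₂ h , true)  = toNext (to next h)

    rotate-rotate⁻¹ : ∀ x → rotate (rotate⁻¹ x) ≡ x
    rotate-rotate⁻¹ (inj₁ e , b)     = cong outward (strictlyInverseˡ next (e , b))
    rotate-rotate⁻¹ (inj₂ h , false) = refl
    rotate-rotate⁻¹ (inj₂ h , true)  = cong (λ g → inj₂ g , true) (strictlyInverseʳ next h)

    rotate⁻¹-rotate : ∀ x → rotate⁻¹ (rotate x) ≡ x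
    rotate⁻¹-rotate (inj₁ e , b)     = refl
    rotate⁻¹-rotate (inj₂ h , false) = cong toNext (strictlyInverseˡ next h)
    rotate⁻¹-rotate (inj₂ h , true)  = cong (λ g → inj₂ g , true) (strictlyInverseʳ next h)

    rotate-end : ∀ x → end♭ (rotate x) ≡ end♭ x
    rotate-end (inj₁ e , b)     = refl
    rotate-end (inj₂ h , false) = strictlyInverseˡ next h
    rotate-end (inj₂ h , true)  = refl

    place : V♭ → Fin 3 → H♭
    place v 0F = outward v
    place v 1F = toNext v
    place v 2F = fromPrev v

    placeOf : H♭ → Fin 3
    placeOf (inj₁ e , b)     = 0F
    placeOf (inj₂ h , false) = 1F
    placeOf (inj₂ h , true)  = 2F

    place-placeOf : ∀ x → place (end♭ x) (placeOf x) ≡ x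
    place-placeOf (inj₁ e , b)     = refl
    place-placeOf (inj₂ h , false) = refl
    place-placeOf (inj₂ h , true)  = cong (λ g → inj₂ g , true) (strictlyInverseʳ next h)

    placeOf-place : ∀ v i → placeOf (place v i) ≡ i
    placeOf-place v 0F = refl
    placeOf-place v 1F = refl
    placeOf-place v 2F = refl

    end-place : ∀ v i → end♭ (place v i) ≡ v
    end-place v 0F = refl
    end-place v 1F = refl
    end-place v 2F = strictlyInverseˡ next v

    turn : ∀ v i j → ∃[ k ] fold (place v i) rotate k ≡ place v j
    turn v 0F 0F = 0 , refl
    turn v 0F 1F = 1 , refl
    turn v 0F 2F = 2 , refl
    turn v 1F 0F = 2 , cong outward (strictlyInverseˡ next v)
    turn v 1F 1F = 0 , refl
    turn v 1F 2F = 1 , refl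
    turn v 2F 0F = 1 , cong outward (strictlyInverseˡ next v)
    turn v 2F 1F = 2 , cong toNext (strictlyInverseˡ next v)
    turn v 2F 2F = 0 , refl

    cyclic♭ : ∀ {x y} → end♭ x ≡ end♭ y → ∃[ k ] fold x rotate k ≡ y
    cyclic♭ {x} {y} eq = subst₂ (λ s t → ∃[ k ] fold s rotate k ≡ t)
      (place-placeOf x)
      (trans (cong (λ v → place v (placeOf y)) eq) (place-placeOf y))
      (turn (end♭ x) (placeOf x) (placeOf y))

    uip : ∀ {v w : V♭} (p q : v ≡ w) → p ≡ q
    uip = Decidable⇒UIP.≡-irrelevant (Finite._≟ᶠ_ finH)

    fibre-≡ : ∀ {v} {s t : Σ[ x ∈ H♭ ] end♭ x ≡ v} → proj₁ s ≡ proj₁ t → s ≡ t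
    fibre-≡ {s = x , p} {t = .x , q} refl = cong (x ,_) (uip p q)

    nonZero-+ : ∀ m n → NonZero m → NonZero (m ℕ.+ n)
    nonZero-+ (suc m) n _ = _

  blowupRibbon : RibbonGraph
  blowupRibbon = record
    { graph    = record
      { V = V♭ ; E = E♭ ; finV = finH ; finE = finite-⊎ finE finH
      ; nonempty = nonZero-+ _ _ nonempty ; end = end♭ }
    ; next     = mk↔ₛ′ rotate rotate⁻¹ rotate-rotate⁻¹ rotate⁻¹-rotate
    ; next-end = rotate-end
    ; cyclic   = cyclic♭
    }

  blowup : TrivalentPMGraph
  blowup = record
    { ribbon    = blowupRibbon
    ; trivalent = λ v → mk↔ₛ′
        (placeOf ∘ proj₁)
        (λ i → place v i , end-place v i)
        (placeOf-place v)
        (λ { (x , refl) → fibre-≡ (place-placeOf x) })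
    ; matching  = record
      { #M      = #E
      ; #N      = size finH
      ; split   = index finE ⊎-↔ index finH
      ; perfect = λ (e , b) →
          (to (index finE) e , b)
          , cong (_, b) (strictlyInverseʳ (index finE) e)
          , λ eq → trans
              (cong (λ (e′ , b′) → to (index finE) e′ , b′) (sym eq))
              (cong (_, _) (strictlyInverseˡ (index finE) _))
      }
    }

module _ where
  open Data.Integer.Base using (_+_; _*_; _-_; _^_)

  ∑ˡ : List ℤ → ℤ
  ∑ˡ = List.foldr _+_ (+ 0)

  -- ⟨Γ⟩ = ⟨0-smoothing at e⟩ - ⟨1-smoothing at e⟩, for the matching edges in turn.
  alternatingSum : ∀ {ℓ} → (Subset ℓ → ℤ) → ℤ
  alternatingSum {zero}  f = f []
  alternatingSum {suc ℓ} f =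
    alternatingSum (λ α → f (false ∷ α)) - alternatingSum (λ α → f (true ∷ α))

  bracket : ℤ → TrivalentPMGraph → ℤ
  bracket d Γ = alternatingSum (λ α → d ^ TrivalentPMGraph.#circles Γ α)

  circleEven : ℕ → ℤ → ℤ → ℤ
  circleEven n q b = + 2 * ∑ˡ (List.map
    (λ k → + 2 * q ^ (2 ℕ.* k) + q ^ suc (2 ℕ.* k) * b) (upTo ⌊ n /2⌋))

  circleOdd : ℕ → ℤ → ℤ
  circleOdd n q = + 3 * ∑ˡ (List.map (q ^_) (upTo n))

  -- The values at (q , b) and at q of the n-bracket, for n even and n odd
  -- respectively, at integers with q ^ n ≡ 1 and b ^ 2 ≡ 1.
  bracketEven : TrivalentPMGraph → ℕ → ℤ → ℤ → ℤ
  bracketEven Γ zero      q b = + 0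
  bracketEven Γ n@(suc _) q b = bracket (circleEven n q b) Γ

  bracketOdd : TrivalentPMGraph → ℕ → ℤ → ℤ
  bracketOdd Γ n q = bracket (circleOdd n q) Γ

module _ (d : ℕ) .{{_ : NonZero d}} where

  -- The subring of ℚ generated by 1/d.
  data InLocalization : ℚ → Set where
    one : InLocalization 1ℚ
    inv : InLocalization (+ 1 / d)
    add : ∀ {x y} → InLocalization x → InLocalization y → InLocalization (x ℚ.+ y)
    mul : ∀ {x y} → InLocalization x → InLocalization y → InLocalization (x ℚ.* y)
    neg : ∀ {x} → InLocalization x → InLocalization (ℚ.- x)

  ℤ[1/_] : CommutativeRing 0ℓ 0ℓ
  ℤ[1/_] = record
    { Carrier = ∃ InLocalization
    ; _≈_     = λ x y → proj₁ x ≡ proj₁ y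
    ; _+_     = λ (x , p) (y , q) → x ℚ.+ y , add p q
    ; _*_     = λ (x , p) (y , q) → x ℚ.* y , mul p q
    ; -_      = λ (x , p) → ℚ.- x , neg p
    ; 0#      = 0ℚ , subst InLocalization (ℚₚ.+-inverseʳ 1ℚ) (add one (neg one))
    ; 1#      = 1ℚ , one
    ; isCommutativeRing = record
      { isRing = record
        { +-isAbelianGroup = record
          { isGroup = record
            { isMonoid = record
              { isSemigroup = record
                { isMagma = record
                  { isEquivalence = record { refl = refl ; sym = sym ; trans = trans }
                  ; ∙-cong = cong₂ ℚ._+_ }
                ; assoc = λ (x , _) (y , _) (z , _) → ℚₚ.+-assoc x y z }
              ; identity = (λ (x , _) → ℚₚ.+-identityˡ x) , (λ (x , _) → ℚₚ.+-identityʳ x) }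
            ; inverse = (λ (x , _) → ℚₚ.+-inverseˡ x) , (λ (x , _) → ℚₚ.+-inverseʳ x)
            ; ⁻¹-cong = cong (λ x → ℚ.- x) }
          ; comm = λ (x , _) (y , _) → ℚₚ.+-comm x y }
        ; *-cong = cong₂ ℚ._*_
        ; *-assoc = λ (x , _) (y , _) (z , _) → ℚₚ.*-assoc x y z
        ; *-identity = (λ (x , _) → ℚₚ.*-identityˡ x) , (λ (x , _) → ℚₚ.*-identityʳ x)
        ; distrib = (λ (x , _) (y , _) (z , _) → ℚₚ.*-distribˡ-+ x y z)
                  , (λ (x , _) (y , _) (z , _) → ℚₚ.*-distribʳ-+ x y z) }
      ; *-comm = λ (x , _) (y , _) → ℚₚ.*-comm x y } }

module _ {c ℓ} (R : CommutativeRing c ℓ) where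
  open CommutativeRing R renaming (Carrier to ∣R∣; refl to ≈-refl; sym to ≈-sym; trans to ≈-trans)
  open import Algebra.Properties.Ring ring using (-1*x≈-x; -‿distribʳ-*)
  open import Algebra.Properties.AbelianGroup +-abelianGroup using (⁻¹-∙-comm; ⁻¹-involutive)
  open import Algebra.Properties.CommutativeSemigroup +-commutativeSemigroup using (interchange)
  open import Relation.Binary.Reasoning.Setoid setoid

  -- The subquotient Z / (Z ∩ B) of the module of functions I → R.
  module Subquotient {I : Set} {z b} (Z : Pred (I → ∣R∣) z) (B : Pred (I → ∣R∣) b)
    (Z-resp : ∀ {v w} → (∀ i → v i ≈ w i) → Z v → Z w)
    (Z-0 : Z (λ _ → 0#))
    (Z-+ : ∀ {v w} → Z v → Z w → Z (λ i → v i + w i))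
    (Z-* : ∀ r {v} → Z v → Z (λ i → r * v i))
    (B-resp : ∀ {v w} → (∀ i → v i ≈ w i) → B v → B w)
    (B-0 : B (λ _ → 0#))
    (B-+ : ∀ {v w} → B v → B w → B (λ i → v i + w i))
    (B-* : ∀ r {v} → B v → B (λ i → r * v i))
    where

    private
      _∼_ : Rel (I → ∣R∣) b
      v ∼ w = B (λ i → v i - w i)

      pointwise : ∀ {v w} → (∀ i → v i ≈ w i) → v ∼ w
      pointwise v≈w = B-resp (λ i → ≈-sym (≈-trans (+-congʳ (v≈w i)) (-‿inverseʳ _))) B-0

      -‿resp : ∀ {v w} → v ∼ w → (λ i → - v i) ∼ (λ i → - w i)
      -‿resp p = B-resp (λ i → ≈-trans (-1*x≈-x _) (≈-sym (⁻¹-∙-comm _ _))) (B-* (- 1#) p)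

      ∼-sym : ∀ {v w} → v ∼ w → w ∼ v
      ∼-sym {v} {w} p = B-resp
        (λ i → begin
          - 1# * (v i - w i)   ≈⟨ -1*x≈-x _ ⟩
          - (v i - w i)        ≈⟨ ⁻¹-∙-comm _ _ ⟨
          - v i + - - w i      ≈⟨ +-comm _ _ ⟩
          - - w i - v i        ≈⟨ +-congʳ (⁻¹-involutive _) ⟩
          w i - v i            ∎)
        (B-* (- 1#) p)

      ∼-trans : ∀ {u v w} → u ∼ v → v ∼ w → u ∼ w
      ∼-trans {u} {v} {w} p q = B-resp
        (λ i → begin
          (u i - v i) + (v i - w i)     ≈⟨ +-assoc _ _ _ ⟩
          u i + (- v i + (v i - w i))   ≈⟨ +-congˡ (+-assoc _ _ _) ⟨
          u i + ((- v i + v i) - w i)   ≈⟨ +-congˡ (+-congʳ (-‿inverseˡ _)) ⟩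
          u i + (0# - w i)              ≈⟨ +-congˡ (+-identityˡ _) ⟩
          u i - w i                     ∎)
        (B-+ p q)

      +-resp : ∀ {u v w x} → u ∼ v → w ∼ x → (λ i → u i + w i) ∼ (λ i → v i + x i)
      +-resp p q = B-resp
        (λ i → ≈-trans (interchange _ _ _ _) (+-congˡ (⁻¹-∙-comm _ _))) (B-+ p q)

      *-resp : ∀ {r s v w} → r ≈ s → v ∼ w → (λ i → r * v i) ∼ (λ i → s * w i)
      *-resp {r} {s} {v} {w} r≈s p = B-resp
        (λ i → begin
          r * (v i - w i)         ≈⟨ distribˡ _ _ _ ⟩
          r * v i + r * - w i     ≈⟨ +-congˡ (-‿distribʳ-* _ _) ⟨
          r * v i - r * w i       ≈⟨ +-congˡ (-‿cong (*-congʳ r≈s)) ⟩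
          r * v i - s * w i       ∎)
        (B-* r p)

    leftModule : LeftModule ring (c Level.⊔ z) b
    leftModule = record
      { Carrierᴹ = ∃ Z
      ; _≈ᴹ_     = λ (v , _) (w , _) → v ∼ w
      ; _+ᴹ_     = λ (v , p) (w , q) → (λ i → v i + w i) , Z-+ p q
      ; _*ₗ_     = λ r (v , p) → (λ i → r * v i) , Z-* r p
      ; 0ᴹ       = (λ _ → 0#) , Z-0
      ; -ᴹ_      = λ (v , p) → (λ i → - v i) , Z-resp (λ i → -1*x≈-x (v i)) (Z-* (- 1#) p)
      ; isLeftModule = record
        { isLeftSemimodule = record
          { +ᴹ-isCommutativeMonoid = record
            { isMonoid = record
              { isSemigroup = record
                { isMagma = record
                  { isEquivalence = record
                    { refl = pointwise (λ _ → ≈-refl) ; sym = ∼-sym ; trans = ∼-trans }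
                  ; ∙-cong = +-resp }
                ; assoc = λ _ _ _ → pointwise (λ _ → +-assoc _ _ _) }
              ; identity = (λ _ → pointwise (λ _ → +-identityˡ _))
                         , (λ _ → pointwise (λ _ → +-identityʳ _)) }
            ; comm = λ _ _ → pointwise (λ _ → +-comm _ _) }
          ; isPreleftSemimodule = record
            { *ₗ-cong      = *-resp
            ; *ₗ-zeroˡ     = λ _ → pointwise (λ _ → zeroˡ _)
            ; *ₗ-distribʳ  = λ _ _ _ → pointwise (λ _ → distribʳ _ _ _)
            ; *ₗ-identityˡ = λ _ → pointwise (λ _ → *-identityˡ _)
            ; *ₗ-assoc     = λ _ _ _ → pointwise (λ _ → *-assoc _ _ _)
            ; *ₗ-zeroʳ     = λ _ → pointwise (λ _ → zeroʳ _)
            ; *ₗ-distribˡ  = λ _ _ _ → pointwise (λ _ → distribˡ _ _ _) } }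
        ; -ᴹ‿cong    = -‿resp
        ; -ᴹ‿inverse = (λ _ → pointwise (λ _ → -‿inverseˡ _))
                     , (λ _ → pointwise (λ _ → -‿inverseʳ _)) } }

  module _ {m ℓm} (M : LeftModule ring m ℓm) where
    open LeftModule M
    open import Algebra.Properties.CommutativeMonoid.Sum +ᴹ-commutativeMonoid using (sum)

    LinearlyIndependent : ∀ {k} → (Fin k → Carrierᴹ) → Set _
    LinearlyIndependent {k} v =
      ∀ (a : Fin k → ∣R∣) → sum (λ i → a i *ₗ v i) ≈ᴹ 0ᴹ → ∀ i → a i ≈ 0#

    HasRank : ℕ → Set _
    HasRank k = ∃ (LinearlyIndependent {k}) × ¬ ∃ (LinearlyIndependent {suc k})

-- Only R = ℤ[1/3n] with its element 1/3n is used; see `Möbius` below.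

module MöbiusOver (R : CommutativeRing 0ℓ 0ℓ) (1/3n : CommutativeRing.Carrier R)
  (n : ℕ) .{{n≢0 : NonZero n}} where

  open CommutativeRing R renaming (Carrier to ∣R∣; refl to ≈-refl; sym to ≈-sym; trans to ≈-trans)
  open import Algebra.Properties.Semiring.Sum semiring
  open import Algebra.Properties.Semiring.Exp semiring using (_^_)
  open import Algebra.Properties.CommutativeSemigroup *-commutativeSemigroup using (x∙yz≈y∙xz)

  -- (i , j) stands for the basis element x^i y^j.
  Monomial : Set
  Monomial = Fin n × Fin 3

  V V⊗V : Set
  V   = Monomial → ∣R∣
  V⊗V = Monomial × Monomial → ∣R∣

  basis : Monomial → V
  basis m m′ = if does (≡-dec _≟_ _≟_ m m′) then 1# else 0#

  -- The normal form of x^i y^j modulo x^n and y^3 - xy.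
  infix 22 x^_y^_
  x^_y^_ : ℕ → ℕ → V
  x^ i y^ suc (suc (suc j)) = x^ suc i y^ suc j
  x^ i y^ j with i ℕₚ.<? n | j ℕₚ.<? 3
  ... | yes i<n | yes j<3 = basis (fromℕ< i<n , fromℕ< j<3)
  ... | _       | _       = λ _ → 0#

  infix 20 _⊗_
  _⊗_ : V → V → V⊗V
  (v ⊗ w) (a , b) = v a * w b

  μ : V⊗V → V
  μ t m = ∑[ i < n ] ∑[ j < 3 ] ∑[ k < n ] ∑[ l < 3 ]
    (t ((i , j) , (k , l)) * (x^ toℕ i ℕ.+ toℕ k y^ (toℕ j ℕ.+ toℕ l)) m)

  infixl 21 _·_
  _·_ : V → V → V
  v · w = μ (v ⊗ w)

  -- The value for even n ≥ 2.
  mV : V → V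
  mV v = v · x^ ⌊ n ℕ.∸ 2 /2⌋ y^ 2

  -- The first sum runs over i + j = n with i = 1 + k and j = n - i > 0, the
  -- second over i + j = n - 1.
  Δ : V → V⊗V
  Δ v p =
    - 1/3n * (∑[ k < n ℕ.∸ 1 ]
      (let i = suc (toℕ k) ; j = n ℕ.∸ i in
       (v · x^ i y^ 0 ⊗ x^ j y^ 0) p))
    + 1/3n * (∑[ k < n ]
      (let i = toℕ k ; j = n ℕ.∸ 1 ℕ.∸ i in
       (v · x^ i y^ 2 ⊗ x^ j y^ 0) p
       + (v · x^ i y^ 1 ⊗ x^ j y^ 1) p
       + (v · x^ i y^ 0 ⊗ x^ j y^ 2) p))

  -- V^⊗ k has as basis the labellings of k circles by monomials.
  Labelling : ℕ → Set
  Labelling = Vec Monomial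

  V^⊗_ : ℕ → Set
  V^⊗ k = Labelling k → ∣R∣

  ∑ᴸ : ∀ {k} → (Labelling k → ∣R∣) → ∣R∣
  ∑ᴸ {zero}  f = f []
  ∑ᴸ {suc k} f = ∑[ i < n ] ∑[ j < 3 ] ∑ᴸ (λ L → f ((i , j) ∷ L))

  ∑ᴸ-cong : ∀ {k} {f g : Labelling k → ∣R∣} → (∀ L → f L ≈ g L) → ∑ᴸ f ≈ ∑ᴸ g
  ∑ᴸ-cong {zero}  f≈g = f≈g []
  ∑ᴸ-cong {suc k} f≈g = sum-cong-≋ λ i → sum-cong-≋ λ j → ∑ᴸ-cong λ L → f≈g ((i , j) ∷ L)

  ∑ᴸ-+ : ∀ {k} (f g : Labelling k → ∣R∣) → ∑ᴸ (λ L → f L + g L) ≈ ∑ᴸ f + ∑ᴸ g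
  ∑ᴸ-+ {zero}  f g = ≈-refl
  ∑ᴸ-+ {suc k} f g = ≈-trans
    (sum-cong-≋ λ i → ≈-trans
      (sum-cong-≋ λ j → ∑ᴸ-+ (λ L → f ((i , j) ∷ L)) (λ L → g ((i , j) ∷ L)))
      (∑-distrib-+ (λ j → ∑ᴸ (λ L → f ((i , j) ∷ L))) (λ j → ∑ᴸ (λ L → g ((i , j) ∷ L)))))
    (∑-distrib-+ (λ i → ∑[ j < 3 ] ∑ᴸ (λ L → f ((i , j) ∷ L)))
                 (λ i → ∑[ j < 3 ] ∑ᴸ (λ L → g ((i , j) ∷ L))))

  ∑ᴸ-* : ∀ {k} r (f : Labelling k → ∣R∣) → ∑ᴸ (λ L → r * f L) ≈ r * ∑ᴸ f
  ∑ᴸ-* {zero}  r f = ≈-refl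
  ∑ᴸ-* {suc k} r f = ≈-sym (≈-trans
    (*-distribˡ-sum r (λ i → ∑[ j < 3 ] ∑ᴸ (λ L → f ((i , j) ∷ L))))
    (sum-cong-≋ λ i → ≈-trans
      (*-distribˡ-sum r (λ j → ∑ᴸ (λ L → f ((i , j) ∷ L))))
      (sum-cong-≋ λ j → ≈-sym (∑ᴸ-* r (λ L → f ((i , j) ∷ L))))))

  onesBefore : ∀ {ℓ} → Subset ℓ → Fin ℓ → ℕ
  onesBefore (b ∷ α)     zero    = 0
  onesBefore (false ∷ α) (suc e) = onesBefore α e
  onesBefore (true ∷ α)  (suc e) = suc (onesBefore α e)

  ∣lower∣ : ∀ {ℓ i} (α : Subset ℓ) e → lookup α e ≡ true → ∣ α ∣ ≡ suc i → ∣ α [ e ]≔ false ∣ ≡ i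
  ∣lower∣ α e eq p = ℕₚ.suc-injective (trans (lemma α e eq) p)
    where
    lemma : ∀ {ℓ} (α : Subset ℓ) e → lookup α e ≡ true → suc ∣ α [ e ]≔ false ∣ ≡ ∣ α ∣
    lemma (true ∷ α)  zero    _ = refl
    lemma (true ∷ α)  (suc e) q = cong suc (lemma α e q)
    lemma (false ∷ α) (suc e) q = lemma α e q

  module Complex (Γ : TrivalentPMGraph) where
    open TrivalentPMGraph Γ using (#M; #N; State; #circles; circle; foot₁; foot₂)

    -- For α and α′ differing at the matching edge e only: the labellings
    -- agree on the circles that do not pass e.
    module _ (e : Fin #M) (α α′ : State) (L : Labelling (#circles α)) (L′ : Labelling (#circles α′)) where

      AgreeAway : Set
      AgreeAway = ∀ f →
        circle α f ≢ circle α (foot₁ e false) → circle α f ≢ circle α (foot₂ e false) →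
        lookup L (circle α f) ≡ lookup L′ (circle α′ f)

      agreeAway? : Dec AgreeAway
      agreeAway? = all? λ f →
        ¬? (_ ≟ _) →-dec (¬? (_ ≟ _) →-dec ≡-dec _≟_ _≟_ _ _)

      -- The coefficient of the basis element L′ in the image of L under ∂_{αα′}.
      coefficient : ∣R∣
      coefficient = if does agreeAway?
        then (if does (p ≟ q)
              then (if does (p′ ≟ q′)
                    then mV (basis (lookup L p)) (lookup L′ p′)
                    else Δ (basis (lookup L p)) (lookup L′ p′ , lookup L′ q′))
              else μ (basis (lookup L p) ⊗ basis (lookup L q)) (lookup L′ p′))
        else 0#
        where
        p  = circle α (foot₁ e false)
        q  = circle α (foot₂ e false)
        p′ = circle α′ (foot₁ e false)
        q′ = circle α′ (foot₂ e false)

    ∂-edge : Fin #M → ∀ α α′ → V^⊗ #circles α → V^⊗ #circles α′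
    ∂-edge e α α′ v L′ = ∑ᴸ λ L → v L * coefficient e α α′ L L′

    ∂-edge-cong : ∀ e α α′ {v w} L′ → (∀ L → v L ≈ w L) → ∂-edge e α α′ v L′ ≈ ∂-edge e α α′ w L′
    ∂-edge-cong e α α′ L′ v≈w = ∑ᴸ-cong {#circles α} λ L → *-congʳ (v≈w L)

    ∂-edge-+ : ∀ e α α′ v w L′ →
      ∂-edge e α α′ (λ L → v L + w L) L′ ≈ ∂-edge e α α′ v L′ + ∂-edge e α α′ w L′
    ∂-edge-+ e α α′ v w L′ = ≈-trans
      (∑ᴸ-cong {#circles α} λ L → distribʳ (coefficient e α α′ L L′) (v L) (w L))
      (∑ᴸ-+ {#circles α} (λ L → v L * coefficient e α α′ L L′) (λ L → w L * coefficient e α α′ L L′))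

    ∂-edge-* : ∀ e α α′ r v L′ → ∂-edge e α α′ (λ L → r * v L) L′ ≈ r * ∂-edge e α α′ v L′
    ∂-edge-* e α α′ r v L′ = ≈-trans
      (∑ᴸ-cong {#circles α} λ L → *-assoc r (v L) (coefficient e α α′ L L′))
      (∑ᴸ-* {#circles α} r (λ L → v L * coefficient e α α′ L L′))

    record Generator (i : ℕ) : Set where
      constructor generator
      field
        state : State
        ones  : ∣ state ∣ ≡ i
        label : Labelling (#circles state)

    Cochain : ℕ → Set
    Cochain i = Generator i → ∣R∣

    restrict : ∀ {i} → Cochain i → (g : Generator (suc i)) → ∀ e →
               lookup (Generator.state g) e ≡ true →
               V^⊗ #circles (Generator.state g [ e ]≔ false)
    restrict v (generator α′ p L′) e eq L = v (generator (α′ [ e ]≔ false) (∣lower∣ α′ e eq p) L)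

    -- The component of the differential along the edge of the cube that
    -- changes the entry e from 0 to 1 and ends in the state of the generator.
    ∂-term : ∀ {i} → Cochain i → (g : Generator (suc i)) → ∀ e b →
             lookup (Generator.state g) e ≡ b → ∣R∣
    ∂-term v g                   e false eq = 0#
    ∂-term v (generator α′ p L′) e true  eq = (- 1#) ^ onesBefore α′ e *
      ∂-edge e (α′ [ e ]≔ false) α′ (restrict v (generator α′ p L′) e eq) L′

    ∂ : ∀ {i} → Cochain i → Cochain (suc i)
    ∂ v g = ∑[ e < #M ] ∂-term v g e _ refl

    ∂-cong : ∀ {i} {v w : Cochain i} → (∀ g → v g ≈ w g) → ∀ g → ∂ v g ≈ ∂ w g
    ∂-cong {i} {v} {w} v≈w g = sum-cong-≋ λ e → term g e _ refl
      where
      term : ∀ g e b eq → ∂-term v g e b eq ≈ ∂-term w g e b eq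
      term g e false eq = ≈-refl
      term g@(generator α′ _ L′) e true eq =
        *-congˡ (∂-edge-cong e (α′ [ e ]≔ false) α′ L′ λ L → v≈w _)

    ∂-+ : ∀ {i} (v w : Cochain i) g → ∂ (λ h → v h + w h) g ≈ ∂ v g + ∂ w g
    ∂-+ v w g = ≈-trans (sum-cong-≋ λ e → term g e _ refl)
      (∑-distrib-+ (λ e → ∂-term v g e _ refl) (λ e → ∂-term w g e _ refl))
      where
      term : ∀ g e b eq →
        ∂-term (λ h → v h + w h) g e b eq ≈ ∂-term v g e b eq + ∂-term w g e b eq
      term g e false eq = ≈-sym (+-identityˡ 0#)
      term g@(generator α′ _ L′) e true eq = ≈-trans
        (*-congˡ (∂-edge-+ e (α′ [ e ]≔ false) α′ (restrict v g e eq) (restrict w g e eq) L′))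
        (distribˡ _ _ _)

    ∂-* : ∀ {i} r (v : Cochain i) g → ∂ (λ h → r * v h) g ≈ r * ∂ v g
    ∂-* r v g = ≈-trans (sum-cong-≋ λ e → term g e _ refl)
      (≈-sym (*-distribˡ-sum r (λ e → ∂-term v g e _ refl)))
      where
      term : ∀ g e b eq → ∂-term (λ h → r * v h) g e b eq ≈ r * ∂-term v g e b eq
      term g e false eq = ≈-sym (zeroʳ r)
      term g@(generator α′ _ L′) e true eq = ≈-trans
        (*-congˡ (∂-edge-* e (α′ [ e ]≔ false) α′ r (restrict v g e eq) L′))
        (x∙yz≈y∙xz _ _ _)

    ∂-0 : ∀ {i} g → ∂ {i} (λ _ → 0#) g ≈ 0#
    ∂-0 g = ≈-trans (∂-cong (λ _ → ≈-sym (zeroˡ 0#)) g) (≈-trans (∂-* 0# (λ _ → 0#) g) (zeroˡ _))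

    -- The internal degree (2i + j , j) in ℤ/n × ℤ/2, added over the circles.
    HasDegree : ∀ {i} → Fin n → Fin 2 → Generator i → Set
    HasDegree a ε (generator _ _ L) =
      Vec.sum (Vec.map (λ (i , j) → 2 ℕ.* toℕ i ℕ.+ toℕ j) L) % n ≡ toℕ a ×
      Vec.sum (Vec.map (λ (i , j) → toℕ j) L) % 2 ≡ toℕ ε

    module _ (a : Fin n) (ε : Fin 2) where

      Homogeneous : ∀ {i} → Pred (Cochain i) 0ℓ
      Homogeneous v = ∀ g → ¬ HasDegree a ε g → v g ≈ 0#

      Cocycle : ∀ {i} → Pred (Cochain i) 0ℓ
      Cocycle v = Homogeneous v × (∀ g → ∂ v g ≈ 0#)

      Coboundary : ∀ {i} → Pred (Cochain i) 0ℓ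
      Coboundary {zero}  v = ∀ g → v g ≈ 0#
      Coboundary {suc i} v = Σ[ w ∈ Cochain i ] Homogeneous w × (∀ g → ∂ w g ≈ v g)

      private
        0+0 : ∀ {x y} → x ≈ 0# → y ≈ 0# → x + y ≈ 0#
        0+0 p q = ≈-trans (+-cong p q) (+-identityˡ 0#)

        r*0 : ∀ r {x} → x ≈ 0# → r * x ≈ 0#
        r*0 r p = ≈-trans (*-congˡ p) (zeroʳ r)

        B-resp : ∀ i {v w : Cochain i} → (∀ g → v g ≈ w g) → Coboundary v → Coboundary w
        B-resp zero    v≈w p           = λ g → ≈-trans (≈-sym (v≈w g)) (p g)
        B-resp (suc i) v≈w (u , h , p) = u , h , λ g → ≈-trans (p g) (v≈w g)

        B-0 : ∀ i → Coboundary {i} (λ _ → 0#)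
        B-0 zero    = λ _ → ≈-refl
        B-0 (suc i) = (λ _ → 0#) , (λ _ _ → ≈-refl) , ∂-0

        B-+ : ∀ i {v w : Cochain i} → Coboundary v → Coboundary w → Coboundary (λ g → v g + w g)
        B-+ zero    p q = λ g → 0+0 (p g) (q g)
        B-+ (suc i) (u , h , p) (u′ , h′ , p′) =
          (λ g → u g + u′ g) , (λ g d → 0+0 (h g d) (h′ g d)) ,
          λ g → ≈-trans (∂-+ u u′ g) (+-cong (p g) (p′ g))

        B-* : ∀ i r {v : Cochain i} → Coboundary v → Coboundary (λ g → r * v g)
        B-* zero    r p = λ g → r*0 r (p g)
        B-* (suc i) r (u , h , p) =
          (λ g → r * u g) , (λ g d → r*0 r (h g d)) ,
          λ g → ≈-trans (∂-* r u g) (*-congˡ (p g))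

      -- The homology in homological degree i and internal degree (a , ε).
      MH : ℕ → LeftModule ring 0ℓ 0ℓ
      MH i = Subquotient.leftModule R (Cocycle {i}) (Coboundary {i})
        (λ v≈w (h , z) → (λ g d → ≈-trans (≈-sym (v≈w g)) (h g d))
                       , (λ g → ≈-trans (≈-sym (∂-cong v≈w g)) (z g)))
        ((λ _ _ → ≈-refl) , ∂-0)
        (λ (h , z) (h′ , z′) → (λ g d → 0+0 (h g d) (h′ g d))
                             , (λ g → ≈-trans (∂-+ _ _ g) (0+0 (z g) (z′ g))))
        (λ r (h , z) → (λ g d → r*0 r (h g d)) , (λ g → ≈-trans (∂-* r _ g) (r*0 r (z g))))
        (B-resp i) (B-0 i) (B-+ i) (B-* i)

    -- A rank is unique when it exists.
    record Ranks : Set where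
      field
        rank    : ℕ → Fin n → Fin 2 → ℕ
        hasRank : ∀ i a ε → HasRank R (MH a ε i) (rank i a ε)

    module _ (ρ : Ranks) where
      open Ranks ρ
      open Data.Integer.Base using () renaming (_+_ to _+ᶻ_)

      -- The coefficient of q^a in the sum over i + ε ≡ s mod 2; homology
      -- vanishes in homological degrees above #M.
      signedPart : ℕ → Fin n → ℤ
      signedPart s a = ∑ˡ (concatMap
        (λ i → List.map (λ ε → if (i ℕ.+ toℕ ε) % 2 ℕ.≡ᵇ s then + rank i a ε else + 0) (allFin 2))
        (upTo (suc #M)))

      Q⁺ Q⁻ : Fin n → ℤ
      Q⁺ = signedPart 0
      Q⁻ = signedPart 1

module Möbius (n : ℕ) .{{n≢0 : NonZero n}} where

  private instance
    3n≢0 : NonZero (3 ℕ.* n)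
    3n≢0 = ℕₚ.m*n≢0 3 n

  open MöbiusOver (ℤ[1/ 3 ℕ.* n ]) (+ 1 / (3 ℕ.* n) , inv) n public

module _ {n : ℕ} where
  open Data.Integer.Base using (_+_; _-_; _≤_; _<_)

  -- An element of ℤ[q]/(q^n - 1) is the function of its coefficients.
  Poly : Set
  Poly = Fin n → ℤ

  evalAt1 : Poly → ℤ
  evalAt1 f = ∑ˡ (List.map f (allFin n))

  _⊖_ : Poly → Poly → Poly
  (f ⊖ g) a = f a - g a

  _>cw_ : Poly → Poly → Set
  f >cw g = (∀ a → + 0 ≤ (f ⊖ g) a) × (∃[ a ] + 0 < (f ⊖ g) a)

module _ (Γ : RibbonGraph) where
  open Möbius 4
  open Complex (blowup Γ)

  Ranks₄ : Set
  Ranks₄ = Ranks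

  Q₄⁺ Q₄⁻ : Ranks₄ → Poly
  Q₄⁺ = Q⁺
  Q₄⁻ = Q⁻

  CoefficientwisePositive : Set
  CoefficientwisePositive = Σ[ ρ ∈ Ranks₄ ] Q₄⁺ ρ >cw Q₄⁻ ρ

FourColourTheorem : Set₁
FourColourTheorem = ∀ Γ → let open RibbonGraph Γ in
  Connected → Planar → Bridgeless → FaceColourable 4

{-# OPTIONS --safe #-}
module Submission where

open import Defs

-- All parts of the theorem evaluate one state sum, `bracket d`, in which every circle has the
-- integer value d. At the given points the circle value of the n-bracket is 2 in (a), 3 in (b), and
-- n or 3n in (d) for positive n; in (c), the value of `Q⁺ - Q⁻` at q = 1 is an Euler characteristic
-- equal to `bracket 4`.
--
-- For a natural number d, d to the number of circles of a state counts the d-colourings of the arcs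
-- of the blowup that are constant on circles. After exchanging sums, `bracket d` is a sum over all
-- colourings of the arcs, and the signs factor over the edges, as in Penrose's formula. An edge
-- contributes 0 unless the two arcs at one end have different colours and the same two colours
-- occur at the other end; then it contributes 1 if the two colour lines run parallel and -1 if they
-- cross. In the plane, lines of different colours cross an even number of times in total, so
-- `bracket d` is the number of such admissible colourings (`bracket-count`). The Jordan curve
-- property behind this is `cycle-bounds`: modulo 2, a colour class bounds a set of faces. It
-- follows from Euler's formula by counting dimensions over the field with two elements.
--
-- It remains to count admissible colourings. For d = 2 they alternate around every vertex, which
-- leaves two choices at a vertex of even degree and none at one of odd degree. For d = 3 and Γ
-- trivalent, giving each edge the colour missing from the arcs beside it is a bijection with the
-- 3-edge colourings. For every d, a proper colouring of the faces colours the corners, hence the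
-- arcs, admissibly; this bounds the chromatic polynomial of the dual. For d = 4, with colours read
-- in (Z/2)^2, the sum of the two colours at an edge is a nowhere zero flow, which `cycle-bounds`
-- turns back into a face colouring.
--
-- For the homology one needs that the differential preserves degrees and squares to zero. Monomials
-- are placed on arcs instead of circles, since arcs are the same in all states. Every edge map then
-- becomes multiplication by 1, by x y^2 or by Δ(1) at the feet of the edge, and the squares of the
-- cube commute because Δ(1) is symmetric, can absorb a factor on either side, and multiplies out to
-- (x y^2)^2. Rank-nullity over the domain Z[1/12] gives the Euler characteristic, to which each
-- circle contributes the factor 4(1 - 1 + 1) = 4. Coefficientwise positivity forces a positive
-- value at q = 1, hence 4-face colourability.

-- Linear algebra without division over a decidable integral domain.

module LinAlg where

  open import Algebra.Bundles using (CommutativeRing)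
  open import Data.Bool.Base using (if_then_else_)
  open import Data.Fin.Base using (Fin; zero; suc; punchIn; punchOut; splitAt; _↑ˡ_; _↑ʳ_)
  open import Data.Fin.Properties using (_≟_; any?; punchIn-punchOut)
  open import Data.Nat.Base using (ℕ; zero; suc; _≤_; z≤n; s≤s)
  import Data.Nat.Base as ℕ
  import Data.Nat.Properties as ℕₚ
  open import Data.Product.Base using (Σ-syntax; _×_; _,_; proj₁; proj₂)
  open import Data.Sum.Base using (_⊎_; inj₁; inj₂)
  open import Data.Vec.Functional using (Vector; _∷_; _++_; insertAt; removeAt)
  open import Data.Vec.Functional.Properties
    using (lookup-++ˡ; lookup-++ʳ; insertAt-lookup; insertAt-punchIn)
  open import Level using (0ℓ)
  open import Relation.Binary.PropositionalEquality as ≡ using (_≡_)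
  open import Relation.Nullary using (¬_; Dec; yes; no; does; contradiction)
  open import Relation.Nullary.Decidable using (¬?; decidable-stable)
  open import Function.Base using (_∘_)

  -- Instantiated twice: with Z[1/12] for the homology, and with the field of two elements for
  -- cycles in plane graphs.
  record IsDecidableDomain (R : CommutativeRing 0ℓ 0ℓ) : Set where
    open CommutativeRing R
    field
      _≈0?   : ∀ x → Dec (x ≈ 0#)
      1≉0    : ¬ 1# ≈ 0#
      cancel : ∀ {x y} → ¬ x ≈ 0# → x * y ≈ 0# → y ≈ 0#

  module IntegralDomain (R : CommutativeRing 0ℓ 0ℓ) (isDomain : IsDecidableDomain R) where

    open CommutativeRing R renaming (Carrier to A) hiding (zero)
    open IsDecidableDomain isDomain
    open import Algebra.Properties.Semiring.Sum semiring public
    open import Relation.Binary.Reasoning.Setoid setoid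
    open import Algebra.Properties.Ring ring using (-‿distribˡ-*; -‿distribʳ-*; -1*x≈-x)
    open import Algebra.Properties.AbelianGroup +-abelianGroup using (inverseʳ-unique; ⁻¹-involutive)

    private
      module Identities where
        open import Algebra.Solver.Ring.NaturalCoefficients.Default commutativeSemiring

        expand : ∀ b P x y z → b * (P * x - y * z) ≈ P * (b * x) + - z * (b * y)
        expand b P x y z = trans (*-congˡ (+-congˡ (-‿distribʳ-* y z)))
          (solve 5 (λ b P x y n → b :* (P :* x :+ y :* n) := P :* (b :* x) :+ n :* (b :* y))
            refl b P x y (- z))

        cancelling : ∀ P x y → P * - (x * y) - - (x * P) * y ≈ 0#
        cancelling P x y = begin
          P * - (x * y) - - (x * P) * y      ≈⟨ +-cong (-‿distribʳ-* P (x * y)) (-‿cong (-‿distribˡ-* (x * P) y)) ⟨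
          - (P * (x * y)) - - (x * P * y)
            ≈⟨ +-cong (-‿cong (solve 3 (λ P x y → P :* (x :* y) := x :* P :* y) refl P x y)) (⁻¹-involutive _) ⟩
          - (x * P * y) + x * P * y          ≈⟨ -‿inverseˡ _ ⟩
          0# ∎

        common-factor : ∀ s t a x y → s * t * (a * x + y) ≈ t * a * (s * x) + s * (t * y)
        common-factor = solve 5 (λ s t a x y →
          s :* t :* (a :* x :+ y) := t :* a :* (s :* x) :+ s :* (t :* y)) refl

    *≉0 : ∀ {x y} → ¬ x ≈ 0# → ¬ y ≈ 0# → ¬ x * y ≈ 0#
    *≉0 x≉0 y≉0 = y≉0 ∘ cancel x≉0

    sum-0 : ∀ {n} {f : Vector A n} → (∀ i → f i ≈ 0#) → sum f ≈ 0#
    sum-0 {n} f≈0 = trans (sum-cong-≋ f≈0) (sum-replicate-zero n)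

    sum-split : ∀ m {n} (f : Vector A (m ℕ.+ n)) →
                sum f ≈ ∑[ i < m ] f (i ↑ˡ n) + ∑[ i < n ] f (m ↑ʳ i)
    sum-split zero    f = sym (+-identityˡ _)
    sum-split (suc m) f = trans (+-congˡ (sum-split m (f ∘ suc))) (sym (+-assoc _ _ _))

    δ : ∀ {n} → Fin n → Vector A n
    δ i j = if does (i ≟ j) then 1# else 0#

    sum-δ : ∀ {n} (f : Vector A n) j → ∑[ i < n ] (f i * δ i j) ≈ f j
    sum-δ {suc n} f zero = begin
      f zero * 1# + ∑[ i < n ] (f (suc i) * 0#)  ≈⟨ +-cong (*-identityʳ _) (sum-0 {n} λ i → zeroʳ _) ⟩
      f zero + 0#                              ≈⟨ +-identityʳ _ ⟩
      f zero                                   ∎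
    sum-δ {suc n} f (suc j) = begin
      f zero * 0# + ∑[ i < n ] (f (suc i) * δ (suc i) (suc j))
        ≈⟨ +-cong (zeroʳ _) (sum-cong-≋ {n} λ i → *-congˡ (reflexive (δ-suc i))) ⟩
      0# + ∑[ i < n ] (f (suc i) * δ i j)        ≈⟨ +-identityˡ _ ⟩
      ∑[ i < n ] (f (suc i) * δ i j)             ≈⟨ sum-δ (f ∘ suc) j ⟩
      f (suc j)                                ∎
      where
      δ-suc : ∀ i → δ (suc i) (suc j) ≡ δ i j
      δ-suc i with i ≟ j
      ... | yes _ = ≡.refl
      ... | no _  = ≡.refl

    -- Vector times matrix, the matrix being the family of images of the unit vectors. Thus `lc x D`
    -- is the value at x of the linear map D.
    lc : ∀ {l k} → Vector A l → Vector (Vector A k) l → Vector A k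
    lc {l} a v j = ∑[ i < l ] (a i * v i j)

    lc-δ : ∀ {k} (a : Vector A k) j → lc a δ j ≈ a j
    lc-δ = sum-δ

    lc-congˡ : ∀ {l k} {a b : Vector A l} (v : Vector (Vector A k) l) →
               (∀ i → a i ≈ b i) → ∀ j → lc a v j ≈ lc b v j
    lc-congˡ v a≈b j = sum-cong-≋ λ i → *-congʳ (a≈b i)

    lc-0 : ∀ {l k} {a : Vector A l} (v : Vector (Vector A k) l) →
           (∀ i → a i ≈ 0#) → ∀ j → lc a v j ≈ 0#
    lc-0 v a≈0 j = sum-0 λ i → trans (*-congʳ (a≈0 i)) (zeroˡ _)

    lc-+ : ∀ {l k} (a b : Vector A l) (v : Vector (Vector A k) l) j →
           lc (λ i → a i + b i) v j ≈ lc a v j + lc b v j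
    lc-+ a b v j = trans (sum-cong-≋ λ i → distribʳ (v i j) (a i) (b i))
      (∑-distrib-+ (λ i → a i * v i j) (λ i → b i * v i j))

    lc-* : ∀ {l k} s (a : Vector A l) (v : Vector (Vector A k) l) j →
           lc (λ i → s * a i) v j ≈ s * lc a v j
    lc-* s a v j = trans (sum-cong-≋ λ i → *-assoc s (a i) (v i j)) (sym (*-distribˡ-sum s (λ i → a i * v i j)))

    lc-lc : ∀ {l m k} (a : Vector A l) (v : Vector (Vector A m) l) (D : Vector (Vector A k) m) j →
            lc (lc a v) D j ≈ lc a (λ i → lc (v i) D) j
    lc-lc {l} {m} a v D j = begin
      ∑[ i < m ] (∑[ t < l ] (a t * v t i) * D i j)
        ≈⟨ sum-cong-≋ {m} (λ i → *-distribʳ-sum (D i j) (λ t → a t * v t i)) ⟩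
      ∑[ i < m ] ∑[ t < l ] (a t * v t i * D i j)
        ≈⟨ ∑-comm (λ i t → a t * v t i * D i j) ⟩
      ∑[ t < l ] ∑[ i < m ] (a t * v t i * D i j)
        ≈⟨ sum-cong-≋ {l} (λ t → trans (sum-cong-≋ {m} λ i → *-assoc _ _ _)
             (sym (*-distribˡ-sum (a t) (λ i → v t i * D i j)))) ⟩
      ∑[ t < l ] (a t * lc (v t) D j) ∎

    lc-++ : ∀ {l m k} (a : Vector A (l ℕ.+ m)) (u : Vector (Vector A k) l) (v : Vector (Vector A k) m) j →
            lc a (u ++ v) j ≈ lc (λ i → a (i ↑ˡ m)) u j + lc (λ i → a (l ↑ʳ i)) v j
    lc-++ {l} {m} a u v j = trans (sum-split l _) (+-cong
      (sum-cong-≋ {l} λ i → *-congˡ (reflexive (≡.cong (λ w → w j) (lookup-++ˡ u v i))))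
      (sum-cong-≋ {m} λ i → *-congˡ (reflexive (≡.cong (λ w → w j) (lookup-++ʳ u v i)))))

    lc-++-++ : ∀ {l m k} (a : Vector A l) (b : Vector A m)
               (u : Vector (Vector A k) l) (v : Vector (Vector A k) m) j →
               lc (a ++ b) (u ++ v) j ≈ lc a u j + lc b v j
    lc-++-++ a b u v j = trans (lc-++ (a ++ b) u v j) (+-cong
      (lc-congˡ u (λ i → reflexive (lookup-++ˡ a b i)) j)
      (lc-congˡ v (λ i → reflexive (lookup-++ʳ a b i)) j))

    Independent Dependent : ∀ {l k} → Vector (Vector A k) l → Set
    Independent v = ∀ a → (∀ j → lc a v j ≈ 0#) → ∀ i → a i ≈ 0#
    Dependent   v = Σ[ a ∈ _ ] (∀ j → lc a v j ≈ 0#) × Σ[ i ∈ _ ] ¬ a i ≈ 0#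

    module _ {l k} (v : Vector (Vector A (suc k)) (suc l)) (p : Fin (suc l)) where

      private
        P = v p zero
        w = λ i → v (punchIn p i)

      -- One step of Gaussian elimination, multiplied through by the pivot P so that no division
      -- occurs.
      eliminated : Vector (Vector A k) l
      eliminated i j = P * w i (suc j) - w i zero * v p (suc j)

      elimination : ∀ b j → ∑[ i < l ] (b i * (P * w i j - w i zero * v p j)) ≈
                            P * lc b w j - lc b w zero * v p j
      elimination b j = begin
        ∑[ i < l ] (b i * (P * w i j - w i zero * v p j))
          ≈⟨ sum-cong-≋ {l} (λ i → Identities.expand (b i) P (w i j) (w i zero) (v p j)) ⟩
        ∑[ i < l ] (P * (b i * w i j) + - v p j * (b i * w i zero))
          ≈⟨ ∑-distrib-+ (λ i → P * (b i * w i j)) _ ⟩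
        ∑[ i < l ] (P * (b i * w i j)) + ∑[ i < l ] ((- v p j) * (b i * w i zero))
          ≈⟨ +-cong (*-distribˡ-sum P (λ i → b i * w i j))
                    (*-distribˡ-sum (- v p j) (λ i → b i * w i zero)) ⟨
        P * lc b w j + - v p j * lc b w zero
          ≈⟨ +-congˡ (trans (sym (-‿distribˡ-* _ _)) (-‿cong (*-comm _ _))) ⟩
        P * lc b w j - lc b w zero * v p j ∎

      -- A relation b among the eliminated vectors lifts to the coefficients P b i; the coefficient
      -- of the pivot vector is then forced by the first coordinate.
      dependent-pivot : Dependent eliminated → ¬ P ≈ 0# → Dependent v
      dependent-pivot (b , rel , i , b≉0) P≉0 = a , rel′ , punchIn p i ,
        λ eq → *≉0 P≉0 b≉0 (trans (sym (reflexive (insertAt-punchIn Pb p ap i))) eq)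
        where
        Pb = λ i → P * b i
        ap = - lc b w zero
        a  = insertAt Pb p ap

        reduced : ∀ j → ∑[ i < l ] (b i * (P * w i j - w i zero * v p j)) ≈ 0#
        reduced zero    = sum-0 {l} λ i → trans
          (*-congˡ (trans (+-congʳ (*-comm _ _)) (-‿inverseʳ _))) (zeroʳ _)
        reduced (suc j) = rel j

        rel′ : ∀ j → lc a v j ≈ 0#
        rel′ j = begin
          lc a v j
            ≈⟨ sum-remove {i = p} (λ q → a q * v q j) ⟩
          a p * v p j + ∑[ i < l ] (a (punchIn p i) * w i j)
            ≈⟨ +-cong (*-congʳ (reflexive (insertAt-lookup Pb p ap)))
                 (sum-cong-≋ {l} λ i → *-congʳ (reflexive (insertAt-punchIn Pb p ap i))) ⟩
          - lc b w zero * v p j + lc Pb w j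
            ≈⟨ +-cong (sym (-‿distribˡ-* _ _)) (lc-* P b w j) ⟩
          - (lc b w zero * v p j) + P * lc b w j
            ≈⟨ +-comm _ _ ⟩
          P * lc b w j - lc b w zero * v p j
            ≈⟨ elimination b j ⟨
          ∑[ i < l ] (b i * (P * w i j - w i zero * v p j))
            ≈⟨ reduced j ⟩
          0# ∎

      -- The first coordinate of a relation expresses the pivot's coefficient through the others.
      -- Substituting it gives a relation of the eliminated vectors, so the others vanish, and then
      -- the pivot's coefficient vanishes because P is not a zero divisor.
      independent-pivot : Independent eliminated → ¬ P ≈ 0# → Independent v
      independent-pivot ind P≉0 a rel q = result q
        where
        b = λ i → a (punchIn p i)

        split : ∀ j → lc b w j ≈ - (a p * v p j)
        split j = inverseʳ-unique _ _
          (trans (sym (sum-remove {i = p} (λ q → a q * v q j))) (rel j))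

        reduced : ∀ j → lc b eliminated j ≈ 0#
        reduced j = begin
          lc b eliminated j                                       ≈⟨ elimination b (suc j) ⟩
          P * lc b w (suc j) - lc b w zero * v p (suc j)
            ≈⟨ +-cong (*-congˡ (split (suc j))) (-‿cong (*-congʳ (split zero))) ⟩
          P * - (a p * v p (suc j)) - - (a p * P) * v p (suc j)   ≈⟨ Identities.cancelling P (a p) (v p (suc j)) ⟩
          0# ∎

        others : ∀ i → b i ≈ 0#
        others = ind b reduced

        pivot : a p ≈ 0#
        pivot = cancel P≉0 (trans (*-comm _ _) (begin
          a p * P        ≈⟨ trans (sym (+-identityʳ _)) (+-congˡ (sym (lc-0 w others zero))) ⟩
          a p * P + lc b w zero  ≈⟨ sum-remove {i = p} (λ q → a q * v q zero) ⟨
          lc a v zero    ≈⟨ rel zero ⟩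
          0# ∎))

        result : ∀ q → a q ≈ 0#
        result q with p ≟ q
        ... | yes ≡.refl = pivot
        ... | no p≢q     = trans (reflexive (≡.cong a (≡.sym (punchIn-punchOut p≢q)))) (others _)

    -- Elimination on the first coordinate: a vector that is nonzero there serves as pivot, and if
    -- there is none the coordinate is dropped. The bound in the first alternative makes the
    -- pigeonhole form of dimension counting immediate: too many vectors are dependent.
    decide : ∀ {l k} (v : Vector (Vector A k) l) → (l ≤ k × Independent v) ⊎ Dependent v
    decide {zero}  {k}     v = inj₁ (z≤n , λ _ _ ())
    decide {suc l} {zero}  v = inj₂ ((λ _ → 1#) , (λ ()) , zero , 1≉0)
    decide {suc l} {suc k} v with any? (λ i → ¬? (v i zero ≈0?))
    ... | yes (p , P≉0) with decide (eliminated v p)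
    ...   | inj₁ (l≤k , ind) = inj₁ (s≤s l≤k , independent-pivot v p ind P≉0)
    ...   | inj₂ dep         = inj₂ (dependent-pivot v p dep P≉0)
    decide {suc l} {suc k} v | no all0 with decide (λ i j → v i (suc j))
    ...   | inj₁ (l≤k , ind)       = inj₁ (ℕₚ.m≤n⇒m≤1+n l≤k , λ a rel → ind a (rel ∘ suc))
    ...   | inj₂ (a , rel , i , n) = inj₂ (a , rel′ , i , n)
      where
      rel′ : ∀ j → lc a v j ≈ 0#
      rel′ zero    = sum-0 λ i → trans
        (*-congˡ (decidable-stable (v i zero ≈0?) λ ≉0 → all0 (i , ≉0))) (zeroʳ (a i))
      rel′ (suc j) = rel j

    independent-≤ : ∀ {l k} (v : Vector (Vector A k) l) → Independent v → l ≤ k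
    independent-≤ v ind with decide v
    ... | inj₁ (l≤k , _)         = l≤k
    ... | inj₂ (a , rel , i , n) = contradiction (ind a rel i) n

    -- Some nonzero multiple lies in the span. This is membership in the span over the field of
    -- fractions, stated without constructing that field.
    Spanned : ∀ {l k} → Vector (Vector A k) l → Vector A k → Set
    Spanned u x = Σ[ s ∈ A ] ¬ s ≈ 0# × Σ[ c ∈ _ ] ∀ j → s * x j ≈ lc c u j

    spanned-lc : ∀ {l m k} {u : Vector (Vector A k) l} (a : Vector A m) (w : Vector (Vector A k) m) →
                 (∀ i → Spanned u (w i)) → Spanned u (lc a w)
    spanned-lc {m = zero} {u = u} a w sp = 1# , 1≉0 , (λ _ → 0#) , λ j →
      trans (*-identityˡ _) (sym (lc-0 u (λ _ → refl) j))
    spanned-lc {m = suc m} {u = u} a w sp with sp zero | spanned-lc (a ∘ suc) (w ∘ suc) (sp ∘ suc)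
    ... | s , s≉0 , c , eq | t , t≉0 , d , eq′ = s * t , *≉0 s≉0 t≉0 ,
      (λ i → t * a zero * c i + s * d i) , λ j → begin
        s * t * (a zero * w zero j + lc (a ∘ suc) (w ∘ suc) j)
          ≈⟨ Identities.common-factor s t (a zero) (w zero j) _ ⟩
        t * a zero * (s * w zero j) + s * (t * lc (a ∘ suc) (w ∘ suc) j)
          ≈⟨ +-cong (*-congˡ (eq j)) (*-congˡ (eq′ j)) ⟩
        t * a zero * lc c u j + s * lc d u j
          ≈⟨ +-cong (lc-* _ c u j) (lc-* s d u j) ⟨
        lc (λ i → t * a zero * c i) u j + lc (λ i → s * d i) u j
          ≈⟨ lc-+ (λ i → t * a zero * c i) (λ i → s * d i) u j ⟨
        lc (λ i → t * a zero * c i + s * d i) u j ∎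

    spanned-resp : ∀ {l k} {u : Vector (Vector A k) l} {x y} →
                   (∀ j → x j ≈ y j) → Spanned u x → Spanned u y
    spanned-resp x≈y (s , s≉0 , c , eq) = s , s≉0 , c , λ j → trans (*-congˡ (sym (x≈y j))) (eq j)

    spanned-* : ∀ {l k} {u : Vector (Vector A k) l} {x} {s} →
                ¬ s ≈ 0# → Spanned u (λ j → s * x j) → Spanned u x
    spanned-* {s = s} s≉0 (t , t≉0 , c , eq) = t * s , *≉0 t≉0 s≉0 , c ,
      λ j → trans (*-assoc _ _ _) (eq j)

    spanned-trans : ∀ {l m k} {u : Vector (Vector A k) l} {w : Vector (Vector A k) m} {x} →
                    (∀ i → Spanned u (w i)) → Spanned w x → Spanned u x
    spanned-trans {w = w} sp (s , s≉0 , c , eq) =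
      spanned-* s≉0 (spanned-resp (λ j → sym (eq j)) (spanned-lc c w sp))

    spanned-self : ∀ {l k} (u : Vector (Vector A k) l) i → Spanned u (u i)
    spanned-self {l} u i = 1# , 1≉0 , (λ t → δ t i) , λ j → begin
      1# * u i j                ≈⟨ *-identityˡ _ ⟩
      u i j                     ≈⟨ sum-δ (λ t → u t j) i ⟨
      ∑[ t < l ] (u t j * δ t i)  ≈⟨ sum-cong-≋ {l} (λ t → *-comm _ _) ⟩
      lc (λ t → δ t i) u j ∎

    spanned-++ˡ : ∀ {l m k} {u : Vector (Vector A k) l} (v : Vector (Vector A k) m) {x} →
                  Spanned u x → Spanned (u ++ v) x
    spanned-++ˡ {u = u} v = spanned-trans λ i →
      ≡.subst (Spanned (u ++ v)) (lookup-++ˡ u v i) (spanned-self (u ++ v) _)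

    spanned-++ʳ : ∀ {l m k} (u : Vector (Vector A k) l) {v : Vector (Vector A k) m} {x} →
                  Spanned v x → Spanned (u ++ v) x
    spanned-++ʳ u {v = v} = spanned-trans λ i →
      ≡.subst (Spanned (u ++ v)) (lookup-++ʳ u v i) (spanned-self (u ++ v) _)

    -- The exchange bound: a dependence among the coefficient vectors in l coordinates, rescaled by
    -- the denominators, would be a dependence of the given vectors.
    spanned-≤ : ∀ {l m k} {u : Vector (Vector A k) l} {w : Vector (Vector A k) m} →
                Independent w → (∀ i → Spanned u (w i)) → m ≤ l
    spanned-≤ {u = u} {w} ind sp with decide (λ i → proj₁ (proj₂ (proj₂ (sp i))))
    ... | inj₁ (m≤l , _) = m≤l
    ... | inj₂ (a , rel , i , a≉0) = contradiction
      (cancel (proj₁ (proj₂ (sp i))) (trans (*-comm _ _) (ind as rel′ i))) a≉0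
      where
      s  = λ i → proj₁ (sp i)
      c  = λ i → proj₁ (proj₂ (proj₂ (sp i)))
      as = λ i → a i * s i

      rel′ : ∀ j → lc as w j ≈ 0#
      rel′ j = begin
        lc as w j                            ≈⟨ sum-cong-≋ (λ i → *-assoc (a i) (s i) (w i j)) ⟩
        lc a (λ i j → s i * w i j) j
          ≈⟨ sum-cong-≋ (λ i → *-congˡ (proj₂ (proj₂ (proj₂ (sp i))) j)) ⟩
        lc a (λ i → lc (c i) u) j            ≈⟨ lc-lc a c u j ⟨
        lc (lc a c) u j                      ≈⟨ lc-0 u rel j ⟩
        0# ∎

    -- Basis extension by members of a given family. Choosing members, rather than arbitrary
    -- vectors, keeps track of which unit vectors the chosen images come from.
    record Extension {r l k} (b : Vector (Vector A k) r) (c : Vector (Vector A k) l) : Set where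
      field
        added       : ℕ
        choice      : Vector (Fin l) added
        independent : Independent ((c ∘ choice) ++ b)
        spanning    : ∀ i → Spanned ((c ∘ choice) ++ b) (c i)

    extend : ∀ {r l k} {b : Vector (Vector A k) r} (c : Vector (Vector A k) l) →
             Independent b → Extension b c
    extend {l = zero}  c ind = record
      { added = 0 ; choice = λ () ; independent = ind ; spanning = λ () }
    extend {l = suc l} {b = b} c ind with extend (c ∘ suc) ind
    ... | E with decide (c zero ∷ ((c ∘ suc ∘ Extension.choice E) ++ b))
    ...   | inj₁ (_ , ind′) = record
      { added       = suc added
      ; choice      = zero ∷ (suc ∘ choice)
      ; independent = λ a rel → ind′ a λ j → trans
          (+-congˡ (sum-cong-≋ λ i → *-congˡ (reflexive (≡.cong (λ w → w j) (same i))))) (rel j)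
      ; spanning    = λ
        { zero    → spanned-self fam zero
        ; (suc i) → spanned-trans {u = fam} (λ t → ≡.subst (Spanned fam) (≡.sym (same t))
            (spanned-self fam (suc t))) (spanning i) }
      }
      where
      open Extension E
      fam = (c ∘ (zero ∷ (suc ∘ choice))) ++ b

      same : ∀ t → ((c ∘ suc ∘ choice) ++ b) t ≡ fam (suc t)
      same t with splitAt added t
      ... | inj₁ _ = ≡.refl
      ... | inj₂ _ = ≡.refl
    ...   | inj₂ (a , rel , i , a≉0) = record
      { added       = added
      ; choice      = suc ∘ choice
      ; independent = independent
      ; spanning    = λ { zero → first ; (suc i) → spanning i }
      }
      where
      open Extension E
      fam = (c ∘ suc ∘ choice) ++ b

      -- The new vector must occur in the relation, since the family chosen so far is independent.
      -- Its coefficient therefore serves as the denominator in `first`.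
      a₀≉0 : ¬ a zero ≈ 0#
      a₀≉0 a₀≈0 = a≉0 (all i)
        where
        tail : ∀ i → a (suc i) ≈ 0#
        tail = independent (a ∘ suc) λ j →
          trans (sym (+-identityˡ _))
            (trans (+-congʳ (sym (trans (*-congʳ a₀≈0) (zeroˡ (c zero j))))) (rel j))
        all : ∀ i → a i ≈ 0#
        all zero    = a₀≈0
        all (suc i) = tail i

      first : Spanned fam (c zero)
      first = a zero , a₀≉0 , (λ i → - a (suc i)) , λ j → begin
        a zero * c zero j   ≈⟨ inverseʳ-unique _ _ (trans (+-comm _ _) (rel j)) ⟩
        - lc (a ∘ suc) fam j              ≈⟨ -1*x≈-x _ ⟨
        - 1# * lc (a ∘ suc) fam j         ≈⟨ lc-* (- 1#) (a ∘ suc) fam j ⟨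
        lc (λ i → - 1# * a (suc i)) fam j ≈⟨ lc-congˡ fam (λ i → -1*x≈-x _) j ⟩
        lc (λ i → - a (suc i)) fam j ∎

    columns : ∀ {l k} (c : Vector (Vector A k) l) → Extension {0} (λ ()) c
    columns c = extend c λ _ _ ()

    rank : ∀ {l k} → Vector (Vector A k) l → ℕ
    rank c = Extension.added (columns c)

    module _ {l k} (c : Vector (Vector A k) l) where
      open Extension (columns c)

      column : Vector (Fin l) (rank c)
      column = choice

      private
        drop : ∀ a → ∀ j → lc a ((c ∘ choice) ++ λ ()) j ≈ lc (λ i → a (i ↑ˡ 0)) (c ∘ choice) j
        drop a j = trans (lc-++ a (c ∘ choice) (λ ()) j) (+-identityʳ _)

      column-independent : Independent (c ∘ column)
      column-independent a rel i = trans (sym (reflexive (lookup-++ˡ a (λ ()) i)))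
        (independent (a ++ λ ()) (λ j → trans (lc-++-++ a (λ ()) (c ∘ choice) (λ ()) j)
          (trans (+-identityʳ _) (rel j))) (i ↑ˡ 0))

      column-spanning : ∀ i → Spanned (c ∘ column) (c i)
      column-spanning i = let s , s≉0 , a , eq = spanning i in
        s , s≉0 , (λ t → a (t ↑ˡ 0)) , λ j → trans (eq j) (drop a j)

      rank-≤ : rank c ≤ k
      rank-≤ = independent-≤ _ column-independent

    -- The homology of D′ followed by D up to torsion: representatives that are independent modulo
    -- the image of D′ and span all cycles modulo that image after scaling, together with
    -- rank-nullity.
    record Homology {q m p} (D′ : Vector (Vector A m) q) (D : Vector (Vector A p) m) : Set where
      field
        dim         : ℕ
        cycle       : Vector (Vector A m) dim
        closed      : ∀ i j → lc (cycle i) D j ≈ 0#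
        independent : ∀ a x → (∀ j → lc a cycle j ≈ lc x D′ j) → ∀ i → a i ≈ 0#
        spanning    : ∀ v → (∀ j → lc v D j ≈ 0#) →
                      Σ[ s ∈ A ] ¬ s ≈ 0# × Σ[ c ∈ _ ] Σ[ x ∈ _ ]
                      ∀ j → s * v j ≈ lc c cycle j + lc x D′ j
        dim-rank    : dim ℕ.+ (rank D′ ℕ.+ rank D) ≡ m

    module _ {q m p} (D′ : Vector (Vector A m) q) (D : Vector (Vector A p) m)
      (D′D≈0 : ∀ i j → lc (D′ i) D j ≈ 0#) where

      private
        σ = column D
        b = D′ ∘ column D′

        -- A kernel vector for every column of D, from its dependence on the chosen ones.
        z : Vector (Vector A m) m
        z i j = let s , _ , c , _ = column-spanning D i in s * δ i j - lc c (δ ∘ σ) j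

        lc-minus : ∀ {l k} (x y : Vector A l) (v : Vector (Vector A k) l) j →
                   lc (λ i → x i - y i) v j ≈ lc x v j - lc y v j
        lc-minus x y v j = begin
          lc (λ i → x i - y i) v j                ≈⟨ lc-+ x (λ i → - y i) v j ⟩
          lc x v j + lc (λ i → - y i) v j         ≈⟨ +-congˡ (lc-congˡ v (λ i → -1*x≈-x (y i)) j) ⟨
          lc x v j + lc (λ i → - 1# * y i) v j    ≈⟨ +-congˡ (trans (lc-* (- 1#) y v j) (-1*x≈-x _)) ⟩
          lc x v j - lc y v j ∎

        lc-δ∘ : ∀ {l k} (i : Fin l) (D : Vector (Vector A k) l) j → lc (δ i) D j ≈ D i j
        lc-δ∘ {l} i D j = begin
          ∑[ t < l ] (δ i t * D t j)  ≈⟨ sum-cong-≋ {l} (λ t → trans (*-comm _ _) (*-congˡ (reflexive (δ-sym t)))) ⟩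
          ∑[ t < l ] (D t j * δ t i)  ≈⟨ sum-δ (λ t → D t j) i ⟩
          D i j ∎
          where
          δ-sym : ∀ t → δ i t ≡ δ t i
          δ-sym t with i ≟ t | t ≟ i
          ... | yes _ | yes _ = ≡.refl
          ... | no _  | no _  = ≡.refl
          ... | yes p | no q  = contradiction (≡.sym p) q
          ... | no p  | yes q = contradiction (≡.sym q) p

        lc-lcδ : ∀ {l t k} (c : Vector A t) (τ : Vector (Fin l) t) (D : Vector (Vector A k) l) j →
                 lc (lc c (δ ∘ τ)) D j ≈ lc c (D ∘ τ) j
        lc-lcδ c τ D j = trans (lc-lc c (δ ∘ τ) D j)
          (sum-cong-≋ λ i → *-congˡ (lc-δ∘ (τ i) D j))

        z-closed : ∀ i j → lc (z i) D j ≈ 0#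
        z-closed i j = let s , _ , c , eq = column-spanning D i in begin
          lc (z i) D j
            ≈⟨ lc-minus (λ t → s * δ i t) (lc c (δ ∘ σ)) D j ⟩
          lc (λ t → s * δ i t) D j - lc (lc c (δ ∘ σ)) D j
            ≈⟨ +-cong (trans (lc-* s (δ i) D j) (*-congˡ (lc-δ∘ i D j))) (-‿cong (lc-lcδ c σ D j)) ⟩
          s * D i j - lc c (D ∘ σ) j
            ≈⟨ trans (+-congʳ (eq j)) (-‿inverseʳ _) ⟩
          0# ∎

        b-closed : ∀ i j → lc (b i) D j ≈ 0#
        b-closed i = D′D≈0 (column D′ i)

        -- A basis of the kernel of D that begins from a basis b of the image of D′. The kernel
        -- vectors that have to be added represent the homology.
        open Extension (extend {b = b} z (column-independent D′))
          renaming (added to h; choice to τ; independent to zb-independent; spanning to zb-spanning)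

        zb = (z ∘ τ) ++ b

        closed-lc : ∀ {l} (a : Vector A l) (v : Vector (Vector A m) l) →
                    (∀ i j → lc (v i) D j ≈ 0#) → ∀ j → lc (lc a v) D j ≈ 0#
        closed-lc a v cl j = trans (lc-lc a v D j)
          (sum-0 λ i → trans (*-congˡ (cl i j)) (zeroʳ _))

        δ-spanned : ∀ i → Spanned (z ++ (δ ∘ σ)) (δ i)
        δ-spanned i = let s , s≉0 , c , _ = column-spanning D i in
          s , s≉0 , δ i ++ c , λ j → begin
            s * δ i j                                 ≈⟨ lemma (s * δ i j) (lc c (δ ∘ σ) j) ⟩
            z i j + lc c (δ ∘ σ) j                    ≈⟨ +-congʳ (lc-δ∘ i z j) ⟨
            lc (δ i) z j + lc c (δ ∘ σ) j             ≈⟨ lc-++-++ (δ i) c z (δ ∘ σ) j ⟨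
            lc (δ i ++ c) (z ++ (δ ∘ σ)) j ∎
          where
          lemma : ∀ x y → x ≈ x - y + y
          lemma x y = sym (trans (+-assoc _ _ _) (trans (+-congˡ (-‿inverseˡ y)) (+-identityʳ x)))

        -- D maps the unit vectors at the chosen columns to independent vectors, so their span meets
        -- the kernel only in zero.
        kernel-part : ∀ {l} (a : Vector A l) (v : Vector (Vector A m) l) y →
                      (∀ i j → lc (v i) D j ≈ 0#) →
                      (∀ j → lc (λ t → lc a v t + lc y (δ ∘ σ) t) D j ≈ 0#) → ∀ i → y i ≈ 0#
        kernel-part a v y cl eq = column-independent D y λ j → begin
          lc y (D ∘ σ) j                                     ≈⟨ lc-lcδ y σ D j ⟨
          lc (lc y (δ ∘ σ)) D j                              ≈⟨ +-identityˡ _ ⟨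
          0# + lc (lc y (δ ∘ σ)) D j                         ≈⟨ +-congʳ (closed-lc a v cl j) ⟨
          lc (lc a v) D j + lc (lc y (δ ∘ σ)) D j            ≈⟨ lc-+ (lc a v) (lc y (δ ∘ σ)) D j ⟨
          lc (λ t → lc a v t + lc y (δ ∘ σ) t) D j           ≈⟨ eq j ⟩
          0# ∎

        ker-spanned : ∀ v → (∀ j → lc v D j ≈ 0#) → Spanned zb v
        ker-spanned v cl = spanned-trans zb-spanning (s , s≉0 , x , λ j → begin
            s * v j                          ≈⟨ *-congˡ (lc-δ v j) ⟨
            s * lc v δ j                     ≈⟨ eq′ j ⟩
            lc x z j + lc y (δ ∘ σ) j        ≈⟨ +-congˡ (lc-0 (δ ∘ σ) y≈0 j) ⟩
            lc x z j + 0#                    ≈⟨ +-identityʳ _ ⟩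
            lc x z j                         ∎)
          where
          sp = spanned-lc v δ δ-spanned
          s  = proj₁ sp
          s≉0 = proj₁ (proj₂ sp)
          xy = proj₁ (proj₂ (proj₂ sp))
          x = λ i → xy (i ↑ˡ rank D)
          y = λ i → xy (m ↑ʳ i)
          eq′ : ∀ j → s * lc v δ j ≈ lc x z j + lc y (δ ∘ σ) j
          eq′ j = trans (proj₂ (proj₂ (proj₂ sp)) j) (lc-++ xy z (δ ∘ σ) j)
          y≈0 = kernel-part x z y z-closed λ j → begin
            lc (λ t → lc x z t + lc y (δ ∘ σ) t) D j
              ≈⟨ lc-congˡ D (λ t → trans (sym (eq′ t)) (*-congˡ (lc-δ v t))) j ⟩
            lc (λ t → s * v t) D j           ≈⟨ lc-* s v D j ⟩
            s * lc v D j                     ≈⟨ trans (*-congˡ (cl j)) (zeroʳ s) ⟩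
            0# ∎

        zb-closed : ∀ i j → lc (zb i) D j ≈ 0#
        zb-closed i j with splitAt h i
        ... | inj₁ t = z-closed (τ t) j
        ... | inj₂ t = b-closed t j

        -- Homology representatives, boundaries and a complement of the kernel form a basis of the
        -- whole space up to scaling. Comparing it with the unit vectors in both directions gives
        -- `dim-rank`.
        full = zb ++ (δ ∘ σ)

        full-independent : Independent full
        full-independent a rel = all
          where
          x = λ i → a (i ↑ˡ rank D)
          y = λ i → a ((h ℕ.+ rank D′) ↑ʳ i)
          y≈0 = kernel-part x zb y zb-closed λ j →
            lc-0 D (λ t → trans (sym (lc-++ a zb (δ ∘ σ) t)) (rel t)) j
          x≈0 = zb-independent x λ j → begin
            lc x zb j                        ≈⟨ +-identityʳ _ ⟨
            lc x zb j + 0#                   ≈⟨ +-congˡ (lc-0 (δ ∘ σ) y≈0 j) ⟨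
            lc x zb j + lc y (δ ∘ σ) j       ≈⟨ lc-++ a zb (δ ∘ σ) j ⟨
            lc a full j                      ≈⟨ rel j ⟩
            0# ∎
          all : ∀ i → a i ≈ 0#
          all i with splitAt (h ℕ.+ rank D′) i in eq
          ... | inj₁ t = trans (reflexive (≡.cong a (≡.sym (splitAt⁻¹-↑ˡ eq)))) (x≈0 t)
            where open import Data.Fin.Properties using (splitAt⁻¹-↑ˡ)
          ... | inj₂ t = trans (reflexive (≡.cong a (≡.sym (splitAt⁻¹-↑ʳ eq)))) (y≈0 t)
            where open import Data.Fin.Properties using (splitAt⁻¹-↑ʳ)

        full-spanning : ∀ i → Spanned full (δ i)
        full-spanning i = spanned-trans both (δ-spanned i)
          where
          both : ∀ t → Spanned full ((z ++ (δ ∘ σ)) t)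
          both t with splitAt m t
          ... | inj₁ u = spanned-++ˡ (δ ∘ σ) (zb-spanning u)
          ... | inj₂ u = spanned-++ʳ zb (spanned-self (δ ∘ σ) u)

        δ-independent : Independent (δ {m})
        δ-independent a rel i = trans (sym (lc-δ a i)) (rel i)

      homology : Homology D′ D
      homology = record
        { dim         = h
        ; cycle       = z ∘ τ
        ; closed      = λ i → z-closed (τ i)
        ; independent = independent′
        ; spanning    = λ v cl → let s , s≉0 , c , eq = ker-spanned v cl in
            s , s≉0 , (λ i → c (i ↑ˡ _)) , lc (λ i → c (h ↑ʳ i)) (δ ∘ column D′) , λ j →
            trans (eq j) (trans (lc-++ c (z ∘ τ) b j) (+-congˡ (sym (lc-lcδ _ (column D′) D′ j))))
        ; dim-rank    = ≡.trans (≡.sym (ℕₚ.+-assoc h _ _))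
            (ℕₚ.≤-antisym (independent-≤ full full-independent) (spanned-≤ δ-independent full-spanning))
        }
        where
        independent′ : ∀ a x → (∀ j → lc a (z ∘ τ) j ≈ lc x D′ j) → ∀ i → a i ≈ 0#
        independent′ a x eq i = cancel s≉0 (trans (sym (reflexive (lookup-++ˡ sa y i)))
            (zb-independent (sa ++ y) (λ j → begin
              lc (sa ++ y) zb j                ≈⟨ lc-++-++ sa y (z ∘ τ) b j ⟩
              lc sa (z ∘ τ) j + lc y b j
                ≈⟨ +-cong (sym (lc-* s a (z ∘ τ) j)) (lc-congˡ b (λ i → -1*x≈-x (d i)) j) ⟨
              s * lc a (z ∘ τ) j + lc (λ i → - 1# * d i) b j
                ≈⟨ +-cong (*-congˡ (eq j)) (trans (lc-* (- 1#) d b j) (-1*x≈-x _)) ⟩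
              s * lc x D′ j - lc d b j         ≈⟨ trans (+-congʳ (eq′ j)) (-‿inverseʳ _) ⟩
              0# ∎) (i ↑ˡ _)))
          where
          sp  = spanned-lc x D′ (column-spanning D′)
          s   = proj₁ sp
          s≉0 = proj₁ (proj₂ sp)
          d   = proj₁ (proj₂ (proj₂ sp))
          eq′ = proj₂ (proj₂ (proj₂ sp))
          sa  = λ i → s * a i
          y   = λ i → - d i

-- Monomials on arcs, and the three ways in which a smoothing change affects circles.

module Cube where

  open import Algebra.Bundles using (CommutativeRing)
  open import Data.Bool.Base using (Bool; if_then_else_; true; false)
  open import Data.Fin.Base using (Fin; zero; suc; toℕ; fromℕ<; punchIn)
  open import Data.Fin.Patterns using (0F; 1F; 2F; 3F)
  open import Data.Fin.Properties using (_≟_; all?; any?; toℕ-injective; suc-injective; punchInᵢ≢i; toℕ-fromℕ<; toℕ<n)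
  open import Data.Fin.Subset using (Subset; ∣_∣)
  open import Data.List.Base using (List; []; _∷_)
  import Data.List.Base as List
  open import Data.Nat.Base using (ℕ; zero; suc; _≤_; _∸_; _%_; NonZero)
  import Data.Nat.Base as ℕ
  import Data.Nat.Properties as ℕₚ
  open import Data.Nat.DivMod using (%-distribˡ-+)
  open import Data.Product.Base using (Σ-syntax; ∃; ∃-syntax; _×_; _,_; proj₁; proj₂)
  open import Data.Product.Properties using (≡-dec)
  open import Data.Sum.Base using (_⊎_; inj₁; inj₂)
  open import Data.Vec.Base using (Vec; lookup; []; _∷_; _[_]≔_)
  import Data.Vec.Base as Vec
  open import Data.Vec.Properties
    using (lookup∘tabulate; tabulate∘lookup; tabulate-cong; []≔-commutes; lookup∘update; lookup∘update′)
  open import Data.Vec.Functional using (Vector)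
  open import Function.Base using (_∘_)
  open import Level using (0ℓ)
  open import Relation.Binary.PropositionalEquality as ≡ using (_≡_; _≢_; cong; cong₂)
  open import Relation.Nullary using (¬_; Dec; yes; no; does; contradiction)
  open import Relation.Nullary.Decidable using (_×-dec_; _→-dec_; ¬?; dec-true; dec-false)
  import Algebra.Properties.CommutativeMonoid.Sum ℕₚ.+-0-commutativeMonoid as ℕ∑

  Exp : Set
  Exp = ℕ × ℕ

  infixl 6 _⊕_
  _⊕_ : Exp → Exp → Exp
  (i , j) ⊕ (k , l) = i ℕ.+ k , j ℕ.+ l

  ⊕-comm : ∀ a b → a ⊕ b ≡ b ⊕ a
  ⊕-comm (i , j) (k , l) = cong₂ _,_ (ℕₚ.+-comm i k) (ℕₚ.+-comm j l)

  ⊕-assoc : ∀ a b d → a ⊕ b ⊕ d ≡ a ⊕ (b ⊕ d)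
  ⊕-assoc (i , j) (k , l) (m , n) = cong₂ _,_ (ℕₚ.+-assoc i k m) (ℕₚ.+-assoc j l n)

  ⊕-identityʳ : ∀ a → a ⊕ (0 , 0) ≡ a
  ⊕-identityʳ (i , j) = cong₂ _,_ (ℕₚ.+-identityʳ i) (ℕₚ.+-identityʳ j)

  ⊕-swap : ∀ a b d → a ⊕ (b ⊕ d) ≡ b ⊕ (a ⊕ d)
  ⊕-swap a b d = ≡.trans (≡.sym (⊕-assoc a b d)) (≡.trans (cong (_⊕ d) (⊕-comm a b)) (⊕-assoc b a d))

  -- Rewrites y^3 to x y but does not truncate powers of x. The relation x^4 = 0 is kept apart, in
  -- `Vanishing`, so that reduction is compatible with adding exponents.
  nf′ : ℕ → ℕ → Exp
  nf′ i (suc (suc (suc j))) = nf′ (suc i) (suc j)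
  nf′ i j                   = i , j

  nf : Exp → Exp
  nf (i , j) = nf′ i j

  nf-⊕ : ∀ a b → nf (a ⊕ b) ≡ nf (nf a ⊕ b)
  nf-⊕ (i , j) b = go i j b
    where
    go : ∀ i j b → nf ((i , j) ⊕ b) ≡ nf (nf′ i j ⊕ b)
    go i 0 b = ≡.refl
    go i 1 b = ≡.refl
    go i 2 b = ≡.refl
    go i (suc (suc (suc j))) b = go (suc i) (suc j) b

  nf-cong : ∀ {a b} d → nf a ≡ nf b → nf (a ⊕ d) ≡ nf (b ⊕ d)
  nf-cong {a} {b} d eq = ≡.trans (nf-⊕ a d) (≡.trans (cong (λ z → nf (z ⊕ d)) eq) (≡.sym (nf-⊕ b d)))

  nf-congʳ : ∀ d {a b} → nf a ≡ nf b → nf (d ⊕ a) ≡ nf (d ⊕ b)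
  nf-congʳ d {a} {b} eq = ≡.trans (cong nf (⊕-comm d a)) (≡.trans (nf-cong {a} {b} d eq) (cong nf (⊕-comm b d)))

  nf-≤ : ∀ i j → i ≤ proj₁ (nf′ i j)
  nf-≤ i 0 = ℕₚ.≤-refl
  nf-≤ i 1 = ℕₚ.≤-refl
  nf-≤ i 2 = ℕₚ.≤-refl
  nf-≤ i (suc (suc (suc j))) = ℕₚ.≤-trans (ℕₚ.n≤1+n i) (nf-≤ (suc i) (suc j))

  -- A monomial with this property is divisible by x^4, hence zero in V.
  Vanishing : Exp → Set
  Vanishing a = 4 ≤ proj₁ (nf a)

  vanishing-⊕ : ∀ a b → Vanishing a → Vanishing (a ⊕ b)
  vanishing-⊕ a b v = ≡.subst (λ z → 4 ≤ proj₁ z) (≡.sym (nf-⊕ a b))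
    (ℕₚ.≤-trans v (ℕₚ.≤-trans (ℕₚ.m≤m+n _ _) (nf-≤ (proj₁ (nf a ⊕ b)) (proj₂ (nf a ⊕ b)))))

  data Kind : Set where
    merging same splitting : Kind

  -- A product of monomials attached to arcs. Arcs persist from state to state while circles do not,
  -- so one arc monomial denotes an element of the tensor power of every state: on each circle,
  -- multiply what its arcs carry.
  Arc-monomial : ℕ → Set
  Arc-monomial N = List (Fin N × Exp)

  only : ∀ {P : Set} → Dec P → Exp → Exp
  only d t = if does d then t else 0 , 0

  only-⊕ : ∀ {P : Set} (d : Dec P) s t → only d (s ⊕ t) ≡ only d s ⊕ only d t
  only-⊕ (yes _) s t = ≡.refl
  only-⊕ (no _)  s t = ≡.refl

  exponent : ∀ {N k} → (Fin N → Fin k) → Arc-monomial N → Fin k → Exp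
  exponent circ []            c = 0 , 0
  exponent circ ((a , t) ∷ m) c = only (circ a ≟ c) t ⊕ exponent circ m c

  ⌜_⌝ : Fin 4 × Fin 3 → Exp
  ⌜ i , j ⌝ = toℕ i , toℕ j

  _≟ᵉ_ : (a b : Exp) → Dec (a ≡ b)
  _≟ᵉ_ = ≡-dec ℕₚ._≟_ ℕₚ._≟_

  -- The arc monomial denotes exactly the basis tensor L.
  Match : ∀ {N k} → (Fin N → Fin k) → Arc-monomial N → Vec (Fin 4 × Fin 3) k → Set
  Match circ m L = ∀ c → nf (exponent circ m c) ≡ ⌜ lookup L c ⌝

  match? : ∀ {N k} circ (m : Arc-monomial N) (L : Vec _ k) → Dec (Match circ m L)
  match? circ m L = all? λ c → nf (exponent circ m c) ≟ᵉ ⌜ lookup L c ⌝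

  vanishing⇒¬match : ∀ {N k} circ (m : Arc-monomial N) (L : Vec _ k) c →
                     Vanishing (exponent circ m c) → ¬ Match circ m L
  vanishing⇒¬match circ m L c v match = ℕₚ.<-irrefl ≡.refl
    (ℕₚ.≤-<-trans (≡.subst (4 ≤_) (cong proj₁ (match c)) v) (toℕ<n (proj₁ (lookup L c))))

  -- The equivalence relation of lying on a common circle after the circles through x and y have
  -- been fused.
  Join : ∀ {N k} → (Fin N → Fin k) → (x y a b : Fin N) → Set
  Join circ x y a b = circ a ≡ circ b ⊎ (circ a ≡ circ x × circ b ≡ circ y)
                                      ⊎ (circ a ≡ circ y × circ b ≡ circ x)

  Refines : ∀ {N k k′} → (Fin N → Fin k) → (Fin N → Fin k′) → Set
  Refines circ circ′ = ∀ {a b} → circ a ≡ circ b → circ′ a ≡ circ′ b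

  -- Here x and y are the feet at one end of the edge whose smoothing changes. The case of two
  -- different circles both before and after is absent; `BlowupStates.step` shows that it cannot
  -- occur.
  data Step {N k k′} (circ : Fin N → Fin k) (circ′ : Fin N → Fin k′) (x y : Fin N) : Kind → Set where
    merges : circ x ≢ circ y → circ′ x ≡ circ′ y → Refines circ circ′ →
             (∀ {a b} → circ′ a ≡ circ′ b → Join circ x y a b) → Step circ circ′ x y merging
    keeps  : circ x ≡ circ y → circ′ x ≡ circ′ y → Refines circ circ′ →
             Refines circ′ circ → Step circ circ′ x y same
    splits : circ x ≡ circ y → circ′ x ≢ circ′ y → Refines circ′ circ →
             (∀ {a b} → circ a ≡ circ b → Join circ′ x y a b) → Step circ circ′ x y splitting

  only-⇔ : ∀ {P Q : Set} (p : Dec P) (q : Dec Q) t → (P → Q) → (Q → P) → only p t ≡ only q t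
  only-⇔ (yes _) (yes _) t f g = ≡.refl
  only-⇔ (no _)  (no _)  t f g = ≡.refl
  only-⇔ (yes p) (no ¬q) t f g = contradiction (f p) ¬q
  only-⇔ (no ¬p) (yes q) t f g = contradiction (g q) ¬p

  only-yes : ∀ {P : Set} (p : Dec P) t → P → only p t ≡ t
  only-yes (yes _) t _ = ≡.refl
  only-yes (no ¬p) t p = contradiction p ¬p

  only-no : ∀ {P : Set} (p : Dec P) t → ¬ P → only p t ≡ (0 , 0)
  only-no (yes p) t ¬p = contradiction p ¬p
  only-no (no _)  t _  = ≡.refl

  ⌜⌝-injective : ∀ {A B} → ⌜ A ⌝ ≡ ⌜ B ⌝ → A ≡ B
  ⌜⌝-injective eq = cong₂ _,_ (toℕ-injective (cong proj₁ eq)) (toℕ-injective (cong proj₂ eq))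

  nf-⌜⌝ : ∀ A → nf ⌜ A ⌝ ≡ ⌜ A ⌝
  nf-⌜⌝ (i , 0F) = ≡.refl
  nf-⌜⌝ (i , 1F) = ≡.refl
  nf-⌜⌝ (i , 2F) = ≡.refl

  module _ {N k k′} (circ : Fin N → Fin k) (circ′ : Fin N → Fin k′) where

    exponent-⇔ : ∀ {c c′} → (∀ b → circ b ≡ c → circ′ b ≡ c′) → (∀ b → circ′ b ≡ c′ → circ b ≡ c) →
                 ∀ m → exponent circ m c ≡ exponent circ′ m c′
    exponent-⇔ f g []            = ≡.refl
    exponent-⇔ f g ((a , t) ∷ m) = cong₂ _⊕_ (only-⇔ (circ a ≟ _) (circ′ a ≟ _) t (f a) (g a)) (exponent-⇔ f g m)

    -- When a circle is the union of two circles of another state, its exponent is the sum of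
    -- theirs. This is how arc monomials see both a merge and a split.
    exponent-split : ∀ {c c₁ c₂} → c₁ ≢ c₂ → (∀ b → circ b ≡ c → circ′ b ≡ c₁ ⊎ circ′ b ≡ c₂) →
                     (∀ b → circ′ b ≡ c₁ → circ b ≡ c) → (∀ b → circ′ b ≡ c₂ → circ b ≡ c) →
                     ∀ m → exponent circ m c ≡ exponent circ′ m c₁ ⊕ exponent circ′ m c₂
    exponent-split c₁≢c₂ f g h [] = ≡.refl
    exponent-split {c} {c₁} {c₂} c₁≢c₂ f g h ((a , t) ∷ m)
      with circ a ≟ c | circ′ a ≟ c₁ | circ′ a ≟ c₂ | exponent-split c₁≢c₂ f g h m
    ... | _       | yes p | yes q | _ = contradiction (≡.trans (≡.sym p) q) c₁≢c₂
    ... | no ≢c   | yes p | _     | _ = contradiction (g a p) ≢c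
    ... | no ≢c   | no _  | yes q | _ = contradiction (h a q) ≢c
    ... | no _    | no _  | no _  | ih = ih
    ... | yes _   | yes _ | no _  | ih = ≡.trans (cong (t ⊕_) ih)
      (≡.sym (⊕-assoc t (exponent circ′ m c₁) (exponent circ′ m c₂)))
    ... | yes _   | no _  | yes _ | ih = ≡.trans (cong (t ⊕_) ih)
      (⊕-swap t (exponent circ′ m c₁) (exponent circ′ m c₂))
    ... | yes a≡c | no ≢₁ | no ≢₂ | _ with f a a≡c
    ...   | inj₁ p = contradiction p ≢₁
    ...   | inj₂ q = contradiction q ≢₂

  exponent-tabulate-0 : ∀ {N k n} (circ : Fin N → Fin k) (r : Fin n → Fin N) (t : Fin n → Exp) c →
                        (∀ i → circ (r i) ≢ c) → exponent circ (List.tabulate λ i → r i , t i) c ≡ (0 , 0)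
  exponent-tabulate-0 {n = zero}  circ r t c ≢c = ≡.refl
  exponent-tabulate-0 {n = suc n} circ r t c ≢c = cong₂ _⊕_ (only-no (circ (r zero) ≟ c) (t zero) (≢c zero))
    (exponent-tabulate-0 circ (r ∘ suc) (t ∘ suc) c (≢c ∘ suc))

  exponent-tabulate : ∀ {N k n} (circ : Fin N → Fin k) (r : Fin n → Fin N) (t : Fin n → Exp) →
                      (∀ {i j} → circ (r i) ≡ circ (r j) → i ≡ j) →
                      ∀ i → exponent circ (List.tabulate λ i → r i , t i) (circ (r i)) ≡ t i
  exponent-tabulate {n = suc n} circ r t inj zero = ≡.trans
    (cong₂ _⊕_ (only-yes (circ (r zero) ≟ _) (t zero) ≡.refl)
      (exponent-tabulate-0 circ (r ∘ suc) (t ∘ suc) (circ (r zero)) λ i eq → contradiction (inj eq) λ ()))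
    (⊕-identityʳ (t zero))
  exponent-tabulate {n = suc n} circ r t inj (suc i) = cong₂ _⊕_
    (only-no (circ (r zero) ≟ _) (t zero) λ eq → contradiction (inj eq) λ ())
    (exponent-tabulate circ (r ∘ suc) (t ∘ suc) (λ eq → suc-injective (inj eq)) i)

  module _ {N k k′} {circ : Fin N → Fin k} {circ′ : Fin N → Fin k′} {x y : Fin N} where

    Near : ∀ {k} → (Fin N → Fin k) → Fin N → Set
    Near circ f = circ f ≡ circ x ⊎ circ f ≡ circ y

    join⇒near : ∀ {k} {circ : Fin N → Fin k} {f} → Join circ x y f x ⊎ Join circ x y f y → Near circ f
    join⇒near (inj₁ (inj₁ p))              = inj₁ p
    join⇒near (inj₁ (inj₂ (inj₁ (p , _)))) = inj₁ p
    join⇒near (inj₁ (inj₂ (inj₂ (p , _)))) = inj₂ p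
    join⇒near (inj₂ (inj₁ p))              = inj₂ p
    join⇒near (inj₂ (inj₂ (inj₁ (p , _)))) = inj₁ p
    join⇒near (inj₂ (inj₂ (inj₂ (p , _)))) = inj₂ p

    near⇒ : ∀ {κ f} → Step circ circ′ x y κ → Near circ f → Near circ′ f
    near⇒ (merges _ _ r _) (inj₁ p) = inj₁ (r p)
    near⇒ (merges _ _ r _) (inj₂ p) = inj₂ (r p)
    near⇒ (keeps _ _ r _)  (inj₁ p) = inj₁ (r p)
    near⇒ (keeps _ _ r _)  (inj₂ p) = inj₂ (r p)
    near⇒ (splits _ _ _ j) (inj₁ p) = join⇒near {circ = circ′} (inj₁ (j p))
    near⇒ (splits _ _ _ j) (inj₂ p) = join⇒near {circ = circ′} (inj₂ (j p))

    near⇐ : ∀ {κ f} → Step circ circ′ x y κ → Near circ′ f → Near circ f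
    near⇐ (merges _ _ _ j) (inj₁ p) = join⇒near {circ = circ} (inj₁ (j p))
    near⇐ (merges _ _ _ j) (inj₂ p) = join⇒near {circ = circ} (inj₂ (j p))
    near⇐ (keeps _ _ _ r)  (inj₁ p) = inj₁ (r p)
    near⇐ (keeps _ _ _ r)  (inj₂ p) = inj₂ (r p)
    near⇐ (splits _ _ r _) (inj₁ p) = inj₁ (r p)
    near⇐ (splits _ _ r _) (inj₂ p) = inj₂ (r p)

    far-join : ∀ {k} {circ : Fin N → Fin k} {b f} → ¬ Near circ f → Join circ x y b f → circ b ≡ circ f
    far-join far (inj₁ p)              = p
    far-join far (inj₂ (inj₁ (_ , q))) = contradiction (inj₂ q) far
    far-join far (inj₂ (inj₂ (_ , q))) = contradiction (inj₁ q) far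

    far⇒ : ∀ {κ f} → Step circ circ′ x y κ → ¬ Near circ f → ∀ b → circ b ≡ circ f → circ′ b ≡ circ′ f
    far⇒ (merges _ _ r _)   far b = r
    far⇒ (keeps _ _ r _)    far b = r
    far⇒ σ@(splits _ _ _ j) far b p = far-join (far ∘ near⇐ σ) (j p)

    far⇐ : ∀ {κ f} → Step circ circ′ x y κ → ¬ Near circ f → ∀ b → circ′ b ≡ circ′ f → circ b ≡ circ f
    far⇐ (merges _ _ _ j) far b p = far-join far (j p)
    far⇐ (keeps _ _ _ r)  far b = r
    far⇐ (splits _ _ r _) far b = r

  nf-<3 : ∀ i j → proj₂ (nf′ i j) ℕ.< 3
  nf-<3 i 0 = ℕ.s≤s ℕ.z≤n
  nf-<3 i 1 = ℕ.s≤s (ℕ.s≤s ℕ.z≤n)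
  nf-<3 i 2 = ℕ.s≤s (ℕ.s≤s (ℕ.s≤s ℕ.z≤n))
  nf-<3 i (suc (suc (suc j))) = nf-<3 (suc i) (suc j)

  -- Every arc monomial denotes a basis tensor or zero: reduce on each circle and check whether a
  -- power x^4 appears.
  match-or-vanishing : ∀ {N k} (circ : Fin N → Fin k) m →
                       (Σ[ L ∈ Vec _ k ] Match circ m L) ⊎ (∃[ c ] Vanishing (exponent circ m c))
  match-or-vanishing circ m with any? (λ c → 4 ℕₚ.≤? proj₁ (nf (exponent circ m c)))
  ... | yes v   = inj₂ v
  ... | no none = inj₁ (Vec.tabulate label , λ c → ≡.sym (≡.trans (cong ⌜_⌝ (lookup∘tabulate label c))
    (cong₂ _,_ (toℕ-fromℕ< (small c)) (toℕ-fromℕ< (nf-<3 (proj₁ (E c)) (proj₂ (E c)))))))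
    where
    E = exponent circ m
    small : ∀ c → proj₁ (nf (E c)) ℕ.< 4
    small c = ℕₚ.≰⇒> λ v → none (c , v)
    label : ∀ c → Fin 4 × Fin 3
    label c = fromℕ< (small c) , fromℕ< (nf-<3 (proj₁ (E c)) (proj₂ (E c)))

  match-unique : ∀ {N k} {circ : Fin N → Fin k} {m} {L L′ : Vec _ k} →
                 Match circ m L → Match circ m L′ → L ≡ L′
  match-unique {L = L} {L′} p q = ≡.trans (≡.sym (tabulate∘lookup L))
    (≡.trans (tabulate-cong λ c → ⌜⌝-injective (≡.trans (≡.sym (p c)) (q c))) (tabulate∘lookup L′))

  -- The relation y^3 = x y preserves degrees only modulo q in general, so the degree of a labelling
  -- agrees modulo q with the weight of any arc monomial that it matches. The weight does not
  -- mention circles, which makes degrees comparable across states.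
  module Degree (D : Exp → ℕ) (D-0 : D (0 , 0) ≡ 0) (D-⊕ : ∀ a b → D (a ⊕ b) ≡ D a ℕ.+ D b)
    (q : ℕ) .{{_ : NonZero q}} (D-nf : ∀ a → D (nf a) % q ≡ D a % q) where

    open ℕ∑

    weight : ∀ {N} → Arc-monomial N → ℕ
    weight []            = 0
    weight ((_ , t) ∷ m) = D t ℕ.+ weight m

    sum-only : ∀ {k} (a : Fin k) t → ∑[ c < k ] D (only (a ≟ c) t) ≡ D t
    sum-only {suc k} zero t = ≡.trans (cong (D t ℕ.+_) (≡.trans
      (sum-cong-≗ {k} {y = λ _ → 0} λ c → D-0) (sum-replicate-zero k))) (ℕₚ.+-identityʳ _)
    sum-only {suc k} (suc a) t = ≡.trans (cong (ℕ._+ ∑[ c < k ] D (only (suc a ≟ suc c) t)) D-0)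
      (≡.trans (sum-cong-≗ {k} λ c → cong D (only-⇔ (suc a ≟ suc c) (a ≟ c) t suc-injective (cong suc)))
        (sum-only a t))

    sum-exponent : ∀ {N k} (circ : Fin N → Fin k) m → ∑[ c < k ] D (exponent circ m c) ≡ weight m
    sum-exponent {k = k} circ [] = ≡.trans (sum-cong-≗ {k} λ c → D-0) (sum-replicate-zero k)
    sum-exponent {k = k} circ ((a , t) ∷ m) = begin
      ∑[ c < k ] D (only (circ a ≟ c) t ⊕ exponent circ m c)
        ≡⟨ sum-cong-≗ {k} (λ c → D-⊕ (only (circ a ≟ c) t) (exponent circ m c)) ⟩
      ∑[ c < k ] (D (only (circ a ≟ c) t) ℕ.+ D (exponent circ m c))
        ≡⟨ ∑-distrib-+ {k} (λ c → D (only (circ a ≟ c) t)) (λ c → D (exponent circ m c)) ⟩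
      ∑[ c < k ] D (only (circ a ≟ c) t) ℕ.+ ∑[ c < k ] D (exponent circ m c)
        ≡⟨ cong₂ ℕ._+_ (sum-only (circ a) t) (sum-exponent circ m) ⟩
      D t ℕ.+ weight m ∎
      where open ≡.≡-Reasoning

    +-cong-% : ∀ {a b x y} → a % q ≡ b % q → x % q ≡ y % q → (a ℕ.+ x) % q ≡ (b ℕ.+ y) % q
    +-cong-% {a} {b} {x} {y} p r = ≡.trans (%-distribˡ-+ a x q)
      (≡.trans (cong₂ (λ u v → (u ℕ.+ v) % q) p r) (≡.sym (%-distribˡ-+ b y q)))

    sum-cong-% : ∀ {k} {f g : Fin k → ℕ} → (∀ c → f c % q ≡ g c % q) → sum f % q ≡ sum g % q
    sum-cong-% {zero}          eq = ≡.refl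
    sum-cong-% {suc k} {f} {g} eq = +-cong-% {f zero} {g zero} (eq zero) (sum-cong-% (eq ∘ suc))

    degree : ∀ {k} → Vec (Fin 4 × Fin 3) k → ℕ
    degree L = Vec.sum (Vec.map (D ∘ ⌜_⌝) L)

    degree-sum : ∀ {k} (L : Vec _ k) → degree L ≡ ∑[ c < k ] D ⌜ lookup L c ⌝
    degree-sum []      = ≡.refl
    degree-sum (A ∷ L) = cong (D ⌜ A ⌝ ℕ.+_) (degree-sum L)

    match-degree : ∀ {N k} {circ : Fin N → Fin k} m {L} → Match circ m L → degree L % q ≡ weight m % q
    match-degree {k = k} {circ} m {L} match = ≡.trans (cong (_% q) (degree-sum L))
      (≡.trans (sum-cong-% {k} λ c → ≡.trans (cong (λ z → D z % q) (≡.sym (match c))) (D-nf (exponent circ m c)))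
        (cong (_% q) (sum-exponent circ m)))

  D₁ D₂ : Exp → ℕ
  D₁ (i , j) = 2 ℕ.* i ℕ.+ j
  D₂ (i , j) = j

  D₁-⊕ : ∀ a b → D₁ (a ⊕ b) ≡ D₁ a ℕ.+ D₁ b
  D₁-⊕ (i , j) (k , l) = ≡.trans (cong (ℕ._+ (j ℕ.+ l)) (ℕₚ.*-distribˡ-+ 2 i k)) (interchange (2 ℕ.* i) (2 ℕ.* k) j l)
    where open import Algebra.Properties.CommutativeSemigroup ℕₚ.+-commutativeSemigroup using (interchange)

  D₁-nf : ∀ a → D₁ (nf a) % 4 ≡ D₁ a % 4
  D₁-nf (i , j) = cong (_% 4) (go i j)
    where
    go : ∀ i j → D₁ (nf′ i j) ≡ D₁ (i , j)
    go i 0 = ≡.refl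
    go i 1 = ≡.refl
    go i 2 = ≡.refl
    go i (suc (suc (suc j))) = ≡.trans (go (suc i) (suc j)) (≡.trans
      (cong (ℕ._+ suc j) (ℕₚ.*-suc 2 i)) (≡.trans (cong (λ z → suc (suc z)) (ℕₚ.+-suc (2 ℕ.* i) j))
      (≡.sym (≡.trans (ℕₚ.+-suc (2 ℕ.* i) (suc (suc j))) (cong suc (≡.trans (ℕₚ.+-suc (2 ℕ.* i) (suc j))
        (cong suc (ℕₚ.+-suc (2 ℕ.* i) j))))))))

  D₂-nf : ∀ a → D₂ (nf a) % 2 ≡ D₂ a % 2
  D₂-nf (i , j) = go i j
    where
    go : ∀ i j → D₂ (nf′ i j) % 2 ≡ j % 2
    go i 0 = ≡.refl
    go i 1 = ≡.refl
    go i 2 = ≡.refl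
    go i (suc (suc (suc j))) = go (suc i) (suc j)

  module Degree₁ = Degree D₁ ≡.refl D₁-⊕ 4 D₁-nf
  module Degree₂ = Degree D₂ ≡.refl (λ _ _ → ≡.refl) 2 D₂-nf

  Balanced : Exp → Exp → Set
  Balanced s t = (D₁ s ℕ.+ D₁ t) % 4 ≡ 0 × (D₂ s ℕ.+ D₂ t) % 2 ≡ 0

  -- The coproduct element Δ(1), the commuting squares of the cube, and the differential.

  module Square where

  open import Algebra.Bundles using (CommutativeRing)
  open import Data.Bool.Base using (Bool; if_then_else_; true; false)
  import Data.Bool.Properties as Boolₚ
  open import Data.Fin.Base using (Fin; zero; suc; toℕ; fromℕ<)
  open import Data.Fin.Patterns using (0F; 1F; 2F; 3F)
  open import Data.Fin.Properties using (_≟_; any?; toℕ-fromℕ<)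
  open import Data.Fin.Subset using (Subset; ∣_∣)
  open import Data.List.Base using (List; []; _∷_)
  import Data.List.Base as List
  open import Data.Nat.Base using (ℕ; zero; suc; _%_; NonZero)
  import Data.Nat.Base as ℕ
  import Data.Nat.Properties as ℕₚ
  open import Data.Nat.DivMod using (%-distribˡ-+)
  open import Data.Product.Base using (Σ-syntax; ∃; ∃-syntax; _×_; _,_; proj₁; proj₂)
  open import Data.Product.Properties using (≡-dec)
  open import Data.Sum.Base using (_⊎_; inj₁; inj₂)
  open import Data.Vec.Base using (Vec; lookup; []; _∷_; _[_]≔_)
  import Data.Vec.Base as Vec
  open import Data.Vec.Properties
    using (lookup∘tabulate; tabulate∘lookup; tabulate-cong; []≔-commutes; lookup∘update; lookup∘update′)
  open import Data.Vec.Functional using (Vector)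
  open import Function.Base using (_∘_)
  open import Level using (0ℓ)
  open import Relation.Binary.PropositionalEquality as ≡ using (_≡_; _≢_; cong; cong₂)
  open import Relation.Nullary using (¬_; Dec; yes; no; does; contradiction)
  open import Relation.Nullary.Decidable using (dec-true; dec-false; decidable-stable)

  module _ (R : CommutativeRing 0ℓ 0ℓ) where
    open CommutativeRing R

    Twelfth : Carrier → Set
    Twelfth c = t + (t + (t + (t + 0#))) ≈ 1#
      where t = c + c + c

  module CubeComplex (R : CommutativeRing 0ℓ 0ℓ) (c : CommutativeRing.Carrier R) (12c≈1 : Twelfth R c) where

    open CommutativeRing R renaming (Carrier to A) hiding (zero)
    open MöbiusOver using (basis; _⊗_; μ; mV; Δ; _·_)
    open MöbiusOver.Complex using (coefficient; agreeAway?; restrict; ∂-edge; ∂-term; ∂)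
    open MöbiusOver R c 4 hiding (basis; _⊗_; μ; mV; Δ; _·_)
    open import Algebra.Properties.Semiring.Sum semiring
    open import Algebra.Properties.Semiring.Exp semiring using (_^_; ^-homo-*)
    open import Algebra.Properties.Ring ring using (-‿distribˡ-*; -‿distribʳ-*; -1*x≈-x)
    open import Algebra.Properties.AbelianGroup +-abelianGroup using (⁻¹-involutive)
    open import Relation.Binary.Reasoning.Setoid setoid
    open import Algebra.Solver.Ring.NaturalCoefficients.Default commutativeSemiring
      using (solve; _:=_; _:+_; _:*_; con)

    ind : ∀ {p} {P : Set p} → Dec P → A
    ind d = if does d then 1# else 0#

    ind-yes : ∀ {p} {P : Set p} (d : Dec P) → P → ind d ≡ 1#
    ind-yes (yes _) _ = ≡.refl
    ind-yes (no ¬p) p = contradiction p ¬p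

    ind-no : ∀ {p} {P : Set p} (d : Dec P) → ¬ P → ind d ≡ 0#
    ind-no (yes p) ¬p = contradiction p ¬p
    ind-no (no _)  _  = ≡.refl

    ind-⇔ : ∀ {p q} {P : Set p} {Q : Set q} (d : Dec P) (e : Dec Q) → (P → Q) → (Q → P) → ind d ≡ ind e
    ind-⇔ (yes p) e f g = ≡.sym (ind-yes e (f p))
    ind-⇔ (no ¬p) e f g = ≡.sym (ind-no e (¬p ∘ g))

    -- A function of a pair of monomials, standing for a linear form on V ⊗ V. An element of V ⊗ V
    -- is handled through its values on such forms.
    Bilinear : Set
    Bilinear = Exp → Exp → A

    X : Bilinear → Vector A 3
    X T k = T (suc (toℕ k) , 0) (4 ∸ suc (toℕ k) , 0)

    Y₂ Y₁ Y₀ : Bilinear → Vector A 4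
    Y₂ T k = T (toℕ k , 2) (3 ∸ toℕ k , 0)
    Y₁ T k = T (toℕ k , 1) (3 ∸ toℕ k , 1)
    Y₀ T k = T (toℕ k , 0) (3 ∸ toℕ k , 2)

    Sx Sy W : Bilinear → A
    Sx T = sum (X T)
    Sy T = ∑[ k < 4 ] (Y₂ T k + Y₁ T k + Y₀ T k)
    W T = - c * Sx T + c * Sy T

    -- Evaluates T at the element by which a step multiplies: 1 ⊗ 1 for a merge, x y^2 ⊗ 1 for one
    -- circle becoming one circle, and Δ(1) for a split.
    weigh : Kind → Bilinear → A
    weigh merging   T = T (0 , 0) (0 , 0)
    weigh same      T = T (1 , 2) (0 , 0)
    weigh splitting T = W T

    weigh-cong : ∀ κ {T U} → (∀ s t → T s t ≈ U s t) → weigh κ T ≈ weigh κ U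
    weigh-cong merging   eq = eq _ _
    weigh-cong same      eq = eq _ _
    weigh-cong splitting {T} {U} eq = +-cong
      (*-congˡ {x = - c} (sum-cong-≋ {3} {X T} {X U} λ k → eq _ _))
      (*-congˡ {x = c} (sum-cong-≋ {4} {λ k → Y₂ T k + Y₁ T k + Y₀ T k} {λ k → Y₂ U k + Y₁ U k + Y₀ U k}
        λ k → +-cong (+-cong (eq _ _) (eq _ _)) (eq _ _)))

    weigh-+ : ∀ κ T U → weigh κ (λ s t → T s t + U s t) ≈ weigh κ T + weigh κ U
    weigh-+ merging   T U = refl
    weigh-+ same      T U = refl
    weigh-+ splitting T U = trans
      (+-cong (*-congˡ {x = - c} (∑-distrib-+ {3} (X T) (X U)))
        (*-congˡ {x = c} (trans (sum-cong-≋ {4} {y = λ k → (Y₂ T k + Y₁ T k + Y₀ T k) + (Y₂ U k + Y₁ U k + Y₀ U k)}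
            λ k → solve 6 (λ a b d e f g →
            (a :+ b) :+ (d :+ e) :+ (f :+ g) := (a :+ d :+ f) :+ (b :+ e :+ g)) refl
            (Y₂ T k) (Y₂ U k) (Y₁ T k) (Y₁ U k) (Y₀ T k) (Y₀ U k))
          (∑-distrib-+ {4} (λ k → Y₂ T k + Y₁ T k + Y₀ T k) (λ k → Y₂ U k + Y₁ U k + Y₀ U k)))))
      (solve 6 (λ n d a b e f → n :* (a :+ b) :+ d :* (e :+ f) := (n :* a :+ d :* e) :+ (n :* b :+ d :* f))
        refl (- c) c (Sx T) (Sx U) (Sy T) (Sy U))

    weigh-* : ∀ κ r T → weigh κ (λ s t → r * T s t) ≈ r * weigh κ T
    weigh-* merging   r T = refl
    weigh-* same      r T = refl
    weigh-* splitting r T = trans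
      (+-cong (*-congˡ {x = - c} (sym (*-distribˡ-sum {3} r (X T))))
        (*-congˡ {x = c} (trans (sum-cong-≋ {4} {y = λ k → r * (Y₂ T k + Y₁ T k + Y₀ T k)} λ k →
            solve 4 (λ r a b d → r :* a :+ r :* b :+ r :* d := r :* (a :+ b :+ d)) refl r
            (Y₂ T k) (Y₁ T k) (Y₀ T k))
          (sym (*-distribˡ-sum {4} r λ k → Y₂ T k + Y₁ T k + Y₀ T k)))))
      (solve 5 (λ n d r a b → n :* (r :* a) :+ d :* (r :* b) := r :* (n :* a :+ d :* b))
        refl (- c) c r (Sx T) (Sy T))

    weigh-0 : ∀ κ {T} → (∀ s t → T s t ≈ 0#) → weigh κ T ≈ 0#
    weigh-0 κ {T} eq = begin
      weigh κ T                        ≈⟨ weigh-cong κ (λ s t → trans (eq s t) (sym (zeroˡ 0#))) ⟩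
      weigh κ (λ _ _ → 0# * 0#)        ≈⟨ weigh-* κ 0# (λ _ _ → 0#) ⟩
      0# * weigh κ (λ _ _ → 0#)        ≈⟨ zeroˡ _ ⟩
      0# ∎

    weigh-sum : ∀ κ {n} (T : Fin n → Bilinear) →
                weigh κ (λ s t → ∑[ k < n ] T k s t) ≈ ∑[ k < n ] weigh κ (T k)
    weigh-sum κ {zero}  T = weigh-0 κ λ _ _ → refl
    weigh-sum κ {suc n} T = trans (weigh-+ κ (T zero) (λ s t → ∑[ k < n ] T (suc k) s t))
      (+-congˡ (weigh-sum κ (T ∘ suc)))

    -- Multiplications by two elements commute, because both are finite linear combinations and the
    -- sums can be exchanged.
    weigh-comm : ∀ κ λ′ (T : Exp → Exp → Bilinear) →
      weigh κ (λ s t → weigh λ′ (T s t)) ≈ weigh λ′ (λ u v → weigh κ (λ s t → T s t u v))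
    weigh-comm κ merging   T = refl
    weigh-comm κ same      T = refl
    weigh-comm κ splitting T = begin
      weigh κ (λ s t → - c * Sx (T s t) + c * Sy (T s t))
        ≈⟨ weigh-+ κ (λ s t → - c * Sx (T s t)) _ ⟩
      weigh κ (λ s t → - c * Sx (T s t)) + weigh κ (λ s t → c * Sy (T s t))
        ≈⟨ +-cong (weigh-* κ (- c) (λ s t → Sx (T s t))) (weigh-* κ c (λ s t → Sy (T s t))) ⟩
      - c * weigh κ (λ s t → Sx (T s t)) + c * weigh κ (λ s t → Sy (T s t))
        ≈⟨ +-cong (*-congˡ (weigh-sum κ {3} λ k s t → X (T s t) k))
                  (*-congˡ (trans (weigh-sum κ {4} λ k s t → Y₂ (T s t) k + Y₁ (T s t) k + Y₀ (T s t) k)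
                    (sum-cong-≋ {4} {y = λ k → Y₂ T′ k + Y₁ T′ k + Y₀ T′ k} λ k → trans
                      (weigh-+ κ (λ s t → Y₂ (T s t) k + Y₁ (T s t) k) (λ s t → Y₀ (T s t) k))
                      (+-congʳ {x = Y₀ T′ k} (weigh-+ κ (λ s t → Y₂ (T s t) k) (λ s t → Y₁ (T s t) k)))))) ⟩
      W T′ ∎
      where
      T′ : Bilinear
      T′ u v = weigh κ (λ s t → T s t u v)

    -- T is well defined on V ⊗ V: it respects y^3 = x y and x^4 = 0 in either factor.
    record Respects (T : Bilinear) : Set where
      field
        respˡ : ∀ {s s′} t → nf s ≡ nf s′ → T s t ≈ T s′ t
        respʳ : ∀ s {t t′} → nf t ≡ nf t′ → T s t ≈ T s t′
        zeroᵒˡ : ∀ s t → Vanishing s → T s t ≈ 0#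
        zeroᵒʳ : ∀ s t → Vanishing t → T s t ≈ 0#

    open Respects

    shiftˡ : ∀ {T} d → Respects T → Respects (λ s t → T (d ⊕ s) t)
    shiftˡ d ρ = record
      { respˡ  = λ {s} {s′} t eq → respˡ ρ t (nf-congʳ d {s} {s′} eq)
      ; respʳ  = λ s eq → respʳ ρ (d ⊕ s) eq
      ; zeroᵒˡ = λ s t v → zeroᵒˡ ρ _ t (≡.subst Vanishing (⊕-comm s d) (vanishing-⊕ s d v))
      ; zeroᵒʳ = λ s t v → zeroᵒʳ ρ _ t v }

    shiftʳ : ∀ {T} d → Respects T → Respects (λ s t → T s (d ⊕ t))
    shiftʳ d ρ = record
      { respˡ  = λ t eq → respˡ ρ (d ⊕ t) eq
      ; respʳ  = λ s {t} {t′} eq → respʳ ρ s (nf-congʳ d {t} {t′} eq)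
      ; zeroᵒˡ = λ s t v → zeroᵒˡ ρ s _ v
      ; zeroᵒʳ = λ s t v → zeroᵒʳ ρ s _ (≡.subst Vanishing (⊕-comm t d) (vanishing-⊕ t d v)) }

    private
      0+0 : ∀ {x y} → x ≈ 0# → y ≈ 0# → x + y ≈ 0#
      0+0 p q = trans (+-cong p q) (+-identityʳ 0#)

      rotate₃ : ∀ {x y z w} → z ≈ 0# → w ≈ 0# → x + (y + (z + 0#)) ≈ w + (x + (y + 0#))
      rotate₃ p q = trans (+-congˡ (+-congˡ (+-congʳ p)))
        (trans (+-congˡ (+-congˡ (+-identityʳ _))) (sym (trans (+-congʳ q) (+-identityˡ _))))

      rotate₄ : ∀ {x y u z w} → z ≈ 0# → w ≈ 0# → x + (y + (u + (z + 0#))) ≈ w + (x + (y + (u + 0#)))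
      rotate₄ p q = trans (+-congˡ (+-congˡ (+-congˡ (+-congʳ p))))
        (trans (+-congˡ (+-congˡ (+-congˡ (+-identityʳ _)))) (sym (trans (+-congʳ q) (+-identityˡ _))))

    -- (x ⊗ 1) Δ(1) = (1 ⊗ x) Δ(1)
    W-move-x : ∀ {T} → Respects T → W (λ s t → T ((1 , 0) ⊕ s) t) ≈ W (λ s t → T s ((1 , 0) ⊕ t))
    -- Multiplying by x shifts each sum by one index. The two sides differ only in their end terms,
    -- which contain x^4.
    W-move-x {T} ρ = +-cong
      (*-congˡ (rotate₃ (zeroᵒˡ ρ (4 , 0) _ ℕₚ.≤-refl) (zeroᵒʳ ρ _ (4 , 0) ℕₚ.≤-refl)))
      (*-congˡ (rotate₄
        (0+0 (0+0 (zeroᵒˡ ρ (4 , 2) _ ℕₚ.≤-refl) (zeroᵒˡ ρ (4 , 1) _ ℕₚ.≤-refl))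
             (zeroᵒˡ ρ (4 , 0) _ ℕₚ.≤-refl))
        (0+0 (0+0 (zeroᵒʳ ρ _ (4 , 0) ℕₚ.≤-refl) (zeroᵒʳ ρ _ (4 , 1) ℕₚ.≤-refl))
             (zeroᵒʳ ρ _ (4 , 2) ℕₚ.≤-refl))))

    -- (y ⊗ 1) Δ(1) = (1 ⊗ y) Δ(1); both sides are the terms of Δ(1) containing y² on one side,
    -- the others cancel because of y³ = xy.
    W-move-y : ∀ {T} → Respects T → W (λ s t → T ((0 , 1) ⊕ s) t) ≈ W (λ s t → T s ((0 , 1) ⊕ t))
    W-move-y {T} ρ = trans left (sym right)
      where
      p : Vector A 4
      p k = T (toℕ k , 2) (3 ∸ toℕ k , 1) + T (toℕ k , 1) (3 ∸ toℕ k , 2)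

      P = sum p

      cancelled : ∀ {x} → - c * x + c * (x + P) ≈ c * P
      cancelled {x} = begin
        - c * x + c * (x + P)        ≈⟨ +-congˡ (distribˡ c x P) ⟩
        - c * x + (c * x + c * P)    ≈⟨ +-assoc _ _ _ ⟨
        (- c * x + c * x) + c * P
          ≈⟨ +-congʳ (trans (+-congʳ (sym (-‿distribˡ-* c x))) (-‿inverseˡ _)) ⟩
        0# + c * P                   ≈⟨ +-identityˡ _ ⟩
        c * P ∎

      left : W (λ s t → T ((0 , 1) ⊕ s) t) ≈ c * P
      left = trans (+-congˡ {x = - c * sum L} (*-congˡ (begin
        ∑[ k < 4 ] (T (toℕ k , 3) (3 ∸ toℕ k , 0) + T (toℕ k , 2) (3 ∸ toℕ k , 1)
                    + T (toℕ k , 1) (3 ∸ toℕ k , 2))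
          ≈⟨ sum-cong-≋ {4} {y = λ k → L⁺ k + p k} (λ k → trans (+-assoc _ _ _)
               (+-congʳ {x = p k} (respˡ ρ {toℕ k , 3} {suc (toℕ k) , 1} _ ≡.refl))) ⟩
        ∑[ k < 4 ] (L⁺ k + p k)
          ≈⟨ ∑-distrib-+ {4} L⁺ p ⟩
        sum L⁺ + P
          ≈⟨ +-congʳ {x = P} (+-congˡ (+-congˡ (+-congˡ
               (trans (+-congʳ (zeroᵒˡ ρ (4 , 1) _ ℕₚ.≤-refl)) (+-identityˡ _))))) ⟩
        sum L + P ∎)))
        (cancelled {sum L})
        where
        L : Vector A 3
        L k = T (suc (toℕ k) , 1) (3 ∸ toℕ k , 0)
        L⁺ : Vector A 4
        L⁺ k = T (suc (toℕ k) , 1) (3 ∸ toℕ k , 0)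

      right : W (λ s t → T s ((0 , 1) ⊕ t)) ≈ c * P
      right = trans (+-congˡ {x = - c * sum Q} (*-congˡ (begin
        ∑[ k < 4 ] (T (toℕ k , 2) (3 ∸ toℕ k , 1) + T (toℕ k , 1) (3 ∸ toℕ k , 2)
                    + T (toℕ k , 0) (3 ∸ toℕ k , 3))
          ≈⟨ sum-cong-≋ {4} {y = λ k → Q⁺ k + p k} (λ k → trans (+-comm _ _)
               (+-congʳ {x = p k} (respʳ ρ _ {3 ∸ toℕ k , 3} {suc (3 ∸ toℕ k) , 1} ≡.refl))) ⟩
        ∑[ k < 4 ] (Q⁺ k + p k)
          ≈⟨ ∑-distrib-+ {4} Q⁺ p ⟩
        sum Q⁺ + P
          ≈⟨ +-congʳ {x = P} (trans (+-congʳ (zeroᵒʳ ρ _ (4 , 1) ℕₚ.≤-refl)) (+-identityˡ _)) ⟩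
        sum Q + P ∎)))
        (cancelled {sum Q})
        where
        Q : Vector A 3
        Q k = T (suc (toℕ k) , 0) (3 ∸ toℕ k , 1)
        Q⁺ : Vector A 4
        Q⁺ k = T (toℕ k , 0) (suc (3 ∸ toℕ k) , 1)

    -- A monomial multiplied into one factor of Δ(1) may be moved to the other factor, one letter at
    -- a time. This is the Frobenius property, which makes Δ a map of V-bimodules.
    W-move : ∀ d {T} → Respects T → W (λ s t → T (d ⊕ s) t) ≈ W (λ s t → T s (d ⊕ t))
    W-move (zero , zero)  ρ = refl
    W-move (zero , suc j) {T} ρ = begin
      W (λ s t → T ((0 , suc j) ⊕ s) t)
        ≈⟨ weigh-cong splitting (λ s t → reflexive (cong (λ z → T z t) (≡.sym (⊕-swap (0 , j) (0 , 1) s)))) ⟩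
      W (λ s t → T ((0 , j) ⊕ ((0 , 1) ⊕ s)) t)  ≈⟨ W-move-y (shiftˡ (0 , j) ρ) ⟩
      W (λ s t → T ((0 , j) ⊕ s) ((0 , 1) ⊕ t))  ≈⟨ W-move (0 , j) (shiftʳ (0 , 1) ρ) ⟩
      W (λ s t → T s ((0 , suc j) ⊕ t)) ∎
    W-move (suc i , j) {T} ρ = begin
      W (λ s t → T ((suc i , j) ⊕ s) t)
        ≈⟨ weigh-cong splitting (λ s t → reflexive (cong (λ z → T z t) (≡.sym (⊕-swap (i , j) (1 , 0) s)))) ⟩
      W (λ s t → T ((i , j) ⊕ ((1 , 0) ⊕ s)) t)  ≈⟨ W-move-x (shiftˡ (i , j) ρ) ⟩
      W (λ s t → T ((i , j) ⊕ s) ((1 , 0) ⊕ t))  ≈⟨ W-move (i , j) (shiftʳ (1 , 0) ρ) ⟩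
      W (λ s t → T s ((suc i , j) ⊕ t)) ∎

    W-sym : ∀ T → W (λ s t → T t s) ≈ W T
    W-sym T = +-cong (*-congˡ (reverse₃ _ _ _)) (*-congˡ (trans
      (sum-cong-≋ {4} λ k → solve 3 (λ a b d → a :+ b :+ d := d :+ b :+ a) refl
        (T (3 ∸ toℕ k , 0) (toℕ k , 2)) (T (3 ∸ toℕ k , 1) (toℕ k , 1)) (T (3 ∸ toℕ k , 2) (toℕ k , 0)))
      (reverse₄ _ _ _ _)))
      where
      reverse₃ : ∀ x y z → x + (y + (z + 0#)) ≈ z + (y + (x + 0#))
      reverse₃ = solve 3 (λ x y z → x :+ (y :+ (z :+ con 0)) := z :+ (y :+ (x :+ con 0))) refl
      reverse₄ : ∀ x y z w → x + (y + (z + (w + 0#))) ≈ w + (z + (y + (x + 0#)))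
      reverse₄ = solve 4 (λ x y z w →
        x :+ (y :+ (z :+ (w :+ con 0))) := w :+ (z :+ (y :+ (x :+ con 0)))) refl

    -- The monomial by which a step multiplies once both feet lie on one circle. For a split it is
    -- left in the unreduced form x^2 y^4, so that it is visibly twice the exponent of x y^2.
    power : Kind → Exp
    power merging   = 0 , 0
    power same      = 1 , 2
    power splitting = 2 , 4

    -- On a single circle Δ acts as multiplication by x^3 y^2, the square of x y^2.
    weigh-power : ∀ κ (U : Exp → A) → (∀ {s s′} → nf s ≡ nf s′ → U s ≈ U s′) →
                  (∀ s → Vanishing s → U s ≈ 0#) →
                  weigh κ (λ s t → U (s ⊕ t)) ≈ U (power κ)
    weigh-power merging   U resp zr = refl
    weigh-power same      U resp zr = refl
    weigh-power splitting U resp zr = begin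
      - c * (U (4 , 0) + (U (4 , 0) + (U (4 , 0) + 0#))) + c * ∑[ k < 4 ] (u + u + u)
        ≈⟨ +-congʳ (*-congˡ (0+0 z (0+0 z (0+0 z refl)))) ⟩
      - c * 0# + c * ∑[ k < 4 ] (u + u + u)
        ≈⟨ solve 3 (λ n d u → let t = u :+ u :+ u ; s = d :+ d :+ d in
             n :* con 0 :+ d :* (t :+ (t :+ (t :+ (t :+ con 0)))) :=
             (s :+ (s :+ (s :+ (s :+ con 0)))) :* u) refl (- c) c u ⟩
      (let t = c + c + c in t + (t + (t + (t + 0#)))) * u   ≈⟨ *-congʳ 12c≈1 ⟩
      1# * u                                                ≈⟨ *-identityˡ u ⟩
      u                                                     ≈⟨ resp ≡.refl ⟩
      U (2 , 4) ∎
      where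
      u = U (3 , 2)
      z = zr (4 , 0) ℕₚ.≤-refl

    module _ {N k} (circ : Fin N → Fin k) (L : Vec (Fin 4 × Fin 3) k) where

      -- The coefficient at L of the tensor denoted by an arc monomial.
      ⟦_⟧ : Arc-monomial N → A
      ⟦ m ⟧ = ind (match? circ m L)

      ⟦⟧-cong : ∀ m m′ → (∀ c → nf (exponent circ m c) ≡ nf (exponent circ m′ c)) → ⟦ m ⟧ ≈ ⟦ m′ ⟧
      ⟦⟧-cong m m′ eq = reflexive (ind-⇔ (match? circ m L) (match? circ m′ L)
        (λ p c → ≡.trans (≡.sym (eq c)) (p c)) (λ p c → ≡.trans (eq c) (p c)))

      ⟦⟧-vanishing : ∀ m c → Vanishing (exponent circ m c) → ⟦ m ⟧ ≈ 0#
      ⟦⟧-vanishing m c v = reflexive (ind-no (match? circ m L) (vanishing⇒¬match circ m L c v))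

      ⟦⟧-swap : ∀ a s b t m → ⟦ (a , s) ∷ (b , t) ∷ m ⟧ ≈ ⟦ (b , t) ∷ (a , s) ∷ m ⟧
      ⟦⟧-swap a s b t m = ⟦⟧-cong ((a , s) ∷ (b , t) ∷ m) ((b , t) ∷ (a , s) ∷ m) λ c → cong nf
        (⊕-swap (only (circ a ≟ c) s) (only (circ b ≟ c) t) (exponent circ m c))

      private
        cons-cong : ∀ a {s s′} m c → nf s ≡ nf s′ →
                    nf (exponent circ ((a , s) ∷ m) c) ≡ nf (exponent circ ((a , s′) ∷ m) c)
        cons-cong a {s} {s′} m c eq with does (circ a ≟ c)
        ... | true  = nf-cong {s} {s′} (exponent circ m c) eq
        ... | false = ≡.refl

        cons-vanishing : ∀ a s m → Vanishing s → Vanishing (exponent circ ((a , s) ∷ m) (circ a))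
        cons-vanishing a s m v with circ a ≟ circ a
        ... | yes _ = vanishing-⊕ s (exponent circ m (circ a)) v
        ... | no ≢  = contradiction ≡.refl ≢

      respects : ∀ a b m → Respects (λ s t → ⟦ (a , s) ∷ (b , t) ∷ m ⟧)
      respects a b m = record
        { respˡ  = λ {s} {s′} t eq → ⟦⟧-cong ((a , s) ∷ (b , t) ∷ m) ((a , s′) ∷ (b , t) ∷ m) λ c → cons-cong a {s} {s′} ((b , t) ∷ m) c eq
        ; respʳ  = λ s {t} {t′} eq → trans (⟦⟧-swap a s b t m)
            (trans (⟦⟧-cong ((b , t) ∷ (a , s) ∷ m) ((b , t′) ∷ (a , s) ∷ m) λ c → cons-cong b {t} {t′} ((a , s) ∷ m) c eq) (⟦⟧-swap b t′ a s m))
        ; zeroᵒˡ = λ s t v → ⟦⟧-vanishing ((a , s) ∷ (b , t) ∷ m) (circ a) (cons-vanishing a s ((b , t) ∷ m) v)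
        ; zeroᵒʳ = λ s t v → trans (⟦⟧-swap a s b t m)
            (⟦⟧-vanishing ((b , t) ∷ (a , s) ∷ m) (circ b) (cons-vanishing b t ((a , s) ∷ m) v))
        }

    module _ {N k} (circ : Fin N → Fin k) (L : Vec (Fin 4 × Fin 3) k) (e₁ e₂ f₁ f₂ : Fin N)
      (m : Arc-monomial N) where

      private
        infix 8 _∼_ _≁_
        _∼_ _≁_ : Fin N → Fin N → Set
        a ∼ b = circ a ≡ circ b
        a ≁ b = ¬ a ∼ b

        K : Exp → Exp → Exp → Exp → A
        K s₁ s₂ t₁ t₂ = ⟦_⟧ circ L ((e₁ , s₁) ∷ (e₂ , s₂) ∷ (f₁ , t₁) ∷ (f₂ , t₂) ∷ m)

        K′ : Exp → Exp → Exp → Exp → A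
        K′ t₁ t₂ s₁ s₂ = ⟦_⟧ circ L ((f₁ , t₁) ∷ (f₂ , t₂) ∷ (e₁ , s₁) ∷ (e₂ , s₂) ∷ m)

        K-cong : ∀ {s₁ s₂ t₁ t₂} u →
          (∀ c → exponent circ ((e₁ , s₁) ∷ (e₂ , s₂) ∷ (f₁ , t₁) ∷ (f₂ , t₂) ∷ m) c ≡ exponent circ u c) →
          K s₁ s₂ t₁ t₂ ≈ ⟦_⟧ circ L u
        K-cong {s₁} {s₂} {t₁} {t₂} u eq =
          ⟦⟧-cong circ L ((e₁ , s₁) ∷ (e₂ , s₂) ∷ (f₁ , t₁) ∷ (f₂ , t₂) ∷ m) u λ c → cong nf (eq c)

        move₄ : ∀ a b c d x → a ⊕ (b ⊕ (c ⊕ (d ⊕ x))) ≡ c ⊕ (d ⊕ (a ⊕ (b ⊕ x)))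
        move₄ a b c d x = ≡.trans (cong (a ⊕_) (⊕-swap b c (d ⊕ x)))
          (≡.trans (⊕-swap a c (b ⊕ (d ⊕ x))) (cong (c ⊕_)
            (≡.trans (cong (a ⊕_) (⊕-swap b d x)) (⊕-swap a d (b ⊕ x)))))

        K≈K′ : ∀ s₁ s₂ t₁ t₂ → K s₁ s₂ t₁ t₂ ≈ K′ t₁ t₂ s₁ s₂
        K≈K′ s₁ s₂ t₁ t₂ = K-cong ((f₁ , t₁) ∷ (f₂ , t₂) ∷ (e₁ , s₁) ∷ (e₂ , s₂) ∷ m) λ c → move₄ (only (circ e₁ ≟ c) s₁) (only (circ e₂ ≟ c) s₂)
          (only (circ f₁ ≟ c) t₁) (only (circ f₂ ≟ c) t₂) (exponent circ m c)

      -- The two composites around a square of the cube agree on an arc monomial at the label L. On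
      -- the left e is changed before f, on the right f before e; in either case both
      -- multiplications are read in the final state.
      Commutes : (κe κf′ κf κe′ : Kind) → Set
      Commutes κe κf′ κf κe′ =
        weigh κe (λ s₁ s₂ → weigh κf′ (λ t₁ t₂ → K′ t₁ t₂ s₁ s₂)) ≈
        weigh κf (λ t₁ t₂ → weigh κe′ (λ s₁ s₂ → K s₁ s₂ t₁ t₂))

      -- If opposite sides of the square have the same kind, both composites multiply by the same
      -- two elements.
      trivially : ∀ κe κf → Commutes κe κf κf κe
      trivially κe κf = trans
        (weigh-cong κe λ s₁ s₂ → weigh-cong κf λ t₁ t₂ → sym (K≈K′ s₁ s₂ t₁ t₂))
        (weigh-comm κe κf K)

      -- When all four arcs lie on one circle, every step is multiplication by a power.
      module _ (e₁∼e₂ : e₁ ∼ e₂) (f₁∼e₁ : f₁ ∼ e₁) (f₁∼f₂ : f₁ ∼ f₂) where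

        private
          U : Exp → A
          U s = ⟦_⟧ circ L ((e₁ , s) ∷ m)

          U-resp : ∀ {s s′} → nf s ≡ nf s′ → U s ≈ U s′
          U-resp {s} {s′} eq = ⟦⟧-cong circ L ((e₁ , s) ∷ m) ((e₁ , s′) ∷ m) λ c → go c
            where
            go : ∀ c → nf (exponent circ ((e₁ , s) ∷ m) c) ≡ nf (exponent circ ((e₁ , s′) ∷ m) c)
            go c with does (circ e₁ ≟ c)
            ... | true  = nf-cong {s} {s′} (exponent circ m c) eq
            ... | false = ≡.refl

          U-zero : ∀ s → Vanishing s → U s ≈ 0#
          U-zero s v = ⟦⟧-vanishing circ L ((e₁ , s) ∷ m) (circ e₁) go
            where
            go : Vanishing (exponent circ ((e₁ , s) ∷ m) (circ e₁))
            go with circ e₁ ≟ circ e₁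
            ... | yes _ = vanishing-⊕ s (exponent circ m (circ e₁)) v
            ... | no ≢  = contradiction ≡.refl ≢

          K≈U : ∀ s₁ s₂ t₁ t₂ → K s₁ s₂ t₁ t₂ ≈ U ((s₁ ⊕ s₂) ⊕ (t₁ ⊕ t₂))
          K≈U s₁ s₂ t₁ t₂ = K-cong ((e₁ , (s₁ ⊕ s₂) ⊕ (t₁ ⊕ t₂)) ∷ m) λ c → go c
            where
            go : ∀ c → exponent circ ((e₁ , s₁) ∷ (e₂ , s₂) ∷ (f₁ , t₁) ∷ (f₂ , t₂) ∷ m) c ≡
                       exponent circ ((e₁ , (s₁ ⊕ s₂) ⊕ (t₁ ⊕ t₂)) ∷ m) c
            go c rewrite ≡.sym f₁∼f₂ | f₁∼e₁ | ≡.sym e₁∼e₂ with does (circ e₁ ≟ c)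
            ... | false = ≡.refl
            ... | true  = ≡.sym (≡.trans (⊕-assoc (s₁ ⊕ s₂) (t₁ ⊕ t₂) _)
              (≡.trans (⊕-assoc s₁ s₂ _) (cong (λ z → s₁ ⊕ (s₂ ⊕ z)) (⊕-assoc t₁ t₂ _))))

          shift-resp : ∀ d {s s′} → nf s ≡ nf s′ → U (d ⊕ s) ≈ U (d ⊕ s′)
          shift-resp d {s} {s′} eq = U-resp (nf-congʳ d {s} {s′} eq)

          shift-zero : ∀ d s → Vanishing s → U (d ⊕ s) ≈ 0#
          shift-zero d s v = U-zero (d ⊕ s) (≡.subst Vanishing (⊕-comm s d) (vanishing-⊕ s d v))

          total : ∀ κ λ′ → weigh κ (λ s₁ s₂ → weigh λ′ (λ t₁ t₂ → U ((s₁ ⊕ s₂) ⊕ (t₁ ⊕ t₂)))) ≈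
                           U (power κ ⊕ power λ′)
          total κ λ′ = trans
            (weigh-cong κ λ s₁ s₂ → trans
              (weigh-power λ′ (λ t → U ((s₁ ⊕ s₂) ⊕ t)) (λ {t} {t′} → shift-resp (s₁ ⊕ s₂) {t} {t′})
                (shift-zero (s₁ ⊕ s₂)))
              (reflexive (cong U (⊕-comm (s₁ ⊕ s₂) (power λ′)))))
            (trans (weigh-power κ (λ s → U (power λ′ ⊕ s)) (λ {t} {t′} → shift-resp (power λ′) {t} {t′})
                (shift-zero (power λ′)))
              (reflexive (cong U (⊕-comm (power λ′) (power κ)))))

        on-one-circle : ∀ κe κf′ κf κe′ → power κe ⊕ power κf′ ≡ power κf ⊕ power κe′ →
                        Commutes κe κf′ κf κe′
        on-one-circle κe κf′ κf κe′ eq = begin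
          weigh κe (λ s₁ s₂ → weigh κf′ (λ t₁ t₂ → K′ t₁ t₂ s₁ s₂))
            ≈⟨ weigh-cong κe (λ s₁ s₂ → weigh-cong κf′ λ t₁ t₂ →
                 trans (sym (K≈K′ s₁ s₂ t₁ t₂)) (K≈U s₁ s₂ t₁ t₂)) ⟩
          weigh κe (λ s₁ s₂ → weigh κf′ (λ t₁ t₂ → U ((s₁ ⊕ s₂) ⊕ (t₁ ⊕ t₂))))
            ≈⟨ total κe κf′ ⟩
          U (power κe ⊕ power κf′)
            ≡⟨ cong U eq ⟩
          U (power κf ⊕ power κe′)
            ≈⟨ total κf κe′ ⟨
          weigh κf (λ t₁ t₂ → weigh κe′ (λ s₁ s₂ → U ((t₁ ⊕ t₂) ⊕ (s₁ ⊕ s₂))))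
            ≈⟨ weigh-cong κf (λ t₁ t₂ → weigh-cong κe′ λ s₁ s₂ →
                 trans (reflexive (cong U (⊕-comm (t₁ ⊕ t₂) (s₁ ⊕ s₂)))) (sym (K≈U s₁ s₂ t₁ t₂))) ⟩
          weigh κf (λ t₁ t₂ → weigh κe′ (λ s₁ s₂ → K s₁ s₂ t₁ t₂)) ∎

      private
        Parallel : Set
        Parallel = (f₁ ∼ e₁ × f₂ ∼ e₂) ⊎ (f₁ ∼ e₂ × f₂ ∼ e₁)

        -- Δ(1) placed at the feet of f equals Δ(1) placed at the feet of e when these feet lie on
        -- the same circles. If they are paired crosswise, symmetry of Δ(1) exchanges its factors,
        -- and `W-move` carries the extra monomial d to the other circle.
        W-parallel : Parallel → ∀ d → W (λ t₁ t₂ → K d (0 , 0) t₁ t₂) ≈ W (λ s₁ s₂ → K s₁ s₂ d (0 , 0))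
        W-parallel (inj₁ (p , q)) d =
          weigh-cong splitting {K d (0 , 0)} {λ s t → K s t d (0 , 0)} λ s t → K-cong ((e₁ , s) ∷ (e₂ , t) ∷ (f₁ , d) ∷ (f₂ , (0 , 0)) ∷ m) (go s t)
          where
          go : ∀ s t c → exponent circ ((e₁ , d) ∷ (e₂ , (0 , 0)) ∷ (f₁ , s) ∷ (f₂ , t) ∷ m) c ≡
                         exponent circ ((e₁ , s) ∷ (e₂ , t) ∷ (f₁ , d) ∷ (f₂ , (0 , 0)) ∷ m) c
          go s t c rewrite p | q = move₄ (only (circ e₁ ≟ c) d) (only (circ e₂ ≟ c) (0 , 0))
            (only (circ e₁ ≟ c) s) (only (circ e₂ ≟ c) t) (exponent circ m c)
        W-parallel (inj₂ (p , q)) d = begin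
          W (λ t₁ t₂ → K d (0 , 0) t₁ t₂)
            ≈⟨ weigh-cong splitting {K d (0 , 0)} {λ s t → G (d ⊕ t) s} (λ s t → K-cong ((e₁ , d ⊕ t) ∷ (e₂ , s) ∷ m) (left s t)) ⟩
          W (λ t₁ t₂ → G (d ⊕ t₂) t₁)         ≈⟨ W-sym (λ s t → G (d ⊕ s) t) ⟩
          W (λ s₁ s₂ → G (d ⊕ s₁) s₂)         ≈⟨ W-move d {G} (respects circ L e₁ e₂ m) ⟩
          W (λ s₁ s₂ → G s₁ (d ⊕ s₂))
            ≈⟨ weigh-cong splitting {λ s t → K s t d (0 , 0)} {λ s t → G s (d ⊕ t)} (λ s t → K-cong ((e₁ , s) ∷ (e₂ , d ⊕ t) ∷ m) (right s t)) ⟨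
          W (λ s₁ s₂ → K s₁ s₂ d (0 , 0)) ∎
          where
          G : Bilinear
          G s t = ⟦_⟧ circ L ((e₁ , s) ∷ (e₂ , t) ∷ m)

          left : ∀ s t c → exponent circ ((e₁ , d) ∷ (e₂ , (0 , 0)) ∷ (f₁ , s) ∷ (f₂ , t) ∷ m) c ≡
                           exponent circ ((e₁ , d ⊕ t) ∷ (e₂ , s) ∷ m) c
          left s t c rewrite p | q with does (circ e₁ ≟ c) | does (circ e₂ ≟ c)
          ... | true  | true  = ≡.trans (cong (d ⊕_) (⊕-swap s t _)) (≡.sym (⊕-assoc d t _))
          ... | true  | false = ≡.sym (⊕-assoc d t _)
          ... | false | true  = ≡.refl
          ... | false | false = ≡.refl

          right : ∀ s t c → exponent circ ((e₁ , s) ∷ (e₂ , t) ∷ (f₁ , d) ∷ (f₂ , (0 , 0)) ∷ m) c ≡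
                            exponent circ ((e₁ , s) ∷ (e₂ , d ⊕ t) ∷ m) c
          right s t c rewrite p | q with does (circ e₁ ≟ c) | does (circ e₂ ≟ c)
          ... | true  | true  = cong (s ⊕_) (≡.trans (⊕-swap t d _) (≡.sym (⊕-assoc d t _)))
          ... | false | true  = ≡.trans (⊕-swap t d _) (≡.sym (⊕-assoc d t _))
          ... | true  | false = ≡.refl
          ... | false | false = ≡.refl

      -- The squares in which either edge may be changed first, with kind κ, while the later change
      -- splits the circle. Both composites amount to one Δ(1) and one monomial on the same pair of
      -- circles.
      parallel : Parallel → ∀ κ → κ ≢ splitting → Commutes κ splitting κ splitting
      parallel par merging   _ = 
        trans (weigh-cong splitting {λ t₁ t₂ → K′ t₁ t₂ (0 , 0) (0 , 0)} {K (0 , 0) (0 , 0)}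
          λ t₁ t₂ → sym (K≈K′ (0 , 0) (0 , 0) t₁ t₂)) (W-parallel par (0 , 0))
      parallel par same      _ = 
        trans (weigh-cong splitting {λ t₁ t₂ → K′ t₁ t₂ (1 , 2) (0 , 0)} {K (1 , 2) (0 , 0)}
          λ t₁ t₂ → sym (K≈K′ (1 , 2) (0 , 0) t₁ t₂)) (W-parallel par (1 , 2))
      parallel par splitting ≢ = contradiction ≡.refl ≢

    module _ {N k₀ k₁ k₂ k} {circ₀ : Fin N → Fin k₀} {circₑ : Fin N → Fin k₁} {circf : Fin N → Fin k₂}
      {circ : Fin N → Fin k} {e₁ e₂ f₁ f₂ : Fin N} (L : Vec (Fin 4 × Fin 3) k) (m : Arc-monomial N) where

      private
        Square : (κe κf′ κf κe′ : Kind) → Set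
        Square κe κf′ κf κe′ =
          Step circ₀ circₑ e₁ e₂ κe → Step circₑ circ f₁ f₂ κf′ →
          Step circ₀ circf f₁ f₂ κf → Step circf circ e₁ e₂ κe′ →
          Commutes circ L e₁ e₂ f₁ f₂ m κe κf′ κf κe′

        trivial : ∀ κe κf → Commutes circ L e₁ e₂ f₁ f₂ m κe κf κf κe
        trivial = trivially circ L e₁ e₂ f₁ f₂ m

        one-circle : ∀ κe κf′ κf κe′ → circ e₁ ≡ circ e₂ → circ f₁ ≡ circ f₂ →
          power κe ⊕ power κf′ ≡ power κf ⊕ power κe′ →
          ∀ {k′} {circ′ : Fin N → Fin k′} → Refines circ′ circ → circ′ f₁ ≢ circ′ f₂ →
          Join circ′ e₁ e₂ f₁ f₂ → Commutes circ L e₁ e₂ f₁ f₂ m κe κf′ κf κe′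
        one-circle κe κf′ κf κe′ E F eq r f≢ (inj₁ f≡) = contradiction f≡ f≢
        one-circle κe κf′ κf κe′ E F eq r f≢ (inj₂ (inj₁ (p , _))) =
          on-one-circle circ L e₁ e₂ f₁ f₂ m E (r p) F κe κf′ κf κe′ eq
        one-circle κe κf′ κf κe′ E F eq r f≢ (inj₂ (inj₂ (p , _))) =
          on-one-circle circ L e₁ e₂ f₁ f₂ m E (≡.trans (r p) (≡.sym E)) F κe κf′ κf κe′ eq

      -- If x , y are joined along a , b but not equal, then joining x , y also joins a , b.
      join-sym : ∀ {k k′} {c₁ : Fin N → Fin k} {c₂ : Fin N → Fin k′} {x y a b} →
                 Refines c₁ c₂ → c₁ x ≢ c₁ y → Join c₁ a b x y → c₂ x ≡ c₂ y → c₂ a ≡ c₂ b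
      join-sym r x≢y (inj₁ x≡y)            _  = contradiction x≡y x≢y
      join-sym r x≢y (inj₂ (inj₁ (p , q))) eq = ≡.trans (≡.sym (r p)) (≡.trans eq (r q))
      join-sym r x≢y (inj₂ (inj₂ (p , q))) eq = ≡.trans (≡.sym (r q)) (≡.trans (≡.sym eq) (r p))

      private
        parallel′ : ∀ κ → κ ≢ splitting → circ e₁ ≢ circ e₂ → Join circ f₁ f₂ e₁ e₂ →
                    Commutes circ L e₁ e₂ f₁ f₂ m κ splitting κ splitting
        parallel′ κ κ≢ E (inj₁ e≡)            = contradiction e≡ E
        parallel′ κ κ≢ E (inj₂ (inj₁ (p , q))) =
          parallel circ L e₁ e₂ f₁ f₂ m (inj₁ (≡.sym p , ≡.sym q)) κ κ≢
        parallel′ κ κ≢ E (inj₂ (inj₂ (p , q))) =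
          parallel circ L e₁ e₂ f₁ f₂ m (inj₂ (≡.sym q , ≡.sym p)) κ κ≢

      -- The kinds of the second steps fix which feet are separated at the end. Each pattern for the
      -- first steps is inconsistent with the circles, or is settled by `trivially` or `parallel`;
      -- the sibling lemmas also use `on-one-circle`.
      splits-splits : ∀ {κe κf} → Square κe splitting κf splitting
      splits-splits (splits _ _ _ _) _ (splits _ _ _ _) _ = trivial splitting splitting
      splits-splits (keeps _ E10 _ _) (splits _ _ _ j) (keeps _ _ _ _) (splits _ E11 _ _) =
        parallel′ same (λ ()) E11 (j E10)
      splits-splits (merges _ E10 _ _) (splits _ _ _ j) (merges _ _ _ _) (splits _ E11 _ _) =
        parallel′ merging (λ ()) E11 (j E10)
      splits-splits (keeps _ _ _ r) (splits F10 _ _ _) (merges F00 _ _ _) _ = contradiction (r F10) F00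
      splits-splits (merges E00 _ _ _) _ (keeps _ _ _ r) (splits E01 _ _ _) = contradiction (r E01) E00
      splits-splits (splits _ E10 _ _) (splits F10 F11 r _) (keeps _ F01 _ _) (splits _ _ _ j) =
        contradiction (join-sym {c₁ = circ} r F11 (j F01) F10) E10
      splits-splits (splits _ E10 _ _) (splits F10 F11 r _) (merges _ F01 _ _) (splits _ _ _ j) =
        contradiction (join-sym {c₁ = circ} r F11 (j F01) F10) E10
      splits-splits (keeps _ E10 _ _) (splits _ _ _ j) (splits _ F01 _ _) (splits E01 E11 r _) =
        contradiction (join-sym {c₁ = circ} r E11 (j E10) E01) F01
      splits-splits (merges _ E10 _ _) (splits _ _ _ j) (splits _ F01 _ _) (splits E01 E11 r _) =
        contradiction (join-sym {c₁ = circ} r E11 (j E10) E01) F01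

      keeps-splits : ∀ {κe κf} → Square κe same κf splitting
      keeps-splits (keeps _ E10 _ _)   (keeps _ _ r _) _ (splits _ E11 _ _) = contradiction (r E10) E11
      keeps-splits (merges _ E10 _ _)  (keeps _ _ r _) _ (splits _ E11 _ _) = contradiction (r E10) E11
      keeps-splits (splits _ _ _ _)    _ (keeps _ _ _ _) _ = trivial splitting same
      keeps-splits (splits _ _ r _)    (keeps F10 _ _ _) (merges F00 _ _ _) _ = contradiction (r F10) F00
      keeps-splits (splits _ _ _ _)    (keeps _ F11 _ _) (splits _ F01 _ _) (splits _ _ r _) =
        contradiction (r F11) F01

      merges-splits : ∀ {κe κf} → Square κe merging κf splitting
      merges-splits (keeps _ E10 _ _)  (merges _ _ r _) _ (splits _ E11 _ _) = contradiction (r E10) E11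
      merges-splits (merges _ E10 _ _) (merges _ _ r _) _ (splits _ E11 _ _) = contradiction (r E10) E11
      merges-splits (splits _ _ _ _)   (merges _ F11 _ _) (splits _ F01 _ _) (splits _ _ r _) =
        contradiction (r F11) F01
      merges-splits (splits _ _ _ j)   (merges F10 F11 r _) (keeps F00 _ _ _) (splits _ E11 _ _) =
        contradiction (join-sym {c₁ = circₑ} r F10 (j F00) F11) E11
      merges-splits (splits _ _ _ _)   _ (merges _ _ _ _) _ = trivial splitting merging

      keeps-keeps : ∀ {κe κf} → Square κe same κf same
      keeps-keeps (splits _ E10 _ _) (keeps _ _ _ r) _ (keeps _ E11 _ _) = contradiction (r E11) E10
      keeps-keeps (keeps _ _ _ _) (keeps _ F11 _ _) (splits _ F01 _ _) (keeps _ _ _ r) = contradiction (r F11) F01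
      keeps-keeps (merges _ _ _ _) (keeps _ F11 _ _) (splits _ F01 _ _) (keeps _ _ _ r) = contradiction (r F11) F01
      keeps-keeps (keeps _ _ _ _) _ (keeps _ _ _ _) _ = trivial same same
      keeps-keeps (merges _ _ r j) (keeps F10 F11 r′ _) (merges F00 _ _ _) (keeps _ E11 _ _) =
        one-circle merging same merging same E11 F11 ≡.refl (λ eq → r′ (r eq)) F00 (j F10)
      keeps-keeps (keeps _ _ _ r) (keeps F10 _ _ _) (merges F00 _ _ _) _ = contradiction (r F10) F00
      keeps-keeps (merges E00 _ _ _) _ (keeps _ _ _ r) (keeps E01 _ _ _) = contradiction (r E01) E00

      merges-keeps : ∀ {κe κf} → Square κe merging κf same
      merges-keeps _ (merges _ F11 _ _) (splits _ F01 _ _) (keeps _ _ _ r) = contradiction (r F11) F01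
      merges-keeps (splits E00 E10 r _) (merges _ _ _ j) (merges F00 _ _ _) (keeps _ E11 _ _) =
        contradiction (join-sym {c₁ = circₑ} r E10 (j E11) E00) F00
      merges-keeps (merges E00 E10 r _) (merges F10 _ _ _) (merges _ _ _ j) (keeps E01 _ _ _) =
        contradiction (join-sym {c₁ = circ₀} r E00 (j E01) E10) F10
      merges-keeps (keeps _ _ _ _) _ (merges _ _ _ _) _ = trivial same merging
      merges-keeps (keeps _ _ r _)  (merges F10 _ _ _) (keeps F00 _ _ _) _ = contradiction (r F00) F10
      merges-keeps (merges _ _ r _) (merges F10 _ _ _) (keeps F00 _ _ _) _ = contradiction (r F00) F10
      merges-keeps (splits _ _ _ j) (merges F10 F11 r _) (keeps F00 _ _ _) (keeps _ E11 _ _) =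
        one-circle splitting merging same same E11 F11 ≡.refl r F10 (j F00)

      merges-merges : ∀ {κe κf} → Square κe merging κf merging
      merges-merges (keeps _ _ r _)  (merges F10 _ _ _) (keeps F00 _ _ _)  _ = contradiction (r F00) F10
      merges-merges (keeps _ _ r _)  (merges F10 _ _ _) (splits F00 _ _ _) _ = contradiction (r F00) F10
      merges-merges (keeps E00 _ _ _) _ (merges _ _ r _) (merges E01 _ _ _)  = contradiction (r E00) E01
      merges-merges (merges _ _ r _) (merges F10 _ _ _) (keeps F00 _ _ _)  _ = contradiction (r F00) F10
      merges-merges (merges _ _ r _) (merges F10 _ _ _) (splits F00 _ _ _) _ = contradiction (r F00) F10
      merges-merges (merges _ _ _ _) _ (merges _ _ _ _) _ = trivial merging merging
      merges-merges (splits E00 _ _ _) _ (keeps _ _ r _)  (merges E01 _ _ _) = contradiction (r E00) E01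
      merges-merges (splits E00 _ _ _) _ (merges _ _ r _) (merges E01 _ _ _) = contradiction (r E00) E01
      merges-merges (splits _ _ _ j) (merges F10 F11 r _) (splits F00 _ _ _) (merges _ E11 _ _) =
        one-circle splitting merging splitting merging E11 F11 ≡.refl r F10 (j F00)

    -- Every square of the cube commutes before signs. The cases are organised by the kinds of the
    -- two second steps.
    commute : ∀ {N k₀ k₁ k₂ k} {circ₀ : Fin N → Fin k₀} {circₑ : Fin N → Fin k₁} {circf : Fin N → Fin k₂}
      {circ : Fin N → Fin k} {e₁ e₂ f₁ f₂ : Fin N} L m {κe κf′ κf κe′} →
      Step circ₀ circₑ e₁ e₂ κe → Step circₑ circ f₁ f₂ κf′ →
      Step circ₀ circf f₁ f₂ κf → Step circf circ e₁ e₂ κe′ →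
      Commutes circ L e₁ e₂ f₁ f₂ m κe κf′ κf κe′
    commute L m {κf′ = splitting} {κe′ = splitting} a b d e = splits-splits L m a b d e
    commute L m {κf′ = same}      {κe′ = splitting} a b d e = keeps-splits L m a b d e
    commute L m {κf′ = merging}   {κe′ = splitting} a b d e = merges-splits L m a b d e
    commute L m {κf′ = same}      {κe′ = same}      a b d e = keeps-keeps L m a b d e
    commute L m {κf′ = merging}   {κe′ = same}      a b d e = merges-keeps L m a b d e
    commute L m {κf′ = merging}   {κe′ = merging}   a b d e = merges-merges L m a b d e
    -- The last three cases are mirror images of earlier ones under exchange of e and f.
    commute L m {κf′ = splitting} {κe′ = same}      a b d e = sym (keeps-splits L m d e a b)
    commute L m {κf′ = splitting} {κe′ = merging}   a b d e = sym (merges-splits L m d e a b)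
    commute L m {κf′ = same}      {κe′ = merging}   a b d e = sym (merges-keeps L m d e a b)

    if-ind : ∀ {P : Set} (d : Dec P) {x} → (if does d then x else 0#) ≈ ind d * x
    if-ind (yes _) = sym (*-identityˡ _)
    if-ind (no _)  = sym (zeroˡ _)

    ind-× : ∀ {P Q S : Set} (d : Dec S) (p : Dec P) (q : Dec Q) → (S → P × Q) → (P → Q → S) →
            ind d ≈ ind p * ind q
    ind-× d (yes p) (yes q) f g = trans (reflexive (ind-yes d (g p q))) (sym (*-identityˡ 1#))
    ind-× d (no ¬p) q       f g = trans (reflexive (ind-no d (¬p ∘ proj₁ ∘ f))) (sym (zeroˡ _))
    ind-× d (yes _) (no ¬q) f g = trans (reflexive (ind-no d (¬q ∘ proj₂ ∘ f))) (sym (zeroʳ _))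

    sum-single : ∀ {n} (f : Vector A n) i → (∀ j → j ≢ i → f j ≈ 0#) → sum f ≈ f i
    sum-single {suc n} f i f≈0 = begin
      sum f                                ≈⟨ sum-remove {i = i} f ⟩
      f i + ∑[ j < n ] f (punchIn i j)     ≈⟨ +-congˡ (trans
        (sum-cong-≋ {n} {y = λ _ → 0#} λ j → f≈0 _ (punchInᵢ≢i i j)) (sum-replicate-zero n)) ⟩
      f i + 0#                             ≈⟨ +-identityʳ _ ⟩
      f i ∎

    ∑-monomial : ∀ (F : Monomial → A) M → (∀ M′ → M′ ≢ M → F M′ ≈ 0#) →
                 ∑[ i < 4 ] ∑[ j < 3 ] F (i , j) ≈ F M
    ∑-monomial F (i , j) F≈0 = trans
      (sum-single {4} (λ i → ∑[ j < 3 ] F (i , j)) i λ i′ i′≢i →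
        trans (sum-cong-≋ {3} {y = λ _ → 0#} λ j → F≈0 (i′ , j) λ eq → i′≢i (cong proj₁ eq)) (sum-replicate-zero 3))
      (sum-single {3} (λ j → F (i , j)) j λ j′ j′≢j → F≈0 _ λ eq → j′≢j (cong proj₂ eq))

    ∑ᴸ-0 : ∀ {k} {F : Labelling k → A} → (∀ L → F L ≈ 0#) → ∑ᴸ F ≈ 0#
    ∑ᴸ-0 {zero}  F≈0 = F≈0 []
    ∑ᴸ-0 {suc k} {F} F≈0 = trans (sum-cong-≋ {4} {y = λ _ → 0#} λ i →
      trans (sum-cong-≋ {3} {y = λ _ → 0#} λ j → ∑ᴸ-0 {k} (λ L → F≈0 ((i , j) ∷ L))) (sum-replicate-zero 3))
      (sum-replicate-zero 4)

    ∑ᴸ-single : ∀ {k} (F : Labelling k → A) M → (∀ L → L ≢ M → F L ≈ 0#) → ∑ᴸ F ≈ F M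
    ∑ᴸ-single {zero}  F []      F≈0 = refl
    ∑ᴸ-single {suc k} F (m ∷ M) F≈0 = trans
      (∑-monomial (λ m → ∑ᴸ (λ L → F (m ∷ L))) m λ m′ m′≢m → ∑ᴸ-0 {k} λ L → F≈0 _ λ eq → m′≢m (cong Vec.head eq))
      (∑ᴸ-single (λ L → F (m ∷ L)) M λ L L≢M → F≈0 _ λ eq → L≢M (cong Vec.tail eq))
      where import Data.Vec.Base as Vec

    -- Links the normal form used in defining V with `nf′`: a monomial is the basis vector of its
    -- reduced exponent, and zero when that exponent has x^4.
    xy-ind : ∀ i j M → (x^ i y^ j) M ≡ ind (nf′ i j ≟ᵉ ⌜ M ⌝)
    xy-ind i (suc (suc (suc j))) M = xy-ind (suc i) (suc j) M
    xy-ind i 0 M with i ℕₚ.<? 4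
    ... | yes i<4 = ind-⇔ (≡-dec _≟_ _≟_ (fromℕ< i<4 , 0F) M) ((i , 0) ≟ᵉ ⌜ M ⌝)
      (λ eq → ≡.trans (cong (_, 0) (≡.sym (toℕ-fromℕ< i<4))) (cong ⌜_⌝ eq))
      (λ eq → ⌜⌝-injective (≡.trans (cong (_, 0) (toℕ-fromℕ< i<4)) eq))
    ... | no i≮4  = ≡.sym (ind-no ((i , 0) ≟ᵉ ⌜ M ⌝)
      λ eq → i≮4 (≡.subst (ℕ._< 4) (≡.sym (cong proj₁ eq)) (toℕ<n (proj₁ M))))
    xy-ind i 1 M with i ℕₚ.<? 4
    ... | yes i<4 = ind-⇔ (≡-dec _≟_ _≟_ (fromℕ< i<4 , 1F) M) ((i , 1) ≟ᵉ ⌜ M ⌝)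
      (λ eq → ≡.trans (cong (_, 1) (≡.sym (toℕ-fromℕ< i<4))) (cong ⌜_⌝ eq))
      (λ eq → ⌜⌝-injective (≡.trans (cong (_, 1) (toℕ-fromℕ< i<4)) eq))
    ... | no i≮4  = ≡.sym (ind-no ((i , 1) ≟ᵉ ⌜ M ⌝)
      λ eq → i≮4 (≡.subst (ℕ._< 4) (≡.sym (cong proj₁ eq)) (toℕ<n (proj₁ M))))
    xy-ind i 2 M with i ℕₚ.<? 4
    ... | yes i<4 = ind-⇔ (≡-dec _≟_ _≟_ (fromℕ< i<4 , 2F) M) ((i , 2) ≟ᵉ ⌜ M ⌝)
      (λ eq → ≡.trans (cong (_, 2) (≡.sym (toℕ-fromℕ< i<4))) (cong ⌜_⌝ eq))
      (λ eq → ⌜⌝-injective (≡.trans (cong (_, 2) (toℕ-fromℕ< i<4)) eq))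
    ... | no i≮4  = ≡.sym (ind-no ((i , 2) ≟ᵉ ⌜ M ⌝)
      λ eq → i≮4 (≡.subst (ℕ._< 4) (≡.sym (cong proj₁ eq)) (toℕ<n (proj₁ M))))

    basis-no : ∀ M M′ → M′ ≢ M → basis R c 4 M M′ ≡ 0#
    basis-no M M′ ≢ = ind-no (≡-dec _≟_ _≟_ M M′) (≢ ∘ ≡.sym)

    basis-yes : ∀ M → basis R c 4 M M ≡ 1#
    basis-yes M = ind-yes (≡-dec _≟_ _≟_ M M) ≡.refl

    Isᵉ : Monomial → Exp → A
    Isᵉ M a = ind (nf a ≟ᵉ ⌜ M ⌝)

    μ-basis : ∀ M M′ B → μ R c 4 (_⊗_ R c 4 (basis R c 4 M) (basis R c 4 M′)) B ≈ Isᵉ B (⌜ M ⌝ ⊕ ⌜ M′ ⌝)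
    μ-basis M M′ B = begin
      μ R c 4 (_⊗_ R c 4 (basis R c 4 M) (basis R c 4 M′)) B
        ≈⟨ ∑-monomial (λ P → ∑[ k < 4 ] ∑[ l < 3 ] F P (k , l)) M (λ P P≢M →
             trans (∑-monomial (F P) M′ λ Q _ → 0P P Q P≢M) (0P P M′ P≢M)) ⟩
      ∑[ k < 4 ] ∑[ l < 3 ] F M (k , l)
        ≈⟨ ∑-monomial (F M) M′ (λ Q Q≢ → trans (*-congʳ (trans (*-congˡ (reflexive (basis-no M′ Q Q≢))) (zeroʳ _)))
             (zeroˡ _)) ⟩
      basis R c 4 M M * basis R c 4 M′ M′ * (x^ toℕ (proj₁ M) ℕ.+ toℕ (proj₁ M′) y^ (toℕ (proj₂ M) ℕ.+ toℕ (proj₂ M′))) B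
        ≈⟨ *-cong (trans (*-cong (reflexive (basis-yes M)) (reflexive (basis-yes M′))) (*-identityˡ 1#))
                  (reflexive (xy-ind (toℕ (proj₁ M) ℕ.+ toℕ (proj₁ M′)) (toℕ (proj₂ M) ℕ.+ toℕ (proj₂ M′)) B)) ⟩
      1# * Isᵉ B (⌜ M ⌝ ⊕ ⌜ M′ ⌝)  ≈⟨ *-identityˡ _ ⟩
      Isᵉ B (⌜ M ⌝ ⊕ ⌜ M′ ⌝) ∎
      where
      F : Monomial → Monomial → A
      F (i , j) (k , l) = _⊗_ R c 4 (basis R c 4 M) (basis R c 4 M′) ((i , j) , (k , l)) * (x^ toℕ i ℕ.+ toℕ k y^ (toℕ j ℕ.+ toℕ l)) B
      0P : ∀ P Q → P ≢ M → F P Q ≈ 0#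
      0P P Q P≢M = trans (*-congʳ (trans (*-congʳ (reflexive (basis-no M P P≢M))) (zeroˡ _))) (zeroˡ _)

    Δ-basis : ∀ M B C → Δ R c 4 (basis R c 4 M) (B , C) ≈ W (λ s t → Isᵉ B (⌜ M ⌝ ⊕ s) * Isᵉ C t)
    Δ-basis M B C = +-cong
      (*-congˡ {x = - c} (sum-cong-≋ {3}
        {λ k → _⊗_ R c 4 (_·_ R c 4 (basis R c 4 M) (x^ suc (toℕ k) y^ 0)) (x^ (4 ∸ suc (toℕ k)) y^ 0) (B , C)} {X T} λ
        { 0F → term (1F , 0F) 3 0 ; 1F → term (2F , 0F) 2 0 ; 2F → term (3F , 0F) 1 0 }))
      (*-congˡ {x = c} (sum-cong-≋ {4}
        {λ k → _⊗_ R c 4 (_·_ R c 4 (basis R c 4 M) (x^ toℕ k y^ 2)) (x^ (3 ∸ toℕ k) y^ 0) (B , C)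
               + _⊗_ R c 4 (_·_ R c 4 (basis R c 4 M) (x^ toℕ k y^ 1)) (x^ (3 ∸ toℕ k) y^ 1) (B , C)
               + _⊗_ R c 4 (_·_ R c 4 (basis R c 4 M) (x^ toℕ k y^ 0)) (x^ (3 ∸ toℕ k) y^ 2) (B , C)}
        {λ k → Y₂ T k + Y₁ T k + Y₀ T k} λ
        { 0F → +-cong (+-cong (term (0F , 2F) 3 0) (term (0F , 1F) 3 1)) (term (0F , 0F) 3 2)
        ; 1F → +-cong (+-cong (term (1F , 2F) 2 0) (term (1F , 1F) 2 1)) (term (1F , 0F) 2 2)
        ; 2F → +-cong (+-cong (term (2F , 2F) 1 0) (term (2F , 1F) 1 1)) (term (2F , 0F) 1 2)
        ; 3F → +-cong (+-cong (term (3F , 2F) 0 0) (term (3F , 1F) 0 1)) (term (3F , 0F) 0 2) }))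
      where
      T : Bilinear
      T s t = Isᵉ B (⌜ M ⌝ ⊕ s) * Isᵉ C t
      term : ∀ M′ i j → μ R c 4 (_⊗_ R c 4 (basis R c 4 M) (basis R c 4 M′)) B * (x^ i y^ j) C ≈ T ⌜ M′ ⌝ (i , j)
      term M′ i j = *-cong (μ-basis M M′ B) (reflexive (xy-ind i j C))

    Isᵉ-cong : ∀ M {a b} → nf a ≡ nf b → Isᵉ M a ≈ Isᵉ M b
    Isᵉ-cong M eq = reflexive (cong (λ z → ind (z ≟ᵉ ⌜ M ⌝)) eq)

    Isᵉ-vanishing : ∀ M a → Vanishing a → Isᵉ M a ≈ 0#
    Isᵉ-vanishing M a v = reflexive (ind-no (nf a ≟ᵉ ⌜ M ⌝) λ eq →
      ℕₚ.<-irrefl ≡.refl (ℕₚ.≤-<-trans (≡.subst (4 ≤_) (cong proj₁ eq) v) (toℕ<n (proj₁ M))))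

    -- The local map on the circles through the arcs x and y, evaluated at the labels B of x and C of y.
    local : Kind → Exp → Exp → Monomial → Monomial → A
    local merging   a b B C = Isᵉ B (a ⊕ b)
    local same      a b B C = Isᵉ B (a ⊕ (1 , 2))
    local splitting a b B C = W (λ s t → Isᵉ B (a ⊕ s) * Isᵉ C t)

    local-cong : ∀ κ {a a′ b b′} B C → nf a ≡ nf a′ → nf b ≡ nf b′ → local κ a b B C ≈ local κ a′ b′ B C
    local-cong merging   {a} {a′} {b} {b′} B C p q =
      Isᵉ-cong B {a ⊕ b} {a′ ⊕ b′} (≡.trans (nf-cong {a} {a′} b p) (nf-congʳ a′ {b} {b′} q))
    local-cong same      {a} {a′} B C p q = Isᵉ-cong B {a ⊕ (1 , 2)} {a′ ⊕ (1 , 2)} (nf-cong {a} {a′} (1 , 2) p)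
    local-cong splitting {a} {a′} B C p q = weigh-cong splitting
      {λ s t → Isᵉ B (a ⊕ s) * Isᵉ C t} {λ s t → Isᵉ B (a′ ⊕ s) * Isᵉ C t}
      λ s t → *-congʳ (Isᵉ-cong B {a ⊕ s} {a′ ⊕ s} (nf-cong {a} {a′} s p))

    module _ {N k k′} {circ : Fin N → Fin k} {circ′ : Fin N → Fin k′} {x y : Fin N}
      (surjective : ∀ c → ∃[ f ] circ f ≡ c) (surjective′ : ∀ c → ∃[ f ] circ′ f ≡ c) where

      module _ (m : Arc-monomial N) (L′ : Labelling k′) where

        Far : Set
        Far = ∀ f → circ f ≢ circ x → circ f ≢ circ y → nf (exponent circ′ m (circ′ f)) ≡ ⌜ lookup L′ (circ′ f) ⌝

        far? : Dec Far
        far? = all? λ f → ¬? (circ f ≟ circ x) →-dec (¬? (circ f ≟ circ y) →-dec (_ ≟ᵉ _))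

        private
          B = lookup L′ (circ′ x)
          C = lookup L′ (circ′ y)

          p = exponent circ m (circ x)
          q = exponent circ m (circ y)

          At : Arc-monomial N → Fin N → Set
          At m′ f = nf (exponent circ′ m′ (circ′ f)) ≡ ⌜ lookup L′ (circ′ f) ⌝

          outside : ∀ s t f → ¬ Near {circ = circ} {circ′} {x} {y} circ′ f →
                    exponent circ′ ((x , s) ∷ (y , t) ∷ m) (circ′ f) ≡ exponent circ′ m (circ′ f)
          outside s t f far = cong₂ _⊕_ (only-no (circ′ x ≟ circ′ f) s λ eq → far (inj₁ (≡.sym eq)))
            (cong (_⊕ exponent circ′ m (circ′ f))
              (only-no (circ′ y ≟ circ′ f) t λ eq → far (inj₂ (≡.sym eq))))

          split-match : ∀ {κ} → Step circ circ′ x y κ → ∀ s t → Match circ′ ((x , s) ∷ (y , t) ∷ m) L′ →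
            Far × At ((x , s) ∷ (y , t) ∷ m) x × At ((x , s) ∷ (y , t) ∷ m) y
          split-match σ s t match =
            (λ f ≢x ≢y → ≡.trans (cong nf (≡.sym (outside s t f (not-near σ ≢x ≢y)))) (match (circ′ f))) ,
            match (circ′ x) , match (circ′ y)
            where
            not-near : ∀ {κ f} → Step circ circ′ x y κ → circ f ≢ circ x → circ f ≢ circ y →
                       ¬ Near {circ = circ} {circ′} {x} {y} circ′ f
            not-near σ ≢x ≢y near with near⇐ σ near
            ... | inj₁ eq = ≢x eq
            ... | inj₂ eq = ≢y eq

          join-match : ∀ {κ} → Step circ circ′ x y κ → ∀ s t → Far →
            At ((x , s) ∷ (y , t) ∷ m) x → At ((x , s) ∷ (y , t) ∷ m) y → Match circ′ ((x , s) ∷ (y , t) ∷ m) L′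
          join-match σ s t far atx aty c with surjective′ c
          ... | f , ≡.refl with circ′ f ≟ circ′ x | circ′ f ≟ circ′ y
          ...   | yes eq | _ = ≡.subst
            (λ c → nf (exponent circ′ ((x , s) ∷ (y , t) ∷ m) c) ≡ ⌜ lookup L′ c ⌝) (≡.sym eq) atx
          ...   | no _ | yes eq = ≡.subst
            (λ c → nf (exponent circ′ ((x , s) ∷ (y , t) ∷ m) c) ≡ ⌜ lookup L′ c ⌝) (≡.sym eq) aty
          ...   | no ≢x | no ≢y = ≡.trans (cong nf (outside s t f not-near))
            (far f (λ eq → not-near (near⇒ σ (inj₁ eq))) (λ eq → not-near (near⇒ σ (inj₂ eq))))
            where
            not-near : ¬ Near {circ = circ} {circ′} {x} {y} circ′ f
            not-near (inj₁ eq) = ≢x eq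
            not-near (inj₂ eq) = ≢y eq

        -- Multiplication at the arcs x and y factors into an agreement condition on the circles
        -- away from the edge and the map μ, Δ or m on the circles through its feet. This identifies
        -- the arc description with the definition of the complex.
        weigh-local : ∀ {κ} → Step circ circ′ x y κ →
          weigh κ (λ s t → ⟦_⟧ circ′ L′ ((x , s) ∷ (y , t) ∷ m)) ≈ ind far? * local κ p q B C
        weigh-local σ@(merges x≢y x≡y r j) = ind-× (match? circ′ ((x , (0 , 0)) ∷ (y , (0 , 0)) ∷ m) L′) far? (nf (p ⊕ q) ≟ᵉ ⌜ B ⌝)
          (λ match → let far , at , _ = split-match σ (0 , 0) (0 , 0) match in
            far , ≡.trans (cong nf (≡.sym eq)) at)
          (λ far at → join-match σ (0 , 0) (0 , 0) far (≡.trans (cong nf eq) at)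
            (≡.subst (λ c → nf (exponent circ′ ((x , (0 , 0)) ∷ (y , (0 , 0)) ∷ m) c) ≡ ⌜ lookup L′ c ⌝) x≡y
              (≡.trans (cong nf eq) at)))
          where
          eq : exponent circ′ ((x , (0 , 0)) ∷ (y , (0 , 0)) ∷ m) (circ′ x) ≡ p ⊕ q
          eq = ≡.trans (cong₂ _⊕_ (only-yes (circ′ x ≟ circ′ x) (0 , 0) ≡.refl)
              (cong (_⊕ exponent circ′ m (circ′ x)) (only-yes (circ′ y ≟ circ′ x) (0 , 0) (≡.sym x≡y))))
            (exponent-split circ′ circ x≢y
              (λ b eq → join⇒near {circ = circ} {circ′} {circ = circ} (inj₁ (j eq)))
              (λ b eq → r eq) (λ b eq → ≡.trans (r eq) (≡.sym x≡y)) m)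
        weigh-local σ@(keeps x≡y x≡′y r r′) = ind-× (match? circ′ ((x , (1 , 2)) ∷ (y , (0 , 0)) ∷ m) L′) far? (nf (p ⊕ (1 , 2)) ≟ᵉ ⌜ B ⌝)
          (λ match → let far , at , _ = split-match σ (1 , 2) (0 , 0) match in
            far , ≡.trans (cong nf (≡.sym eq)) at)
          (λ far at → join-match σ (1 , 2) (0 , 0) far (≡.trans (cong nf eq) at)
            (≡.subst (λ c → nf (exponent circ′ ((x , (1 , 2)) ∷ (y , (0 , 0)) ∷ m) c) ≡ ⌜ lookup L′ c ⌝) x≡′y
              (≡.trans (cong nf eq) at)))
          where
          eq : exponent circ′ ((x , (1 , 2)) ∷ (y , (0 , 0)) ∷ m) (circ′ x) ≡ p ⊕ (1 , 2)
          eq = ≡.trans (cong₂ _⊕_ (only-yes (circ′ x ≟ circ′ x) (1 , 2) ≡.refl)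
              (cong (_⊕ exponent circ′ m (circ′ x)) (only-yes (circ′ y ≟ circ′ x) (0 , 0) (≡.sym x≡′y))))
            (≡.trans (⊕-comm (1 , 2) (exponent circ′ m (circ′ x)))
              (cong (_⊕ (1 , 2)) (exponent-⇔ circ′ circ (λ b → r′) (λ b → r) m)))
        weigh-local σ@(splits x≡y x≢y r j) = begin
          W (λ s t → ⟦_⟧ circ′ L′ ((x , s) ∷ (y , t) ∷ m))
            ≈⟨ weigh-cong splitting {λ s t → ⟦_⟧ circ′ L′ ((x , s) ∷ (y , t) ∷ m)}
                 {λ s t → ind far? * (Isᵉ B (u ⊕ s) * Isᵉ C (v ⊕ t))} factor ⟩
          W (λ s t → ind far? * (Isᵉ B (u ⊕ s) * Isᵉ C (v ⊕ t)))
            ≈⟨ weigh-* splitting (ind far?) (λ s t → Isᵉ B (u ⊕ s) * Isᵉ C (v ⊕ t)) ⟩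
          ind far? * W (λ s t → T s (v ⊕ t))
            -- The arcs carry u on the circle of x and v on the circle of y, whereas Δ multiplies
            -- the whole old label into its first factor. Moving v across reconciles the two.
            ≈⟨ *-congˡ (W-move v {T} T-respects) ⟨
          ind far? * W (λ s t → T (v ⊕ s) t)
            ≈⟨ *-congˡ (weigh-cong splitting {λ s t → T (v ⊕ s) t} {λ s t → Isᵉ B (p ⊕ s) * Isᵉ C t}
                 λ s t → *-congʳ (reflexive (cong (Isᵉ B) (≡.trans (≡.sym (⊕-assoc u v s)) (cong (_⊕ s) (≡.sym uv)))))) ⟩
          ind far? * W (λ s t → Isᵉ B (p ⊕ s) * Isᵉ C t) ∎
          where
          u = exponent circ′ m (circ′ x)
          v = exponent circ′ m (circ′ y)

          T : Bilinear
          T s t = Isᵉ B (u ⊕ s) * Isᵉ C t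

          uv : p ≡ u ⊕ v
          uv = exponent-split circ circ′ x≢y
            (λ b eq → join⇒near {circ = circ} {circ′} {circ = circ′} (inj₁ (j eq)))
            (λ b eq → r eq) (λ b eq → ≡.trans (r eq) (≡.sym x≡y)) m

          T-respects : Respects T
          T-respects = record
            { respˡ  = λ {s} {s′} t eq → *-congʳ (Isᵉ-cong B {u ⊕ s} {u ⊕ s′} (nf-congʳ u {s} {s′} eq))
            ; respʳ  = λ s {t} {t′} eq → *-congˡ (Isᵉ-cong C {t} {t′} eq)
            ; zeroᵒˡ = λ s t v → trans (*-congʳ (Isᵉ-vanishing B (u ⊕ s)
                (≡.subst Vanishing (⊕-comm s u) (vanishing-⊕ s u v)))) (zeroˡ _)
            ; zeroᵒʳ = λ s t v → trans (*-congˡ (Isᵉ-vanishing C t v)) (zeroʳ _)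
            }

          atx : ∀ s t → exponent circ′ ((x , s) ∷ (y , t) ∷ m) (circ′ x) ≡ u ⊕ s
          atx s t = ≡.trans (cong₂ _⊕_ (only-yes (circ′ x ≟ circ′ x) s ≡.refl)
              (cong (_⊕ u) (only-no (circ′ y ≟ circ′ x) t (x≢y ∘ ≡.sym))))
            (⊕-comm s u)

          aty : ∀ s t → exponent circ′ ((x , s) ∷ (y , t) ∷ m) (circ′ y) ≡ v ⊕ t
          aty s t = ≡.trans (cong₂ _⊕_ (only-no (circ′ x ≟ circ′ y) s x≢y)
              (cong (_⊕ v) (only-yes (circ′ y ≟ circ′ y) t ≡.refl)))
            (⊕-comm t v)

          factor : ∀ s t → ⟦_⟧ circ′ L′ ((x , s) ∷ (y , t) ∷ m) ≈ ind far? * (Isᵉ B (u ⊕ s) * Isᵉ C (v ⊕ t))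
          factor s t = trans
            (ind-× (match? circ′ ((x , s) ∷ (y , t) ∷ m) L′) far? (X? ×-dec Y?)
              (λ match → let far , a , b = split-match σ s t match in
                far , ≡.trans (cong nf (≡.sym (atx s t))) a , ≡.trans (cong nf (≡.sym (aty s t))) b)
              (λ far (a , b) → join-match σ s t far (≡.trans (cong nf (atx s t)) a) (≡.trans (cong nf (aty s t)) b)))
            (*-congˡ (ind-× (X? ×-dec Y?) X? Y? (λ z → z) _,_))
            where
            X? = nf (u ⊕ s) ≟ᵉ ⌜ B ⌝
            Y? = nf (v ⊕ t) ≟ᵉ ⌜ C ⌝

    -- All terms of the three multiplying elements have degree 0 in Z/4 × Z/2, so a form that
    -- vanishes on such pairs of monomials has value zero. This is the source of degree
    -- preservation.
    weigh-balanced : ∀ κ {T} → (∀ s t → Balanced s t → T s t ≈ 0#) → weigh κ T ≈ 0#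
    weigh-balanced merging   eq = eq _ _ (≡.refl , ≡.refl)
    weigh-balanced same      eq = eq _ _ (≡.refl , ≡.refl)
    weigh-balanced splitting {T} eq = 0+0
      (r0 (trans (sum-cong-≋ {3} {X T} {λ _ → 0#} λ
        { 0F → z (1 , 0) (3 , 0) ; 1F → z (2 , 0) (2 , 0) ; 2F → z (3 , 0) (1 , 0) }) (sum-replicate-zero 3)))
      (r0 (trans (sum-cong-≋ {4} {λ k → Y₂ T k + Y₁ T k + Y₀ T k} {λ _ → 0#} λ
        { 0F → 0+0 (0+0 (z (0 , 2) (3 , 0)) (z (0 , 1) (3 , 1))) (z (0 , 0) (3 , 2))
        ; 1F → 0+0 (0+0 (z (1 , 2) (2 , 0)) (z (1 , 1) (2 , 1))) (z (1 , 0) (2 , 2))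
        ; 2F → 0+0 (0+0 (z (2 , 2) (1 , 0)) (z (2 , 1) (1 , 1))) (z (2 , 0) (1 , 2))
        ; 3F → 0+0 (0+0 (z (3 , 2) (0 , 0)) (z (3 , 1) (0 , 1))) (z (3 , 0) (0 , 2)) }) (sum-replicate-zero 4)))
      where
      r0 : ∀ {r x} → x ≈ 0# → r * x ≈ 0#
      r0 p = trans (*-congˡ p) (zeroʳ _)
      z : ∀ s t {{_ : (D₁ s ℕ.+ D₁ t) % 4 ≡ 0}} {{_ : (D₂ s ℕ.+ D₂ t) % 2 ≡ 0}} → T s t ≈ 0#
      z s t {{p}} {{q}} = eq s t (p , q)
      instance
        0≡0 : 0 ≡ 0
        0≡0 = ≡.refl

    ∑ᴸ-weigh : ∀ κ k (T : Labelling k → Bilinear) →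
               ∑ᴸ {k} (λ L → weigh κ (T L)) ≈ weigh κ (λ s t → ∑ᴸ {k} (λ L → T L s t))
    ∑ᴸ-weigh κ zero    T = refl
    ∑ᴸ-weigh κ (suc k) T = sym (begin
      weigh κ (λ s t → ∑[ i < 4 ] ∑[ j < 3 ] F i j s t)
        ≈⟨ weigh-sum κ {4} (λ i s t → ∑[ j < 3 ] F i j s t) ⟩
      ∑[ i < 4 ] weigh κ (λ s t → ∑[ j < 3 ] F i j s t)
        ≈⟨ sum-cong-≋ {4} {λ i → weigh κ (λ s t → ∑[ j < 3 ] F i j s t)}
             {λ i → ∑[ j < 3 ] ∑ᴸ {k} (λ L → weigh κ (T ((i , j) ∷ L)))}
             (λ i → trans (weigh-sum κ {3} (F i))
               (sum-cong-≋ {3} {λ j → weigh κ (F i j)} {λ j → ∑ᴸ {k} (λ L → weigh κ (T ((i , j) ∷ L)))}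
                 λ j → sym (∑ᴸ-weigh κ k (λ L → T ((i , j) ∷ L))))) ⟩
      ∑[ i < 4 ] ∑[ j < 3 ] ∑ᴸ {k} (λ L → weigh κ (T ((i , j) ∷ L))) ∎)
      where
      F : Fin 4 → Fin 3 → Bilinear
      F i j s t = ∑ᴸ {k} (λ L → T ((i , j) ∷ L) s t)

    ∑ᴸ-sum : ∀ {n} k (F : Fin n → Labelling k → A) →
             ∑[ i < n ] ∑ᴸ {k} (F i) ≈ ∑ᴸ {k} (λ M → ∑[ i < n ] F i M)
    ∑ᴸ-sum {zero}  k F = sym (∑ᴸ-0 {k} {λ _ → 0#} λ _ → refl)
    ∑ᴸ-sum {suc n} k F = trans (+-congˡ (∑ᴸ-sum k (F ∘ suc)))
      (sym (∑ᴸ-+ {k} (F zero) (λ M → ∑[ i < n ] F (suc i) M)))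

    ∑ᴸ-comm : ∀ k l (F : Labelling k → Labelling l → A) →
              ∑ᴸ {k} (λ L → ∑ᴸ {l} (F L)) ≈ ∑ᴸ {l} (λ M → ∑ᴸ {k} (λ L → F L M))
    ∑ᴸ-comm zero    l F = refl
    ∑ᴸ-comm (suc k) l F = begin
      ∑[ i < 4 ] ∑[ j < 3 ] ∑ᴸ {k} (λ L → ∑ᴸ {l} (F ((i , j) ∷ L)))
        ≈⟨ sum-cong-≋ {4} {λ i → ∑[ j < 3 ] ∑ᴸ {k} (λ L → ∑ᴸ {l} (F ((i , j) ∷ L)))}
            {λ i → ∑ᴸ {l} (λ M → ∑[ j < 3 ] ∑ᴸ {k} (λ L → F ((i , j) ∷ L) M))} (λ i → trans
          (sum-cong-≋ {3} {λ j → ∑ᴸ {k} (λ L → ∑ᴸ {l} (F ((i , j) ∷ L)))}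
            {λ j → ∑ᴸ {l} (λ M → ∑ᴸ {k} (λ L → F ((i , j) ∷ L) M))}
            λ j → ∑ᴸ-comm k l (λ L → F ((i , j) ∷ L)))
          (∑ᴸ-sum {3} l λ j M → ∑ᴸ {k} (λ L → F ((i , j) ∷ L) M))) ⟩
      ∑[ i < 4 ] ∑ᴸ {l} (λ M → ∑[ j < 3 ] ∑ᴸ {k} (λ L → F ((i , j) ∷ L) M))
        ≈⟨ ∑ᴸ-sum {4} l (λ i M → ∑[ j < 3 ] ∑ᴸ {k} (λ L → F ((i , j) ∷ L) M)) ⟩
      ∑ᴸ {l} (λ M → ∑ᴸ {suc k} (λ L → F L M)) ∎

    ∑ᴸ-pull-sum : ∀ {n} k σ (D : Fin n → Labelling k → A) (C : Labelling k → A) →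
      σ * ∑ᴸ {k} (λ L → (∑[ f < n ] D f L) * C L) ≈ ∑[ f < n ] (σ * ∑ᴸ {k} (λ L → D f L * C L))
    ∑ᴸ-pull-sum {n} k σ D C = begin
      σ * ∑ᴸ {k} (λ L → (∑[ f < n ] D f L) * C L)
        ≈⟨ *-congˡ {σ} (∑ᴸ-cong {k} {λ L → (∑[ f < n ] D f L) * C L} {λ L → ∑[ f < n ] (D f L * C L)}
             λ L → *-distribʳ-sum (C L) (λ f → D f L)) ⟩
      σ * ∑ᴸ {k} (λ L → ∑[ f < n ] (D f L * C L))
        ≈⟨ *-congˡ {σ} (∑ᴸ-sum k (λ f L → D f L * C L)) ⟨
      σ * ∑[ f < n ] ∑ᴸ {k} (λ L → D f L * C L)
        ≈⟨ *-distribˡ-sum σ (λ f → ∑ᴸ {k} (λ L → D f L * C L)) ⟩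
      ∑[ f < n ] (σ * ∑ᴸ {k} (λ L → D f L * C L)) ∎

    ∑ᴸ-pull-∑ᴸ : ∀ k l σ τ (w : Labelling k → A) (B : Labelling k → Labelling l → A) (C : Labelling l → A) →
      σ * ∑ᴸ {l} (λ L′ → (τ * ∑ᴸ {k} (λ L → w L * B L L′)) * C L′) ≈
      σ * τ * ∑ᴸ {k} (λ L → w L * ∑ᴸ {l} (λ L′ → B L L′ * C L′))
    ∑ᴸ-pull-∑ᴸ k l σ τ w B C = begin
      σ * ∑ᴸ {l} (λ L′ → (τ * I L′) * C L′)
        ≈⟨ *-congˡ {σ} (∑ᴸ-cong {l} {λ L′ → (τ * I L′) * C L′} {λ L′ → τ * (I L′ * C L′)}
             λ L′ → *-assoc τ (I L′) (C L′)) ⟩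
      σ * ∑ᴸ {l} (λ L′ → τ * (I L′ * C L′))
        ≈⟨ *-congˡ {σ} (∑ᴸ-* {l} τ (λ L′ → I L′ * C L′)) ⟩
      σ * (τ * ∑ᴸ {l} (λ L′ → I L′ * C L′))
        ≈⟨ *-congˡ {σ} (*-congˡ {τ}
             (∑ᴸ-cong {l} {λ L′ → I L′ * C L′} {λ L′ → ∑ᴸ {k} (λ L → w L * (B L L′ * C L′))} distribute)) ⟩
      σ * (τ * ∑ᴸ {l} (λ L′ → ∑ᴸ {k} (λ L → w L * (B L L′ * C L′))))
        ≈⟨ *-congˡ {σ} (*-congˡ {τ} (∑ᴸ-comm k l (λ L L′ → w L * (B L L′ * C L′)))) ⟨
      σ * (τ * ∑ᴸ {k} (λ L → ∑ᴸ {l} (λ L′ → w L * (B L L′ * C L′))))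
        ≈⟨ *-congˡ {σ} (*-congˡ {τ} (∑ᴸ-cong {k} {λ L → ∑ᴸ {l} (λ L′ → w L * (B L L′ * C L′))}
             {λ L → w L * ∑ᴸ {l} (λ L′ → B L L′ * C L′)} λ L → ∑ᴸ-* {l} (w L) (λ L′ → B L L′ * C L′))) ⟩
      σ * (τ * ∑ᴸ {k} (λ L → w L * ∑ᴸ {l} (λ L′ → B L L′ * C L′)))
        ≈⟨ *-assoc σ τ (∑ᴸ {k} (λ L → w L * ∑ᴸ {l} (λ L′ → B L L′ * C L′))) ⟨
      σ * τ * ∑ᴸ {k} (λ L → w L * ∑ᴸ {l} (λ L′ → B L L′ * C L′)) ∎
      where
      I : Labelling l → A
      I L′ = ∑ᴸ {k} (λ L → w L * B L L′)

      distribute : ∀ L′ → I L′ * C L′ ≈ ∑ᴸ {k} (λ L → w L * (B L L′ * C L′))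
      distribute L′ = begin
        I L′ * C L′                          ≈⟨ *-comm (I L′) (C L′) ⟩
        C L′ * I L′                          ≈⟨ ∑ᴸ-* {k} (C L′) (λ L → w L * B L L′) ⟨
        ∑ᴸ {k} (λ L → C L′ * (w L * B L L′))
          ≈⟨ ∑ᴸ-cong {k} {λ L → C L′ * (w L * B L L′)} {λ L → w L * (B L L′ * C L′)} (λ L →
               trans (*-comm (C L′) (w L * B L L′)) (*-assoc (w L) (B L L′) (C L′))) ⟩
        ∑ᴸ {k} (λ L → w L * (B L L′ * C L′)) ∎

    module _ (Γ : TrivalentPMGraph) where
      open TrivalentPMGraph Γ using (#M; #N; State; circles; #circles; circle; foot₁; foot₂)
      open Complex Γ hiding (coefficient; agreeAway?; restrict; ∂-edge; ∂-term; ∂)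

      circle-surjective : ∀ α c → ∃[ f ] circle α f ≡ c
      circle-surjective α = Quotient.surjective (circles α)

      -- Represents a basis tensor by placing the label of each circle on one chosen arc of it; the
      -- other arcs carry 1.
      monomial : ∀ α → Labelling (#circles α) → Arc-monomial #N
      monomial α L = List.tabulate λ c → proj₁ (circle-surjective α c) , ⌜ lookup L c ⌝

      exponent-monomial : ∀ α L c → exponent (circle α) (monomial α L) c ≡ ⌜ lookup L c ⌝
      exponent-monomial α L c = ≡.trans
        (cong (exponent (circle α) (monomial α L)) (≡.sym (proj₂ (circle-surjective α c))))
        (exponent-tabulate (circle α) (λ c → proj₁ (circle-surjective α c)) (λ c → ⌜ lookup L c ⌝)
          (λ {i} {j} eq → ≡.trans (≡.sym (proj₂ (circle-surjective α i))) (≡.trans eq (proj₂ (circle-surjective α j)))) c)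

      match-monomial : ∀ α L → Match (circle α) (monomial α L) L
      match-monomial α L c = ≡.trans (cong nf (exponent-monomial α L c)) (nf-⌜⌝ (lookup L c))

      StepAt : Fin #M → State → State → Kind → Set
      StepAt e α α′ = Step (circle α) (circle α′) (foot₁ e false) (foot₂ e false)

      sign : State → Fin #M → A
      sign α e = (- 1#) ^ onesBefore α e

      -- Sealed, since comparing two coefficients by unfolding Δ is very slow.
      abstract
        coef : Fin #M → (α α′ : State) → Labelling (#circles α) → Labelling (#circles α′) → A
        coef e α α′ = coefficient R c 4 Γ e α α′

        ∂-term-true : ∀ {i} (v : Cochain i) α p L′ e q → ∂-term R c 4 Γ v (generator α p L′) e true q ≡
          sign α e * ∑ᴸ {#circles (α [ e ]≔ false)} (λ L →
            v (generator (α [ e ]≔ false) (∣lower∣ α e q p) L) * coef e (α [ e ]≔ false) α L L′)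
        ∂-term-true v α p L′ e q = ≡.trans step₁ (cong (sign α e *_) step₂)
          where
          step₁ : ∂-term R c 4 Γ v (generator α p L′) e true q ≡
            sign α e * ∂-edge R c 4 Γ e (α [ e ]≔ false) α (restrict R c 4 Γ v (generator α p L′) e q) L′
          step₁ = ≡.refl

          unfold : ∀ f α β w L′ → ∂-edge R c 4 Γ f α β w L′ ≡
            ∑ᴸ {#circles α} (λ L → w L * coefficient R c 4 Γ f α β L L′)
          unfold f α β w L′ = ≡.refl

          step₂ : ∂-edge R c 4 Γ e (α [ e ]≔ false) α (restrict R c 4 Γ v (generator α p L′) e q) L′ ≡
            ∑ᴸ {#circles (α [ e ]≔ false)} (λ L →
              v (generator (α [ e ]≔ false) (∣lower∣ α e q p) L) * coefficient R c 4 Γ e (α [ e ]≔ false) α L L′)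
          step₂ = unfold e (α [ e ]≔ false) α (restrict R c 4 Γ v (generator α p L′) e q) L′

        private
          branch : ∀ {k k′} → Labelling k → Labelling k′ → Fin k → Fin k → Fin k′ → Fin k′ → A
          branch L L′ p q p′ q′ =
            if does (p ≟ q)
            then (if does (p′ ≟ q′)
                  then mV R c 4 (basis R c 4 (lookup L p)) (lookup L′ p′)
                  else Δ R c 4 (basis R c 4 (lookup L p)) (lookup L′ p′ , lookup L′ q′))
            else μ R c 4 (_⊗_ R c 4 (basis R c 4 (lookup L p)) (basis R c 4 (lookup L q))) (lookup L′ p′)

          coef-branch : ∀ e α α′ L L′ → coef e α α′ L L′ ≡
            (if does (agreeAway? R c 4 Γ e α α′ L L′)
             then branch L L′ (circle α (foot₁ e false)) (circle α (foot₂ e false))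
                              (circle α′ (foot₁ e false)) (circle α′ (foot₂ e false))
             else 0#)
          coef-branch e α α′ L L′ = ≡.refl

          branch-merging : ∀ {k k′} (L : Labelling k) (L′ : Labelling k′) p q p′ q′ → p ≢ q →
            branch L L′ p q p′ q′ ≈ local merging ⌜ lookup L p ⌝ ⌜ lookup L q ⌝ (lookup L′ p′) (lookup L′ q′)
          branch-merging L L′ p q p′ q′ p≢q = trans
            (reflexive (cong (λ z → if z then (if does (p′ ≟ q′)
              then mV R c 4 (basis R c 4 (lookup L p)) (lookup L′ p′)
              else Δ R c 4 (basis R c 4 (lookup L p)) (lookup L′ p′ , lookup L′ q′))
              else μ R c 4 (_⊗_ R c 4 (basis R c 4 (lookup L p)) (basis R c 4 (lookup L q))) (lookup L′ p′))
              (dec-false (p ≟ q) p≢q)))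
            (μ-basis (lookup L p) (lookup L q) (lookup L′ p′))

          branch-same : ∀ {k k′} (L : Labelling k) (L′ : Labelling k′) p q p′ q′ → p ≡ q → p′ ≡ q′ →
            branch L L′ p q p′ q′ ≈ local same ⌜ lookup L p ⌝ ⌜ lookup L q ⌝ (lookup L′ p′) (lookup L′ q′)
          branch-same L L′ p q p′ q′ p≡q p′≡q′ = trans
            (reflexive (cong₂ (λ z w → if z then (if w
              then mV R c 4 (basis R c 4 (lookup L p)) (lookup L′ p′)
              else Δ R c 4 (basis R c 4 (lookup L p)) (lookup L′ p′ , lookup L′ q′))
              else μ R c 4 (_⊗_ R c 4 (basis R c 4 (lookup L p)) (basis R c 4 (lookup L q))) (lookup L′ p′))
              (dec-true (p ≟ q) p≡q) (dec-true (p′ ≟ q′) p′≡q′)))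
            (μ-basis (lookup L p) (1F , 2F) (lookup L′ p′))

          branch-splitting : ∀ {k k′} (L : Labelling k) (L′ : Labelling k′) p q p′ q′ → p ≡ q → p′ ≢ q′ →
            branch L L′ p q p′ q′ ≈ local splitting ⌜ lookup L p ⌝ ⌜ lookup L q ⌝ (lookup L′ p′) (lookup L′ q′)
          branch-splitting L L′ p q p′ q′ p≡q p′≢q′ = trans
            (reflexive (cong₂ (λ z w → if z then (if w
              then mV R c 4 (basis R c 4 (lookup L p)) (lookup L′ p′)
              else Δ R c 4 (basis R c 4 (lookup L p)) (lookup L′ p′ , lookup L′ q′))
              else μ R c 4 (_⊗_ R c 4 (basis R c 4 (lookup L p)) (basis R c 4 (lookup L q))) (lookup L′ p′))
              (dec-true (p ≟ q) p≡q) (dec-false (p′ ≟ q′) p′≢q′)))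
            (Δ-basis (lookup L p) (lookup L′ p′) (lookup L′ q′))

      private
        branch-local : ∀ e {α α′ κ} → StepAt e α α′ κ → ∀ L L′ →
          branch L L′ (circle α (foot₁ e false)) (circle α (foot₂ e false))
                      (circle α′ (foot₁ e false)) (circle α′ (foot₂ e false)) ≈
          local κ ⌜ lookup L (circle α (foot₁ e false)) ⌝ ⌜ lookup L (circle α (foot₂ e false)) ⌝
                (lookup L′ (circle α′ (foot₁ e false))) (lookup L′ (circle α′ (foot₂ e false)))
        branch-local e {α} {α′} (merges x≢y _ _ _) L L′ = branch-merging L L′
          (circle α (foot₁ e false)) (circle α (foot₂ e false))
          (circle α′ (foot₁ e false)) (circle α′ (foot₂ e false)) x≢y
        branch-local e {α} {α′} (keeps x≡y x≡′y _ _) L L′ = branch-same L L′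
          (circle α (foot₁ e false)) (circle α (foot₂ e false))
          (circle α′ (foot₁ e false)) (circle α′ (foot₂ e false)) x≡y x≡′y
        branch-local e {α} {α′} (splits x≡y x≢′y _ _) L L′ = branch-splitting L L′
          (circle α (foot₁ e false)) (circle α (foot₂ e false))
          (circle α′ (foot₁ e false)) (circle α′ (foot₂ e false)) x≡y x≢′y

      coefficient-local : ∀ e {α α′ κ} → StepAt e α α′ κ → ∀ L L′ → coef e α α′ L L′ ≈
        ind (agreeAway? R c 4 Γ e α α′ L L′) * local κ
          ⌜ lookup L (circle α (foot₁ e false)) ⌝ ⌜ lookup L (circle α (foot₂ e false)) ⌝
          (lookup L′ (circle α′ (foot₁ e false))) (lookup L′ (circle α′ (foot₂ e false)))
      coefficient-local e {α} {α′} {κ} σ L L′ = trans (reflexive (coef-branch e α α′ L L′))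
        (trans (if-ind (agreeAway? R c 4 Γ e α α′ L L′))
          (*-congˡ {ind (agreeAway? R c 4 Γ e α α′ L L′)} (branch-local e {α} {α′} {κ} σ L L′)))

      module _ (e : Fin #M) {α α′ : State} where

        private
          x = foot₁ e false
          y = foot₂ e false

        -- The image of an arc monomial under an edge map, in the arc description: insert the
        -- factors at the feet and read the result in the new state.
        transfer : Arc-monomial #N → Kind → Labelling (#circles α′) → A
        transfer m κ L′ = weigh κ (λ s t → ⟦_⟧ (circle α′) L′ ((x , s) ∷ (y , t) ∷ m))

        module _ {κ} (σ : StepAt e α α′ κ) (m : Arc-monomial #N) (L′ : Labelling (#circles α′)) where

          private
            exponent-far : ∀ f → circle α f ≢ circle α x → circle α f ≢ circle α y →
              exponent (circle α) m (circle α f) ≡ exponent (circle α′) m (circle α′ f)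
            exponent-far f ≢x ≢y = exponent-⇔ (circle α) (circle α′) (far⇒ σ far) (far⇐ σ far) m
              where
              far : ¬ Near {circ = circle α} {circle α′} {x} {y} (circle α) f
              far (inj₁ eq) = ≢x eq
              far (inj₂ eq) = ≢y eq

            far : Dec _
            far = far? {circ = circle α} {circle α′} {x} {y} (circle-surjective α) (circle-surjective α′) m L′

            transfer-local : transfer m κ L′ ≈ ind far * local κ
              (exponent (circle α) m (circle α x)) (exponent (circle α) m (circle α y))
              (lookup L′ (circle α′ x)) (lookup L′ (circle α′ y))
            transfer-local = weigh-local (circle-surjective α) (circle-surjective α′) m L′ σ

          coefficient-match : ∀ L → Match (circle α) m L → coef e α α′ L L′ ≈ transfer m κ L′
          coefficient-match L match = begin
            coef e α α′ L L′  ≈⟨ coefficient-local e σ L L′ ⟩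
            ind (agreeAway? R c 4 Γ e α α′ L L′) * local κ ⌜ lookup L (circle α x) ⌝ ⌜ lookup L (circle α y) ⌝ _ _
              ≈⟨ *-cong
                (reflexive (ind-⇔ (agreeAway? R c 4 Γ e α α′ L L′) far
                  (λ agree f ≢x ≢y → ≡.trans (cong nf (≡.sym (exponent-far f ≢x ≢y)))
                    (≡.trans (match (circle α f)) (cong ⌜_⌝ (agree f ≢x ≢y))))
                  (λ away f ≢x ≢y → ⌜⌝-injective (≡.trans (≡.sym (match (circle α f)))
                    (≡.trans (cong nf (exponent-far f ≢x ≢y)) (away f ≢x ≢y))))))
                (local-cong κ {⌜ lookup L (circle α x) ⌝} {exponent (circle α) m (circle α x)}
                  {⌜ lookup L (circle α y) ⌝} {exponent (circle α) m (circle α y)}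
                  (lookup L′ (circle α′ x)) (lookup L′ (circle α′ y))
                  (≡.trans (nf-⌜⌝ _) (≡.sym (match (circle α x)))) (≡.trans (nf-⌜⌝ _) (≡.sym (match (circle α y))))) ⟩
            ind far * local κ _ _ _ _  ≈⟨ transfer-local ⟨
            transfer m κ L′ ∎

          local-vanishing : ∀ f → Vanishing (exponent (circle α) m (circle α f)) →
                            Near {circ = circle α} {circle α′} {x} {y} (circle α) f →
                            ∀ B C → local κ (exponent (circle α) m (circle α x))
                              (exponent (circle α) m (circle α y)) B C ≈ 0#
          local-vanishing f v near B C = go σ near
            where
            p = exponent (circle α) m (circle α x)
            q = exponent (circle α) m (circle α y)
            at : ∀ {c} → circle α f ≡ c → Vanishing (exponent (circle α) m c)
            at eq = ≡.subst (λ c → Vanishing (exponent (circle α) m c)) eq v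
            go : ∀ {κ} → StepAt e α α′ κ → Near {circ = circle α} {circle α′} {x} {y} (circle α) f →
                 local κ p q B C ≈ 0#
            go (merges _ _ _ _) (inj₁ eq) = Isᵉ-vanishing B (p ⊕ q) (vanishing-⊕ p q (at eq))
            go (merges _ _ _ _) (inj₂ eq) = Isᵉ-vanishing B (p ⊕ q)
              (≡.subst Vanishing (⊕-comm q p) (vanishing-⊕ q p (at eq)))
            go (keeps x≡y _ _ _) near = Isᵉ-vanishing B (p ⊕ (1 , 2)) (vanishing-⊕ p (1 , 2) (at (to-x near x≡y)))
              where
              to-x : Near {circ = circle α} {circle α′} {x} {y} (circle α) f → circle α x ≡ circle α y → circle α f ≡ circle α x
              to-x (inj₁ eq) _   = eq
              to-x (inj₂ eq) x≡y = ≡.trans eq (≡.sym x≡y)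
            go (splits x≡y _ _ _) near = weigh-0 splitting {λ s t → Isᵉ B (p ⊕ s) * Isᵉ C t} λ s t →
              trans (*-congʳ (Isᵉ-vanishing B (p ⊕ s) (vanishing-⊕ p s (at (to-x near x≡y))))) (zeroˡ _)
              where
              to-x : Near {circ = circle α} {circle α′} {x} {y} (circle α) f → circle α x ≡ circle α y → circle α f ≡ circle α x
              to-x (inj₁ eq) _   = eq
              to-x (inj₂ eq) x≡y = ≡.trans eq (≡.sym x≡y)

          -- An arc monomial that is zero before the step has zero image. After one step the
          -- inserted factors may produce x^4, so the formula for the edge map must cover such
          -- monomials too.
          transfer-vanishing : ∀ c → Vanishing (exponent (circle α) m c) → transfer m κ L′ ≈ 0#
          transfer-vanishing c v = go (circle-surjective α c)
            where
            go : ∃[ f ] circle α f ≡ c → transfer m κ L′ ≈ 0#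
            go (f , ≡.refl) = go′ (circle α f ≟ circle α x) (circle α f ≟ circle α y)
              where
              away-zero : circle α f ≢ circle α x → circle α f ≢ circle α y → ind far ≈ 0#
              away-zero ≢x ≢y = reflexive (ind-no far λ away →
                vanishing⇒¬match (λ (_ : Fin 1) → 0F) ((0F , exponent (circle α) m (circle α f)) ∷ [])
                  (lookup L′ (circle α′ f) ∷ [])
                  0F (≡.subst Vanishing (≡.sym (⊕-identityʳ (exponent (circle α) m (circle α f)))) v)
                  (λ { 0F → ≡.trans (cong nf (≡.trans (⊕-identityʳ (exponent (circle α) m (circle α f)))
                    (exponent-far f ≢x ≢y))) (away f ≢x ≢y) }))

              near-zero : Near {circ = circle α} {circle α′} {x} {y} (circle α) f → transfer m κ L′ ≈ 0#
              near-zero near = trans transfer-local (trans (*-congˡ (local-vanishing f v near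
                (lookup L′ (circle α′ x)) (lookup L′ (circle α′ y)))) (zeroʳ (ind far)))

              go′ : Dec (circle α f ≡ circle α x) → Dec (circle α f ≡ circle α y) → transfer m κ L′ ≈ 0#
              go′ (yes eq) _        = near-zero (inj₁ eq)
              go′ (no _)   (yes eq) = near-zero (inj₂ eq)
              go′ (no ≢x)  (no ≢y)  = trans transfer-local (trans (*-congʳ (away-zero ≢x ≢y)) (zeroˡ _))

          -- The matrix of the edge map acts on any arc monomial as `transfer`: in the sum over
          -- labels at most one term survives, and none does when the monomial is zero.
          apply-edge : ∑ᴸ (λ L → ⟦_⟧ (circle α) L m * coef e α α′ L L′) ≈ transfer m κ L′
          apply-edge = go (match-or-vanishing (circle α) m)
            where
            go : (Σ[ L ∈ _ ] Match (circle α) m L) ⊎ (∃[ c ] Vanishing (exponent (circle α) m c)) →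
                 ∑ᴸ (λ L → ⟦_⟧ (circle α) L m * coef e α α′ L L′) ≈ transfer m κ L′
            go (inj₁ (L₀ , match)) = begin
              ∑ᴸ (λ L → ⟦_⟧ (circle α) L m * coef e α α′ L L′)
                ≈⟨ ∑ᴸ-single (λ L → ⟦_⟧ (circle α) L m * coef e α α′ L L′) L₀ (λ L L≢ → trans
                  (*-congʳ (reflexive (ind-no (match? (circle α) m L)
                    λ match′ → L≢ (match-unique {circ = circle α} {m} match′ match)))) (zeroˡ _)) ⟩
              ⟦_⟧ (circle α) L₀ m * coef e α α′ L₀ L′
                ≈⟨ trans (*-congʳ (reflexive (ind-yes (match? (circle α) m L₀) match))) (*-identityˡ _) ⟩
              coef e α α′ L₀ L′  ≈⟨ coefficient-match L₀ match ⟩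
              transfer m κ L′ ∎
            go (inj₂ (c , v)) = trans (∑ᴸ-0 {#circles α} λ L → trans
              (*-congʳ (reflexive (ind-no (match? (circle α) m L) (vanishing⇒¬match (circle α) m L c v)))) (zeroˡ _))
              (sym (transfer-vanishing c v))

        coefficient-transfer : ∀ {κ} → StepAt e α α′ κ → ∀ L L′ →
                               coef e α α′ L L′ ≈ transfer (monomial α L) κ L′
        coefficient-transfer σ L L′ = coefficient-match σ (monomial α L) L′ L (match-monomial α L)

        degree₁-≢ : ∀ {κ} → StepAt e α α′ κ → ∀ L L′ → Degree₁.degree L % 4 ≢ Degree₁.degree L′ % 4 →
                    coef e α α′ L L′ ≈ 0#
        degree₁-≢ {κ} σ L L′ ≢ = trans (coefficient-transfer σ L L′) (weigh-balanced κ λ s t (b , _) →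
          reflexive (ind-no (match? (circle α′) ((x , s) ∷ (y , t) ∷ monomial α L) L′) λ match → ≢ (≡.sym (≡.trans
            (Degree₁.match-degree {circ = circle α′} ((x , s) ∷ (y , t) ∷ monomial α L) {L′} match)
            (≡.trans (cong (_% 4) (≡.sym (ℕₚ.+-assoc (D₁ s) (D₁ t) (Degree₁.weight (monomial α L)))))
              (≡.trans (Degree₁.+-cong-% {D₁ s ℕ.+ D₁ t} {0} {Degree₁.weight (monomial α L)} {Degree₁.weight (monomial α L)} b ≡.refl)
                (≡.sym (Degree₁.match-degree {circ = circle α} (monomial α L) {L} (match-monomial α L)))))))))

        degree₂-≢ : ∀ {κ} → StepAt e α α′ κ → ∀ L L′ → Degree₂.degree L % 2 ≢ Degree₂.degree L′ % 2 →
                    coef e α α′ L L′ ≈ 0#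
        degree₂-≢ {κ} σ L L′ ≢ = trans (coefficient-transfer σ L L′) (weigh-balanced κ λ s t (_ , b) →
          reflexive (ind-no (match? (circle α′) ((x , s) ∷ (y , t) ∷ monomial α L) L′) λ match → ≢ (≡.sym (≡.trans
            (Degree₂.match-degree {circ = circle α′} ((x , s) ∷ (y , t) ∷ monomial α L) {L′} match)
            (≡.trans (cong (_% 2) (≡.sym (ℕₚ.+-assoc (D₂ s) (D₂ t) (Degree₂.weight (monomial α L)))))
              (≡.trans (Degree₂.+-cong-% {D₂ s ℕ.+ D₂ t} {0} {Degree₂.weight (monomial α L)} {Degree₂.weight (monomial α L)} b ≡.refl)
                (≡.sym (Degree₂.match-degree {circ = circle α} (monomial α L) {L} (match-monomial α L)))))))))

      composite : (e f : Fin #M) (α₀ α₁ α : State) → Labelling (#circles α₀) → Labelling (#circles α) → A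
      composite e f α₀ α₁ α L L″ = ∑ᴸ λ L′ → coef e α₀ α₁ L L′ * coef f α₁ α L′ L″

      -- Write the image of L under the first map as a combination of arc monomials and apply the
      -- second map to each. The intermediate circles disappear, leaving an expression in the final
      -- state to which `commute` applies.
      composite-weigh : ∀ {e f α₀ α₁ α κ λ′} → StepAt e α₀ α₁ κ → StepAt f α₁ α λ′ → ∀ L L″ →
        composite e f α₀ α₁ α L L″ ≈ weigh κ (λ s₁ s₂ → weigh λ′ (λ t₁ t₂ → ⟦_⟧ (circle α) L″
          ((foot₁ f false , t₁) ∷ (foot₂ f false , t₂) ∷ (foot₁ e false , s₁) ∷ (foot₂ e false , s₂) ∷ monomial α₀ L)))
      composite-weigh {e} {f} {α₀} {α₁} {α} {κ} {λ′} σ τ L L″ = begin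
        ∑ᴸ (λ L′ → coef e α₀ α₁ L L′ * C L′)
          ≈⟨ ∑ᴸ-cong {#circles α₁} {λ L′ → coef e α₀ α₁ L L′ * C L′} {λ L′ → weigh κ (T L′) * C L′}
               (λ L′ → *-congʳ {C L′} (coefficient-transfer e {α₀} {α₁} {κ} σ L L′)) ⟩
        ∑ᴸ (λ L′ → weigh κ (T L′) * C L′)
          ≈⟨ ∑ᴸ-cong {#circles α₁} {λ L′ → weigh κ (T L′) * C L′} {λ L′ → weigh κ (TC L′)} scale ⟩
        ∑ᴸ (λ L′ → weigh κ (TC L′))
          ≈⟨ ∑ᴸ-weigh κ (#circles α₁) TC ⟩
        weigh κ (λ s t → ∑ᴸ (λ L′ → TC L′ s t))
          ≈⟨ weigh-cong κ {λ s t → ∑ᴸ (λ L′ → TC L′ s t)} {λ s t → transfer f {α₁} {α} (m s t) λ′ L″}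
               (λ s t → apply-edge f {α₁} {α} {λ′} τ (m s t) L″) ⟩
        weigh κ (λ s t → transfer f {α₁} {α} (m s t) λ′ L″) ∎
        where
        m : Exp → Exp → Arc-monomial #N
        m s t = (foot₁ e false , s) ∷ (foot₂ e false , t) ∷ monomial α₀ L

        C : Labelling (#circles α₁) → A
        C L′ = coef f α₁ α L′ L″

        T TC : Labelling (#circles α₁) → Bilinear
        T  L′ s t = ⟦_⟧ (circle α₁) L′ (m s t)
        TC L′ s t = T L′ s t * C L′

        scale : ∀ L′ → weigh κ (T L′) * C L′ ≈ weigh κ (TC L′)
        scale L′ = begin
          weigh κ (T L′) * C L′            ≈⟨ *-comm (weigh κ (T L′)) (C L′) ⟩
          C L′ * weigh κ (T L′)            ≈⟨ weigh-* κ (C L′) (T L′) ⟨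
          weigh κ (λ s t → C L′ * T L′ s t)
            ≈⟨ weigh-cong κ {λ s t → C L′ * T L′ s t} {TC L′} (λ s t → *-comm (C L′) (T L′ s t)) ⟩
          weigh κ (TC L′) ∎

      composite-comm : ∀ {e f α₀ α₁ α₂ α κe κf′ κf κe′} →
        StepAt e α₀ α₁ κe → StepAt f α₁ α κf′ → StepAt f α₀ α₂ κf → StepAt e α₂ α κe′ → ∀ L L″ →
        composite e f α₀ α₁ α L L″ ≈ composite f e α₀ α₂ α L L″
      composite-comm {e} {f} {α₀} {α₁} {α₂} {α} {κe} {κf′} {κf} {κe′} σe σf′ σf σe′ L L″ = trans
        (composite-weigh {e} {f} {α₀} {α₁} {α} {κe} {κf′} σe σf′ L L″)
        (trans
          (commute {circ₀ = circle α₀} {circle α₁} {circle α₂} {circle α}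
            {foot₁ e false} {foot₂ e false} {foot₁ f false} {foot₂ f false}
            L″ (monomial α₀ L) {κe} {κf′} {κf} {κe′} σe σf′ σf σe′)
          (sym (composite-weigh {f} {e} {α₀} {α₂} {α} {κf} {κe′} σf σe′ L L″)))

      -- Deleting two ones in either order gives opposite signs.
      onesBefore-delete : ∀ {ℓ} (α : Subset ℓ) {e f} → e ≢ f → lookup α e ≡ true → lookup α f ≡ true →
        let m = onesBefore α e ℕ.+ onesBefore (α [ e ]≔ false) f
            n = onesBefore α f ℕ.+ onesBefore (α [ f ]≔ false) e in m ≡ suc n ⊎ n ≡ suc m
      onesBefore-delete (b ∷ α) {zero} {zero} e≢f p q = contradiction ≡.refl e≢f
      onesBefore-delete (true ∷ α) {zero} {suc f} e≢f p q = inj₂ (cong suc (ℕₚ.+-identityʳ _))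
      onesBefore-delete (true ∷ α) {suc e} {zero} e≢f p q = inj₁ (cong suc (ℕₚ.+-identityʳ _))
      onesBefore-delete (false ∷ α) {suc e} {suc f} e≢f p q = onesBefore-delete α (e≢f ∘ cong suc) p q
      onesBefore-delete (true ∷ α) {suc e} {suc f} e≢f p q with onesBefore-delete α (e≢f ∘ cong suc) p q
      ... | inj₁ eq = inj₁ (cong suc (≡.trans (ℕₚ.+-suc _ _) (cong suc (≡.trans eq (≡.sym (ℕₚ.+-suc _ _))))))
      ... | inj₂ eq = inj₂ (cong suc (≡.trans (ℕₚ.+-suc _ _) (cong suc (≡.trans eq (≡.sym (ℕₚ.+-suc _ _))))))

      sign-delete : ∀ α {e f} → e ≢ f → lookup α e ≡ true → lookup α f ≡ true →
                    sign α e * sign (α [ e ]≔ false) f ≈ - (sign α f * sign (α [ f ]≔ false) e)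
      sign-delete α {e} {f} e≢f p q with onesBefore-delete α e≢f p q
      ... | inj₁ eq = begin
        sign α e * sign (α [ e ]≔ false) f  ≈⟨ ^-homo-* (- 1#) (onesBefore α e) _ ⟨
        (- 1#) ^ (onesBefore α e ℕ.+ onesBefore (α [ e ]≔ false) f)  ≡⟨ cong ((- 1#) ^_) eq ⟩
        - 1# * (- 1#) ^ (onesBefore α f ℕ.+ onesBefore (α [ f ]≔ false) e)  ≈⟨ -1*x≈-x _ ⟩
        - (- 1#) ^ (onesBefore α f ℕ.+ onesBefore (α [ f ]≔ false) e)
          ≈⟨ -‿cong (^-homo-* (- 1#) (onesBefore α f) _) ⟩
        - (sign α f * sign (α [ f ]≔ false) e) ∎
      ... | inj₂ eq = begin
        sign α e * sign (α [ e ]≔ false) f  ≈⟨ ⁻¹-involutive _ ⟨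
        - - (sign α e * sign (α [ e ]≔ false) f)
          ≈⟨ -‿cong (-‿cong (^-homo-* (- 1#) (onesBefore α e) _)) ⟨
        - - ((- 1#) ^ (onesBefore α e ℕ.+ onesBefore (α [ e ]≔ false) f))  ≈⟨ -‿cong (-1*x≈-x _) ⟨
        - ((- 1#) ^ suc (onesBefore α e ℕ.+ onesBefore (α [ e ]≔ false) f))  ≡⟨ cong (λ n → - ((- 1#) ^ n)) eq ⟨
        - ((- 1#) ^ (onesBefore α f ℕ.+ onesBefore (α [ f ]≔ false) e))
          ≈⟨ -‿cong (^-homo-* (- 1#) (onesBefore α f) _) ⟩
        - (sign α f * sign (α [ f ]≔ false) e) ∎

      module _ (steps : ∀ α e → lookup α e ≡ true → ∃[ κ ] StepAt e (α [ e ]≔ false) α κ) where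

        ∂-term-irrelevant : ∀ {i} (v : Cochain i) g e {b b′} (p : lookup (Generator.state g) e ≡ b)
          (q : lookup (Generator.state g) e ≡ b′) → ∂-term R c 4 Γ v g e b p ≡ ∂-term R c 4 Γ v g e b′ q
        ∂-term-irrelevant v g e ≡.refl ≡.refl = ≡.refl

        -- In each term of the differential, either the matrix coefficient vanishes because the
        -- degrees differ, or the source label lies outside the prescribed degree, where v is zero.
        ∂-homogeneous : ∀ {a ε i} {v : Cochain i} → Homogeneous a ε v → Homogeneous a ε (∂ R c 4 Γ v)
        ∂-homogeneous {a} {ε} {i} {v} hom g@(generator α p L′) ¬d = trans
          (sum-cong-≋ {#M} {y = λ _ → 0#} λ e → term e _ ≡.refl) (sum-replicate-zero #M)
          where
          vanish : ∀ e (eq : lookup α e ≡ true) L → v (generator (α [ e ]≔ false) (∣lower∣ α e eq p) L) * coef e (α [ e ]≔ false) α L L′ ≈ 0#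
          vanish e eq L = go (Degree₁.degree L % 4 ℕₚ.≟ Degree₁.degree L′ % 4) (Degree₂.degree L % 2 ℕₚ.≟ Degree₂.degree L′ % 2)
            where
            go : Dec (Degree₁.degree L % 4 ≡ Degree₁.degree L′ % 4) → Dec (Degree₂.degree L % 2 ≡ Degree₂.degree L′ % 2) →
                 v (generator (α [ e ]≔ false) (∣lower∣ α e eq p) L) * coef e (α [ e ]≔ false) α L L′ ≈ 0#
            go (no ≢)  _       = trans (*-congˡ (degree₁-≢ e {α [ e ]≔ false} {α} {proj₁ (steps α e eq)} (proj₂ (steps α e eq)) L L′ ≢)) (zeroʳ _)
            go (yes _) (no ≢)  = trans (*-congˡ (degree₂-≢ e {α [ e ]≔ false} {α} {proj₁ (steps α e eq)} (proj₂ (steps α e eq)) L L′ ≢)) (zeroʳ _)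
            go (yes p₁) (yes q₁) = trans (*-congʳ (hom (generator (α [ e ]≔ false) (∣lower∣ α e eq p) L) λ (p′ , q′) → ¬d (≡.trans (≡.sym p₁) p′ , ≡.trans (≡.sym q₁) q′))) (zeroˡ _)

          term : ∀ e b eq → ∂-term R c 4 Γ v g e b eq ≈ 0#
          term e false eq = refl
          term e true  eq = trans (reflexive (∂-term-true v α p L′ e eq)) (trans (*-congˡ {sign α e} (∑ᴸ-0 {#circles (α [ e ]≔ false)} (vanish e eq))) (zeroʳ _))

        module _ (2-cancel : ∀ {x} → x + x ≈ 0# → x ≈ 0#) {i} (v : Cochain i) (α : State)
          (∣α∣ : ∣ α ∣ ≡ suc (suc i)) (L″ : Labelling (#circles α)) where

          private
            -- The contribution to the twofold differential of changing f first and e last. It is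
            -- zero when the entry at e is 0; stating it for an arbitrary proof of the value of that
            -- entry permits case distinction.
            Q : ∀ e {b} → lookup α e ≡ b → Fin #M → A
            Q e {false} p f = 0#
            Q e {true}  p f = sign α e *
              ∑ᴸ (λ L′ → ∂-term R c 4 Γ v (generator (α [ e ]≔ false) (∣lower∣ α e p ∣α∣) L′) f _ ≡.refl * coef e (α [ e ]≔ false) α L′ L″)

            expand : ∀ e {b} (p : lookup α e ≡ b) → ∂-term R c 4 Γ (∂ R c 4 Γ v) (generator α ∣α∣ L″) e b p ≈ ∑[ f < #M ] Q e p f
            expand e {false} p = sym (sum-replicate-zero #M)
            expand e {true}  p = trans (reflexive (∂-term-true (∂ R c 4 Γ v) α ∣α∣ L″ e p)) (∑ᴸ-pull-sum (#circles (α [ e ]≔ false)) (sign α e)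
              (λ f L′ → ∂-term R c 4 Γ v (generator (α [ e ]≔ false) (∣lower∣ α e p ∣α∣) L′) f _ ≡.refl) (λ L′ → coef e (α [ e ]≔ false) α L′ L″))

            Q-zero : ∀ e {b} (p : lookup α e ≡ b) f → lookup (α [ e ]≔ false) f ≡ false → Q e p f ≈ 0#
            Q-zero e {false} p f q = refl
            Q-zero e {true}  p f q = trans (*-congˡ (∑ᴸ-0 {#circles (α [ e ]≔ false)} λ L′ → trans
              (*-congʳ (reflexive (∂-term-irrelevant v (generator (α [ e ]≔ false) (∣lower∣ α e p ∣α∣) L′) f ≡.refl q))) (zeroˡ _))) (zeroʳ _)

            inner : ∀ (s : State) (∣s∣ : ∣ s ∣ ≡ i) e f (α₁ : State) → A
            inner s ∣s∣ e f α₁ = ∑ᴸ λ L → v (generator s ∣s∣ L) * composite f e s α₁ α L L″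

            Q-inner : ∀ e (p : lookup α e ≡ true) f (q : lookup (α [ e ]≔ false) f ≡ true) →
              Q e p f ≈ sign α e * sign (α [ e ]≔ false) f *
                inner (α [ e ]≔ false [ f ]≔ false) (∣lower∣ (α [ e ]≔ false) f q (∣lower∣ α e p ∣α∣)) e f (α [ e ]≔ false)
            Q-inner e p f q = trans
              (*-congˡ {sign α e} (∑ᴸ-cong {#circles (α [ e ]≔ false)}
                {λ L′ → ∂-term R c 4 Γ v (generator (α [ e ]≔ false) (∣lower∣ α e p ∣α∣) L′) f _ ≡.refl
                        * coef e (α [ e ]≔ false) α L′ L″}
                {λ L′ → sign (α [ e ]≔ false) f * ∑ᴸ (λ L →
                          v (generator (α [ e ]≔ false [ f ]≔ false) (∣lower∣ (α [ e ]≔ false) f q (∣lower∣ α e p ∣α∣)) L)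
                          * coef f (α [ e ]≔ false [ f ]≔ false) (α [ e ]≔ false) L L′)
                        * coef e (α [ e ]≔ false) α L′ L″}
                λ L′ → *-congʳ {coef e (α [ e ]≔ false) α L′ L″} (reflexive (≡.trans
                  (∂-term-irrelevant v (generator (α [ e ]≔ false) (∣lower∣ α e p ∣α∣) L′) f ≡.refl q)
                  (∂-term-true v (α [ e ]≔ false) (∣lower∣ α e p ∣α∣) L′ f q)))))
              (∑ᴸ-pull-∑ᴸ (#circles (α [ e ]≔ false [ f ]≔ false)) (#circles (α [ e ]≔ false))
                (sign α e) (sign (α [ e ]≔ false) f)
                (λ L → v (generator (α [ e ]≔ false [ f ]≔ false) (∣lower∣ (α [ e ]≔ false) f q (∣lower∣ α e p ∣α∣)) L))
                (coef f (α [ e ]≔ false [ f ]≔ false) (α [ e ]≔ false)) (λ L′ → coef e (α [ e ]≔ false) α L′ L″))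

            inner-swap : ∀ {s s′} → s ≡ s′ → (∣s∣ : ∣ s ∣ ≡ i) (∣s′∣ : ∣ s′ ∣ ≡ i) → ∀ {e f α₁ α₂ κe κf′ κf κe′} →
              StepAt f s α₁ κf → StepAt e α₁ α κe′ → StepAt e s′ α₂ κe → StepAt f α₂ α κf′ →
              inner s ∣s∣ e f α₁ ≈ inner s′ ∣s′∣ f e α₂
            inner-swap {s} ≡.refl ∣s∣ ∣s′∣ {e} {f} {α₁} {α₂} {κe} {κf′} {κf} {κe′} σf σe′ σe σf′ = ∑ᴸ-cong {#circles s} λ L → *-cong
              (reflexive (cong (λ z → v (generator s z L)) (ℕₚ.≡-irrelevant ∣s∣ ∣s′∣)))
              (composite-comm {f} {e} {s} {α₁} {α₂} {α} {κf} {κe′} {κe} {κf′} σf σe′ σe σf′ L L″)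

            -- For distinct edges with entry 1, the square commutes and the signs of the two orders
            -- are opposite. In the remaining cases both terms vanish; on the diagonal this is
            -- because the entry at e has already been cleared.
            antisymmetric : ∀ e f → Q e ≡.refl f ≈ - Q f ≡.refl e
            antisymmetric e f = go e f ≡.refl ≡.refl
              where
              zeros : ∀ {x y} → x ≈ 0# → y ≈ 0# → x ≈ - y
              zeros p q = trans p (sym (trans (-‿cong q) (trans (sym (-1*x≈-x _)) (zeroʳ _))))

              go : ∀ e f {b b′} (p : lookup α e ≡ b) (q : lookup α f ≡ b′) → Q e p f ≈ - Q f q e
              go′ : ∀ {e f b b′} → Dec (e ≡ f) → (p : lookup α e ≡ b) (q : lookup α f ≡ b′) → Q e p f ≈ - Q f q e

              go e f = go′ (e ≟ f)

              go′ {e} {.e} (yes ≡.refl) p q = zeros (Q-zero e p e (lookup∘update e α false)) (Q-zero e q e (lookup∘update e α false))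
              go′ {e} {f} {false} (no e≢f) p q = zeros refl (Q-zero f q e (≡.trans (lookup∘update′ e≢f α false) p))
              go′ {e} {f} {true} {false} (no e≢f) p q = zeros (Q-zero e p f (≡.trans (lookup∘update′ (e≢f ∘ ≡.sym) α false) q)) refl
              go′ {e} {f} {true} {true} (no e≢f) p q = begin
                Q e p f                                      ≈⟨ Q-inner e p f q′ ⟩
                sign α e * sign α₁ f * inner s₁ ∣s₁∣ e f α₁  ≈⟨ *-cong (sign-delete α e≢f p q)
                  (inner-swap {s₁} {s₂} ([]≔-commutes α e f e≢f) ∣s₁∣ ∣s₂∣ {e} {f} {α₁} {α₂}
                    (proj₂ (steps α₁ f q′)) (proj₂ (steps α e p)) (proj₂ (steps α₂ e p′)) (proj₂ (steps α f q))) ⟩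
                - (sign α f * sign α₂ e) * inner s₂ ∣s₂∣ f e α₂  ≈⟨ -‿distribˡ-* _ _ ⟨
                - (sign α f * sign α₂ e * inner s₂ ∣s₂∣ f e α₂)  ≈⟨ -‿cong (Q-inner f q e p′) ⟨
                - Q f q e ∎
                where
                α₁ = α [ e ]≔ false
                α₂ = α [ f ]≔ false
                s₁ = α₁ [ f ]≔ false
                s₂ = α₂ [ e ]≔ false
                q′ : lookup α₁ f ≡ true
                q′ = ≡.trans (lookup∘update′ (e≢f ∘ ≡.sym) α false) q
                p′ : lookup α₂ e ≡ true
                p′ = ≡.trans (lookup∘update′ e≢f α false) p
                ∣s₁∣ = ∣lower∣ α₁ f q′ (∣lower∣ α e p ∣α∣)
                ∣s₂∣ = ∣lower∣ α₂ e p′ (∣lower∣ α f q ∣α∣)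

          ∂∂≈0 : ∂ R c 4 Γ (∂ R c 4 Γ v) (generator α ∣α∣ L″) ≈ 0#
          -- Exchanging the summation indices shows S = -S for the double sum S. Since 2 is not a
          -- zero divisor, S = 0.
          ∂∂≈0 = trans (sum-cong-≋ {#M} λ e → expand e ≡.refl) (2-cancel (begin
            S + S
              ≈⟨ +-congˡ (sum-cong-≋ {#M} λ e → sum-cong-≋ {#M} λ f → trans (antisymmetric e f) (sym (-1*x≈-x _))) ⟩
            S + ∑[ e < #M ] ∑[ f < #M ] (- 1# * Q f ≡.refl e)
              ≈⟨ +-congˡ (sum-cong-≋ {#M} λ e → sym (*-distribˡ-sum (- 1#) (λ f → Q f ≡.refl e))) ⟩
            S + ∑[ e < #M ] (- 1# * ∑[ f < #M ] Q f ≡.refl e)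
              ≈⟨ +-congˡ (*-distribˡ-sum (- 1#) (λ e → ∑[ f < #M ] Q f ≡.refl e)) ⟨
            S + - 1# * (∑[ e < #M ] ∑[ f < #M ] Q f ≡.refl e)
              ≈⟨ +-congˡ (trans (*-congˡ (∑-comm (λ e f → Q f ≡.refl e))) (-1*x≈-x S)) ⟩
            S - S  ≈⟨ -‿inverseʳ S ⟩
            0# ∎))
            where S = ∑[ e < #M ] ∑[ f < #M ] Q e ≡.refl f

-- Existence and uniqueness of the ranks of the homology modules.

module HomRanks where

  open import Algebra.Bundles using (CommutativeRing; CommutativeMonoid)
  open import Algebra.Module.Bundles using (LeftModule)
  open import Data.Bool.Base using (Bool; true; false)
  open import Data.Empty using (⊥-elim)
  open import Data.Fin.Base using (Fin; zero; suc; toℕ; _↑ˡ_; _↑ʳ_)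
  open import Data.Fin.Properties using (_≟_)
  open import Data.Fin.Subset using (Subset; ∣_∣)
  open import Data.Fin.Subset.Properties using (∣p∣≤n)
  open import Data.List.Base using (List; []; _∷_; concatMap; filter; cartesianProductWith; cartesianProduct; allFin)
  import Data.List.Base as List
  open import Data.List.Membership.Propositional using (_∈_)
  open import Data.List.Membership.Propositional.Properties
  open import Data.List.Relation.Unary.All as All using (All; []; _∷_)
  import Data.List.Relation.Unary.All.Properties as Allₚ
  open import Data.List.Relation.Unary.Any as Any using (here; there)
  open import Data.List.Relation.Unary.Any.Properties using (lookup-index)
  open import Data.List.Relation.Unary.AllPairs using ([]; _∷_)
  open import Data.List.Relation.Unary.Unique.Propositional using (Unique)
  import Data.List.Relation.Unary.Unique.Propositional.Properties as Uniqueₚ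
  open import Data.Nat.Base using (ℕ; zero; suc; _≤_; _<_; NonZero)
  import Data.Nat.Base as ℕ
  import Data.Nat.Properties as ℕₚ
  open import Data.Product.Base using (Σ-syntax; ∃; ∃-syntax; _×_; _,_; proj₁; proj₂)
  open import Data.Sum.Base using (_⊎_; inj₁; inj₂)
  open import Data.Vec.Base using (Vec; []; _∷_)
  open import Data.Vec.Functional using (Vector; _++_)
  open import Data.Vec.Functional.Properties using (lookup-++ˡ; lookup-++ʳ)
  open import Data.Vec.Properties using (∷-injective)
  open import Function.Base using (_∘_)
  open import Level using (0ℓ)
  open import Relation.Binary.Definitions using (tri<; tri≈; tri>)
  open import Relation.Binary.PropositionalEquality as ≡ using (_≡_; _≢_; cong; cong₂)
  open import Relation.Nullary using (¬_; Dec; yes; no; contradiction)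
  open import Relation.Nullary.Decidable using (_×-dec_)
  open import Relation.Unary using (Decidable)
  open LinAlg

  module _ {A : Set} where

    unique-lookup : ∀ {xs : List A} → Unique xs → ∀ i j → List.lookup xs i ≡ List.lookup xs j → i ≡ j
    unique-lookup (_ ∷ _)     zero    zero    eq = ≡.refl
    unique-lookup (x∉ ∷ _)    zero    (suc j) eq = contradiction eq (All.lookup x∉ (∈-lookup j))
    unique-lookup (x∉ ∷ _)    (suc i) zero    eq = contradiction (≡.sym eq) (All.lookup x∉ (∈-lookup i))
    unique-lookup (_ ∷ xs!)   (suc i) (suc j) eq = cong suc (unique-lookup xs! i j eq)

  subsets : ∀ ℓ → List (Subset ℓ)
  subsets zero    = [] ∷ []
  subsets (suc ℓ) = List.map (false ∷_) (subsets ℓ) List.++ List.map (true ∷_) (subsets ℓ)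

  ∈-subsets : ∀ {ℓ} (α : Subset ℓ) → α ∈ subsets ℓ
  ∈-subsets []          = here ≡.refl
  ∈-subsets (false ∷ α) = ∈-++⁺ˡ (∈-map⁺ (false ∷_) (∈-subsets α))
  ∈-subsets (true ∷ α)  = ∈-++⁺ʳ _ (∈-map⁺ (true ∷_) (∈-subsets α))

  subsets! : ∀ ℓ → Unique (subsets ℓ)
  subsets! zero    = [] ∷ []
  subsets! (suc ℓ) = Uniqueₚ.++⁺ (Uniqueₚ.map⁺ (proj₂ ∘ ∷-injective) (subsets! ℓ))
    (Uniqueₚ.map⁺ (proj₂ ∘ ∷-injective) (subsets! ℓ)) disjoint
    where
    disjoint : ∀ {α} → α ∈ List.map (false ∷_) (subsets ℓ) × α ∈ List.map (true ∷_) (subsets ℓ) → _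
    disjoint (p , q) with ∈-map⁻ (false ∷_) p | ∈-map⁻ (true ∷_) q
    ... | _ , _ , ≡.refl | _ , _ , ()

  vectors : ∀ {A : Set} → List A → ∀ k → List (Vec A k)
  vectors xs zero    = [] ∷ []
  vectors xs (suc k) = cartesianProductWith _∷_ xs (vectors xs k)

  ∈-vectors : ∀ {A : Set} {xs : List A} → (∀ x → x ∈ xs) → ∀ {k} (v : Vec A k) → v ∈ vectors xs k
  ∈-vectors full []      = here ≡.refl
  ∈-vectors full (x ∷ v) = ∈-cartesianProductWith⁺ _∷_ (full x) (∈-vectors full v)

  vectors! : ∀ {A : Set} {xs : List A} → Unique xs → ∀ k → Unique (vectors xs k)
  vectors! xs! zero    = [] ∷ []
  vectors! xs! (suc k) = Uniqueₚ.cartesianProductWith⁺ _∷_ ∷-injective xs! (vectors! xs! k)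

  module _ {A : Set} {B : A → Set} (f : ∀ a → List (B a)) where

    pairs : List A → List (Σ[ a ∈ A ] B a)
    pairs = concatMap λ a → List.map (a ,_) (f a)

    ∈-pairs : ∀ {xs a b} → a ∈ xs → b ∈ f a → (a , b) ∈ pairs xs
    ∈-pairs {a = a} p q = ∈-concatMap⁺ (λ a → List.map (a ,_) (f a)) (Any.map (λ { ≡.refl → ∈-map⁺ (a ,_) q }) p)

    pairs-∈ : ∀ xs {a b} → (a , b) ∈ pairs xs → a ∈ xs
    pairs-∈ xs p = Any.map (λ q → cong proj₁ (proj₂ (proj₂ (∈-map⁻ _ q))))
      (∈-concatMap⁻ (λ a → List.map (a ,_) (f a)) {xs = xs} p)

    pairs! : ∀ {xs} → Unique xs → (∀ a → Unique (f a)) → Unique (pairs xs)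
    pairs! {[]}     []         f! = []
    pairs! {x ∷ xs} (x∉ ∷ xs!) f! = Uniqueₚ.++⁺ (Uniqueₚ.map⁺ (λ { ≡.refl → ≡.refl }) (f! x)) (pairs! xs! f!)
      λ (p , q) → disjoint p q
      where
      disjoint : ∀ {ab} → ab ∈ List.map (x ,_) (f x) → ab ∈ pairs xs → _
      disjoint p q with ∈-map⁻ (x ,_) p
      ... | _ , _ , ≡.refl = contradiction ≡.refl (All.lookup x∉ (pairs-∈ xs q))

  module SumSplit {c ℓ} (M : CommutativeMonoid c ℓ) where
    open CommutativeMonoid M
    open import Algebra.Properties.CommutativeMonoid.Sum M

    sum-split : ∀ m {n} (f : Vector Carrier (m ℕ.+ n)) →
                sum f ≈ sum (λ i → f (i ↑ˡ n)) ∙ sum (λ i → f (m ↑ʳ i))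
    sum-split zero    f = sym (identityˡ _)
    sum-split (suc m) f = trans (∙-congˡ (sum-split m (f ∘ suc))) (sym (assoc _ _ _))

  module RankUniqueness (R : CommutativeRing 0ℓ 0ℓ) {m ℓ} (M : LeftModule (CommutativeRing.ring R) m ℓ) where
    open CommutativeRing R using (0#; _≈_) renaming (Carrier to A; refl to ≈-refl; sym to ≈-sym; trans to ≈-trans; reflexive to ≈-reflexive)
    open LeftModule M
    open import Algebra.Properties.CommutativeMonoid.Sum +ᴹ-commutativeMonoid

    independent-initial : ∀ {k l} → k ≤ l → ∃ (LinearlyIndependent R M {l}) → ∃ (LinearlyIndependent R M {k})
    independent-initial {k} {l} k≤l (v , ind) with ℕₚ.m≤n⇒∃[o]m+o≡n k≤l
    ... | r , ≡.refl = (λ i → v (i ↑ˡ r)) , λ a rel i → ≈-trans (≈-reflexive (≡.sym (lookup-++ˡ a z i)))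
      (ind (a ++ z) (≈ᴹ-trans (SumSplit.sum-split +ᴹ-commutativeMonoid k (λ i → (a ++ z) i *ₗ v i))
        (≈ᴹ-trans (+ᴹ-cong
          (≈ᴹ-trans (sum-cong-≋ {k} λ i → *ₗ-congʳ (≈-reflexive (lookup-++ˡ a z i))) rel)
          (≈ᴹ-trans (sum-cong-≋ {r} {y = λ _ → 0ᴹ} λ i → ≈ᴹ-trans (*ₗ-congʳ (≈-reflexive (lookup-++ʳ a z i))) (*ₗ-zeroˡ _))
            (sum-replicate-zero r)))
          (+ᴹ-identityʳ 0ᴹ))) (i ↑ˡ r))
      where
      z : Vector A r
      z _ = 0#

    -- An independent family may be shortened, so two different ranks would contradict each other.
    -- The theorem speaks of an arbitrary system of ranks, and this identifies it with the one
    -- computed by elimination.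
    rank-unique : ∀ {k l} → HasRank R M k → HasRank R M l → k ≡ l
    rank-unique {k} {l} (ik , nk) (il , nl) with ℕₚ.<-cmp k l
    ... | tri< k<l _ _ = ⊥-elim (nk (independent-initial k<l il))
    ... | tri≈ _ k≡l _ = k≡l
    ... | tri> _ _ l<k = ⊥-elim (nl (independent-initial l<k ik))

  module _ (R : CommutativeRing 0ℓ 0ℓ) (c : CommutativeRing.Carrier R) (n : ℕ) .{{_ : NonZero n}}
    (Γ : TrivalentPMGraph) where
    open MöbiusOver R c n
    open Complex Γ

    Degree-preserving : Set
    Degree-preserving = ∀ {a ε i} {v : Cochain i} → Homogeneous a ε v → Homogeneous a ε (∂ v)

    Square-zero : Set
    Square-zero = ∀ {i} (v : Cochain i) g → CommutativeRing._≈_ R (∂ (∂ v) g) (CommutativeRing.0# R)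

  module HomologyRanks (R : CommutativeRing 0ℓ 0ℓ) (isDomain : IsDecidableDomain R)
    (c : CommutativeRing.Carrier R) (n : ℕ) .{{_ : NonZero n}} (Γ : TrivalentPMGraph)
    (∂-homogeneous : Degree-preserving R c n Γ) (∂∂≈0 : Square-zero R c n Γ) where

    open MöbiusOver R c n
    open Complex Γ
    open CommutativeRing R renaming (Carrier to A) hiding (zero)
    open TrivalentPMGraph Γ using (#M; State; #circles)
    open IntegralDomain R isDomain
    open IsDecidableDomain isDomain
    open import Relation.Binary.Reasoning.Setoid setoid
    open import Algebra.Properties.Ring ring using (-1*x≈-x)

    monomials : List Monomial
    monomials = cartesianProduct (allFin n) (allFin 3)

    -- A duplicate-free list of all basis elements of the complex, in all homological degrees at
    -- once. Each graded piece is obtained from it by filtering.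
    labelledStates : List (Σ[ α ∈ State ] Labelling (#circles α))
    labelledStates = pairs (λ α → vectors monomials (#circles α)) (subsets #M)

    ∈-labelledStates : ∀ s → s ∈ labelledStates
    ∈-labelledStates (α , L) = ∈-pairs (λ α → vectors monomials (#circles α)) (∈-subsets α)
      (∈-vectors (λ (i , j) → ∈-cartesianProduct⁺ (∈-allFin i) (∈-allFin j)) L)

    labelledStates! : Unique labelledStates
    labelledStates! = pairs! (λ α → vectors monomials (#circles α)) (subsets! #M)
      λ α → vectors! (Uniqueₚ.cartesianProduct⁺ (Uniqueₚ.allFin⁺ n) (Uniqueₚ.allFin⁺ 3)) (#circles α)

    module _ (a : Fin n) (ε : Fin 2) where

      InDegree : ℕ → Σ[ α ∈ State ] Labelling (#circles α) → Set
      InDegree i (α , L) = Σ[ p ∈ ∣ α ∣ ≡ i ] HasDegree a ε (generator {i} α p L)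

      inDegree? : ∀ i → Decidable (InDegree i)
      inDegree? i (α , L) with ∣ α ∣ ℕₚ.≟ i
      ... | no ≢ = no (≢ ∘ proj₁)
      ... | yes p with (_ ℕₚ.≟ toℕ a) ×-dec (_ ℕₚ.≟ toℕ ε)
      ...   | yes d = yes (p , d)
      ...   | no ¬d = no (¬d ∘ proj₂)

      homogeneousStates : ℕ → List (Σ[ α ∈ State ] Labelling (#circles α))
      homogeneousStates i = filter (inDegree? i) labelledStates

      dimension : ℕ → ℕ
      dimension i = List.length (homogeneousStates i)

      private
        at : ∀ i (j : Fin (dimension i)) → InDegree i (List.lookup (homogeneousStates i) j)
        at i j = proj₂ (∈-filter⁻ (inDegree? i) {xs = labelledStates} (∈-lookup j))

      element : ∀ i → Fin (dimension i) → Generator i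
      element i j = let α , L = List.lookup (homogeneousStates i) j in generator α (proj₁ (at i j)) L

      element-degree : ∀ i j → HasDegree a ε (element i j)
      element-degree i j = proj₂ (at i j)

      private
        forget : ∀ {i} → Generator i → Σ[ α ∈ State ] Labelling (#circles α)
        forget (generator α _ L) = α , L

        forget-injective : ∀ {i} {g h : Generator i} → forget g ≡ forget h → g ≡ h
        forget-injective {g = generator α p L} {generator .α q .L} ≡.refl =
          cong (λ r → generator α r L) (ℕₚ.≡-irrelevant p q)

      element-injective : ∀ i {j k} → element i j ≡ element i k → j ≡ k
      element-injective i {j} {k} eq =
        unique-lookup (Uniqueₚ.filter⁺ (inDegree? i) labelledStates!) j k (cong forget eq)

      position : ∀ i (g : Generator i) → HasDegree a ε g → Σ[ j ∈ Fin (dimension i) ] element i j ≡ g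
      position i g@(generator α p L) d = Any.index mem , forget-injective (≡.sym (lookup-index mem))
        where
        mem : (α , L) ∈ homogeneousStates i
        mem = ∈-filter⁺ (inDegree? i) (∈-labelledStates (α , L)) (p , d)

      hasDegree? : ∀ {i} (g : Generator i) → Dec (HasDegree a ε g)
      hasDegree? (generator α p L) = (_ ℕₚ.≟ toℕ a) ×-dec (_ ℕₚ.≟ toℕ ε)

      -- A state has at most #M ones. This closes the telescoping sum of boundary ranks at the upper
      -- end.
      dimension-top : dimension (suc #M) ≡ 0
      dimension-top with dimension (suc #M) in eq
      ... | zero  = ≡.refl
      ... | suc m = contradiction (∣p∣≤n (proj₁ s)) (ℕₚ.<⇒≱ (ℕₚ.≤-reflexive (≡.sym (proj₁ (at (suc #M) j)))))
        where
        j : Fin (dimension (suc #M))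
        j = ≡.subst Fin (≡.sym eq) zero
        s = List.lookup (homogeneousStates (suc #M)) j

      -- Coordinates of a graded piece are turned into a cochain by extending them by zero outside
      -- its degree.
      extension : ∀ {i} → Vector A (dimension i) → Cochain i
      extension {i} x g with hasDegree? g
      ... | yes d = x (proj₁ (position i g d))
      ... | no _  = 0#

      extension-homogeneous : ∀ {i} (x : Vector A (dimension i)) → Homogeneous a ε (extension x)
      extension-homogeneous x g ¬d with hasDegree? g
      ... | yes d = contradiction d ¬d
      ... | no _  = refl

      extension-element : ∀ {i} (x : Vector A (dimension i)) j → extension x (element i j) ≈ x j
      extension-element {i} x j with hasDegree? (element i j)
      ... | yes d = reflexive (cong x (element-injective i (proj₂ (position i (element i j) d))))
      ... | no ¬d = contradiction (element-degree i j) ¬d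

      homogeneous-≈ : ∀ {i} {v w : Cochain i} → Homogeneous a ε v → Homogeneous a ε w →
                      (∀ j → v (element i j) ≈ w (element i j)) → ∀ g → v g ≈ w g
      homogeneous-≈ {i} {v} {w} hv hw eq g with hasDegree? g
      ... | no ¬d = trans (hv g ¬d) (sym (hw g ¬d))
      ... | yes d = ≡.subst (λ g → v g ≈ w g) (proj₂ (position i g d)) (eq _)

      extension-lc : ∀ {i l} (b : Vector A l) (x : Vector (Vector A (dimension i)) l) g →
                     extension (lc b x) g ≈ ∑[ t < l ] (b t * extension (x t) g)
      extension-lc {i} {l} b x g with hasDegree? g
      ... | yes d = refl
      ... | no _  = sym (sum-0 {l} {λ t → b t * 0#} λ t → zeroʳ (b t))

      ∂-sum : ∀ {i l} (b : Vector A l) (v : Fin l → Cochain i) g →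
              ∂ (λ h → ∑[ t < l ] (b t * v t h)) g ≈ ∑[ t < l ] (b t * ∂ (v t) g)
      ∂-sum {l = zero}  b v g = ∂-0 g
      ∂-sum {l = suc l} b v g = trans (∂-+ (λ h → b zero * v zero h) (λ h → ∑[ t < l ] (b (suc t) * v (suc t) h)) g)
        (+-cong (∂-* (b zero) (v zero) g) (∂-sum (b ∘ suc) (v ∘ suc) g))

      -- The differential on one internal degree. Degree preservation ensures that restricting to
      -- these coordinates loses nothing.
      matrix : ∀ i → Vector (Vector A (dimension (suc i))) (dimension i)
      matrix i j k = ∂ (extension (δ j)) (element (suc i) k)

      matrix-lc : ∀ {i} (x : Vector A (dimension i)) k → lc x (matrix i) k ≈ ∂ (extension x) (element (suc i) k)
      matrix-lc {i} x k = begin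
        ∑[ j < dimension i ] (x j * ∂ (extension (δ j)) (element (suc i) k))
          ≈⟨ ∂-sum x (λ j → extension (δ j)) (element (suc i) k) ⟨
        ∂ (λ h → ∑[ j < dimension i ] (x j * extension (δ j) h)) (element (suc i) k)
          ≈⟨ ∂-cong (λ h → extension-lc x δ h) (element (suc i) k) ⟨
        ∂ (extension (lc x δ)) (element (suc i) k)
          ≈⟨ ∂-cong (homogeneous-≈ (extension-homogeneous (lc x δ)) (extension-homogeneous x) λ j →
               trans (extension-element (lc x δ) j) (trans (lc-δ x j) (sym (extension-element x j))))
               (element (suc i) k) ⟩
        ∂ (extension x) (element (suc i) k) ∎

      -- The map into degree i, which in degree 0 is the empty family. Hence the boundary rank there
      -- is 0.
      incoming : ∀ i → Σ[ q ∈ ℕ ] Vector (Vector A (dimension i)) q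
      incoming zero    = 0 , λ ()
      incoming (suc i) = dimension i , matrix i

      matrix-square : ∀ i j k → lc (proj₂ (incoming i) j) (matrix i) k ≈ 0#
      matrix-square (suc i) j k = begin
        lc (matrix i j) (matrix (suc i)) k   ≈⟨ matrix-lc (matrix i j) k ⟩
        ∂ (extension (matrix i j)) (element (suc (suc i)) k)
          ≈⟨ ∂-cong (homogeneous-≈ (extension-homogeneous (matrix i j))
               (∂-homogeneous (extension-homogeneous (δ j))) (extension-element (matrix i j)))
               (element (suc (suc i)) k) ⟩
        ∂ (∂ (extension (δ j))) (element (suc (suc i)) k)  ≈⟨ ∂∂≈0 (extension (δ j)) (element (suc (suc i)) k) ⟩
        0# ∎

      homologyAt : ∀ i → Homology (proj₂ (incoming i)) (matrix i)
      homologyAt i = homology (proj₂ (incoming i)) (matrix i) (matrix-square i)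

      module _ (i : ℕ) where
        open Homology (homologyAt i)

        private
          M = MH a ε i
          module M = LeftModule M
          import Algebra.Properties.CommutativeMonoid.Sum
          module M∑ = Algebra.Properties.CommutativeMonoid.Sum M.+ᴹ-commutativeMonoid

          sum-proj : ∀ {l} (t : Fin l → M.Carrierᴹ) g → proj₁ (M∑.sum t) g ≈ ∑[ j < l ] proj₁ (t j) g
          sum-proj {zero}  t g = refl
          sum-proj {suc l} t g = +-congˡ (sum-proj (t ∘ suc) g)

          z : Fin dim → M.Carrierᴹ
          z j = extension (cycle j) , extension-homogeneous (cycle j) ,
            homogeneous-≈ (∂-homogeneous (extension-homogeneous (cycle j))) (λ _ _ → refl) λ k →
              trans (sym (matrix-lc (cycle j) k)) (closed j k)

          boundary⇒ : ∀ {i v} → Coboundary a ε {i} v →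
            Σ[ x ∈ Vector A (proj₁ (incoming i)) ] ∀ j → v (element i j) ≈ lc x (proj₂ (incoming i)) j
          boundary⇒ {zero}  b           = (λ ()) , λ j → b _
          boundary⇒ {suc i} {v} (w , h , eq) = (λ j → w (element i j)) , λ k → begin
            v (element (suc i) k)                                    ≈⟨ eq _ ⟨
            ∂ w (element (suc i) k)
              ≈⟨ ∂-cong (homogeneous-≈ h (extension-homogeneous (λ j → w (element i j)))
                   λ j → sym (extension-element (λ j → w (element i j)) j)) (element (suc i) k) ⟩
            ∂ (extension (λ j → w (element i j))) (element (suc i) k)  ≈⟨ matrix-lc (λ j → w (element i j)) k ⟨
            lc (λ j → w (element i j)) (matrix i) k ∎

          ⇒boundary : ∀ {i v} → Homogeneous a ε v → (x : Vector A (proj₁ (incoming i))) →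
            (∀ j → v (element i j) ≈ lc x (proj₂ (incoming i)) j) → Coboundary a ε {i} v
          ⇒boundary {zero}  h x eq = homogeneous-≈ h (λ _ _ → refl) eq
          ⇒boundary {suc i} h x eq = extension x , extension-homogeneous x ,
            homogeneous-≈ (∂-homogeneous (extension-homogeneous x)) h λ k →
              trans (sym (matrix-lc x k)) (sym (eq k))

          x-0 : ∀ x → x - 0# ≈ x
          x-0 x = trans (+-congˡ (trans (sym (-1*x≈-x 0#)) (zeroʳ _))) (+-identityʳ x)

          z-independent : LinearlyIndependent R M z
          z-independent b rel = independent b x λ j → begin
            lc b cycle j
              ≈⟨ sum-cong-≋ {dim} (λ t → *-congˡ (sym (extension-element (cycle t) j))) ⟩
            ∑[ t < dim ] (b t * extension (cycle t) (element i j))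
              ≈⟨ sum-proj (λ t → b t M.*ₗ z t) (element i j) ⟨
            proj₁ (M∑.sum (λ t → b t M.*ₗ z t)) (element i j)        ≈⟨ x-0 _ ⟨
            proj₁ (M∑.sum (λ t → b t M.*ₗ z t)) (element i j) - 0#   ≈⟨ proj₂ bd j ⟩
            lc x (proj₂ (incoming i)) j ∎
            where
            bd = boundary⇒ rel
            x = proj₁ bd

          -- Up to scaling, each of dim + 1 cocycles has coordinates in the chosen representatives
          -- modulo boundaries. That many coordinate vectors are dependent, and the relation,
          -- multiplied by the scaling factors, gives a boundary with a nonzero coefficient.
          no-more : ¬ ∃ (LinearlyIndependent R M {suc dim})
          no-more (w , ind) = go (decide coefficients)
            where
            vec : Fin (suc dim) → Vector A (dimension i)
            vec t j = proj₁ (w t) (element i j)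

            vec-closed : ∀ t k → lc (vec t) (matrix i) k ≈ 0#
            vec-closed t k = begin
              lc (vec t) (matrix i) k                     ≈⟨ matrix-lc (vec t) k ⟩
              ∂ (extension (vec t)) (element (suc i) k)
                ≈⟨ ∂-cong (homogeneous-≈ (extension-homogeneous (vec t)) (proj₁ (proj₂ (w t)))
                     (extension-element (vec t))) (element (suc i) k) ⟩
              ∂ (proj₁ (w t)) (element (suc i) k)         ≈⟨ proj₂ (proj₂ (w t)) (element (suc i) k) ⟩
              0# ∎

            sp : ∀ t → _
            sp t = spanning (vec t) (vec-closed t)

            scale : Fin (suc dim) → A
            scale t = proj₁ (sp t)

            coefficients : Fin (suc dim) → Vector A dim
            coefficients t = proj₁ (proj₂ (proj₂ (sp t)))

            rests : Fin (suc dim) → Vector A (proj₁ (incoming i))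
            rests t = proj₁ (proj₂ (proj₂ (proj₂ (sp t))))

            go : (suc dim ≤ dim × Independent coefficients) ⊎ Dependent coefficients → _
            go (inj₁ (d<d , _)) = ℕₚ.<-irrefl ≡.refl d<d
            go (inj₂ (b , rel , t , b≉0)) = b≉0 (cancel (proj₁ (proj₂ (sp t))) (trans (*-comm _ _) (ind bs bounds t)))
              where
              bs : Fin (suc dim) → A
              bs t = b t * scale t

              total : M.Carrierᴹ
              total = M∑.sum (λ t → bs t M.*ₗ w t)

              bounds : total M.≈ᴹ M.0ᴹ
              bounds = ⇒boundary {v = λ g → proj₁ total g - 0#}
                (λ g ¬d → trans (x-0 _) (proj₁ (proj₂ total) g ¬d)) (lc b rests) λ j → begin
                proj₁ total (element i j) - 0#                       ≈⟨ x-0 _ ⟩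
                proj₁ total (element i j)                            ≈⟨ sum-proj (λ t → bs t M.*ₗ w t) (element i j) ⟩
                ∑[ t < suc dim ] (b t * scale t * vec t j)
                  ≈⟨ sum-cong-≋ {suc dim} (λ t → trans (*-assoc (b t) (scale t) (vec t j))
                       (trans (*-congˡ (proj₂ (proj₂ (proj₂ (proj₂ (sp t)))) j)) (distribˡ (b t) _ _))) ⟩
                ∑[ t < suc dim ] (b t * lc (coefficients t) cycle j + b t * lc (rests t) (proj₂ (incoming i)) j)
                  ≈⟨ ∑-distrib-+ {suc dim} (λ t → b t * lc (coefficients t) cycle j)
                       (λ t → b t * lc (rests t) (proj₂ (incoming i)) j) ⟩
                lc b (λ t → lc (coefficients t) cycle) j + lc b (λ t → lc (rests t) (proj₂ (incoming i))) j
                  ≈⟨ +-cong (lc-lc b coefficients cycle j) (lc-lc b rests (proj₂ (incoming i)) j) ⟨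
                lc (lc b coefficients) cycle j + lc (lc b rests) (proj₂ (incoming i)) j
                  ≈⟨ +-congʳ (lc-0 cycle rel j) ⟩
                0# + lc (lc b rests) (proj₂ (incoming i)) j          ≈⟨ +-identityˡ _ ⟩
                lc (lc b rests) (proj₂ (incoming i)) j ∎

        hasRank : HasRank R M dim
        hasRank = (z , z-independent) , no-more

      boundaryRank : ℕ → ℕ
      boundaryRank i = rank (proj₂ (incoming i))

      dimension-rank : ∀ i → Homology.dim (homologyAt i) ℕ.+ (boundaryRank i ℕ.+ boundaryRank (suc i)) ≡ dimension i
      dimension-rank i = Homology.dim-rank (homologyAt i)

      boundaryRank-top : boundaryRank (suc #M) ≡ 0
      boundaryRank-top = ℕₚ.n≤0⇒n≡0 (≡.subst (boundaryRank (suc #M) ≤_) dimension-top (rank-≤ (matrix #M)))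

    ranks : Ranks
    ranks = record { rank = λ i a ε → Homology.dim (homologyAt a ε i) ; hasRank = λ i a ε → hasRank a ε i }

    -- Rank-nullity for any given system of ranks: the dimension of a graded piece is its homology
    -- rank plus the ranks of the two adjacent differentials.
    ranks-dimension : (ρ : Ranks) → ∀ i a ε →
      Ranks.rank ρ i a ε ℕ.+ (boundaryRank a ε i ℕ.+ boundaryRank a ε (suc i)) ≡ dimension a ε i
    ranks-dimension ρ i a ε = ≡.trans
      (cong (ℕ._+ _) (RankUniqueness.rank-unique R (MH a ε i) (Ranks.hasRank ρ i a ε) (hasRank a ε i)))
      (dimension-rank a ε i)

-- Integer sums over lists, signs and alternating sums.

module ListSum where

  open import Data.Bool.Base using (Bool; true; false; if_then_else_)
  open import Data.Fin.Base using (Fin; zero; suc)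
  open import Data.Fin.Subset using (Subset; ∣_∣)
  open import Data.Integer.Base using (ℤ; +_; -_; _+_; _*_; _-_; _^_; 0ℤ; 1ℤ)
  import Data.Integer.Properties as ℤₚ
  open import Data.Integer.Tactic.RingSolver using (solve-∀)
  open import Data.List.Base using (List; []; _∷_; _++_; map; concatMap; filter; length; cartesianProductWith; applyUpTo; upTo)
  open import Data.List.Membership.Propositional using (_∈_)
  open import Data.List.Relation.Unary.All as All using (All; []; _∷_)
  open import Data.List.Relation.Unary.Any using (here; there)
  open import Data.List.Relation.Unary.AllPairs using ([]; _∷_)
  open import Data.List.Relation.Unary.Unique.Propositional using (Unique)
  open import Data.Nat.Base using (ℕ; zero; suc)
  import Data.Nat.Base as ℕ
  open import Data.Product.Base using (_×_; _,_)
  open import Data.Vec.Base using ([]; _∷_)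
  open import Function.Base using (_∘_)
  open import Relation.Binary.PropositionalEquality
  open import Relation.Nullary using (¬_; Dec; yes; no; does; contradiction)
  open import Relation.Unary using (Decidable)
  open import Defs using (∑ˡ; alternatingSum)

  Σˡ : ∀ {A : Set} → (A → ℤ) → List A → ℤ
  Σˡ f xs = ∑ˡ (map f xs)

  indℤ : ∀ {P : Set} → Dec P → ℤ
  indℤ d = if does d then 1ℤ else 0ℤ

  indℤ-yes : ∀ {P : Set} (d : Dec P) → P → indℤ d ≡ 1ℤ
  indℤ-yes (yes _) _ = refl
  indℤ-yes (no ¬p) p = contradiction p ¬p

  indℤ-no : ∀ {P : Set} (d : Dec P) → ¬ P → indℤ d ≡ 0ℤ
  indℤ-no (yes p) ¬p = contradiction p ¬p
  indℤ-no (no _)  _  = refl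

  sgn : ℕ → ℤ
  sgn zero    = 1ℤ
  sgn (suc n) = - sgn n

  sgn-+ : ∀ m n → sgn (m ℕ.+ n) ≡ sgn m * sgn n
  sgn-+ zero    n = sym (ℤₚ.*-identityˡ _)
  sgn-+ (suc m) n = trans (cong -_ (sgn-+ m n)) (ℤₚ.neg-distribˡ-* (sgn m) (sgn n))

  private
    interchange : ∀ (a b c d : ℤ) → (a + b) + (c + d) ≡ (a + c) + (b + d)
    interchange = solve-∀

    minus-interchange : ∀ (a b c d : ℤ) → (a - b) + (c - d) ≡ (a + c) - (b + d)
    minus-interchange = solve-∀

  module _ {A : Set} where

    Σˡ-cong : ∀ {f g : A → ℤ} → (∀ x → f x ≡ g x) → ∀ xs → Σˡ f xs ≡ Σˡ g xs
    Σˡ-cong eq []       = refl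
    Σˡ-cong eq (x ∷ xs) = cong₂ _+_ (eq x) (Σˡ-cong eq xs)

    Σˡ-0 : ∀ {f : A → ℤ} xs → (∀ x → f x ≡ 0ℤ) → Σˡ f xs ≡ 0ℤ
    Σˡ-0 []       eq = refl
    Σˡ-0 (x ∷ xs) eq = cong₂ _+_ (eq x) (Σˡ-0 xs eq)

    Σˡ-+ : ∀ (f g : A → ℤ) xs → Σˡ (λ x → f x + g x) xs ≡ Σˡ f xs + Σˡ g xs
    Σˡ-+ f g []       = refl
    Σˡ-+ f g (x ∷ xs) = trans (cong (_+_ (f x + g x)) (Σˡ-+ f g xs)) (interchange (f x) (g x) _ _)

    Σˡ-minus : ∀ (f g : A → ℤ) xs → Σˡ (λ x → f x - g x) xs ≡ Σˡ f xs - Σˡ g xs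
    Σˡ-minus f g []       = refl
    Σˡ-minus f g (x ∷ xs) = trans (cong (_+_ (f x - g x)) (Σˡ-minus f g xs)) (minus-interchange (f x) (g x) _ _)

    Σˡ-*ˡ : ∀ c (f : A → ℤ) xs → Σˡ (λ x → c * f x) xs ≡ c * Σˡ f xs
    Σˡ-*ˡ c f []       = sym (ℤₚ.*-zeroʳ c)
    Σˡ-*ˡ c f (x ∷ xs) = trans (cong (_+_ (c * f x)) (Σˡ-*ˡ c f xs)) (sym (ℤₚ.*-distribˡ-+ c (f x) _))

    Σˡ-*ʳ : ∀ (f : A → ℤ) c xs → Σˡ (λ x → f x * c) xs ≡ Σˡ f xs * c
    Σˡ-*ʳ f c xs = trans (Σˡ-cong (λ x → ℤₚ.*-comm (f x) c) xs) (trans (Σˡ-*ˡ c f xs) (ℤₚ.*-comm c _))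

    Σˡ-++ : ∀ (f : A → ℤ) xs ys → Σˡ f (xs ++ ys) ≡ Σˡ f xs + Σˡ f ys
    Σˡ-++ f []       ys = sym (ℤₚ.+-identityˡ _)
    Σˡ-++ f (x ∷ xs) ys = trans (cong (_+_ (f x)) (Σˡ-++ f xs ys)) (sym (ℤₚ.+-assoc (f x) _ _))

    Σˡ-const : ∀ c (xs : List A) → Σˡ (λ _ → c) xs ≡ + length xs * c
    Σˡ-const c []       = sym (ℤₚ.*-zeroˡ c)
    Σˡ-const c (x ∷ xs) = trans (cong (_+_ c) (Σˡ-const c xs)) (sym (ℤₚ.suc-* (+ length xs) c))

    Σˡ-filter : ∀ {P : A → Set} (P? : Decidable P) xs → + length (filter P? xs) ≡ Σˡ (λ x → indℤ (P? x)) xs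
    Σˡ-filter P? []       = refl
    Σˡ-filter P? (x ∷ xs) with P? x
    ... | yes _ = cong (_+_ 1ℤ) (Σˡ-filter P? xs)
    ... | no _  = trans (Σˡ-filter P? xs) (sym (ℤₚ.+-identityˡ _))

    Σˡ-single : ∀ {f : A → ℤ} {xs} → Unique xs → ∀ {x} → x ∈ xs → (∀ y → y ≢ x → f y ≡ 0ℤ) → Σˡ f xs ≡ f x
    Σˡ-single {f} (x∉ ∷ _) (here {xs = xs} refl) eq = trans (cong (_+_ (f _)) (zeros xs x∉)) (ℤₚ.+-identityʳ _)
      where
      zeros : ∀ ys → All (_ ≢_) ys → Σˡ f ys ≡ 0ℤ
      zeros []       []        = refl
      zeros (y ∷ ys) (≢ ∷ ≢s) = cong₂ _+_ (eq y (≢ ∘ sym)) (zeros ys ≢s)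
    Σˡ-single (y∉ ∷ xs!) (there x∈) eq = trans
      (cong₂ _+_ (eq _ (All.lookup y∉ x∈)) (Σˡ-single xs! x∈ eq)) (ℤₚ.+-identityˡ _)

  module _ {A B : Set} where

    Σˡ-map : ∀ (f : B → ℤ) (g : A → B) xs → Σˡ f (map g xs) ≡ Σˡ (f ∘ g) xs
    Σˡ-map f g []       = refl
    Σˡ-map f g (x ∷ xs) = cong (_+_ (f (g x))) (Σˡ-map f g xs)

    Σˡ-concatMap : ∀ (f : B → ℤ) (g : A → List B) xs → Σˡ f (concatMap g xs) ≡ Σˡ (λ x → Σˡ f (g x)) xs
    Σˡ-concatMap f g []       = refl
    Σˡ-concatMap f g (x ∷ xs) = trans (Σˡ-++ f (g x) (concatMap g xs)) (cong (_+_ (Σˡ f (g x))) (Σˡ-concatMap f g xs))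

    Σˡ-comm : ∀ (f : A → B → ℤ) xs ys → Σˡ (λ x → Σˡ (f x) ys) xs ≡ Σˡ (λ y → Σˡ (λ x → f x y) xs) ys
    Σˡ-comm f []       ys = sym (Σˡ-0 ys λ _ → refl)
    Σˡ-comm f (x ∷ xs) ys = trans (cong (_+_ (Σˡ (f x) ys)) (Σˡ-comm f xs ys)) (sym (Σˡ-+ (f x) _ ys))

  Σˡ-cartesian : ∀ {A B C : Set} (f : C → ℤ) (g : A → B → C) xs ys →
                 Σˡ f (cartesianProductWith g xs ys) ≡ Σˡ (λ x → Σˡ (λ y → f (g x y)) ys) xs
  Σˡ-cartesian f g []       ys = refl
  Σˡ-cartesian f g (x ∷ xs) ys = trans (Σˡ-++ f (map (g x) ys) _)
    (cong₂ _+_ (Σˡ-map f (g x) ys) (Σˡ-cartesian f g xs ys))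

  sumℕ : ℕ → (ℕ → ℤ) → ℤ
  sumℕ zero    f = 0ℤ
  sumℕ (suc n) f = f 0 + sumℕ n (f ∘ suc)

  Σˡ-applyUpTo : ∀ (f : ℕ → ℤ) g n → Σˡ f (applyUpTo g n) ≡ sumℕ n (f ∘ g)
  Σˡ-applyUpTo f g zero    = refl
  Σˡ-applyUpTo f g (suc n) = cong (_+_ (f (g 0))) (Σˡ-applyUpTo f (g ∘ suc) n)

  -- Each inner b occurs twice with opposite signs. Applied to boundary ranks, this is why they
  -- cancel in an Euler characteristic.
  telescope : ∀ n (b : ℕ → ℤ) → sumℕ n (λ i → sgn i * (b i + b (suc i))) ≡ b 0 - sgn n * b n
  telescope zero    b = base (b 0)
    where
    base : ∀ x → 0ℤ ≡ x - 1ℤ * x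
    base = solve-∀
  telescope (suc n) b = trans (cong (_+_ (1ℤ * (b 0 + b 1))) (trans (negated n (λ i → b (suc i)))
      (cong -_ (telescope n (b ∘ suc))))) (step (b 0) (b 1) (sgn n) (b (suc n)))
    where
    step : ∀ x y s z → 1ℤ * (x + y) + - (y - s * z) ≡ x - (- s) * z
    step = solve-∀
    pull : ∀ s x y → (- s) * x + (- y) ≡ - (s * x + y)
    pull = solve-∀
    negated′ : ∀ (s b : ℕ → ℤ) n → sumℕ n (λ i → (- s i) * b i) ≡ - sumℕ n (λ i → s i * b i)
    negated′ s b zero    = refl
    negated′ s b (suc n) = trans (cong (_+_ ((- s 0) * b 0)) (negated′ (s ∘ suc) (b ∘ suc) n)) (pull (s 0) (b 0) _)
    negated : ∀ n (b : ℕ → ℤ) → sumℕ n (λ i → sgn (suc i) * (b i + b (suc i))) ≡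
                                - sumℕ n (λ i → sgn i * (b i + b (suc i)))
    negated n b = negated′ sgn (λ i → b i + b (suc i)) n

  alternatingSum-cong : ∀ {ℓ} {f g : Subset ℓ → ℤ} → (∀ α → f α ≡ g α) → alternatingSum f ≡ alternatingSum g
  alternatingSum-cong {zero}  eq = eq []
  alternatingSum-cong {suc ℓ} eq = cong₂ _-_ (alternatingSum-cong (λ α → eq (false ∷ α)))
    (alternatingSum-cong (λ α → eq (true ∷ α)))

  alternatingSum-+ : ∀ {ℓ} (f g : Subset ℓ → ℤ) →
                     alternatingSum (λ α → f α + g α) ≡ alternatingSum f + alternatingSum g
  alternatingSum-+ {zero}  f g = refl
  alternatingSum-+ {suc ℓ} f g = trans
    (cong₂ _-_ (alternatingSum-+ (λ α → f (false ∷ α)) (λ α → g (false ∷ α)))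
               (alternatingSum-+ (λ α → f (true ∷ α)) (λ α → g (true ∷ α))))
    (sym (minus-interchange (alternatingSum (λ α → f (false ∷ α))) _ _ _))

  alternatingSum-Σˡ : ∀ {A : Set} {ℓ} (f : A → Subset ℓ → ℤ) xs →
                      alternatingSum (λ α → Σˡ (λ x → f x α) xs) ≡ Σˡ (λ x → alternatingSum (f x)) xs
  alternatingSum-Σˡ {ℓ = ℓ} f [] = zeros ℓ
    where
    zeros : ∀ ℓ → alternatingSum {ℓ} (λ _ → 0ℤ) ≡ 0ℤ
    zeros zero    = refl
    zeros (suc ℓ) = cong₂ _-_ (zeros ℓ) (zeros ℓ)
  alternatingSum-Σˡ f (x ∷ xs) = trans (alternatingSum-+ (f x) _)
    (cong (_+_ (alternatingSum (f x))) (alternatingSum-Σˡ f xs))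

  alternatingSum-*ˡ : ∀ {ℓ} c (f : Subset ℓ → ℤ) → alternatingSum (λ α → c * f α) ≡ c * alternatingSum f
  alternatingSum-*ˡ {zero}  c f = refl
  alternatingSum-*ˡ {suc ℓ} c f = trans
    (cong₂ _-_ (alternatingSum-*ˡ c (λ α → f (false ∷ α))) (alternatingSum-*ˡ c (λ α → f (true ∷ α))))
    (factor c (alternatingSum (λ α → f (false ∷ α))) (alternatingSum (λ α → f (true ∷ α))))
    where
    factor : ∀ c x y → c * x - c * y ≡ c * (x - y)
    factor = solve-∀

-- The Euler characteristic of the complex as a bracket.

module Euler where

  open import Algebra.Bundles using (CommutativeRing)
  open import Data.Bool.Base using (Bool; true; false; if_then_else_)
  open import Data.Fin.Base using (Fin; zero; suc; toℕ; fromℕ<)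
  open import Data.Fin.Patterns using (0F; 1F; 2F)
  open import Data.Fin.Properties using (toℕ-fromℕ<; toℕ-injective)
  open import Data.Fin.Subset using (Subset; ∣_∣)
  open import Data.Fin.Subset.Properties using (∣p∣≤n)
  open import Data.Integer.Base using (ℤ; +_; -_; _+_; _*_; _-_; _^_; 0ℤ; 1ℤ)
  import Data.Integer.Properties as ℤₚ
  open import Data.Integer.Tactic.RingSolver using (solve-∀)
  open import Data.List.Base using (List; []; _∷_; _++_; map; concatMap; upTo; allFin; cartesianProduct; length)
  open import Data.List.Membership.Propositional.Properties using (∈-upTo⁺; ∈-allFin)
  open import Data.List.Properties using (length-tabulate; map-id)
  import Data.List.Relation.Unary.Unique.Propositional.Properties as Uniqueₚ
  open import Data.Nat.Base using (ℕ; zero; suc; NonZero; _%_; _≡ᵇ_)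
  import Data.Nat.Base as ℕ
  open import Data.Nat.DivMod using (m%n<n)
  import Data.Nat.Properties as ℕₚ
  open import Data.Product.Base using (Σ-syntax; _×_; _,_; proj₁; proj₂)
  open import Data.Vec.Base using (Vec; []; _∷_)
  import Data.Vec.Base as Vec
  open import Function.Base using (_∘_)
  open import Level using (0ℓ)
  open import Relation.Binary.PropositionalEquality
  open import Relation.Nullary using (¬_; Dec; yes; no; does; contradiction)
  open ListSum
  open LinAlg
  open HomRanks

  parity-split : ∀ k (r : ℤ) → (if k % 2 ≡ᵇ 0 then r else 0ℤ) - (if k % 2 ≡ᵇ 1 then r else 0ℤ) ≡ sgn k * r
  parity-split 0 r = trans (ℤₚ.+-identityʳ r) (sym (ℤₚ.*-identityˡ r))
  parity-split 1 r = trans (ℤₚ.+-identityˡ (- r)) (sym (ℤₚ.-1*i≡-i r))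
  parity-split (suc (suc k)) r = trans (parity-split k r) (cong (_* r) (sym (ℤₚ.neg-involutive (sgn k))))

  sgn-%2 : ∀ k → sgn (k % 2) ≡ sgn k
  sgn-%2 0 = refl
  sgn-%2 1 = refl
  sgn-%2 (suc (suc k)) = trans (sgn-%2 k) (sym (ℤₚ.neg-involutive (sgn k)))

  Σˡ-subsets : ∀ ℓ (F : Subset ℓ → ℤ) → Σˡ (λ α → sgn ∣ α ∣ * F α) (subsets ℓ) ≡ alternatingSum F
  Σˡ-subsets zero    F = trans (ℤₚ.+-identityʳ _) (ℤₚ.*-identityˡ (F []))
  Σˡ-subsets (suc ℓ) F = begin
    Σˡ G (map (false ∷_) (subsets ℓ) ++ map (true ∷_) (subsets ℓ))
      ≡⟨ Σˡ-++ G (map (false ∷_) (subsets ℓ)) _ ⟩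
    Σˡ G (map (false ∷_) (subsets ℓ)) + Σˡ G (map (true ∷_) (subsets ℓ))
      ≡⟨ cong₂ _+_ (Σˡ-map G (false ∷_) (subsets ℓ)) (Σˡ-map G (true ∷_) (subsets ℓ)) ⟩
    Σˡ (λ α → sgn ∣ α ∣ * F (false ∷ α)) (subsets ℓ) + Σˡ (λ α → - sgn ∣ α ∣ * F (true ∷ α)) (subsets ℓ)
      ≡⟨ cong₂ _+_ (Σˡ-subsets ℓ (F ∘ (false ∷_))) (trans
           (Σˡ-cong (λ α → trans (sym (ℤₚ.neg-distribˡ-* (sgn ∣ α ∣) _)) (sym (ℤₚ.-1*i≡-i _))) (subsets ℓ))
           (trans (Σˡ-*ˡ (- 1ℤ) (λ α → sgn ∣ α ∣ * F (true ∷ α)) (subsets ℓ)) (trans (ℤₚ.-1*i≡-i _)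
             (cong -_ (Σˡ-subsets ℓ (F ∘ (true ∷_))))))) ⟩
    alternatingSum F ∎
    where
    open ≡-Reasoning
    G : Subset (suc ℓ) → ℤ
    G α = sgn ∣ α ∣ * F α

  module EulerCharacteristic (R : CommutativeRing 0ℓ 0ℓ) (isDomain : IsDecidableDomain R)
    (c : CommutativeRing.Carrier R) (n : ℕ) .{{_ : NonZero n}} (Γ : TrivalentPMGraph)
    (∂-homogeneous : Degree-preserving R c n Γ) (∂∂≈0 : Square-zero R c n Γ) where

    open MöbiusOver R c n
    open Complex Γ
    open TrivalentPMGraph Γ using (#M; State; #circles)
    open HomologyRanks R isDomain c n Γ ∂-homogeneous ∂∂≈0
    open ≡-Reasoning

    Labelled : Set
    Labelled = Σ[ α ∈ State ] Labelling (#circles α)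

    degree₁ degree₂ : ∀ {k} → Labelling k → ℕ
    degree₁ L = Vec.sum (Vec.map (λ (i , j) → 2 ℕ.* toℕ i ℕ.+ toℕ j) L)
    degree₂ L = Vec.sum (Vec.map (λ (i , j) → toℕ j) L)

    sign : Labelled → ℤ
    sign (α , L) = sgn ∣ α ∣ * sgn (degree₂ L)

    -- For each power of x, the degrees 0, 1 and 2 in y contribute 1 - 1 + 1 = 1. So the signed
    -- dimension of V is n, the value of one circle.
    Σˡ-monomials : Σˡ (λ (i , j) → sgn (toℕ j)) monomials ≡ + n
    Σˡ-monomials = begin
      Σˡ (λ (i , j) → sgn (toℕ j)) monomials
        ≡⟨ Σˡ-cartesian (λ (i , j) → sgn (toℕ j)) _,_ (allFin n) (allFin 3) ⟩
      Σˡ (λ _ → 1ℤ) (allFin n)      ≡⟨ Σˡ-const 1ℤ (allFin n) ⟩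
      + length (allFin n) * 1ℤ      ≡⟨ ℤₚ.*-identityʳ _ ⟩
      + length (allFin n)           ≡⟨ cong +_ (length-tabulate {n = n} (λ i → i)) ⟩
      + n ∎

    Σˡ-labellings : ∀ k → Σˡ (λ L → sgn (degree₂ L)) (vectors monomials k) ≡ (+ n) ^ k
    Σˡ-labellings zero    = refl
    Σˡ-labellings (suc k) = begin
      Σˡ (λ L → sgn (degree₂ L)) (vectors monomials (suc k))
        ≡⟨ Σˡ-cartesian (λ L → sgn (degree₂ L)) _∷_ monomials (vectors monomials k) ⟩
      Σˡ (λ m → Σˡ (λ L → sgn (toℕ (proj₂ m) ℕ.+ degree₂ L)) (vectors monomials k)) monomials
        ≡⟨ Σˡ-cong (λ m → trans (Σˡ-cong (λ L → sgn-+ (toℕ (proj₂ m)) (degree₂ L)) (vectors monomials k))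
             (trans (Σˡ-*ˡ (sgn (toℕ (proj₂ m))) (λ L → sgn (degree₂ L)) (vectors monomials k))
               (cong (sgn (toℕ (proj₂ m)) *_) (Σˡ-labellings k)))) monomials ⟩
      Σˡ (λ m → sgn (toℕ (proj₂ m)) * (+ n) ^ k) monomials
        ≡⟨ Σˡ-*ʳ (λ m → sgn (toℕ (proj₂ m))) ((+ n) ^ k) monomials ⟩
      Σˡ (λ m → sgn (toℕ (proj₂ m))) monomials * (+ n) ^ k
        ≡⟨ cong (_* (+ n) ^ k) Σˡ-monomials ⟩
      + n * (+ n) ^ k ∎

    Σˡ-sign : Σˡ sign labelledStates ≡ bracket (+ n) Γ
    Σˡ-sign = begin
      Σˡ sign labelledStates
        ≡⟨ Σˡ-concatMap sign (λ α → map (α ,_) (vectors monomials (#circles α))) (subsets #M) ⟩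
      Σˡ (λ α → Σˡ sign (map (α ,_) (vectors monomials (#circles α)))) (subsets #M)
        ≡⟨ Σˡ-cong (λ α → trans (Σˡ-map sign (α ,_) (vectors monomials (#circles α)))
             (trans (Σˡ-*ˡ (sgn ∣ α ∣) (λ L → sgn (degree₂ L)) (vectors monomials (#circles α)))
               (cong (sgn ∣ α ∣ *_) (Σˡ-labellings (#circles α))))) (subsets #M) ⟩
      Σˡ (λ α → sgn ∣ α ∣ * (+ n) ^ #circles α) (subsets #M)
        ≡⟨ Σˡ-subsets #M (λ α → (+ n) ^ #circles α) ⟩
      bracket (+ n) Γ ∎

    -- Every labelled state has exactly one trigrading.
    Σˡ-degrees : ∀ s → Σˡ (λ a → Σˡ (λ ε → Σˡ (λ i → sgn (i ℕ.+ toℕ ε) * indℤ (inDegree? a ε i s))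
                   (upTo (suc #M))) (allFin 2)) (allFin n) ≡ sign s
    Σˡ-degrees s@(α , L) = begin
      _ ≡⟨ Σˡ-single (Uniqueₚ.allFin⁺ n) (∈-allFin a₀) (λ a a≢ → Σˡ-0 (allFin 2) λ ε → Σˡ-0 (upTo (suc #M)) λ i →
             off (i ℕ.+ toℕ ε) (inDegree? a ε i s) λ (_ , d , _) → a≢ (toℕ-injective (trans (sym d) (sym (toℕ-fromℕ< _))))) ⟩
      _ ≡⟨ Σˡ-single (Uniqueₚ.allFin⁺ 2) (∈-allFin ε₀) (λ ε ε≢ → Σˡ-0 (upTo (suc #M)) λ i →
             off (i ℕ.+ toℕ ε) (inDegree? a₀ ε i s) λ (_ , _ , d) → ε≢ (toℕ-injective (trans (sym d) (sym (toℕ-fromℕ< _))))) ⟩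
      _ ≡⟨ Σˡ-single (Uniqueₚ.upTo⁺ (suc #M)) (∈-upTo⁺ (ℕ.s≤s (∣p∣≤n α))) (λ i i≢ →
             off (i ℕ.+ toℕ ε₀) (inDegree? a₀ ε₀ i s) λ (p , _) → i≢ (sym p)) ⟩
      sgn (∣ α ∣ ℕ.+ toℕ ε₀) * indℤ (inDegree? a₀ ε₀ ∣ α ∣ s)
        ≡⟨ trans (cong (sgn (∣ α ∣ ℕ.+ toℕ ε₀) *_) (indℤ-yes (inDegree? a₀ ε₀ ∣ α ∣ s)
             (refl , sym (toℕ-fromℕ< _) , sym (toℕ-fromℕ< _)))) (ℤₚ.*-identityʳ _) ⟩
      sgn (∣ α ∣ ℕ.+ toℕ ε₀)        ≡⟨ sgn-+ ∣ α ∣ (toℕ ε₀) ⟩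
      sgn ∣ α ∣ * sgn (toℕ ε₀)
        ≡⟨ cong (sgn ∣ α ∣ *_) (trans (cong sgn (toℕ-fromℕ< (m%n<n (degree₂ L) 2))) (sgn-%2 (degree₂ L))) ⟩
      sign s ∎
      where
      a₀ : Fin n
      a₀ = fromℕ< (m%n<n (degree₁ L) n)
      ε₀ : Fin 2
      ε₀ = fromℕ< (m%n<n (degree₂ L) 2)
      off : ∀ k {P : Set} (d : Dec P) → ¬ P → sgn k * indℤ d ≡ 0ℤ
      off k d ¬p = trans (cong (sgn k *_) (indℤ-no d ¬p)) (ℤₚ.*-zeroʳ (sgn k))

    module _ (ρ : Ranks) where
      open Ranks ρ using (rank)

      private
        is : List ℕ
        is = upTo (suc #M)

      -- By `ranks-dimension`, ranks and dimensions differ by adjacent boundary ranks; these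
      -- telescope to the two extreme ones, both of which are 0.
      alternating-rank : ∀ a ε → Σˡ (λ i → sgn i * + rank i a ε) is ≡ Σˡ (λ i → sgn i * + dimension a ε i) is
      alternating-rank a ε = begin
        Σˡ (λ i → sgn i * + rank i a ε) is
          ≡⟨ Σˡ-cong (λ i → trans (expand (sgn i) (+ rank i a ε) (+ b i) (+ b (suc i)))
               (cong (λ z → sgn i * z - sgn i * (+ b i + + b (suc i))) (cong +_ (ranks-dimension ρ i a ε)))) is ⟩
        Σˡ (λ i → sgn i * + dimension a ε i - sgn i * (+ b i + + b (suc i))) is
          ≡⟨ Σˡ-minus (λ i → sgn i * + dimension a ε i) (λ i → sgn i * (+ b i + + b (suc i))) is ⟩
        Σˡ (λ i → sgn i * + dimension a ε i) is - Σˡ (λ i → sgn i * (+ b i + + b (suc i))) is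
          ≡⟨ cong (λ z → Σˡ (λ i → sgn i * + dimension a ε i) is - z)
               (trans (Σˡ-applyUpTo (λ i → sgn i * (+ b i + + b (suc i))) (λ i → i) (suc #M))
                 (trans (telescope (suc #M) (λ i → + b i))
                   (trans (cong (λ z → 0ℤ - sgn (suc #M) * z) (cong +_ (boundaryRank-top a ε)))
                     (cong (λ z → 0ℤ - z) (ℤₚ.*-zeroʳ (sgn (suc #M))))))) ⟩
        Σˡ (λ i → sgn i * + dimension a ε i) is - 0ℤ  ≡⟨ ℤₚ.+-identityʳ _ ⟩
        Σˡ (λ i → sgn i * + dimension a ε i) is ∎
        where
        b = boundaryRank a ε
        expand : ∀ s x y z → s * x ≡ s * (x + (y + z)) - s * (y + z)
        expand = solve-∀

      Q-difference : ∀ a → Q⁺ ρ a - Q⁻ ρ a ≡ Σˡ (λ ε → Σˡ (λ i → sgn (i ℕ.+ toℕ ε) * + rank i a ε) is) (allFin 2)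
      Q-difference a = begin
        Q⁺ ρ a - Q⁻ ρ a
          ≡⟨ cong₂ _-_ (nested 0) (nested 1) ⟩
        Σˡ (λ i → Σˡ (term 0 i) (allFin 2)) is - Σˡ (λ i → Σˡ (term 1 i) (allFin 2)) is
          ≡⟨ Σˡ-minus (λ i → Σˡ (term 0 i) (allFin 2)) (λ i → Σˡ (term 1 i) (allFin 2)) is ⟨
        Σˡ (λ i → Σˡ (term 0 i) (allFin 2) - Σˡ (term 1 i) (allFin 2)) is
          ≡⟨ Σˡ-cong (λ i → trans (sym (Σˡ-minus (term 0 i) (term 1 i) (allFin 2)))
               (Σˡ-cong (λ ε → parity-split (i ℕ.+ toℕ ε) (+ rank i a ε)) (allFin 2))) is ⟩
        Σˡ (λ i → Σˡ (λ ε → sgn (i ℕ.+ toℕ ε) * + rank i a ε) (allFin 2)) is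
          ≡⟨ Σˡ-comm (λ i ε → sgn (i ℕ.+ toℕ ε) * + rank i a ε) is (allFin 2) ⟩
        Σˡ (λ ε → Σˡ (λ i → sgn (i ℕ.+ toℕ ε) * + rank i a ε) is) (allFin 2) ∎
        where
        term : ℕ → ℕ → Fin 2 → ℤ
        term s i ε = if (i ℕ.+ toℕ ε) % 2 ≡ᵇ s then + rank i a ε else + 0

        nested : ∀ s → signedPart ρ s a ≡ Σˡ (λ i → Σˡ (term s i) (allFin 2)) is
        nested s = go is
          where
          go : ∀ is → ∑ˡ (concatMap (λ i → map (term s i) (allFin 2)) is) ≡ Σˡ (λ i → Σˡ (term s i) (allFin 2)) is
          go is = trans (cong ∑ˡ (sym (map-id (concatMap (λ i → map (term s i) (allFin 2)) is))))
            (trans (Σˡ-concatMap (λ x → x) (λ i → map (term s i) (allFin 2)) is)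
              (Σˡ-cong (λ i → trans (cong ∑ˡ (map-id (map (term s i) (allFin 2)))) refl) is))

      -- Replace ranks by dimensions, then sum over all labelled states, each of which has exactly
      -- one tridegree. A state with k circles contributes n to the power k with the sign of its
      -- number of ones.
      euler-characteristic : evalAt1 (Q⁺ ρ ⊖ Q⁻ ρ) ≡ bracket (+ n) Γ
      euler-characteristic = begin
        Σˡ (λ a → Q⁺ ρ a - Q⁻ ρ a) (allFin n)
          ≡⟨ Σˡ-cong (λ a → trans (Q-difference a) (Σˡ-cong (λ ε → ranks⇒dimensions a ε) (allFin 2))) (allFin n) ⟩
        Σˡ (λ a → Σˡ (λ ε → Σˡ (λ i → Σˡ (λ s → F a ε i s) labelledStates) is) (allFin 2)) (allFin n)
          ≡⟨ Σˡ-cong (λ a → trans (Σˡ-cong (λ ε → Σˡ-comm (F a ε) is labelledStates) (allFin 2))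
               (Σˡ-comm (λ ε s → Σˡ (λ i → F a ε i s) is) (allFin 2) labelledStates)) (allFin n) ⟩
        Σˡ (λ a → Σˡ (λ s → Σˡ (λ ε → Σˡ (λ i → F a ε i s) is) (allFin 2)) labelledStates) (allFin n)
          ≡⟨ Σˡ-comm (λ a s → Σˡ (λ ε → Σˡ (λ i → F a ε i s) is) (allFin 2)) (allFin n) labelledStates ⟩
        Σˡ (λ s → Σˡ (λ a → Σˡ (λ ε → Σˡ (λ i → F a ε i s) is) (allFin 2)) (allFin n)) labelledStates
          ≡⟨ Σˡ-cong Σˡ-degrees labelledStates ⟩
        Σˡ sign labelledStates  ≡⟨ Σˡ-sign ⟩
        bracket (+ n) Γ ∎
        where
        F : Fin n → Fin 2 → ℕ → Labelled → ℤ
        F a ε i s = sgn (i ℕ.+ toℕ ε) * indℤ (inDegree? a ε i s)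

        shift : ∀ (f : ℕ → ℤ) ε → Σˡ (λ i → sgn (i ℕ.+ ε) * f i) is ≡ sgn ε * Σˡ (λ i → sgn i * f i) is
        shift f ε = trans (Σˡ-cong (λ i → trans (cong (_* f i) (sgn-+ i ε)) (swap (sgn i) (sgn ε) (f i))) is)
          (Σˡ-*ˡ (sgn ε) (λ i → sgn i * f i) is)
          where
          swap : ∀ x y z → (x * y) * z ≡ y * (x * z)
          swap = solve-∀

        ranks⇒dimensions : ∀ a ε → Σˡ (λ i → sgn (i ℕ.+ toℕ ε) * + rank i a ε) is ≡
                                   Σˡ (λ i → Σˡ (λ s → F a ε i s) labelledStates) is
        ranks⇒dimensions a ε = begin
          Σˡ (λ i → sgn (i ℕ.+ toℕ ε) * + rank i a ε) is       ≡⟨ shift (λ i → + rank i a ε) (toℕ ε) ⟩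
          sgn (toℕ ε) * Σˡ (λ i → sgn i * + rank i a ε) is     ≡⟨ cong (sgn (toℕ ε) *_) (alternating-rank a ε) ⟩
          sgn (toℕ ε) * Σˡ (λ i → sgn i * + dimension a ε i) is  ≡⟨ shift (λ i → + dimension a ε i) (toℕ ε) ⟨
          Σˡ (λ i → sgn (i ℕ.+ toℕ ε) * + dimension a ε i) is
            ≡⟨ Σˡ-cong (λ i → trans (cong (sgn (i ℕ.+ toℕ ε) *_) (Σˡ-filter (inDegree? a ε i) labelledStates))
                 (sym (Σˡ-*ˡ (sgn (i ℕ.+ toℕ ε)) (λ s → indℤ (inDegree? a ε i s)) labelledStates))) is ⟩
          Σˡ (λ i → Σˡ (λ s → F a ε i s) labelledStates) is ∎

-- Cycles modulo 2 in a connected plane ribbon graph.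

module Surface where

  open import Algebra.Bundles using (CommutativeRing; CommutativeMonoid)
  open import Data.Bool.Base using (Bool; true; false; not; _∧_; _xor_; if_then_else_)
  import Data.Bool.Properties as Boolₚ
  open import Data.Fin.Base using (Fin; zero; suc; _↑ˡ_; _↑ʳ_; combine; splitAt)
  open import Data.Fin.Properties using (_≟_)
  open import Data.List.Membership.Propositional using (_∈_)
  open import Data.List.Membership.Propositional.Properties using (∈-map⁺; ∈-allFin)
  open import Data.List.Relation.Unary.Any using (here)
  open import Data.Nat.Base using (ℕ; zero; suc; NonZero; s≤s)
  import Data.Nat.Base as ℕ
  import Data.Nat.Properties as ℕₚ
  open import Data.Nat.GeneralisedArithmetic using (fold)
  open import Data.Product.Base using (Σ-syntax; ∃; ∃-syntax; _×_; _,_; proj₁; proj₂)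
  open import Data.Sum.Base using (_⊎_; inj₁; inj₂)
  open import Data.Vec.Functional using (Vector; _∷_; _++_)
  open import Function.Base using (_∘_)
  open import Function.Bundles using (_↔_; module Inverse)
  open import Function.Construct.Composition using (_↔-∘_)
  open import Function.Construct.Symmetry using (↔-sym)
  open import Relation.Binary.Construct.Closure.ReflexiveTransitive using (Star; ε; _◅_)
  open import Relation.Binary.Construct.Closure.Symmetric using (fwd)
  open import Relation.Binary.PropositionalEquality
  open import Relation.Nullary using (¬_; Dec; yes; no; does; contradiction)
  open import Relation.Nullary.Decidable using (dec-true; dec-false)
  open LinAlg

  open Inverse using (to; from; strictlyInverseˡ; strictlyInverseʳ)

  ∧-cancel : ∀ {x y} → ¬ x ≡ false → x ∧ y ≡ false → y ≡ false
  ∧-cancel {false} x≢false _  = contradiction refl x≢false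
  ∧-cancel {true}  _       eq = eq

  xor-∧-isDomain : IsDecidableDomain Boolₚ.xor-∧-commutativeRing
  xor-∧-isDomain = record { _≈0? = Boolₚ._≟ false ; 1≉0 = λ () ; cancel = ∧-cancel }

  -- From here on `sum` is addition modulo 2 and `lc` is linear combination over the field with two
  -- elements.
  open IntegralDomain Boolₚ.xor-∧-commutativeRing xor-∧-isDomain public

  xor-self : ∀ x → x xor x ≡ false
  xor-self = Boolₚ.xor-same

  xor-≡ : ∀ {x y} → x xor y ≡ false → x ≡ y
  xor-≡ {false} {false} _ = refl
  xor-≡ {true}  {true}  _ = refl

  xor-interchange : ∀ a b c d → (a xor b) xor (c xor d) ≡ (a xor c) xor (b xor d)
  xor-interchange = interchange
    where open import Algebra.Properties.CommutativeSemigroup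
            (CommutativeMonoid.commutativeSemigroup (CommutativeRing.+-commutativeMonoid Boolₚ.xor-∧-commutativeRing))

  sum-combine : ∀ m {n} (f : Vector Bool (m ℕ.* n)) → sum f ≡ ∑[ i < m ] ∑[ j < n ] f (combine i j)
  sum-combine zero        f = refl
  sum-combine (suc m) {n} f = trans (sum-split n f) (cong (sum (λ j → f (j ↑ˡ (m ℕ.* n))) xor_)
    (sum-combine m (λ k → f (n ↑ʳ k))))

  module Graphs (G : Graph) where
    open Graph G

    edge : Fin #E → E
    edge = from (Finite.index finE)

    edgeIndex : E → Fin #E
    edgeIndex = to (Finite.index finE)

    edge-edgeIndex : ∀ e → edge (edgeIndex e) ≡ e
    edge-edgeIndex = strictlyInverseʳ (Finite.index finE)

    flip-flip : ∀ h → flip (flip h) ≡ h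
    flip-flip (e , false) = refl
    flip-flip (e , true)  = refl

    -- A sum over half-edges arranged edge by edge, which suits exchange of the ends of an edge;
    -- `sumᴴ-index` gives the plain enumeration, needed for the rotation.
    sumᴴ : (HalfEdge → Bool) → Bool
    sumᴴ F = ∑[ i < #E ] (F (edge i , false) xor F (edge i , true))

    sumᴴ-cong : ∀ {F F′ : HalfEdge → Bool} → (∀ h → F h ≡ F′ h) → sumᴴ F ≡ sumᴴ F′
    sumᴴ-cong eq = sum-cong-≗ {#E} λ i → cong₂ _xor_ (eq _) (eq _)

    sumᴴ-xor : ∀ F F′ → sumᴴ (λ h → F h xor F′ h) ≡ sumᴴ F xor sumᴴ F′
    sumᴴ-xor F F′ = trans (sum-cong-≗ {#E} λ i → xor-interchange (F (edge i , false)) _ _ _)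
      (∑-distrib-+ (λ i → F (edge i , false) xor F (edge i , true)) (λ i → F′ (edge i , false) xor F′ (edge i , true)))

    sumᴴ-∧ : ∀ c F → sumᴴ (λ h → c ∧ F h) ≡ c ∧ sumᴴ F
    sumᴴ-∧ c F = trans (sum-cong-≗ {#E} λ i → sym (Boolₚ.∧-distribˡ-xor c _ _))
      (sym (*-distribˡ-sum c (λ i → F (edge i , false) xor F (edge i , true))))

    sumᴴ-sum : ∀ {n} (F : Fin n → HalfEdge → Bool) → sumᴴ (λ h → ∑[ k < n ] F k h) ≡ ∑[ k < n ] sumᴴ (F k)
    sumᴴ-sum {n} F = trans
      (sum-cong-≗ {#E} λ i → sym (∑-distrib-+ (λ k → F k (edge i , false)) (λ k → F k (edge i , true))))
      (∑-comm (λ i k → F k (edge i , false) xor F k (edge i , true)))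

    sumᴴ-index : ∀ F → sumᴴ F ≡ ∑[ k < Finite.size finH ] F (from (Finite.index finH) k)
    sumᴴ-index F = sym (trans (sum-combine #E (λ k → F (from (Finite.index finH) k)))
      (sum-cong-≗ {#E} λ i → cong₂ _xor_ (cong F (half i false)) (trans (Boolₚ.xor-identityʳ _) (cong F (half i true)))))
      where
      bit : Bool → Fin 2
      bit false = zero
      bit true  = suc zero
      half : ∀ i b → from (Finite.index finH) (combine i (bit b)) ≡ (edge i , b)
      half i false = trans (cong (λ z → from (Finite.index finH) (combine z zero)) (sym (strictlyInverseˡ (Finite.index finE) i)))
        (strictlyInverseʳ (Finite.index finH) (edge i , false))
      half i true  = trans (cong (λ z → from (Finite.index finH) (combine z (suc zero))) (sym (strictlyInverseˡ (Finite.index finE) i)))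
        (strictlyInverseʳ (Finite.index finH) (edge i , true))

    sumᴴ-permute : ∀ F (π : HalfEdge ↔ HalfEdge) → sumᴴ F ≡ sumᴴ (F ∘ to π)
    sumᴴ-permute F π = trans (sumᴴ-index F) (trans (sum-permute (F ∘ from ix) (ix ↔-∘ (π ↔-∘ ↔-sym ix)))
      (trans (sum-cong-≗ {Finite.size finH} λ k → cong F (strictlyInverseʳ ix _)) (sym (sumᴴ-index (F ∘ to π)))))
      where ix = Finite.index finH

    sumᴴ-edge : ∀ (F : HalfEdge → Bool) (h : HalfEdge) → sumᴴ (λ h′ → F h′ ∧ δ (edgeIndex (proj₁ h′)) (edgeIndex (proj₁ h))) ≡ F h xor F (flip h)
    sumᴴ-edge F (e , b) = trans (sum-cong-≗ {#E} λ i → trans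
        (cong (λ z → (F (edge i , false) ∧ δ z (edgeIndex e)) xor (F (edge i , true) ∧ δ z (edgeIndex e)))
          (strictlyInverseˡ (Finite.index finE) i))
        (sym (Boolₚ.∧-distribʳ-xor (δ i (edgeIndex e)) (F (edge i , false)) (F (edge i , true)))))
      (trans (sum-δ (λ i → F (edge i , false) xor F (edge i , true)) (edgeIndex e))
        (trans (cong (λ e → F (e , false) xor F (e , true)) (edge-edgeIndex e)) (order b)))
      where
      order : ∀ b → F (e , false) xor F (e , true) ≡ F (e , b) xor F (e , not b)
      order false = refl
      order true  = Boolₚ.xor-comm (F (e , false)) _

    sumᴴ-symmetric : ∀ F → (∀ h → F (flip h) ≡ F h) → sumᴴ F ≡ false
    sumᴴ-symmetric F symm = trans (sum-cong-≗ {#E} {y = λ _ → false} λ i →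
      trans (cong (F (edge i , false) xor_) (symm (edge i , false))) (xor-self (F (edge i , false)))) (sum-replicate-zero #E)

  module Ribbon (Γ : RibbonGraph) where
    open RibbonGraph Γ
    open Graphs graph public

    next′ prev : HalfEdge → HalfEdge
    next′ = to next
    prev  = from next

    prev-end : ∀ h → end (prev h) ≡ end h
    prev-end h = trans (sym (next-end (prev h))) (cong end (strictlyInverseˡ next h))

    face-step : ∀ h → face h ≡ face (next′ (flip h))
    face-step h = Quotient.sound faces (fwd (subst (λ z → (z , next′ (flip z)) ∈ _) (strictlyInverseʳ (Finite.index finH) h)
      (∈-map⁺ (λ h → h , next′ (flip h)) (∈-map⁺ (from (Finite.index finH)) (∈-allFin (to (Finite.index finH) h))))) ◅ ε)

    -- The corner between h and the next half-edge lies in one face, which is on the other side of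
    -- h. A difference of face values across h is therefore a difference of consecutive corner
    -- values.
    face-flip : ∀ h → face (flip h) ≡ face (next′ h)
    face-flip h = trans (face-step (flip h)) (cong (face ∘ next′) (flip-flip h))

    vertexIndex : HalfEdge → Fin #V
    vertexIndex h = to (Finite.index finV) (end h)

    rotation-invariant : ∀ {A : Set} {k : HalfEdge → A} → (∀ h → k (next′ h) ≡ k h) → ∀ {h h′} → end h ≡ end h′ → k h ≡ k h′
    rotation-invariant {k = k} fixed {h} eq with cyclic eq
    ... | n , refl = go n
      where
      go : ∀ n → k h ≡ k (fold h next′ n)
      go zero    = refl
      go (suc n) = trans (go n) (sym (fixed (fold h next′ n)))

    connected-invariant : ∀ {A : Set} {k : HalfEdge → A} → Connected → (∀ h → k (next′ h) ≡ k h) →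
                          (∀ h → k (flip h) ≡ k h) → ∀ h h′ → k h ≡ k h′
    connected-invariant {k = k} conn fixed symm h h′ = go h (conn (end h) (end h′)) refl
      where
      go : ∀ {v} h → Star Adjacent v (end h′) → end h ≡ v → k h ≡ k h′
      go h ε                      eq = rotation-invariant fixed eq
      go h ((g , eq₁ , eq₂) ◅ path) eq =
        trans (rotation-invariant fixed (trans eq (sym eq₁))) (trans (sym (symm g)) (go (flip g) path eq₂))

    -- The boundary of the chain F at the vertices, paired with a function on them.
    coboundary-pairing : ∀ (c : HalfEdge → Bool) → (∀ h → c (next′ h) ≡ c h) → ∀ F →
                         sumᴴ (λ h → c h ∧ (F h xor F (prev h))) ≡ false
    coboundary-pairing c fixed F = begin
      sumᴴ (λ h → c h ∧ (F h xor F (prev h)))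
        ≡⟨ sumᴴ-cong (λ h → Boolₚ.∧-distribˡ-xor (c h) (F h) (F (prev h))) ⟩
      sumᴴ (λ h → (c h ∧ F h) xor (c h ∧ F (prev h)))
        ≡⟨ sumᴴ-xor (λ h → c h ∧ F h) (λ h → c h ∧ F (prev h)) ⟩
      sumᴴ (λ h → c h ∧ F h) xor sumᴴ (λ h → c h ∧ F (prev h))
        ≡⟨ cong (sumᴴ (λ h → c h ∧ F h) xor_) (trans (sumᴴ-permute (λ h → c h ∧ F (prev h)) next)
             (sumᴴ-cong λ h → cong₂ _∧_ (fixed h) (cong F (strictlyInverseʳ next h)))) ⟩
      sumᴴ (λ h → c h ∧ F h) xor sumᴴ (λ h → c h ∧ F h)
        ≡⟨ xor-self (sumᴴ (λ h → c h ∧ F h)) ⟩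
      false ∎
      where open ≡-Reasoning

    module _ (connected : Connected) (planar : Planar) (h₀ : HalfEdge) where

      private
        v₀ : Fin #V
        v₀ = vertexIndex h₀

        f₀ : Fin #F
        f₀ = face h₀

        chain : ∀ {v w} → Star Adjacent v w → HalfEdge → Bool
        chain ε               h = false
        chain ((g , _) ◅ path) h = δ (edgeIndex (proj₁ h)) (edgeIndex (proj₁ g)) xor chain path h

        path-to : (v : Fin #V) → Star Adjacent (end h₀) (from (Finite.index finV) v)
        path-to v = connected (end h₀) (from (Finite.index finV) v)

        at : Fin #V → HalfEdge → Bool
        at w h = δ (vertexIndex h) w

        at-next : ∀ w h → at w (next′ h) ≡ at w h
        at-next w h = cong (λ v → δ (to (Finite.index finV) v) w) (next-end h)

        ix : V → Fin #V
        ix = to (Finite.index finV)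

        -- Modulo 2, the boundary of a path consists of its two end points; the inner vertices
        -- cancel in pairs.
        chain-boundary : ∀ {u v} (path : Star Adjacent u v) w →
                         sumᴴ (λ h → at w h ∧ chain path h) ≡ δ (ix u) w xor δ (ix v) w
        chain-boundary {u} ε w = trans (sumᴴ-cong λ h → Boolₚ.∧-zeroʳ (at w h))
          (trans (sumᴴ-symmetric (λ _ → false) λ _ → refl) (sym (xor-self (δ (ix u) w))))
        chain-boundary {u} {v} ((g , refl , refl) ◅ path) w = begin
          sumᴴ (λ h → at w h ∧ (δ (edgeIndex (proj₁ h)) (edgeIndex (proj₁ g)) xor chain path h))
            ≡⟨ sumᴴ-cong (λ h → Boolₚ.∧-distribˡ-xor (at w h) (δ (edgeIndex (proj₁ h)) (edgeIndex (proj₁ g))) (chain path h)) ⟩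
          sumᴴ (λ h → (at w h ∧ δ (edgeIndex (proj₁ h)) (edgeIndex (proj₁ g))) xor (at w h ∧ chain path h))
            ≡⟨ sumᴴ-xor (λ h → at w h ∧ δ (edgeIndex (proj₁ h)) (edgeIndex (proj₁ g))) (λ h → at w h ∧ chain path h) ⟩
          sumᴴ (λ h → at w h ∧ δ (edgeIndex (proj₁ h)) (edgeIndex (proj₁ g))) xor sumᴴ (λ h → at w h ∧ chain path h)
            ≡⟨ cong₂ _xor_ (sumᴴ-edge (at w) g) (chain-boundary path w) ⟩
          (at w g xor at w (flip g)) xor (at w (flip g) xor δ (ix v) w)
            ≡⟨ Boolₚ.xor-assoc (at w g) _ _ ⟩
          at w g xor (at w (flip g) xor (at w (flip g) xor δ (ix v) w))
            ≡⟨ cong (at w g xor_) (trans (sym (Boolₚ.xor-assoc (at w (flip g)) _ _))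
                 (cong (_xor δ (ix v) w) (xor-self (at w (flip g))))) ⟩
          at w g xor δ (ix v) w ∎
          where open ≡-Reasoning

        -- Two extra coordinates kill the root face and the root vertex.
        faceVector : Fin #F → Vector Bool (2 ℕ.+ #E)
        faceVector f = δ f f₀ ∷ (false ∷ λ i → δ f (face (edge i , false)) xor δ f (face (edge i , true)))

        pathVector : Fin #V → Vector Bool (2 ℕ.+ #E)
        pathVector v = false ∷ (δ v v₀ ∷ λ i → chain (path-to v) (edge i , false))

        chain-edge : ∀ {u v} (path : Star Adjacent u v) e b → chain path (e , b) ≡ chain path (e , false)
        chain-edge ε               e b = refl
        chain-edge ((g , _) ◅ path) e b = cong (δ (edgeIndex e) (edgeIndex (proj₁ g)) xor_) (chain-edge path e b)

      -- In a plane graph every cycle modulo 2 is the boundary of a set of faces: the boundaries of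
      -- the faces, the paths from a root to the vertices and one more cycle are too many vectors.
      cycle-bounds : (f : HalfEdge → Bool) → (∀ h → f (flip h) xor f (prev (flip h)) ≡ f h xor f (prev h)) →
        Σ[ g ∈ (Fin #F → Bool) ] (∀ h → f h xor f (prev h) ≡ g (face h) xor g (face (flip h)))
      -- The family has 1 + #F + #V vectors in 2 + #E coordinates. By Euler's formula that is one
      -- too many, so it is dependent.
      cycle-bounds f symm = conclude (decide (cycleVector ∷ (faceVector ++ pathVector)))
        where
        open ≡-Reasoning

        ψ : HalfEdge → Bool
        ψ h = f h xor f (prev h)

        cycleVector : Vector Bool (2 ℕ.+ #E)
        cycleVector = false ∷ (false ∷ λ i → ψ (edge i , false))

        module _ (a : Vector Bool (suc (#F ℕ.+ #V))) (rel : ∀ j → lc a (cycleVector ∷ (faceVector ++ pathVector)) j ≡ false) where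

          s = a zero
          g = λ k → a (suc (k ↑ˡ #V))
          t = λ k → a (suc (#F ↑ʳ k))

          rel′ : ∀ j → (s ∧ cycleVector j) xor (lc g faceVector j xor lc t pathVector j) ≡ false
          rel′ j = trans (cong ((s ∧ cycleVector j) xor_) (sym (lc-++ (a ∘ suc) faceVector pathVector j))) (rel j)

          g-root : g f₀ ≡ false
          g-root = begin
            g f₀                              ≡⟨ sum-δ g f₀ ⟨
            lc g faceVector zero              ≡⟨ Boolₚ.xor-identityʳ _ ⟨
            lc g faceVector zero xor false
              ≡⟨ cong (lc g faceVector zero xor_) (sym (sum-0 {#V} {λ k → t k ∧ false} λ k → Boolₚ.∧-zeroʳ (t k))) ⟩
            lc g faceVector zero xor lc t pathVector zero
              ≡⟨ cong (_xor (lc g faceVector zero xor lc t pathVector zero)) (sym (Boolₚ.∧-zeroʳ s)) ⟩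
            (s ∧ false) xor (lc g faceVector zero xor lc t pathVector zero)  ≡⟨ rel′ zero ⟩
            false ∎

          t-root : t v₀ ≡ false
          t-root = begin
            t v₀                              ≡⟨ sum-δ t v₀ ⟨
            lc t pathVector (suc zero)
              ≡⟨ cong (_xor lc t pathVector (suc zero)) (sym (sum-0 {#F} {λ k → g k ∧ false} λ k → Boolₚ.∧-zeroʳ (g k))) ⟩
            lc g faceVector (suc zero) xor lc t pathVector (suc zero)
              ≡⟨ cong (_xor (lc g faceVector (suc zero) xor lc t pathVector (suc zero))) (sym (Boolₚ.∧-zeroʳ s)) ⟩
            (s ∧ false) xor (lc g faceVector (suc zero) xor lc t pathVector (suc zero))  ≡⟨ rel′ (suc zero) ⟩
            false ∎

          paths : HalfEdge → Bool
          paths h = ∑[ k < #V ] (t k ∧ chain (path-to k) h)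

          g-boundary : HalfEdge → Bool
          g-boundary h = g (face h) xor g (face (flip h))

          face-sum : ∀ x y → ∑[ k < #F ] (g k ∧ (δ k x xor δ k y)) ≡ g x xor g y
          face-sum x y = trans (sum-cong-≗ {#F} λ k → Boolₚ.∧-distribˡ-xor (g k) (δ k x) (δ k y))
            (trans (∑-distrib-+ (λ k → g k ∧ δ k x) (λ k → g k ∧ δ k y)) (cong₂ _xor_ (sum-δ g x) (sum-δ g y)))

          -- The relation, read on every half-edge.
          relᴴ : ∀ h → (s ∧ ψ h) xor (g-boundary h xor paths h) ≡ false
          relᴴ (e , b) = trans (cong₂ _xor_ (cong (s ∧_) (ψ-sym b)) (cong₂ _xor_ (g-sym b)
              (sum-cong-≗ {#V} λ k → cong (t k ∧_) (chain-edge (path-to k) e b))))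
            (subst (λ e → (s ∧ ψ (e , false)) xor (g-boundary (e , false) xor paths (e , false)) ≡ false) (edge-edgeIndex e)
              (trans (cong (λ z → (s ∧ ψ (edge (edgeIndex e) , false)) xor (z xor paths (edge (edgeIndex e) , false)))
                (sym (face-sum (face (edge (edgeIndex e) , false)) (face (edge (edgeIndex e) , true)))))
                (rel′ (suc (suc (edgeIndex e))))))
            where
            ψ-sym : ∀ b → ψ (e , b) ≡ ψ (e , false)
            ψ-sym false = refl
            ψ-sym true  = symm (e , false)
            g-sym : ∀ b → g-boundary (e , b) ≡ g-boundary (e , false)
            g-sym false = refl
            g-sym true  = Boolₚ.xor-comm (g (face (e , true))) _

          -- A sum of face boundaries is a cycle: around w, the corner values telescope.
          boundary-zero : ∀ w → sumᴴ (λ h → at w h ∧ g-boundary h) ≡ false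
          boundary-zero w = trans (sumᴴ-cong {λ h → at w h ∧ g-boundary h}
              {λ h → at w h ∧ (g (face (next′ h)) xor g (face (next′ (prev h))))} λ h → cong (at w h ∧_) (trans (Boolₚ.xor-comm (g (face h)) (g (face (flip h))))
              (cong₂ (λ x y → g x xor g y) (face-flip h) (cong face (sym (strictlyInverseˡ next h))))))
            (coboundary-pairing (at w) (at-next w) (λ h → g (face (next′ h))))

          paths-boundary : ∀ w → sumᴴ (λ h → at w h ∧ paths h) ≡ t w xor (δ v₀ w ∧ sum t)
          paths-boundary w = begin
            sumᴴ (λ h → at w h ∧ paths h)
              ≡⟨ sumᴴ-cong (λ h → trans (*-distribˡ-sum (at w h) (λ k → t k ∧ chain (path-to k) h))
                   (sum-cong-≗ {#V} λ k → ∧-swap (at w h) (t k) _)) ⟩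
            sumᴴ (λ h → ∑[ k < #V ] (t k ∧ (at w h ∧ chain (path-to k) h)))
              ≡⟨ sumᴴ-sum (λ k h → t k ∧ (at w h ∧ chain (path-to k) h)) ⟩
            ∑[ k < #V ] sumᴴ (λ h → t k ∧ (at w h ∧ chain (path-to k) h))
              ≡⟨ sum-cong-≗ {#V} (λ k → trans (sumᴴ-∧ (t k) (λ h → at w h ∧ chain (path-to k) h))
                   (cong (t k ∧_) (trans (chain-boundary (path-to k) w) (trans
                     (cong (λ z → δ v₀ w xor δ z w) (strictlyInverseˡ (Finite.index finV) k)) (Boolₚ.xor-comm (δ v₀ w) _))))) ⟩
            ∑[ k < #V ] (t k ∧ (δ k w xor δ v₀ w))
              ≡⟨ trans (sum-cong-≗ {#V} λ k → Boolₚ.∧-distribˡ-xor (t k) (δ k w) (δ v₀ w))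
                   (∑-distrib-+ (λ k → t k ∧ δ k w) (λ k → t k ∧ δ v₀ w)) ⟩
            lc t δ w xor ∑[ k < #V ] (t k ∧ δ v₀ w)
              ≡⟨ cong₂ _xor_ (sum-δ t w) (trans (sym (*-distribʳ-sum (δ v₀ w) t)) (Boolₚ.∧-comm (sum t) _)) ⟩
            t w xor (δ v₀ w ∧ sum t) ∎
            where
            ∧-swap : ∀ x y z → x ∧ (y ∧ z) ≡ y ∧ (x ∧ z)
            ∧-swap x y z = trans (sym (Boolₚ.∧-assoc x y z)) (trans (cong (_∧ z) (Boolₚ.∧-comm x y)) (Boolₚ.∧-assoc y x z))

          -- Take the boundary of the relation at w. The given cycle and the face boundaries
          -- contribute nothing, so away from the root the boundary of the paths leaves only the
          -- coefficient of the path to w; the root coordinate settles the remaining vertex.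
          t-zero : ∀ w → t w ≡ false
          t-zero w with v₀ ≟ w in eq
          ... | yes refl = t-root
          ... | no v₀≢w = begin
            t w                                              ≡⟨ Boolₚ.xor-identityʳ (t w) ⟨
            t w xor (false ∧ sum t)                          ≡⟨ cong (λ z → t w xor (z ∧ sum t)) (sym (cong (λ d → if does d then true else false) eq)) ⟩
            t w xor (δ v₀ w ∧ sum t)                         ≡⟨ paths-boundary w ⟨
            sumᴴ (λ h → at w h ∧ paths h)
              ≡⟨ cong (_xor sumᴴ (λ h → at w h ∧ paths h)) (sym (boundary-zero w)) ⟩
            sumᴴ (λ h → at w h ∧ g-boundary h) xor sumᴴ (λ h → at w h ∧ paths h)
              ≡⟨ cong (_xor (sumᴴ (λ h → at w h ∧ g-boundary h) xor sumᴴ (λ h → at w h ∧ paths h)))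
                   (sym (trans (cong (s ∧_) (coboundary-pairing (at w) (at-next w) f)) (Boolₚ.∧-zeroʳ s))) ⟩
            (s ∧ sumᴴ (λ h → at w h ∧ ψ h)) xor (sumᴴ (λ h → at w h ∧ g-boundary h) xor sumᴴ (λ h → at w h ∧ paths h))
              ≡⟨ cong₂ _xor_ (sumᴴ-∧ s (λ h → at w h ∧ ψ h)) (sumᴴ-xor (λ h → at w h ∧ g-boundary h) (λ h → at w h ∧ paths h)) ⟨
            sumᴴ (λ h → s ∧ (at w h ∧ ψ h)) xor sumᴴ (λ h → (at w h ∧ g-boundary h) xor (at w h ∧ paths h))
              ≡⟨ sumᴴ-xor (λ h → s ∧ (at w h ∧ ψ h)) (λ h → (at w h ∧ g-boundary h) xor (at w h ∧ paths h)) ⟨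
            sumᴴ (λ h → (s ∧ (at w h ∧ ψ h)) xor ((at w h ∧ g-boundary h) xor (at w h ∧ paths h)))
              ≡⟨ sumᴴ-cong (λ h → trans (collect (at w h) s (ψ h) (g-boundary h) (paths h))
                   (trans (cong (at w h ∧_) (relᴴ h)) (Boolₚ.∧-zeroʳ (at w h)))) ⟩
            sumᴴ (λ _ → false)                               ≡⟨ sumᴴ-symmetric (λ _ → false) (λ _ → refl) ⟩
            false ∎
            where
            collect : ∀ c s x y z → (s ∧ (c ∧ x)) xor ((c ∧ y) xor (c ∧ z)) ≡ c ∧ ((s ∧ x) xor (y xor z))
            collect false s x y z = cong (_xor false) (Boolₚ.∧-zeroʳ s)
            collect true  s x y z = refl

          cycle-relation : ∀ h → s ∧ ψ h ≡ g-boundary h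
          cycle-relation h = xor-≡ (begin
            (s ∧ ψ h) xor g-boundary h
              ≡⟨ cong ((s ∧ ψ h) xor_) (sym (Boolₚ.xor-identityʳ (g-boundary h))) ⟩
            (s ∧ ψ h) xor (g-boundary h xor false)
              ≡⟨ cong (λ z → (s ∧ ψ h) xor (g-boundary h xor z))
                   (sym (sum-0 {#V} {λ k → t k ∧ chain (path-to k) h} λ k → cong (_∧ chain (path-to k) h) (t-zero k))) ⟩
            (s ∧ ψ h) xor (g-boundary h xor paths h)         ≡⟨ relᴴ h ⟩
            false ∎)

          -- If the cycle did not occur in the relation, g would agree on the two sides of every
          -- edge, hence be constant by connectedness, hence zero because it vanishes at the root
          -- face.
          g-zero : s ≡ false → ∀ k → g k ≡ false
          g-zero s≡0 k with Quotient.surjective faces k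
          ... | h , refl = trans (connected-invariant {k = λ h → g (face h)} connected
              (λ h → trans (cong g (sym (face-flip h))) (flat h)) flat h h₀) g-root
            where
            flat : ∀ h → g (face (flip h)) ≡ g (face h)
            flat h = sym (xor-≡ (trans (sym (cycle-relation h)) (cong (_∧ ψ h) s≡0)))

          all-zero : s ≡ false → ∀ i → a i ≡ false
          all-zero s≡0 zero    = s≡0
          all-zero s≡0 (suc i) with splitAt #F i in eq
          ... | inj₁ k = trans (cong (a ∘ suc) (sym (splitAt⁻¹-↑ˡ eq))) (g-zero s≡0 k)
            where open import Data.Fin.Properties using (splitAt⁻¹-↑ˡ)
          ... | inj₂ k = trans (cong (a ∘ suc) (sym (splitAt⁻¹-↑ʳ eq))) (t-zero k)
            where open import Data.Fin.Properties using (splitAt⁻¹-↑ʳ)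

        conclude : (suc (#F ℕ.+ #V) ℕ.≤ 2 ℕ.+ #E × Independent (cycleVector ∷ (faceVector ++ pathVector))) ⊎
                   Dependent (cycleVector ∷ (faceVector ++ pathVector)) →
                   Σ[ g ∈ (Fin #F → Bool) ] (∀ h → f h xor f (prev h) ≡ g (face h) xor g (face (flip h)))
        conclude (inj₁ (bound , _)) = contradiction
          (subst (ℕ._≤ 2 ℕ.+ #E) (cong suc (trans (ℕₚ.+-comm #F #V) (trans planar (ℕₚ.+-comm #E 2)))) bound)
          (ℕₚ.<-irrefl refl)
        -- A nontrivial relation must involve the given cycle, since otherwise all its coefficients
        -- vanish. The set g of faces in that relation has the cycle as its boundary.
        conclude (inj₂ (a , rel , i , a≢0)) = go (s a rel) refl
          where
          go : ∀ b → s a rel ≡ b → Σ[ g ∈ (Fin #F → Bool) ] (∀ h → f h xor f (prev h) ≡ g (face h) xor g (face (flip h)))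
          go false eq = contradiction (all-zero a rel eq i) a≢0
          go true  eq = g a rel , λ h → trans (cong (_∧ ψ h) (sym eq)) (cycle-relation a rel h)

-- How circles change along an edge of the cube.

module States where

  open import Data.Bool.Base using (Bool; true; false; _∧_; _xor_; if_then_else_)
  import Data.Bool.Properties as Boolₚ
  open import Data.Fin.Base using (Fin; zero; suc)
  open import Data.Fin.Properties using (_≟_)
  open import Data.List.Base using (List; []; _∷_; concatMap; allFin)
  open import Data.List.Membership.Propositional using (_∈_; lose; find)
  open import Data.List.Membership.Propositional.Properties using (∈-concatMap⁺; ∈-concatMap⁻; ∈-allFin)
  open import Data.List.Relation.Unary.Any using (here; there)
  open import Data.Nat.Base using (ℕ)
  open import Data.Product.Base using (Σ-syntax; ∃; ∃-syntax; _×_; _,_; proj₁; proj₂)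
  open import Data.Sum.Base using (_⊎_; inj₁; inj₂; [_,_]′)
  open import Data.Vec.Base using (lookup; _[_]≔_)
  open import Data.Vec.Properties using (lookup∘update; lookup∘update′)
  open import Function.Base using (_∘_)
  open import Function.Bundles using (module Inverse)
  open import Relation.Binary.Construct.Closure.Equivalence as EqClosure using (EqClosure)
  open import Relation.Binary.Construct.Closure.ReflexiveTransitive using (ε; _◅_)
  open import Relation.Binary.Construct.Closure.Symmetric using (fwd)
  open import Relation.Binary.PropositionalEquality
  open import Relation.Binary.Structures using (IsEquivalence)
  open import Relation.Nullary using (¬_; Dec; yes; no; does; contradiction)
  open Cube
  open Surface

  open Inverse using (to; from; strictlyInverseˡ; strictlyInverseʳ)

  module _ {N k} (circ : Fin N → Fin k) (x y : Fin N) where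

    join-isEquivalence : IsEquivalence (Join circ x y)
    join-isEquivalence = record { refl = inj₁ refl ; sym = symm ; trans = transi }
      where
      symm : ∀ {a b} → Join circ x y a b → Join circ x y b a
      symm (inj₁ p)              = inj₁ (sym p)
      symm (inj₂ (inj₁ (p , q))) = inj₂ (inj₂ (q , p))
      symm (inj₂ (inj₂ (p , q))) = inj₂ (inj₁ (q , p))

      transi : ∀ {a b c} → Join circ x y a b → Join circ x y b c → Join circ x y a c
      transi (inj₁ p)              (inj₁ q)              = inj₁ (trans p q)
      transi (inj₁ p)              (inj₂ (inj₁ (q , r))) = inj₂ (inj₁ (trans p q , r))
      transi (inj₁ p)              (inj₂ (inj₂ (q , r))) = inj₂ (inj₂ (trans p q , r))
      transi (inj₂ (inj₁ (p , q))) (inj₁ r)              = inj₂ (inj₁ (p , trans (sym r) q))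
      transi (inj₂ (inj₂ (p , q))) (inj₁ r)              = inj₂ (inj₂ (p , trans (sym r) q))
      transi (inj₂ (inj₁ (p , q))) (inj₂ (inj₁ (r , s))) = inj₂ (inj₁ (p , s))
      transi (inj₂ (inj₁ (p , q))) (inj₂ (inj₂ (r , s))) = inj₁ (trans p (sym s))
      transi (inj₂ (inj₂ (p , q))) (inj₂ (inj₁ (r , s))) = inj₁ (trans p (sym s))
      transi (inj₂ (inj₂ (p , q))) (inj₂ (inj₂ (r , s))) = inj₂ (inj₂ (p , s))

    join-collapse : circ x ≡ circ y → ∀ {a b} → Join circ x y a b → circ a ≡ circ b
    join-collapse x≡y (inj₁ p)              = p
    join-collapse x≡y (inj₂ (inj₁ (p , q))) = trans p (trans x≡y (sym q))
    join-collapse x≡y (inj₂ (inj₂ (p , q))) = trans p (trans (sym x≡y) (sym q))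

  unless : ∀ {A : Set} {n} → Fin n → Fin n → List A → List A
  unless i e xs = if does (i ≟ e) then [] else xs

  ∈-unless⁺ : ∀ {A : Set} {n} {i e : Fin n} {x : A} {xs} → i ≢ e → x ∈ xs → x ∈ unless i e xs
  ∈-unless⁺ {i = i} {e} i≢e x∈xs with i ≟ e
  ... | yes i≡e = contradiction i≡e i≢e
  ... | no _    = x∈xs

  ∈-unless⁻ : ∀ {A : Set} {n} {i e : Fin n} {x : A} {xs} → x ∈ unless i e xs → i ≢ e × x ∈ xs
  ∈-unless⁻ {i = i} {e} x∈ with i ≟ e
  ... | no i≢e = i≢e , x∈

  δ⇒≡ : ∀ {n} {a b : Fin n} → δ a b ≡ true → a ≡ b
  δ⇒≡ {a = a} {b} eq with a ≟ b
  ... | yes a≡b = a≡b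

  δ-refl : ∀ {n} (a : Fin n) → δ a a ≡ true
  δ-refl a with a ≟ a
  ... | yes _  = refl
  ... | no a≢a = contradiction refl a≢a

  supported-at : ∀ {n} {e : Fin n} (f : Fin n → Bool) → (∀ i → i ≢ e → f i ≡ false) → ∀ i → f i ≡ f i ∧ δ i e
  supported-at {e = e} f vanishes i with i ≟ e
  ... | yes refl = sym (Boolₚ.∧-identityʳ (f e))
  ... | no i≢e   = trans (vanishes i i≢e) (sym (Boolₚ.∧-zeroʳ (f i)))

  another-end : ∀ c d b → (true xor c) xor (d xor b) ≡ false → c ≡ true ⊎ d ≡ true ⊎ b ≡ true
  another-end true  d     b     eq = inj₁ refl
  another-end false true  b     eq = inj₂ (inj₁ refl)
  another-end false false true  eq = inj₂ (inj₂ refl)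

  module BlowupStates (Γ : RibbonGraph) where
    open RibbonGraph Γ using (HalfEdge; finH; finE)
    open Ribbon Γ
    open TrivalentPMGraph (blowup Γ) using (#M; #N; State; circles; circle; smoothing; foot₁; foot₂)

    arc : HalfEdge → Fin #N
    arc = to (Finite.index finH)

    foot₁-arc : ∀ i b → foot₁ i b ≡ arc (edge i , b)
    foot₁-arc i b = refl

    foot₂-arc : ∀ i b → foot₂ i b ≡ arc (prev (edge i , b))
    foot₂-arc i b = refl

    links : State → List (Fin #N × Fin #N)
    links α = concatMap (λ i → smoothing (lookup α i) i) (allFin #M)

    linked : ∀ α i {u v} → (u , v) ∈ smoothing (lookup α i) i → circle α u ≡ circle α v
    linked α i p = Quotient.sound (circles α)
      (fwd (∈-concatMap⁺ (λ i → smoothing (lookup α i) i) (lose (∈-allFin i) p)) ◅ ε)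

    module _ (α β : State) (e : Fin #M) (same-elsewhere : ∀ i → i ≢ e → lookup α i ≡ lookup β i) where

      -- Two states differing at e have the same circles once the feet of e are joined.
      refines-join : (∀ {u v} → (u , v) ∈ smoothing (lookup α e) e →
                        Join (circle β) (foot₁ e false) (foot₂ e false) u v) →
                     ∀ {a b} → circle α a ≡ circle α b → Join (circle β) (foot₁ e false) (foot₂ e false) a b
      refines-join at-e eq = EqClosure.gfold (join-isEquivalence (circle β) _ _) (λ a → a) step
        (Quotient.complete (circles α) eq)
        where
        step : ∀ {u v} → (u , v) ∈ links α → Join (circle β) (foot₁ e false) (foot₂ e false) u v
        step {u} {v} p = let i , _ , q = find (∈-concatMap⁻ (λ i → smoothing (lookup α i) i) {xs = allFin #M} p) in
          at i (i ≟ e) q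
          where
          at : ∀ i → Dec (i ≡ e) → (u , v) ∈ smoothing (lookup α i) i → Join (circle β) (foot₁ e false) (foot₂ e false) u v
          at i (yes refl) q = at-e q
          at i (no i≢e)   q = inj₁ (linked β i (subst (λ b → (u , v) ∈ smoothing b i) (same-elsewhere i i≢e) q))

    module _ (α : State) (e : Fin #M) (αe : lookup α e ≡ true) where

      private
        s : State
        s = α [ e ]≔ false

        x = foot₁ e false
        y = foot₂ e false

        s-e : lookup s e ≡ false
        s-e = lookup∘update e α false

        s-elsewhere : ∀ i → i ≢ e → lookup s i ≡ lookup α i
        s-elsewhere i i≢e = lookup∘update′ i≢e α false

        at-true : ∀ {u v} → (u , v) ∈ smoothing true e → circle α u ≡ circle α v
        at-true p = linked α e (subst (λ b → _ ∈ smoothing b e) (sym αe) p)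

        at-false : ∀ {u v} → (u , v) ∈ smoothing false e → circle s u ≡ circle s v
        at-false p = linked s e (subst (λ b → _ ∈ smoothing b e) (sym s-e) p)

        join-s⇒α : ∀ {a b} → circle s a ≡ circle s b → Join (circle α) x y a b
        join-s⇒α = refines-join s α e s-elsewhere λ p → go (subst (λ b → _ ∈ smoothing b e) s-e p)
          where
          go : ∀ {u v} → (u , v) ∈ smoothing false e → Join (circle α) x y u v
          go (here refl)         = inj₂ (inj₂ (at-true (here refl) , refl))
          go (there (here refl)) = inj₂ (inj₁ (at-true (there (here refl)) , refl))

        join-α⇒s : ∀ {a b} → circle α a ≡ circle α b → Join (circle s) x y a b
        join-α⇒s = refines-join α s e (λ i i≢e → sym (s-elsewhere i i≢e)) λ p → go (subst (λ b → _ ∈ smoothing b e) αe p)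
          where
          go : ∀ {u v} → (u , v) ∈ smoothing true e → Join (circle s) x y u v
          go (here refl)         = inj₂ (inj₁ (at-false (here refl) , refl))
          go (there (here refl)) = inj₂ (inj₂ (at-false (there (here refl)) , refl))

        -- The arcs joined by the smoothings at all edges other than e. The components common to
        -- both states arise in this way, and the four feet at e are their only free ends.
        restLinks : List (Fin #N × Fin #N)
        restLinks = concatMap (λ i → unless i e (smoothing (lookup α i) i)) (allFin #M)

        abstract
          rest : Quotient (Fin #N) (Linked restLinks)
          rest = quotient (finite-Fin #N) restLinks

        rest-linked : ∀ i → i ≢ e → ∀ {u v} → (u , v) ∈ smoothing (lookup α i) i → Quotient.class rest u ≡ Quotient.class rest v
        rest-linked i i≢e p = Quotient.sound rest
          (fwd (∈-concatMap⁺ (λ i → unless i e (smoothing (lookup α i) i)) (lose (∈-allFin i) (∈-unless⁺ i≢e p))) ◅ ε)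

        rest-refines : ∀ β → (∀ i → i ≢ e → lookup α i ≡ lookup β i) → ∀ {a b} →
                       Quotient.class rest a ≡ Quotient.class rest b → circle β a ≡ circle β b
        rest-refines β agree eq = EqClosure.gfold isEquivalence (circle β) step (Quotient.complete rest eq)
          where
          step : ∀ {u v} → (u , v) ∈ restLinks → circle β u ≡ circle β v
          step {u} {v} p =
            let i , _ , q = find (∈-concatMap⁻ (λ i → unless i e (smoothing (lookup α i) i)) {xs = allFin #M} p)
                i≢e , q′  = ∈-unless⁻ q
            in linked β i (subst (λ b → (u , v) ∈ smoothing b i) (agree i i≢e) q′)

        -- The arcs joined to x away from e have an even number of ends at e.
        joined : HalfEdge → Bool
        joined h = δ (Quotient.class rest (arc h)) (Quotient.class rest x)

        joined-linked : ∀ i → i ≢ e → ∀ {g h} → (arc g , arc h) ∈ smoothing (lookup α i) i → joined g ≡ joined h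
        joined-linked i i≢e p = cong (λ c → δ c (Quotient.class rest x)) (rest-linked i i≢e p)

        ends : Fin #M → Bool
        ends i = (joined (edge i , false) xor joined (prev (edge i , false))) xor (joined (edge i , true) xor joined (prev (edge i , true)))

        ends-elsewhere : ∀ i → i ≢ e → ends i ≡ false
        ends-elsewhere i i≢e = go (lookup α i) refl
          where
          a = joined (edge i , false)
          c = joined (prev (edge i , false))
          d = joined (edge i , true)
          b = joined (prev (edge i , true))
          go : ∀ z → lookup α i ≡ z → ends i ≡ false
          go false eq = trans (cong₂ (λ u v → (a xor c) xor (u xor v))
              (joined-linked i i≢e {edge i , true} {prev (edge i , false)} (subst (λ z → _ ∈ smoothing z i) (sym eq) (there (here refl))))
              (joined-linked i i≢e {prev (edge i , true)} {edge i , false} (subst (λ z → _ ∈ smoothing z i) (sym eq) (here refl))))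
            (trans (cong ((a xor c) xor_) (Boolₚ.xor-comm c a)) (xor-self (a xor c)))
          go true eq = trans (cong₂ (λ u v → (a xor c) xor (u xor v))
              (joined-linked i i≢e {edge i , true} {edge i , false} (subst (λ z → _ ∈ smoothing z i) (sym eq) (there (here refl))))
              (joined-linked i i≢e {prev (edge i , true)} {prev (edge i , false)} (subst (λ z → _ ∈ smoothing z i) (sym eq) (here refl))))
            (xor-self (a xor c))

        -- Each arc is counted at both of its ends, so the total over all edges is even. The other
        -- edges contribute evenly because their smoothings pair the four feet, which leaves an even
        -- number at e.
        ends-e : ends e ≡ false
        ends-e = begin
          ends e                                 ≡⟨ sum-δ ends e ⟨
          ∑[ i < #M ] (ends i ∧ δ i e)           ≡⟨ sum-cong-≗ {#M} (supported-at ends ends-elsewhere) ⟨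
          sumᴴ (λ h → true ∧ (joined h xor joined (prev h)))  ≡⟨ coboundary-pairing (λ _ → true) (λ _ → refl) joined ⟩
          false ∎
          where
          open ≡-Reasoning

        start : joined (edge e , false) ≡ true
        start = δ-refl (Quotient.class rest x)

        -- The component of x has another free end at e. If it is the other foot at the same end of
        -- e, x and y are joined already; if it is one of the two feet at the far end, the
        -- 0-smoothing or the 1-smoothing connects that foot to y.
        crossing : circle s x ≡ circle s y ⊎ circle α x ≡ circle α y
        crossing = go (another-end (joined (prev (edge e , false))) (joined (edge e , true)) (joined (prev (edge e , true)))
          (subst (λ z → (z xor joined (prev (edge e , false))) xor (joined (edge e , true) xor joined (prev (edge e , true))) ≡ false)
            start ends-e))
          where
          go : joined (prev (edge e , false)) ≡ true ⊎ joined (edge e , true) ≡ true ⊎ joined (prev (edge e , true)) ≡ true →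
               circle s x ≡ circle s y ⊎ circle α x ≡ circle α y
          go (inj₁ c)        = inj₂ (sym (rest-refines α (λ _ _ → refl) (δ⇒≡ c)))
          go (inj₂ (inj₁ d)) = inj₁ (trans (sym (rest-refines s (λ i i≢e → sym (s-elsewhere i i≢e)) (δ⇒≡ d)))
            (at-false (there (here refl))))
          go (inj₂ (inj₂ b)) = inj₂ (trans (sym (rest-refines α (λ _ _ → refl) (δ⇒≡ b))) (at-true (here refl)))

      step : ∃[ κ ] Step (circle s) (circle α) x y κ
      step = cases (circle s x ≟ circle s y) (circle α x ≟ circle α y)
        where
        cases : Dec (circle s x ≡ circle s y) → Dec (circle α x ≡ circle α y) → ∃[ κ ] Step (circle s) (circle α) x y κ
        cases (yes p) (yes q) = same , keeps p q (join-collapse (circle α) x y q ∘ join-s⇒α) (join-collapse (circle s) x y p ∘ join-α⇒s)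
        cases (no p)  (yes q) = merging , merges p q (join-collapse (circle α) x y q ∘ join-s⇒α) join-α⇒s
        cases (yes p) (no q)  = splitting , splits p q (join-collapse (circle s) x y p ∘ join-α⇒s) join-s⇒α
        cases (no p)  (no q)  = [ (λ eq → contradiction eq p) , (λ eq → contradiction eq q) ]′ crossing

-- The bracket of a plane graph as a number of colourings of arcs.

module Penrose where

  open import Data.Bool.Base using (Bool; true; false; not; _∧_; _xor_; if_then_else_)
  import Data.Bool.Properties as Boolₚ
  open import Data.Fin.Base using (Fin; zero; suc; toℕ)
  open import Data.Fin.Patterns using (0F; 1F; 2F; 3F)
  open import Data.Fin.Properties using (_≟_; all?; injective⇒≤; ¬∀⟶∃¬; toℕ-injective)
  open import Data.Fin.Subset using (Subset)
  open import Data.Integer.Base using (ℤ; +_; -_; _+_; _*_; _-_; _^_; 0ℤ; 1ℤ)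
  import Data.Integer.Properties as ℤₚ
  open import Data.List.Base using (List; []; _∷_; filter; length; allFin; concatMap)
  import Data.List.Base as List
  open import Data.List.Membership.Propositional using (_∈_; lose; find)
  open import Data.List.Membership.Propositional.Properties
  open import Data.List.Properties using (length-tabulate)
  open import Data.List.Relation.Unary.Any as Any using (here; there)
  open import Data.List.Relation.Unary.Any.Properties using (lookup-index)
  open import Data.List.Relation.Unary.Unique.Propositional using (Unique)
  import Data.List.Relation.Unary.Unique.Propositional.Properties as Uniqueₚ
  open import Data.Nat.Base using (ℕ; zero; suc)
  import Data.Nat.Base as ℕ
  import Data.Nat.Properties as ℕₚ
  open import Data.Product.Base using (Σ-syntax; ∃; ∃-syntax; _×_; _,_; proj₁; proj₂)
  open import Data.Sum.Base using (_⊎_; inj₁; inj₂; [_,_]′)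
  open import Data.Vec.Base using (Vec; []; _∷_; lookup; tabulate)
  open import Data.Vec.Properties using (lookup∘tabulate; tabulate∘lookup; tabulate-cong)
  open import Function.Base using (_∘_)
  open import Function.Bundles using (module Inverse; _⇔_; mk⇔)
  open import Relation.Binary.Construct.Closure.Equivalence as EqClosure using (EqClosure)
  open import Relation.Binary.Construct.Closure.ReflexiveTransitive using (ε; _◅_)
  open import Relation.Binary.Construct.Closure.Symmetric using (fwd)
  open import Relation.Binary.Definitions using (tri<; tri≈; tri>)
  open import Relation.Binary.PropositionalEquality
  open import Relation.Nullary using (¬_; Dec; yes; no; does; contradiction)
  open import Relation.Nullary.Decidable using (_×-dec_; _⊎-dec_; ¬?; dec-true; dec-false)
  open import Relation.Unary using (Decidable)
  open ListSum
  open HomRanks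
  open Surface

  open Inverse using (to; from; strictlyInverseˡ; strictlyInverseʳ)

  -- Counting by injections between duplicate-free lists; the later equalities of counts are
  -- obtained from two such inequalities.
  length-≤ : ∀ {A B : Set} {xs : List A} {ys : List B} → Unique xs → (f : A → B) →
             (∀ {x} → x ∈ xs → f x ∈ ys) → (∀ {x y} → x ∈ xs → y ∈ xs → f x ≡ f y → x ≡ y) →
             length xs ℕ.≤ length ys
  length-≤ {xs = xs} {ys} xs! f maps inj = injective⇒≤ {f = g} λ {i} {j} eq →
    unique-lookup xs! i j (inj (∈-lookup i) (∈-lookup j) (trans (lookup-index (maps (∈-lookup i)))
      (trans (cong (List.lookup ys) eq) (sym (lookup-index (maps (∈-lookup j)))))))
    where
    g : Fin (length xs) → Fin (length ys)
    g i = Any.index (maps (∈-lookup i))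

  colourings≡vectors : ∀ k m → colourings k m ≡ vectors (allFin k) m
  colourings≡vectors k zero    = refl
  colourings≡vectors k (suc m) = cong (List.cartesianProductWith _∷_ (allFin k)) (colourings≡vectors k m)

  colourings! : ∀ k m → Unique (colourings k m)
  colourings! k m = subst Unique (sym (colourings≡vectors k m)) (vectors! (Uniqueₚ.allFin⁺ k) m)

  ∈-colourings : ∀ {k m} (v : Vec (Fin k) m) → v ∈ colourings k m
  ∈-colourings {k} {m} v = subst (v ∈_) (sym (colourings≡vectors k m)) (∈-vectors ∈-allFin v)

  length-colourings : ∀ k m → + length (colourings k m) ≡ (+ k) ^ m
  length-colourings k m = trans (sym (trans (Σˡ-const 1ℤ (colourings k m)) (ℤₚ.*-identityʳ _))) (go m)
    where
    go : ∀ m → Σˡ (λ _ → 1ℤ) (colourings k m) ≡ (+ k) ^ m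
    go zero    = refl
    go (suc m) = trans (Σˡ-cartesian (λ _ → 1ℤ) _∷_ (allFin k) (colourings k m))
      (trans (Σˡ-cong (λ _ → go m) (allFin k)) (trans (Σˡ-const ((+ k) ^ m) (allFin k))
        (cong (λ n → + n * (+ k) ^ m) (length-tabulate {n = k} (λ i → i)))))

  count : ∀ {k m} {P : Vec (Fin k) m → Set} → Decidable P → ℕ
  count {k} {m} P? = length (filter P? (colourings k m))

  count-≤ : ∀ {k l m n} {P : Vec (Fin k) m → Set} {Q : Vec (Fin l) n → Set} (P? : Decidable P) (Q? : Decidable Q) →
            (f : Vec (Fin k) m → Vec (Fin l) n) → (∀ v → P v → Q (f v)) →
            (∀ u v → P u → P v → f u ≡ f v → u ≡ v) → count P? ℕ.≤ count Q?
  count-≤ {k} {l} {m} {n} P? Q? f maps inj = length-≤ (Uniqueₚ.filter⁺ P? (colourings! k m)) f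
    (λ v∈ → ∈-filter⁺ Q? (∈-colourings (f _)) (maps _ (holds v∈)))
    (λ u∈ v∈ → inj _ _ (holds u∈) (holds v∈))
    where
    holds : ∀ {v} → v ∈ filter P? (colourings k m) → _
    holds v∈ = proj₂ (∈-filter⁻ P? {xs = colourings k m} v∈)

  count-positive : ∀ {k m} {P : Vec (Fin k) m → Set} (P? : Decidable P) v → P v → 0 ℕ.< count P?
  count-positive P? v p with filter P? (colourings _ _) | ∈-filter⁺ P? (∈-colourings v) p
  ... | _ ∷ _ | _ = ℕ.s≤s ℕ.z≤n

  count-witness : ∀ {k m} {P : Vec (Fin k) m → Set} (P? : Decidable P) → 0 ℕ.< count P? → ∃ P
  count-witness {k} {m} P? 0<n with filter P? (colourings k m) in eq
  ... | v ∷ vs = v , proj₂ (∈-filter⁻ P? {xs = colourings k m} (subst (v ∈_) (sym eq) (here refl)))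

  Πᶠ : ∀ {n} → (Fin n → ℤ) → ℤ
  Πᶠ {zero}  f = 1ℤ
  Πᶠ {suc n} f = f zero * Πᶠ (f ∘ suc)

  Πᶠ-cong : ∀ {n} {f g : Fin n → ℤ} → (∀ i → f i ≡ g i) → Πᶠ f ≡ Πᶠ g
  Πᶠ-cong {zero}  eq = refl
  Πᶠ-cong {suc n} eq = cong₂ _*_ (eq zero) (Πᶠ-cong (eq ∘ suc))

  Πᶠ-1 : ∀ {n} {f : Fin n → ℤ} → (∀ i → f i ≡ 1ℤ) → Πᶠ f ≡ 1ℤ
  Πᶠ-1 {zero}  eq = refl
  Πᶠ-1 {suc n} eq = cong₂ _*_ (eq zero) (Πᶠ-1 (eq ∘ suc))

  Πᶠ-0 : ∀ {n} {f : Fin n → ℤ} i → f i ≡ 0ℤ → Πᶠ f ≡ 0ℤ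
  Πᶠ-0 {f = f} zero    eq = trans (cong (_* Πᶠ (f ∘ suc)) eq) (ℤₚ.*-zeroˡ (Πᶠ (f ∘ suc)))
  Πᶠ-0 {f = f} (suc i) eq = trans (cong (f zero *_) (Πᶠ-0 i eq)) (ℤₚ.*-zeroʳ (f zero))

  Πᶠ-ind : ∀ {n} {P : Fin n → Set} (P? : Decidable P) (all : Dec (∀ i → P i)) → Πᶠ (λ i → indℤ (P? i)) ≡ indℤ all
  Πᶠ-ind P? (yes p) = Πᶠ-1 λ i → indℤ-yes (P? i) (p i)
  Πᶠ-ind P? (no ¬p) with ¬∀⟶∃¬ _ _ P? ¬p
  ... | i , ¬pi = Πᶠ-0 i (indℤ-no (P? i) ¬pi)

  -- The distributive law: a sum over all states of a product over edges is a product over edges of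
  -- sums over the two smoothings.
  alternatingSum-Πᶠ : ∀ {ℓ} (w : Fin ℓ → Bool → ℤ) →
                      alternatingSum (λ α → Πᶠ (λ i → w i (lookup α i))) ≡ Πᶠ (λ i → w i false - w i true)
  alternatingSum-Πᶠ {zero}  w = refl
  alternatingSum-Πᶠ {suc ℓ} w = trans
    (cong₂ _-_ (trans (alternatingSum-*ˡ (w zero false) (λ α → Πᶠ (λ i → w (suc i) (lookup α i))))
                      (cong (w zero false *_) (alternatingSum-Πᶠ (w ∘ suc))))
               (trans (alternatingSum-*ˡ (w zero true) (λ α → Πᶠ (λ i → w (suc i) (lookup α i))))
                      (cong (w zero true *_) (alternatingSum-Πᶠ (w ∘ suc)))))
    (factor (w zero false) (w zero true) _)
    where
    open import Data.Integer.Tactic.RingSolver using (solve-∀)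
    factor : ∀ a b x → a * x - b * x ≡ (a - b) * x
    factor = solve-∀

  signᵇ : Bool → ℤ
  signᵇ b = if b then - 1ℤ else 1ℤ

  Πᶠ-sign : ∀ {n} (x : Fin n → Bool) → Πᶠ (signᵇ ∘ x) ≡ signᵇ (sum x)
  Πᶠ-sign {zero}  x = refl
  Πᶠ-sign {suc n} x = trans (cong (signᵇ (x zero) *_) (Πᶠ-sign (x ∘ suc))) (go (x zero) (sum (x ∘ suc)))
    where
    go : ∀ a b → signᵇ a * signᵇ b ≡ signᵇ (a xor b)
    go false false = refl
    go false true  = refl
    go true  false = refl
    go true  true  = refl

  module BracketExpansion (Γ : TrivalentPMGraph) (d : ℕ) where
    open TrivalentPMGraph Γ using (#M; #N; State; circles; #circles; circle; smoothing; foot₁; foot₂)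

    Fits : Vec (Fin d) #N → Fin #M → Bool → Set
    Fits φ i false = lookup φ (foot₂ i true) ≡ lookup φ (foot₁ i false) × lookup φ (foot₁ i true) ≡ lookup φ (foot₂ i false)
    Fits φ i true  = lookup φ (foot₂ i true) ≡ lookup φ (foot₂ i false) × lookup φ (foot₁ i true) ≡ lookup φ (foot₁ i false)

    fits? : ∀ φ i b → Dec (Fits φ i b)
    fits? φ i false = (_ ≟ _) ×-dec (_ ≟ _)
    fits? φ i true  = (_ ≟ _) ×-dec (_ ≟ _)

    fits⇒ : ∀ {φ i} b → Fits φ i b → ∀ {u v} → (u , v) ∈ smoothing b i → lookup φ u ≡ lookup φ v
    fits⇒ false (p , q) (here refl)         = p
    fits⇒ false (p , q) (there (here refl)) = q
    fits⇒ true  (p , q) (here refl)         = p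
    fits⇒ true  (p , q) (there (here refl)) = q

    ⇒fits : ∀ {φ i} b → (∀ {u v} → (u , v) ∈ smoothing b i → lookup φ u ≡ lookup φ v) → Fits φ i b
    ⇒fits false f = f (here refl) , f (there (here refl))
    ⇒fits true  f = f (here refl) , f (there (here refl))

    Compatible : State → Vec (Fin d) #N → Set
    Compatible α φ = ∀ i → Fits φ i (lookup α i)

    compatible? : ∀ α → Decidable (Compatible α)
    compatible? α φ = all? λ i → fits? φ i (lookup α i)

    compatible-constant : ∀ {α φ} → Compatible α φ → ∀ {a b} → circle α a ≡ circle α b → lookup φ a ≡ lookup φ b
    compatible-constant {α} {φ} comp eq = EqClosure.gfold isEquivalence (lookup φ) step (Quotient.complete (circles α) eq)
      where
      step : ∀ {u v} → (u , v) ∈ concatMap (λ i → smoothing (lookup α i) i) (allFin #M) → lookup φ u ≡ lookup φ v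
      step p with find (∈-concatMap⁻ (λ i → smoothing (lookup α i) i) {xs = allFin #M} p)
      ... | i , _ , q = fits⇒ (lookup α i) (comp i) q

    -- Colourings constant along all smoothings of the state are colourings of its circles, so there
    -- are d to the number of circles of them.
    count-compatible : ∀ α → count (compatible? α) ≡ length (colourings d (#circles α))
    count-compatible α = ℕₚ.≤-antisym
      (length-≤ (Uniqueₚ.filter⁺ (compatible? α) (colourings! d #N)) restrict (λ _ → ∈-colourings _) λ u∈ v∈ eq →
        pointwise λ a → begin-≡ u∈ v∈ eq a)
      (length-≤ (colourings! d (#circles α)) pull (λ {ψ} _ → ∈-filter⁺ (compatible? α) (∈-colourings (pull ψ)) (pull-compatible ψ))
        λ {ψ} {ψ′} _ _ eq → pointwise λ c → let a , ac = Quotient.surjective (circles α) c in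
          trans (cong (lookup ψ) (sym ac)) (trans (sym (lookup∘tabulate _ a)) (trans (cong (λ w → lookup w a) eq)
            (trans (lookup∘tabulate _ a) (cong (lookup ψ′) ac)))))
      where
      rep : Fin (#circles α) → Fin #N
      rep c = proj₁ (Quotient.surjective (circles α) c)

      restrict : Vec (Fin d) #N → Vec (Fin d) (#circles α)
      restrict φ = tabulate (lookup φ ∘ rep)

      pull : Vec (Fin d) (#circles α) → Vec (Fin d) #N
      pull ψ = tabulate (lookup ψ ∘ circle α)

      pointwise : ∀ {n} {u v : Vec (Fin d) n} → (∀ a → lookup u a ≡ lookup v a) → u ≡ v
      pointwise {u = u} {v} eq = trans (sym (tabulate∘lookup u)) (trans (tabulate-cong eq) (tabulate∘lookup v))

      pull-compatible : ∀ ψ → Compatible α (pull ψ)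
      pull-compatible ψ i = ⇒fits (lookup α i) λ {u} {v} p → trans (lookup∘tabulate _ u)
        (trans (cong (lookup ψ) (Quotient.sound (circles α)
          (fwd (∈-concatMap⁺ (λ i → smoothing (lookup α i) i) (lose (∈-allFin i) p)) ◅ ε))) (sym (lookup∘tabulate _ v)))

      at-rep : ∀ {φ} → φ ∈ filter (compatible? α) (colourings d #N) → ∀ a → lookup φ a ≡ lookup (restrict φ) (circle α a)
      at-rep {φ} φ∈ a = trans
        (compatible-constant {α} {φ} (proj₂ (∈-filter⁻ (compatible? α) {xs = colourings d #N} φ∈))
          (sym (proj₂ (Quotient.surjective (circles α) (circle α a)))))
        (sym (lookup∘tabulate _ (circle α a)))

      begin-≡ : ∀ {u v} → u ∈ filter (compatible? α) (colourings d #N) → v ∈ filter (compatible? α) (colourings d #N) →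
                restrict u ≡ restrict v → ∀ a → lookup u a ≡ lookup v a
      begin-≡ u∈ v∈ eq a = trans (at-rep u∈ a) (trans (cong (λ w → lookup w (circle α a)) eq) (sym (at-rep v∈ a)))

    weight : Vec (Fin d) #N → Fin #M → ℤ
    weight φ i = indℤ (fits? φ i false) - indℤ (fits? φ i true)

    bracket-expansion : bracket (+ d) Γ ≡ Σˡ (λ φ → Πᶠ (weight φ)) (colourings d #N)
    bracket-expansion = begin
      alternatingSum (λ α → (+ d) ^ #circles α)
        ≡⟨ alternatingSum-cong (λ α → trans (sym (length-colourings d (#circles α)))
             (trans (cong +_ (sym (count-compatible α))) (Σˡ-filter (compatible? α) (colourings d #N)))) ⟩
      alternatingSum (λ α → Σˡ (λ φ → indℤ (compatible? α φ)) (colourings d #N))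
        ≡⟨ alternatingSum-Σˡ (λ φ α → indℤ (compatible? α φ)) (colourings d #N) ⟩
      Σˡ (λ φ → alternatingSum (λ α → indℤ (compatible? α φ))) (colourings d #N)
        ≡⟨ Σˡ-cong (λ φ → trans (alternatingSum-cong λ α → sym (Πᶠ-ind (λ i → fits? φ i (lookup α i)) (compatible? α φ)))
             (alternatingSum-Πᶠ (λ i b → indℤ (fits? φ i b)))) (colourings d #N) ⟩
      Σˡ (λ φ → Πᶠ (weight φ)) (colourings d #N) ∎
      where open ≡-Reasoning

  module Admissibility (Γ : RibbonGraph) (d : ℕ) where
    open RibbonGraph Γ
    open Ribbon Γ
    open TrivalentPMGraph (blowup Γ) using (#M; #N; foot₁; foot₂)
    open BracketExpansion (blowup Γ) d

    at : Vec (Fin d) #N → HalfEdge → Fin d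
    at φ h = lookup φ (to (Finite.index finH) h)

    left right : Fin #E → HalfEdge
    left i  = edge i , false
    right i = edge i , true

    Distinct : Vec (Fin d) #N → Fin #M → Set
    Distinct φ i = at φ (left i) ≢ at φ (prev (left i))

    -- Exactly the colourings with nonzero weight at every edge. Distinctness is required at one end
    -- only, since fitting a smoothing carries it to the other.
    Admissible : Vec (Fin d) #N → Set
    Admissible φ = ∀ i → (Fits φ i false ⊎ Fits φ i true) × Distinct φ i

    admissible? : Decidable Admissible
    admissible? φ = all? λ i → (fits? φ i false ⊎-dec fits? φ i true) ×-dec ¬? (_ ≟ _)

    -- At an admissible edge the two colours at either end are the same.
    symmetric : ∀ {φ} → Admissible φ → (F : Fin d → Bool) → ∀ h →
                F (at φ (flip h)) xor F (at φ (prev (flip h))) ≡ F (at φ h) xor F (at φ (prev h))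
    symmetric {φ} adm F (e , false) = subst
      (λ e → F (at φ (e , true)) xor F (at φ (prev (e , true))) ≡ F (at φ (e , false)) xor F (at φ (prev (e , false))))
      (edge-edgeIndex e) (go (proj₁ (adm (edgeIndex e))))
      where
      i = edgeIndex e
      go : Fits φ i false ⊎ Fits φ i true → F (at φ (right i)) xor F (at φ (prev (right i))) ≡
                                              F (at φ (left i)) xor F (at φ (prev (left i)))
      go (inj₁ (p , q)) = trans (cong₂ (λ x y → F x xor F y) q p) (Boolₚ.xor-comm (F (at φ (prev (left i)))) (F (at φ (left i))))
      go (inj₂ (p , q)) = cong₂ (λ x y → F x xor F y) q p
    symmetric {φ} adm F (e , true) = sym (symmetric {φ} adm F (e , false))

    weight-admissible : ∀ φ i (s : Fits φ i false ⊎ Fits φ i true) → Distinct φ i →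
                        weight φ i ≡ signᵇ ([ (λ _ → false) , (λ _ → true) ]′ s)
    weight-admissible φ i (inj₁ (p , q)) ≢ = cong₂ _-_ (indℤ-yes (fits? φ i false) (p , q))
      (indℤ-no (fits? φ i true) λ (p′ , _) → ≢ (trans (sym p) p′))
    weight-admissible φ i (inj₂ (p , q)) ≢ = cong₂ _-_
      (indℤ-no (fits? φ i false) λ (p′ , _) → ≢ (trans (sym p′) p)) (indℤ-yes (fits? φ i true) (p , q))

    -- If the two colours at the left end agree, the two smoothings impose the same conditions, so
    -- their contributions cancel.
    weight-inadmissible : ∀ φ i → ¬ ((Fits φ i false ⊎ Fits φ i true) × Distinct φ i) → weight φ i ≡ 0ℤ
    weight-inadmissible φ i ¬adm = go (at φ (left i) ≟ at φ (prev (left i))) (fits? φ i false)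
      where
      go : Dec (at φ (left i) ≡ at φ (prev (left i))) → Dec (Fits φ i false) → weight φ i ≡ 0ℤ
      go (no ≢)   _             = cong₂ _-_ (indℤ-no (fits? φ i false) λ f → ¬adm (inj₁ f , ≢))
                                            (indℤ-no (fits? φ i true) λ f → ¬adm (inj₂ f , ≢))
      go (yes eq) (yes (p , q)) = cong₂ _-_ (indℤ-yes (fits? φ i false) (p , q))
                                            (indℤ-yes (fits? φ i true) (trans p eq , trans q (sym eq)))
      go (yes eq) (no ¬f)       = cong₂ _-_ (indℤ-no (fits? φ i false) ¬f)
                                            (indℤ-no (fits? φ i true) λ (p , q) → ¬f (trans p (sym eq) , trans q eq))

    module _ (connected : Connected) (planar : Planar) (h₀ : HalfEdge) where

      -- A colour class, shifted by a set of faces that it bounds, is constant at the vertices; on an edge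
      -- the shifted class changes exactly where curves of two different colours cross.
      module Crossings (φ : Vec (Fin d) #N) (adm : Admissible φ) where

        crossed : Fin #E → Bool
        crossed i = [ (λ _ → false) , (λ _ → true) ]′ (proj₁ (adm i))

        below : Fin d → Fin d → Bool
        below j p = does (toℕ p ℕₚ.<? toℕ j)

        module _ (j : Fin d) where

          private
            f : HalfEdge → Bool
            f h = δ j (at φ h)

            ψ′ : HalfEdge → Bool
            ψ′ h = below j (at φ h) xor below j (at φ (prev h))

            bounding = cycle-bounds connected planar h₀ f (symmetric {φ} adm (δ j))
            g = proj₁ bounding

            u : HalfEdge → Bool
            u h = f h xor g (face (flip h))

            face-prev : ∀ h → face (flip (prev h)) ≡ face h
            face-prev h = trans (face-flip (prev h)) (cong face (strictlyInverseˡ next h))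

            u-prev : ∀ h → u (prev h) ≡ u h
            u-prev h = trans (cong (λ F → f (prev h) xor g F) (face-prev h)) (sym (swap {f h} {f (prev h)} {g (face h)} {g (face (flip h))} (proj₂ bounding h)))
              where
              swap : ∀ {a b c d} → a xor b ≡ c xor d → a xor d ≡ b xor c
              swap {false} {false} {false} {false} _ = refl
              swap {false} {false} {true}  {true}  _ = refl
              swap {false} {true}  {false} {true}  _ = refl
              swap {false} {true}  {true}  {false} _ = refl
              swap {true}  {false} {false} {true}  _ = refl
              swap {true}  {false} {true}  {false} _ = refl
              swap {true}  {true}  {false} {false} _ = refl
              swap {true}  {true}  {true}  {true}  _ = refl

            u-next : ∀ h → u (next′ h) ≡ u h
            u-next h = trans (sym (u-prev (next′ h))) (cong u (strictlyInverseʳ next h))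

            -- Passing along the edge, the corner value of g at the two ends is the same face and
            -- cancels. What remains is whether the colour lines cross and whether one of them has
            -- colour j.
            change : ∀ i → u (left i) xor u (right i) ≡ crossed i ∧ (f (left i) xor f (prev (left i)))
            change i = trans (cong (u (left i) xor_) (trans (sym (u-prev (right i)))
                (cong (λ F → f (prev (right i)) xor g F) (face-prev (right i)))))
              (trans (xor-interchange (f (left i)) _ _ _) (trans (cong ((f (left i) xor f (prev (right i))) xor_) (xor-self (g (face (right i)))))
                (trans (Boolₚ.xor-identityʳ _) (go (proj₁ (adm i))))))
              where
              go : (s : Fits φ i false ⊎ Fits φ i true) →
                   f (left i) xor f (prev (right i)) ≡ [ (λ _ → false) , (λ _ → true) ]′ s ∧ (f (left i) xor f (prev (left i)))
              go (inj₁ (p , q)) = trans (cong (λ c → f (left i) xor δ j c) p) (xor-self (f (left i)))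
              go (inj₂ (p , q)) = cong (λ c → f (left i) xor δ j c) p

          -- The shifted class is constant at vertices, and the threshold colouring `below j` has
          -- zero total change around every vertex. Their pairing is therefore zero; it counts,
          -- modulo 2, crossings of colour j that the threshold separates.
          vanishing : ∑[ i < #E ] (crossed i ∧ ((δ j (at φ (left i)) xor δ j (at φ (prev (left i))))
                                   ∧ (below j (at φ (left i)) xor below j (at φ (prev (left i)))))) ≡ false
          vanishing = begin
            ∑[ i < #E ] (crossed i ∧ ((f (left i) xor f (prev (left i))) ∧ ψ′ (left i)))
              ≡⟨ sum-cong-≗ {#E} (λ i → trans (sym (Boolₚ.∧-assoc (crossed i) _ _)) (trans (cong (_∧ ψ′ (left i)) (sym (change i)))
                   (trans (Boolₚ.∧-distribʳ-xor (ψ′ (left i)) (u (left i)) (u (right i)))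
                     (cong (λ z → (u (left i) ∧ ψ′ (left i)) xor (u (right i) ∧ z)) (sym (symmetric {φ} adm (below j) (left i))))))) ⟩
            sumᴴ (λ h → u h ∧ ψ′ h)
              ≡⟨ coboundary-pairing u u-next (λ h → below j (at φ h)) ⟩
            false ∎
            where open ≡-Reasoning

        -- For two different colours, exactly one of p < q and q < p holds. Summed over j, each
        -- crossing is thus counted an odd number of times, which combines the relations `vanishing`
        -- into the parity of all crossings.
        order-parity : ∀ p q → p ≢ q → ∑[ j < d ] ((δ j p xor δ j q) ∧ (below j p xor below j q)) ≡ true
        order-parity p q p≢q = begin
          ∑[ j < d ] ((δ j p xor δ j q) ∧ F j)
            ≡⟨ sum-cong-≗ {d} (λ j → trans (Boolₚ.∧-comm (δ j p xor δ j q) (F j)) (Boolₚ.∧-distribˡ-xor (F j) (δ j p) (δ j q))) ⟩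
          ∑[ j < d ] ((F j ∧ δ j p) xor (F j ∧ δ j q))
            ≡⟨ ∑-distrib-+ (λ j → F j ∧ δ j p) (λ j → F j ∧ δ j q) ⟩
          (∑[ j < d ] (F j ∧ δ j p)) xor (∑[ j < d ] (F j ∧ δ j q))
            ≡⟨ cong₂ _xor_ (sum-δ F p) (sum-δ F q) ⟩
          (below p p xor below p q) xor (below q p xor below q q)
            ≡⟨ order (ℕₚ.<-cmp (toℕ p) (toℕ q)) ⟩
          true ∎
          where
          open ≡-Reasoning
          F : Fin d → Bool
          F j = below j p xor below j q

          irreflexive : ∀ p → below p p ≡ false
          irreflexive p = dec-false (toℕ p ℕₚ.<? toℕ p) (ℕₚ.<-irrefl refl)

          order : _ → (below p p xor below p q) xor (below q p xor below q q) ≡ true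
          order (tri< p<q _ q≮p) = cong₂ _xor_
            (cong₂ _xor_ (irreflexive p) (dec-false (toℕ q ℕₚ.<? toℕ p) q≮p))
            (cong₂ _xor_ (dec-true (toℕ p ℕₚ.<? toℕ q) p<q) (irreflexive q))
          order (tri≈ _ p≡q _) = contradiction (toℕ-injective p≡q) p≢q
          order (tri> p≮q _ q<p) = cong₂ _xor_
            (cong₂ _xor_ (irreflexive p) (dec-true (toℕ q ℕₚ.<? toℕ p) q<p))
            (cong₂ _xor_ (dec-false (toℕ p ℕₚ.<? toℕ q) p≮q) (irreflexive q))

        even-crossings : sum crossed ≡ false
        even-crossings = begin
          sum crossed
            ≡⟨ sum-cong-≗ {#E} (λ i → trans (sym (Boolₚ.∧-identityʳ (crossed i))) (cong (crossed i ∧_) (sym (order-parity _ _ (proj₂ (adm i)))))) ⟩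
          ∑[ i < #E ] (crossed i ∧ ∑[ j < d ] T i j)
            ≡⟨ sum-cong-≗ {#E} (λ i → *-distribˡ-sum (crossed i) (T i)) ⟩
          ∑[ i < #E ] ∑[ j < d ] (crossed i ∧ T i j)
            ≡⟨ ∑-comm (λ i j → crossed i ∧ T i j) ⟩
          ∑[ j < d ] ∑[ i < #E ] (crossed i ∧ T i j)
            ≡⟨ sum-0 {d} vanishing ⟩
          false ∎
          where
          open ≡-Reasoning
          T : Fin #E → Fin d → Bool
          T i j = (δ j (at φ (left i)) xor δ j (at φ (prev (left i)))) ∧ (below j (at φ (left i)) xor below j (at φ (prev (left i))))

      -- An admissible colouring has product of weights -1 to the number of crossed edges, which is
      -- 1 by `even-crossings`; any other colouring has a factor 0.
      bracket-count : bracket (+ d) (blowup Γ) ≡ + count admissible?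
      bracket-count = trans bracket-expansion (trans
        (Σˡ-cong (λ φ → product φ (admissible? φ)) (colourings d #N)) (sym (Σˡ-filter admissible? (colourings d #N))))
        where
        product : ∀ φ (dec : Dec (Admissible φ)) → Πᶠ (weight φ) ≡ indℤ dec
        product φ (yes adm) = trans (Πᶠ-cong λ i → weight-admissible φ i (proj₁ (adm i)) (proj₂ (adm i)))
          (trans (Πᶠ-sign (Crossings.crossed φ adm)) (cong signᵇ (Crossings.even-crossings φ adm)))
        product φ (no ¬adm) with ¬∀⟶∃¬ _ _ (λ i → (fits? φ i false ⊎-dec fits? φ i true) ×-dec ¬? (_ ≟ _)) ¬adm
        ... | i , ¬i = Πᶠ-0 i (weight-inadmissible φ i ¬i)

    -- An arc lies in the corner between consecutive half-edges and takes the colour of the face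
    -- containing that corner.
    fromFaces : (Fin #F → Fin d) → Vec (Fin d) #N
    fromFaces c = tabulate λ k → c (face (flip (from (Finite.index finH) k)))

    at-fromFaces : ∀ c h → at (fromFaces c) h ≡ c (face (flip h))
    at-fromFaces c h = trans (lookup∘tabulate _ (to (Finite.index finH) h))
      (cong (λ h → c (face (flip h))) (strictlyInverseʳ (Finite.index finH) h))

    at-fromFaces-prev : ∀ c h → at (fromFaces c) (prev h) ≡ c (face h)
    at-fromFaces-prev c h = trans (at-fromFaces c (prev h))
      (cong c (trans (face-flip (prev h)) (cong face (strictlyInverseˡ next h))))

    fromFaces-admissible : ∀ c → (∀ e → c (face (e , false)) ≢ c (face (e , true))) → Admissible (fromFaces c)
    fromFaces-admissible c proper i =
      inj₁ (trans (at-fromFaces-prev c (right i)) (sym (at-fromFaces c (left i))) ,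
            trans (at-fromFaces c (right i)) (sym (at-fromFaces-prev c (left i)))) ,
      λ eq → proper (edge i) (sym (trans (sym (at-fromFaces c (left i))) (trans eq (at-fromFaces-prev c (left i)))))

    -- The faces on the two sides of an edge have different colours and continue along it uncrossed,
    -- so every edge fits the 0-smoothing. The colouring can be recovered, since every face has a
    -- corner.
    χ-≤-admissible : χ dual d ℕ.≤ count admissible?
    χ-≤-admissible = count-≤ (properVertexColouring? dual) admissible? (λ c → fromFaces (lookup c))
      (λ c proper → fromFaces-admissible (lookup c) λ e → subst
        (λ e → lookup c (face (e , false)) ≢ lookup c (face (e , true))) (edge-edgeIndex e) (proper (edgeIndex e)))
      λ c c′ _ _ eq → trans (sym (tabulate∘lookup c)) (trans (tabulate-cong (same c c′ eq)) (tabulate∘lookup c′))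
      where
      same : ∀ c c′ → fromFaces (lookup c) ≡ fromFaces (lookup c′) → ∀ F → lookup c F ≡ lookup c′ F
      same c c′ eq F with Quotient.surjective faces F
      ... | h , refl = trans (sym (at-fromFaces-prev (lookup c) h)) (trans (cong (λ φ → at φ (prev h)) eq)
        (at-fromFaces-prev (lookup c′) h))

  module FourColours (Γ : RibbonGraph) where
    open RibbonGraph Γ
    open Ribbon Γ
    open Admissibility Γ 4

    bit₀ bit₁ : Fin 4 → Bool
    bit₀ 0F = false
    bit₀ 1F = true
    bit₀ 2F = false
    bit₀ 3F = true
    bit₁ 0F = false
    bit₁ 1F = false
    bit₁ 2F = true
    bit₁ 3F = true

    encode : Bool → Bool → Fin 4
    encode false false = 0F
    encode true  false = 1F
    encode false true  = 2F
    encode true  true  = 3F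

    encode-bits : ∀ p → encode (bit₀ p) (bit₁ p) ≡ p
    encode-bits 0F = refl
    encode-bits 1F = refl
    encode-bits 2F = refl
    encode-bits 3F = refl

    bits-injective : ∀ p q → bit₀ p ≡ bit₀ q → bit₁ p ≡ bit₁ q → p ≡ q
    bits-injective p q eq₀ eq₁ = trans (sym (encode-bits p)) (trans (cong₂ encode eq₀ eq₁) (encode-bits q))

    bit₀-encode : ∀ x y → bit₀ (encode x y) ≡ x
    bit₀-encode false false = refl
    bit₀-encode true  false = refl
    bit₀-encode false true  = refl
    bit₀-encode true  true  = refl

    bit₁-encode : ∀ x y → bit₁ (encode x y) ≡ y
    bit₁-encode false false = refl
    bit₁-encode true  false = refl
    bit₁-encode false true  = refl
    bit₁-encode true  true  = refl

    -- The sum of the two colours at an edge, in ℤ/2 × ℤ/2, is a nowhere zero flow.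
    admissible⇒colourable : Connected → Planar → HalfEdge → ∀ φ → Admissible φ → FaceColourable 4
    admissible⇒colourable connected planar h₀ φ adm = (λ F → encode (g₀ F) (g₁ F)) , proper
      where
      bounding₀ = cycle-bounds connected planar h₀ (bit₀ ∘ at φ) (symmetric {φ} adm bit₀)
      bounding₁ = cycle-bounds connected planar h₀ (bit₁ ∘ at φ) (symmetric {φ} adm bit₁)
      g₀ = proj₁ bounding₀
      g₁ = proj₁ bounding₁

      -- If both sides of e had the same colour, both bits of the flow would vanish there, making
      -- the two arc colours at e equal against admissibility.
      proper : ∀ e → encode (g₀ (face (e , false))) (g₁ (face (e , false))) ≢ encode (g₀ (face (e , true))) (g₁ (face (e , true)))
      proper e eq = subst (λ e → at φ (e , false) ≢ at φ (prev (e , false))) (edge-edgeIndex e) (proj₂ (adm (edgeIndex e)))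
        (bits-injective _ _
          (xor-≡ (trans (proj₂ bounding₀ (e , false)) (equal (trans (sym (bit₀-encode _ _)) (trans (cong bit₀ eq) (bit₀-encode _ _))))))
          (xor-≡ (trans (proj₂ bounding₁ (e , false)) (equal (trans (sym (bit₁-encode _ _)) (trans (cong bit₁ eq) (bit₁-encode _ _)))))))
        where
        equal : ∀ {x y} → x ≡ y → x xor y ≡ false
        equal {x} refl = xor-self x

    colourable⇔admissible : Connected → Planar → HalfEdge → FaceColourable 4 ⇔ (0 ℕ.< count admissible?)
    colourable⇔admissible connected planar h₀ = mk⇔
      (λ (c , proper) → count-positive admissible? (fromFaces c) (fromFaces-admissible c proper))
      (λ 0<n → let φ , adm = count-witness admissible? 0<n in admissible⇒colourable connected planar h₀ φ adm)

-- Counting admissible colourings with two colours, and with three colours on trivalent graphs.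

module Colourings where

  open import Data.Bool.Base using (Bool; true; false; not; _xor_; if_then_else_)
  import Data.Bool.Properties as Boolₚ
  open import Data.Fin.Base using (Fin; zero; suc; toℕ; fromℕ<)
  open import Data.Fin.Patterns using (0F; 1F)
  open import Data.Fin.Permutation using (↔⇒≡)
  open import Data.Fin.Properties using (_≟_; all?; toℕ<n; toℕ-fromℕ<; toℕ-injective)
  open import Data.Integer.Base using (ℤ; +_)
  open import Data.List.Base using (length)
  import Data.List.Relation.Unary.Unique.Propositional.Properties as Uniqueₚ
  open import Data.List.Membership.Propositional.Properties using (∈-filter⁺; ∈-filter⁻)
  open import Data.Nat.Base using (ℕ; zero; suc; NonZero; _∸_; _%_; _/_; _^_; z≤n; s≤s)
  import Data.Nat.Base as ℕ
  open import Data.Nat.Divisibility using (_∣_; divides)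
  open import Data.Nat.DivMod using (m≡m%n+[m/n]*n; m%n<n)
  open import Data.Nat.GeneralisedArithmetic using (fold; fold-+)
  import Data.Nat.Properties as ℕₚ
  open import Data.Product.Base using (Σ-syntax; ∃; ∃-syntax; _×_; _,_; proj₁; proj₂)
  open import Data.Sum.Base using (_⊎_; inj₁; inj₂)
  open import Data.Vec.Base using (Vec; lookup; tabulate)
  open import Data.Vec.Properties using (lookup∘tabulate; tabulate∘lookup; tabulate-cong)
  open import Function.Base using (_∘_)
  open import Function.Bundles using (_↔_; mk↔ₛ′; module Inverse)
  open import Function.Construct.Composition using (_↔-∘_)
  open import Function.Construct.Symmetry using (↔-sym)
  open import Relation.Binary.Construct.Closure.ReflexiveTransitive using (Star; ε; _◅_)
  open import Relation.Binary.Definitions using (tri<; tri≈; tri>)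
  open import Relation.Binary.PropositionalEquality
  open import Relation.Nullary using (¬_; Dec; yes; no; does; contradiction)
  open import Relation.Nullary.Decidable using (¬?; _→-dec_; from-yes)
  open import Axiom.UniquenessOfIdentityProofs using (module Decidable⇒UIP)
  open Surface
  open Penrose

  open Inverse using (to; from; strictlyInverseˡ; strictlyInverseʳ)

  least : ∀ {P : ℕ → Set} → (∀ k → Dec (P k)) → ∀ n → P n → Σ[ m ∈ ℕ ] P m × (∀ k → k ℕ.< m → ¬ P k)
  least {P} P? n pn with go (suc n)
    where
    go : ∀ n → (Σ[ m ∈ ℕ ] P m × (∀ k → k ℕ.< m → ¬ P k)) ⊎ (∀ k → k ℕ.< n → ¬ P k)
    go zero = inj₂ λ _ ()
    go (suc n) with go n
    ... | inj₁ found = inj₁ found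
    ... | inj₂ none with P? n
    ...   | yes p = inj₁ (n , p , none)
    ...   | no ¬p = inj₂ λ k k<1+n pk → ¬p (subst P (ℕₚ.≤∧≮⇒≡ (ℕₚ.≤-pred k<1+n) λ k<n → none k k<n pk) pk)
  ... | inj₁ found = found
  ... | inj₂ none  = contradiction pn (none n ℕₚ.≤-refl)

  only-two : (x y a : Fin 2) → x ≢ a → y ≢ a → x ≡ y
  only-two = from-yes decision
    where
    decision : Dec ((x y a : Fin 2) → x ≢ a → y ≢ a → x ≡ y)
    decision = all? λ x → all? λ y → all? λ a → ¬? (x ≟ a) →-dec (¬? (y ≟ a) →-dec (x ≟ y))

  only-three : (x y a b : Fin 3) → a ≢ b → x ≢ a → x ≢ b → y ≢ a → y ≢ b → x ≡ y
  only-three = from-yes decision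
    where
    decision : Dec ((x y a b : Fin 3) → a ≢ b → x ≢ a → x ≢ b → y ≢ a → y ≢ b → x ≡ y)
    decision = all? λ x → all? λ y → all? λ a → all? λ b → ¬? (a ≟ b) →-dec
      (¬? (x ≟ a) →-dec (¬? (x ≟ b) →-dec (¬? (y ≟ a) →-dec (¬? (y ≟ b) →-dec (x ≟ y)))))

  -- With three colours, a pair of distinct colours is determined up to order by the colour x that
  -- it omits.
  pairing : (a a′ b b′ x : Fin 3) → a ≢ a′ → b ≢ b′ → a ≢ x → a′ ≢ x → b ≢ x → b′ ≢ x →
            (b′ ≡ a × b ≡ a′) ⊎ (b′ ≡ a′ × b ≡ a)
  pairing a a′ b b′ x a≢a′ b≢b′ a≢x a′≢x b≢x b′≢x with b′ ≟ a
  ... | yes b′≡a = inj₁ (b′≡a , only-three b a′ a x a≢x (λ b≡a → b≢b′ (trans b≡a (sym b′≡a))) b≢x (a≢a′ ∘ sym) a′≢x)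
  ... | no b′≢a  = inj₂ (b′≡a′ , only-three b a a′ x a′≢x (λ b≡a′ → b≢b′ (trans b≡a′ (sym b′≡a′))) b≢x a≢a′ a≢x)
    where
    b′≡a′ : b′ ≡ a′
    b′≡a′ = only-three b′ a′ a x a≢x b′≢a b′≢x (a≢a′ ∘ sym) a′≢x

  pointwise : ∀ {A : Set} {n} {u v : Vec A n} → (∀ i → lookup u i ≡ lookup v i) → u ≡ v
  pointwise {u = u} {v} eq = trans (sym (tabulate∘lookup u)) (trans (tabulate-cong eq) (tabulate∘lookup v))

  module Rotation (Γ : RibbonGraph) where
    open RibbonGraph Γ
    open Ribbon Γ public

    _≟ᴴ_ : (g h : HalfEdge) → Dec (g ≡ h)
    _≟ᴴ_ = Finite._≟ᶠ_ finH

    rotate : HalfEdge → ℕ → HalfEdge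
    rotate h k = fold h next′ k

    rotate-+ : ∀ m {n} h → rotate h (m ℕ.+ n) ≡ rotate (rotate h n) m
    rotate-+ m h = fold-+ h next′ m

    rotate-end : ∀ h k → end (rotate h k) ≡ end h
    rotate-end h zero    = refl
    rotate-end h (suc k) = trans (next-end _) (rotate-end h k)

    rotate-injective : ∀ k {g h} → rotate g k ≡ rotate h k → g ≡ h
    rotate-injective zero    eq = eq
    rotate-injective (suc k) eq = rotate-injective k
      (trans (sym (strictlyInverseʳ next _)) (trans (cong prev eq) (strictlyInverseʳ next _)))

    module Orbit (r : HalfEdge) where

      private
        returns : Σ[ k ∈ ℕ ] rotate r (suc k) ≡ r
        returns with cyclic {r} {prev r} (sym (prev-end r))
        ... | k , eq = k , trans (cong next′ eq) (strictlyInverseˡ next r)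

        first = least (λ k → rotate r (suc k) ≟ᴴ r) (proj₁ returns) (proj₂ returns)

      period : ℕ
      period = suc (proj₁ first)

      rotate-period : rotate r period ≡ r
      rotate-period = proj₁ (proj₂ first)

      minimal : ∀ k → suc k ℕ.< period → rotate r (suc k) ≢ r
      minimal k k<p = proj₂ (proj₂ first) k (ℕₚ.≤-pred k<p)

      rotate-multiple : ∀ q → rotate r (q ℕ.* period) ≡ r
      rotate-multiple zero    = refl
      rotate-multiple (suc q) = trans (rotate-+ period r) (trans (cong (λ h → rotate h period) (rotate-multiple q)) rotate-period)

      rotate-% : ∀ k → rotate r (k % period) ≡ rotate r k
      rotate-% k = sym (trans (cong (rotate r) (m≡m%n+[m/n]*n k period)) (trans (rotate-+ (k % period) r)
        (cong (λ h → rotate h (k % period)) (rotate-multiple (k / period)))))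

      private
        no-early : ∀ {i j} → i ℕ.< j → j ℕ.< period → rotate r i ≢ rotate r j
        no-early {i} {j} i<j j<p eq with ℕₚ.m≤n⇒∃[o]m+o≡n i<j
        ... | o , refl = minimal o (ℕₚ.≤-trans (s≤s (ℕₚ.≤-trans (ℕₚ.m≤n+m (suc o) i) (ℕₚ.≤-reflexive (ℕₚ.+-suc i o)))) j<p)
          (sym (rotate-injective i (trans eq (trans (cong (rotate r) (sym (ℕₚ.+-suc i o))) (rotate-+ i r)))))

      rotate-injectiveʳ : ∀ {i j} → i ℕ.< period → j ℕ.< period → rotate r i ≡ rotate r j → i ≡ j
      rotate-injectiveʳ {i} {j} i<p j<p eq with ℕₚ.<-cmp i j
      ... | tri< i<j _ _ = contradiction eq (no-early i<j j<p)
      ... | tri≈ _ i≡j _ = i≡j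
      ... | tri> _ _ j<i = contradiction (sym eq) (no-early j<i i<p)

      period-∣ : ∀ k → rotate r k ≡ r → period ∣ k
      period-∣ k eq = divides (k / period) (trans (m≡m%n+[m/n]*n k period) (cong (ℕ._+ (k / period) ℕ.* period)
        (rotate-injectiveʳ {k % period} {0} (m%n<n k period) (s≤s z≤n) (trans (rotate-% k) eq))))

      -- The degree of a vertex is the length of its rotation orbit, so parity of the degree can be
      -- tested by walking once around.
      period-degree : HasDegree (end r) period
      period-degree = mk↔ₛ′ (λ (h , eq) → place h eq) (λ i → rotate r (toℕ i) , rotate-end r (toℕ i))
        (λ i → toℕ-injective (rotate-injectiveʳ {toℕ (place (rotate r (toℕ i)) (rotate-end r (toℕ i)))} {toℕ i}
          (toℕ<n _) (toℕ<n i) (rotate-place (rotate r (toℕ i)) (rotate-end r (toℕ i)))))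
        λ (h , eq) → fibre-≡ (rotate-place h eq)
        where
        place : ∀ h → end h ≡ end r → Fin period
        place h eq = fromℕ< (m%n<n (proj₁ (cyclic (sym eq))) period)

        rotate-place : ∀ h eq → rotate r (toℕ (place h eq)) ≡ h
        rotate-place h eq = let k , reaches = cyclic (sym eq) in
          trans (cong (rotate r) (toℕ-fromℕ< (m%n<n k period))) (trans (rotate-% k) reaches)

        fibre-≡ : ∀ {s t : Σ[ h ∈ HalfEdge ] end h ≡ end r} → proj₁ s ≡ proj₁ t → s ≡ t
        fibre-≡ {x , p} {.x , q} refl = cong (x ,_) (Decidable⇒UIP.≡-irrelevant (Finite._≟ᶠ_ finV) p q)

      degree-period : ∀ {d} → HasDegree (end r) d → d ≡ period
      degree-period deg = ↔⇒≡ (period-degree ↔-∘ ↔-sym deg)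

    module _ (connected : Connected) (h₀ : HalfEdge) where

      rooted : ∀ v → Σ[ h ∈ HalfEdge ] end h ≡ v
      rooted v = go (connected v (end h₀))
        where
        go : ∀ {v} → Star Adjacent v (end h₀) → Σ[ h ∈ HalfEdge ] end h ≡ v
        go ε                   = h₀ , refl
        go ((g , eq , _) ◅ _) = g , eq

      root : V → HalfEdge
      root v = proj₁ (rooted v)

      root-end : ∀ v → end (root v) ≡ v
      root-end v = proj₂ (rooted v)

  odd : ℕ → Bool
  odd zero    = false
  odd (suc n) = not (odd n)

  odd-+ : ∀ m n → odd (m ℕ.+ n) ≡ odd m xor odd n
  odd-+ zero    n = refl
  odd-+ (suc m) n = trans (cong not (odd-+ m n)) (Boolₚ.not-distribˡ-xor (odd m) (odd n))

  odd-*2 : ∀ q → odd (q ℕ.* 2) ≡ false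
  odd-*2 zero    = refl
  odd-*2 (suc q) = trans (Boolₚ.not-involutive _) (odd-*2 q)

  even⇒2∣ : ∀ n → odd n ≡ false → 2 ∣ n
  even⇒2∣ zero          _  = divides 0 refl
  even⇒2∣ (suc (suc n)) eq with even⇒2∣ n (trans (sym (Boolₚ.not-involutive (odd n))) eq)
  ... | divides q eq′ = divides (suc q) (cong (λ k → suc (suc k)) eq′)

  module TwoColours (Γ : RibbonGraph) where
    open RibbonGraph Γ
    open Rotation Γ
    open Admissibility Γ 2

    Alternating : Vec (Fin 2) _ → Set
    Alternating φ = ∀ h → at φ (next′ h) ≢ at φ h

    -- Neighbouring arcs meet at the end of some edge and therefore differ; at the right end this
    -- comes from `symmetric`.
    admissible⇒alternating : ∀ φ → Admissible φ → Alternating φ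
    admissible⇒alternating φ adm h eq = distinct (next′ h) (trans eq (cong (at φ) (sym (strictlyInverseʳ next h))))
      where
      distinct : ∀ h → at φ h ≢ at φ (prev h)
      distinct (e , false) = subst (λ e → at φ (e , false) ≢ at φ (prev (e , false))) (edge-edgeIndex e) (proj₂ (adm (edgeIndex e)))
      distinct (e , true) eq = contradiction (trans (sym (symmetric {φ} adm (δ (at φ (e , true))) (e , false)))
        (trans (cong (δ (at φ (e , true)) (at φ (e , true)) xor_) (cong (δ (at φ (e , true))) (sym eq))) (xor-self (δ (at φ (e , true)) (at φ (e , true))))))
        (differ (at φ (e , false)) (at φ (prev (e , false))) (at φ (e , true)) (distinct (e , false)))
        where
        differ : ∀ (a b c : Fin 2) → a ≢ b → ¬ (δ c a xor δ c b ≡ false)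
        differ = from-yes decision
          where
          decision : Dec (∀ (a b c : Fin 2) → a ≢ b → ¬ (δ c a xor δ c b ≡ false))
          decision = all? λ a → all? λ b → all? λ c → ¬? (a ≟ b) →-dec ¬? ((δ c a xor δ c b) Boolₚ.≟ false)

    -- With only two colours, distinct pairs at the two ends necessarily consist of the same colours
    -- and so fit one of the smoothings.
    alternating⇒admissible : ∀ φ → Alternating φ → Admissible φ
    alternating⇒admissible φ alt i = fits (at φ (prev (right i)) ≟ at φ (left i)) , distinct (left i)
      where
      distinct : ∀ h → at φ h ≢ at φ (prev h)
      distinct h eq = alt (prev h) (trans (cong (at φ) (strictlyInverseˡ next h)) eq)

      fits : Dec (at φ (prev (right i)) ≡ at φ (left i)) → _
      fits (yes p) = inj₁ (p , only-two _ _ (at φ (left i))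
        (λ eq → distinct (right i) (trans eq (sym p))) (λ eq → distinct (left i) (sym eq)))
      fits (no differs)  = inj₂ (only-two _ _ (at φ (left i)) differs (λ eq → distinct (left i) (sym eq)) ,
        only-two _ _ (at φ (prev (right i))) (distinct (right i)) (λ eq → differs (sym eq)))

    alternates : ∀ φ → Alternating φ → ∀ h k → (odd k ≡ false → at φ (rotate h k) ≡ at φ h) ×
                                                (odd k ≡ true → at φ (rotate h k) ≢ at φ h)
    alternates φ alt h zero = (λ _ → refl) , λ ()
    alternates φ alt h (suc k) with odd k in eq | alternates φ alt h k
    ... | false | same , _ = (λ ()) , λ _ p → alt (rotate h k) (trans p (sym (same refl)))
    ... | true  | _ , diff = (λ _ → only-two _ _ (at φ (rotate h k)) (alt (rotate h k)) (λ p → diff refl (sym p))) , λ ()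

    module _ (connected : Connected) (h₀ : HalfEdge) where

      private
        roots : V → HalfEdge
        roots = root connected h₀

      -- After a full turn the colour must return, whereas after an odd number of alternations it
      -- would have changed.
      admissible⇒eulerian : ∀ φ → Admissible φ → Eulerian
      admissible⇒eulerian φ adm v = subst (λ v → ∃[ d ] HasDegree v d × 2 ∣ d) (root-end connected h₀ v)
        (period , period-degree , even⇒2∣ period even)
        where
        open Orbit (roots v)
        even : odd period ≡ false
        even with odd period in eq
        ... | false = refl
        ... | true  = contradiction (cong (at φ) rotate-period)
          (proj₂ (alternates φ (admissible⇒alternating φ adm) (roots v) period) eq)

      module _ (eulerian : Eulerian) where

        private
          period-even : ∀ r → odd (Orbit.period r) ≡ false
          period-even r with eulerian (end r)
          ... | d , deg , divides q eq = trans (cong odd (trans (sym (Orbit.degree-period r deg)) eq)) (odd-*2 q)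

          odd-multiple : ∀ q p → odd p ≡ false → odd (q ℕ.* p) ≡ false
          odd-multiple zero    p eq = refl
          odd-multiple (suc q) p eq = trans (odd-+ p (q ℕ.* p)) (cong₂ _xor_ eq (odd-multiple q p eq))

          returns-evenly : ∀ r k → rotate r k ≡ r → odd k ≡ false
          returns-evenly r k eq with Orbit.period-∣ r k eq
          ... | divides q refl = odd-multiple q (Orbit.period r) (period-even r)

          position : ∀ h → Σ[ k ∈ ℕ ] rotate (roots (end h)) k ≡ h
          position h = cyclic (root-end connected h₀ (end h))

          -- The parity of the number of rotations from the root of the vertex. The number itself is
          -- only determined modulo the period, which is even in the Eulerian case.
          parity : HalfEdge → Bool
          parity h = odd (proj₁ (position h))

          same-parity-≤ : ∀ r {i j} → i ℕ.≤ j → rotate r i ≡ rotate r j → odd i ≡ odd j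
          same-parity-≤ r {i} i≤j eq with ℕₚ.m≤n⇒∃[o]m+o≡n i≤j
          ... | o , refl = sym (trans (odd-+ i o) (trans (cong (odd i xor_)
            (returns-evenly r o (sym (rotate-injective i (trans eq (rotate-+ i r)))))) (Boolₚ.xor-identityʳ (odd i))))

          same-parity : ∀ r i j → rotate r i ≡ rotate r j → odd i ≡ odd j
          same-parity r i j eq with ℕₚ.≤-total i j
          ... | inj₁ i≤j = same-parity-≤ r i≤j eq
          ... | inj₂ j≤i = sym (same-parity-≤ r j≤i (sym eq))

          parity-next : ∀ h → parity (next′ h) ≡ not (parity h)
          parity-next h = same-parity (roots (end h)) (proj₁ (position (next′ h))) (suc (proj₁ (position h)))
            (trans (cong (λ v → rotate (roots v) (proj₁ (position (next′ h)))) (sym (next-end h)))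
              (trans (proj₂ (position (next′ h))) (cong next′ (sym (proj₂ (position h))))))

          swapIf : Bool → Fin 2 → Fin 2
          swapIf false c  = c
          swapIf true  0F = 1F
          swapIf true  1F = 0F

          swapIf-injective : ∀ b c c′ → swapIf b c ≡ swapIf b c′ → c ≡ c′
          swapIf-injective false c  c′ eq = eq
          swapIf-injective true  0F 0F eq = refl
          swapIf-injective true  0F 1F ()
          swapIf-injective true  1F 0F ()
          swapIf-injective true  1F 1F eq = refl

          swapIf-not : ∀ b c → swapIf (not b) c ≢ swapIf b c
          swapIf-not false 0F ()
          swapIf-not false 1F ()
          swapIf-not true  0F ()
          swapIf-not true  1F ()

          vertexOf : HalfEdge → Fin #V
          vertexOf h = to (Finite.index finV) (end h)

          -- The alternating colouring with a prescribed colour at the root of each vertex; `sample`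
          -- reads those colours back.
          spread : Vec (Fin 2) #V → Vec (Fin 2) (Finite.size finH)
          spread c = tabulate λ k → let h = from (Finite.index finH) k in swapIf (parity h) (lookup c (vertexOf h))

          at-spread : ∀ c h → at (spread c) h ≡ swapIf (parity h) (lookup c (vertexOf h))
          at-spread c h = trans (lookup∘tabulate _ (to (Finite.index finH) h))
            (cong (λ h → swapIf (parity h) (lookup c (vertexOf h))) (strictlyInverseʳ (Finite.index finH) h))

          spread-alternating : ∀ c → Alternating (spread c)
          spread-alternating c h eq = swapIf-not (parity h) (lookup c (vertexOf h))
            (trans (sym (trans (at-spread c (next′ h)) (cong₂ swapIf (parity-next h)
              (cong (λ v → lookup c (to (Finite.index finV) v)) (next-end h))))) (trans eq (at-spread c h)))

          vertexOf-root : ∀ i → vertexOf (roots (from (Finite.index finV) i)) ≡ i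
          vertexOf-root i = trans (cong (to (Finite.index finV)) (root-end connected h₀ (from (Finite.index finV) i)))
            (strictlyInverseˡ (Finite.index finV) i)

          sample : Vec (Fin 2) (Finite.size finH) → Vec (Fin 2) #V
          sample φ = tabulate λ i → at φ (roots (from (Finite.index finV) i))

          sample-injective : ∀ φ φ′ → Admissible φ → Admissible φ′ → sample φ ≡ sample φ′ → φ ≡ φ′
          sample-injective φ φ′ adm adm′ eq = pointwise λ k →
            subst (λ k → lookup φ k ≡ lookup φ′ k) (strictlyInverseˡ (Finite.index finH) k) (same (from (Finite.index finH) k))
            where
            at-root : ∀ v → at φ (roots v) ≡ at φ′ (roots v)
            at-root v = subst (λ v → at φ (roots v) ≡ at φ′ (roots v)) (strictlyInverseʳ (Finite.index finV) v)
              (trans (sym (lookup∘tabulate _ (to (Finite.index finV) v)))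
                (trans (cong (λ w → lookup w (to (Finite.index finV) v)) eq) (lookup∘tabulate _ (to (Finite.index finV) v))))

            alt  = admissible⇒alternating φ adm
            alt′ = admissible⇒alternating φ′ adm′

            along : ∀ r → at φ r ≡ at φ′ r → ∀ k → at φ (rotate r k) ≡ at φ′ (rotate r k)
            along r eq zero    = eq
            along r eq (suc k) = only-two _ _ (at φ (rotate r k)) (alt (rotate r k))
              (λ p → alt′ (rotate r k) (trans p (along r eq k)))

            same : ∀ h → at φ h ≡ at φ′ h
            same h = subst (λ h → at φ h ≡ at φ′ h) (proj₂ (position h))
              (along (roots (end h)) (at-root (end h)) (proj₁ (position h)))

        count-eulerian : count admissible? ≡ length (colourings 2 #V)
        count-eulerian = ℕₚ.≤-antisym
          (length-≤ (Uniqueₚ.filter⁺ admissible? (colourings! 2 _)) sample (λ _ → ∈-colourings _)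
            λ u∈ v∈ → sample-injective _ _ (proj₂ (∈-filter⁻ admissible? {xs = colourings 2 _} u∈))
              (proj₂ (∈-filter⁻ admissible? {xs = colourings 2 _} v∈)))
          (length-≤ (colourings! 2 #V) spread
            (λ {c} _ → ∈-filter⁺ admissible? (∈-colourings (spread c)) (alternating⇒admissible (spread c) (spread-alternating c)))
            λ {c} {c′} _ _ eq → pointwise λ i → let h = roots (from (Finite.index finV) i) in
              subst (λ i → lookup c i ≡ lookup c′ i) (vertexOf-root i)
                (swapIf-injective (parity h) _ _ (trans (sym (at-spread c h)) (trans (cong (λ φ → at φ h) eq) (at-spread c′ h)))))

  module ThreeColours (Γ : RibbonGraph) where
    open RibbonGraph Γ
    open Rotation Γ
    open Admissibility Γ 3

    module _ (trivalent : Trivalent) where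

      private
        period-3 : ∀ h → 3 ≡ Orbit.period h
        period-3 h = Orbit.degree-period h (trivalent (end h))

        next³ : ∀ h → next′ (next′ (next′ h)) ≡ h
        next³ h = trans (cong (rotate h) (period-3 h)) (Orbit.rotate-period h)

        next≢ : ∀ h → next′ h ≢ h
        next≢ h = Orbit.minimal h 0 (subst (1 ℕ.<_) (period-3 h) (s≤s (s≤s z≤n)))

        next²≢ : ∀ h → next′ (next′ h) ≢ h
        next²≢ h = Orbit.minimal h 1 (subst (2 ℕ.<_) (period-3 h) (s≤s (s≤s (s≤s z≤n))))

        prev≡ : ∀ h → prev h ≡ next′ (next′ h)
        prev≡ h = trans (cong prev (sym (next³ h))) (strictlyInverseʳ next _)

        rotations : ∀ h k → rotate h k ≡ h ⊎ rotate h k ≡ next′ h ⊎ rotate h k ≡ next′ (next′ h)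
        rotations h zero = inj₁ refl
        rotations h (suc k) with rotations h k
        ... | inj₁ eq        = inj₂ (inj₁ (cong next′ eq))
        ... | inj₂ (inj₁ eq) = inj₂ (inj₂ (cong next′ eq))
        ... | inj₂ (inj₂ eq) = inj₁ (trans (cong next′ eq) (next³ h))

        neighbours : ∀ {h h′} → end h ≡ end h′ → h′ ≢ h → h′ ≡ next′ h ⊎ h′ ≡ next′ (next′ h)
        neighbours {h} eq differs with cyclic eq
        ... | k , refl with rotations h k
        ...   | inj₁ p = contradiction p differs
        ...   | inj₂ p = p

      module FromArcs (φ : Vec (Fin 3) (Finite.size finH)) (adm : Admissible φ) where

        distinct : ∀ h → at φ h ≢ at φ (prev h)
        distinct (e , false) = subst (λ e → at φ (e , false) ≢ at φ (prev (e , false))) (edge-edgeIndex e) (proj₂ (adm (edgeIndex e)))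
        distinct (e , true) eq = differ (at φ (e , false)) (at φ (prev (e , false))) (at φ (e , false)) (distinct (e , false))
          (δ-refl (at φ (e , false))) (trans (sym (symmetric {φ} adm (δ (at φ (e , false))) (e , false)))
            (trans (cong (λ c → δ (at φ (e , false)) (at φ (e , true)) xor δ (at φ (e , false)) c) (sym eq)) (xor-self (δ (at φ (e , false)) (at φ (e , true))))))
          where
          δ-refl : ∀ {n} (a : Fin n) → δ a a ≡ true
          δ-refl a with a ≟ a
          ... | yes _ = refl
          ... | no differs = contradiction refl differs
          differ : ∀ (a b c : Fin 3) → a ≢ b → δ c a ≡ true → ¬ (δ c a xor δ c b ≡ false)
          differ = from-yes decision
            where
            decision : Dec (∀ (a b c : Fin 3) → a ≢ b → δ c a ≡ true → ¬ (δ c a xor δ c b ≡ false))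
            decision = all? λ a → all? λ b → all? λ c →
              ¬? (a ≟ b) →-dec ((δ c a Boolₚ.≟ true) →-dec ¬? ((δ c a xor δ c b) Boolₚ.≟ false))

        next-≢ : ∀ h → at φ (next′ h) ≢ at φ h
        next-≢ h eq = distinct (next′ h) (trans eq (cong (at φ) (sym (strictlyInverseʳ next h))))

        next-≢-prev : ∀ h → at φ (next′ h) ≢ at φ (prev h)
        next-≢-prev h eq = next-≢ (next′ h) (trans (cong (at φ) (sym (prev≡ h))) (sym eq))

        -- The third colour at an end of an edge is the same at both ends.
        across : ∀ e → at φ (next′ (e , true)) ≡ at φ (next′ (e , false))
        across e = subst (λ e → at φ (next′ (e , true)) ≡ at φ (next′ (e , false))) (edge-edgeIndex e) (go (proj₁ (adm (edgeIndex e))))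
          where
          l = left (edgeIndex e)
          r = right (edgeIndex e)
          go : _ → at φ (next′ r) ≡ at φ (next′ l)
          go (inj₁ (p , q)) = only-three _ _ (at φ r) (at φ (prev r)) (distinct r) (next-≢ r) (next-≢-prev r)
            (λ eq → next-≢-prev l (trans eq q)) (λ eq → next-≢ l (trans eq p))
          go (inj₂ (p , q)) = only-three _ _ (at φ r) (at φ (prev r)) (distinct r) (next-≢ r) (next-≢-prev r)
            (λ eq → next-≢ l (trans eq q)) (λ eq → next-≢-prev l (trans eq p))

        across-half : ∀ h → at φ (next′ (proj₁ h , false)) ≡ at φ (next′ h)
        across-half (e , false) = refl
        across-half (e , true)  = sym (across e)

      -- At a trivalent vertex the arc beginning at the next half-edge is opposite to the edge, and
      -- its colour is the one missing from the two arcs beside that edge.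
      toEdges : Vec (Fin 3) (Finite.size finH) → Vec (Fin 3) #E
      toEdges φ = tabulate λ i → at φ (next′ (left i))

      lookup-toEdges : ∀ φ → Admissible φ → ∀ h → lookup (toEdges φ) (edgeIndex (proj₁ h)) ≡ at φ (next′ h)
      lookup-toEdges φ adm h = trans (lookup∘tabulate _ (edgeIndex (proj₁ h)))
        (trans (cong (λ e → at φ (next′ (e , false))) (edge-edgeIndex (proj₁ h))) (FromArcs.across-half φ adm h))

      -- Two edges at a vertex receive the colours of their opposite arcs, which are different arcs
      -- at that vertex and hence differently coloured.
      toEdges-proper : ∀ φ → Admissible φ → ProperEdgeColouring graph (toEdges φ)
      toEdges-proper φ adm i j i≢j same-end eq = go (neighbours same-end λ h′≡h → i≢j
          (trans (sym (strictlyInverseˡ (Finite.index finH) i)) (trans (cong (to (Finite.index finH)) (sym h′≡h)) (strictlyInverseˡ (Finite.index finH) j))))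
        where
        open FromArcs φ adm
        h  = from (Finite.index finH) i
        h′ = from (Finite.index finH) j
        eq′ : at φ (next′ h) ≡ at φ (next′ h′)
        eq′ = trans (sym (lookup-toEdges φ adm h)) (trans eq (lookup-toEdges φ adm h′))
        go : h′ ≡ next′ h ⊎ h′ ≡ next′ (next′ h) → _
        go (inj₁ p) = next-≢ (next′ h) (trans (cong (at φ ∘ next′) (sym p)) (sym eq′))
        go (inj₂ p) = next-≢ h (trans eq′ (trans (cong (at φ ∘ next′) p) (cong (at φ) (next³ h))))

      toEdges-injective : ∀ φ φ′ → Admissible φ → Admissible φ′ → toEdges φ ≡ toEdges φ′ → φ ≡ φ′
      toEdges-injective φ φ′ adm adm′ eq = pointwise λ k →
        subst (λ k → lookup φ k ≡ lookup φ′ k) (strictlyInverseˡ (Finite.index finH) k) (same (from (Finite.index finH) k))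
        where
        same : ∀ h → at φ h ≡ at φ′ h
        same h = subst (λ h → at φ h ≡ at φ′ h) (strictlyInverseˡ next h) (trans (sym (lookup-toEdges φ adm (prev h)))
          (trans (cong (λ c → lookup c (edgeIndex (proj₁ (prev h)))) eq) (lookup-toEdges φ′ adm′ (prev h))))

      colour : Vec (Fin 3) #E → HalfEdge → Fin 3
      colour c h = lookup c (edgeIndex (proj₁ h))

      proper-≢ : ∀ c → ProperEdgeColouring graph c → ∀ h h′ → h ≢ h′ → end h ≡ end h′ → colour c h ≢ colour c h′
      proper-≢ c proper h h′ h≢h′ same-end = subst₂ (λ h h′ → colour c h ≢ colour c h′) (back h) (back h′)
        (proper (to ix h) (to ix h′) (λ eq → h≢h′ (trans (sym (back h)) (trans (cong (from ix) eq) (back h′))))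
          (trans (cong end (back h)) (trans same-end (cong end (sym (back h′))))))
        where
        ix = Finite.index finH
        back = strictlyInverseʳ ix

      fromEdges : Vec (Fin 3) #E → Vec (Fin 3) (Finite.size finH)
      fromEdges c = tabulate λ k → colour c (prev (from (Finite.index finH) k))

      at-fromEdges : ∀ c h → at (fromEdges c) h ≡ colour c (prev h)
      at-fromEdges c h = trans (lookup∘tabulate _ (to (Finite.index finH) h))
        (cong (colour c ∘ prev) (strictlyInverseʳ (Finite.index finH) h))

      -- The two arcs at an end of an edge take the colours of the two other edges there, which
      -- differ from each other and from the edge's own colour. Both ends omit this same third
      -- colour, so `pairing` supplies a smoothing.
      fromEdges-admissible : ∀ c → ProperEdgeColouring graph c → Admissible (fromEdges c)
      fromEdges-admissible c proper i =
        pairing (at φ (left i)) (at φ (prev (left i))) (at φ (right i)) (at φ (prev (right i))) (colour c (left i))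
          (distinct (left i)) (distinct (right i)) (own₁ (left i)) (own₂ (left i)) (own₁ (right i)) (own₂ (right i)) ,
        distinct (left i)
        where
        φ = fromEdges c

        prev≢ : ∀ h → prev h ≢ h
        prev≢ h eq = next≢ h (trans (cong next′ (sym eq)) (strictlyInverseˡ next h))

        prev²≢ : ∀ h → prev (prev h) ≢ h
        prev²≢ h eq = next²≢ h (trans (cong (next′ ∘ next′) (sym eq)) (trans (cong next′ (strictlyInverseˡ next (prev h))) (strictlyInverseˡ next h)))

        distinct : ∀ h → at φ h ≢ at φ (prev h)
        distinct h eq = proper-≢ c proper (prev h) (prev (prev h)) (λ p → prev≢ (prev h) (sym p)) (sym (prev-end (prev h)))
          (trans (sym (at-fromEdges c h)) (trans eq (at-fromEdges c (prev h))))

        own₁ : ∀ h → at φ h ≢ colour c h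
        own₁ h eq = proper-≢ c proper (prev h) h (prev≢ h) (prev-end h) (trans (sym (at-fromEdges c h)) eq)

        own₂ : ∀ h → at φ (prev h) ≢ colour c h
        own₂ h eq = proper-≢ c proper (prev (prev h)) h (prev²≢ h) (trans (prev-end (prev h)) (prev-end h))
          (trans (sym (at-fromEdges c (prev h))) eq)

      fromEdges-injective : ∀ c c′ → fromEdges c ≡ fromEdges c′ → c ≡ c′
      fromEdges-injective c c′ eq = pointwise λ i → subst (λ i → lookup c i ≡ lookup c′ i)
        (strictlyInverseˡ (Finite.index finE) i) (subst (λ h → colour c h ≡ colour c′ h) (strictlyInverseʳ next (left i))
          (trans (sym (at-fromEdges c (next′ (left i)))) (trans (cong (λ φ → at φ (next′ (left i))) eq) (at-fromEdges c′ (next′ (left i))))))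

      count-trivalent : count admissible? ≡ #edgeColourings graph 3
      count-trivalent = ℕₚ.≤-antisym
        (count-≤ admissible? (properEdgeColouring? graph) toEdges toEdges-proper toEdges-injective)
        (count-≤ (properEdgeColouring? graph) admissible? fromEdges fromEdges-admissible λ c c′ _ _ → fromEdges-injective c c′)

-- Circle values, the ring Z[1/12], and assembly of the theorem.

open import Algebra.Bundles using (CommutativeRing)
open import Data.Bool.Base using (Bool; true; false)
open import Data.Fin.Base using (Fin; zero; suc)
open import Data.Fin.Properties using (¬Fin0)
open import Data.Integer.Base as ℤ using (ℤ; +_; -[1+_]; _≤_; _<_; +≤+; +<+; 0ℤ; 1ℤ)
import Data.Integer.Properties as ℤₚ
open import Data.Integer.Tactic.RingSolver using (solve-∀)
open import Data.List.Base using (List; []; _∷_; length; upTo; allFin)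
import Data.List.Base as List
open import Data.List.Membership.Propositional using (_∈_)
open import Data.List.Membership.Propositional.Properties using (∈-allFin)
open import Data.List.Properties using (length-upTo)
open import Data.List.Relation.Unary.Any using (here; there)
open import Data.Nat.Base using (ℕ; zero; suc; _>_; _*_; _^_; NonZero; ⌊_/2⌋; s≤s; z≤n)
import Data.Nat.Base as ℕ
import Data.Nat.Properties as ℕₚ
open import Data.Nat.Divisibility using (_∣_; divides)
open import Data.Product.Base using (Σ-syntax; _×_; _,_; proj₁; proj₂)
open import Data.Rational.Base as ℚ using (0ℚ; 1ℚ; _/_)
import Data.Rational.Properties as ℚₚ
open import Data.Sum.Base using (_⊎_)
open import Data.Vec.Base using (lookup; _[_]≔_)
open import Function.Base using (_∘_)
open import Function.Bundles using (_⇔_; mk⇔; module Equivalence; module Inverse)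
open import Relation.Binary.PropositionalEquality
open import Relation.Nullary using (¬_; Dec; yes; no; contradiction)
open LinAlg
open Cube
open HomRanks
open ListSum
open Euler
open States
open Penrose
open Colourings

+-^ : ∀ a n → (+ a) ℤ.^ n ≡ + (a ^ n)
+-^ a zero    = refl
+-^ a (suc n) = trans (cong ((+ a) ℤ.*_) (+-^ a n)) (sym (ℤₚ.pos-* a (a ^ n)))

∑ˡ-map-const : ∀ {A : Set} {f : A → ℤ} d (xs : List A) → (∀ x → f x ≡ d) → ∑ˡ (List.map f xs) ≡ + length xs ℤ.* d
∑ˡ-map-const d []       eq = sym (ℤₚ.*-zeroˡ d)
∑ˡ-map-const d (x ∷ xs) eq = trans (cong₂ ℤ._+_ (eq x) (∑ˡ-map-const d xs eq)) (sym (ℤₚ.suc-* (+ length xs) d))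

half-double : ∀ q → ⌊ q * 2 /2⌋ ≡ q
half-double zero    = refl
half-double (suc q) = cong suc (half-double q)

-- At q = 1 each of the n/2 summands becomes 2 + b, so the circle has value 3n for b = 1 and n for b
-- = -1.
circleEven-at-1 : ∀ q b → circleEven (q * 2) 1ℤ b ≡ + 2 ℤ.* (+ q ℤ.* (+ 2 ℤ.+ b))
circleEven-at-1 q b = cong (+ 2 ℤ.*_) (trans (Σˡ-cong term (upTo ⌊ q * 2 /2⌋))
  (trans (Σˡ-const (+ 2 ℤ.+ b) (upTo ⌊ q * 2 /2⌋))
    (cong (λ k → + k ℤ.* (+ 2 ℤ.+ b)) (trans (length-upTo _) (half-double q)))))
  where
  term : ∀ k → + 2 ℤ.* 1ℤ ℤ.^ (2 * k) ℤ.+ 1ℤ ℤ.^ suc (2 * k) ℤ.* b ≡ + 2 ℤ.+ b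
  term k = cong₂ ℤ._+_ (cong (+ 2 ℤ.*_) (ℤₚ.^-zeroˡ (2 * k)))
    (trans (cong (ℤ._* b) (ℤₚ.^-zeroˡ (suc (2 * k)))) (ℤₚ.*-identityˡ b))

circleEven-at-1,1 : ∀ {n} → 2 ∣ n → circleEven n 1ℤ (+ 1) ≡ + (3 * n)
circleEven-at-1,1 (divides q refl) = trans (circleEven-at-1 q (+ 1))
  (trans (regroup (+ q)) (trans (cong (+ 3 ℤ.*_) (sym (ℤₚ.pos-* q 2))) (sym (ℤₚ.pos-* 3 (q * 2)))))
  where
  regroup : ∀ x → + 2 ℤ.* (x ℤ.* + 3) ≡ + 3 ℤ.* (x ℤ.* + 2)
  regroup = solve-∀

circleEven-at-1,-1 : ∀ {n} → 2 ∣ n → circleEven n 1ℤ -[1+ 0 ] ≡ + n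
circleEven-at-1,-1 (divides q refl) = trans (circleEven-at-1 q -[1+ 0 ])
  (trans (regroup (+ q)) (sym (ℤₚ.pos-* q 2)))
  where
  regroup : ∀ x → + 2 ℤ.* (x ℤ.* + 1) ≡ x ℤ.* + 2
  regroup = solve-∀

circleOdd-at-1 : ∀ n → circleOdd n 1ℤ ≡ + (3 * n)
circleOdd-at-1 n = trans (cong (+ 3 ℤ.*_) (trans (Σˡ-cong ℤₚ.^-zeroˡ (upTo n))
  (trans (Σˡ-const 1ℤ (upTo n)) (trans (ℤₚ.*-identityʳ _) (cong +_ (length-upTo n))))))
  (sym (ℤₚ.pos-* 3 n))

module _ {A : Set} {f : A → ℤ} (f≥0 : ∀ x → 0ℤ ≤ f x) where

  Σˡ-nonNegative : ∀ xs → 0ℤ ≤ Σˡ f xs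
  Σˡ-nonNegative []       = ℤₚ.≤-refl
  Σˡ-nonNegative (x ∷ xs) = ℤₚ.+-mono-≤ (f≥0 x) (Σˡ-nonNegative xs)

  Σˡ-positive : ∀ {x xs} → x ∈ xs → 0ℤ < f x → 0ℤ < Σˡ f xs
  Σˡ-positive {xs = _ ∷ xs} (here refl) 0<fx = ℤₚ.+-mono-<-≤ 0<fx (Σˡ-nonNegative xs)
  Σˡ-positive {xs = y ∷ _} (there x∈xs) 0<fx = ℤₚ.+-mono-≤-< (f≥0 y) (Σˡ-positive x∈xs 0<fx)

ℚ-cancel : ∀ {p q} → p ≢ 0ℚ → p ℚ.* q ≡ 0ℚ → q ≡ 0ℚ
ℚ-cancel {p} {q} p≢0 pq≡0 = begin
  q                          ≡⟨ ℚₚ.*-identityˡ q ⟨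
  1ℚ ℚ.* q                   ≡⟨ cong (ℚ._* q) (ℚₚ.*-inverseˡ p) ⟨
  (ℚ.1/ p ℚ.* p) ℚ.* q       ≡⟨ ℚₚ.*-assoc (ℚ.1/ p) p q ⟩
  ℚ.1/ p ℚ.* (p ℚ.* q)       ≡⟨ cong (ℚ.1/ p ℚ.*_) pq≡0 ⟩
  ℚ.1/ p ℚ.* 0ℚ              ≡⟨ ℚₚ.*-zeroʳ (ℚ.1/ p) ⟩
  0ℚ                         ∎
  where
  open ≡-Reasoning
  instance
    p-nonZero : ℚ.NonZero p
    p-nonZero = ℚ.≢-nonZero p≢0

ℚ-2-cancel : ∀ {p} → p ℚ.+ p ≡ 0ℚ → p ≡ 0ℚ
ℚ-2-cancel {p} eq = ℚ-cancel {1ℚ ℚ.+ 1ℚ} (λ ()) (trans (ℚₚ.*-distribʳ-+ p 1ℚ 1ℚ)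
  (trans (cong₂ ℚ._+_ (ℚₚ.*-identityˡ p) (ℚₚ.*-identityˡ p)) eq))

ℤ[1/12] : CommutativeRing _ _
ℤ[1/12] = ℤ[1/ 12 ]

ℤ[1/12]-isDomain : IsDecidableDomain ℤ[1/12]
ℤ[1/12]-isDomain = record { _≈0? = λ x → proj₁ x ℚₚ.≟ 0ℚ ; 1≉0 = λ () ; cancel = ℚ-cancel }

1/12 : CommutativeRing.Carrier ℤ[1/12]
1/12 = + 1 / 12 , inv

module Homology₄ (Γ : RibbonGraph) where

  private
    Γ♭ = blowup Γ

    module Complex₄ = MöbiusOver.Complex ℤ[1/12] 1/12 4 Γ♭

    ∂-homogeneous : ∀ {a ε i} {v : Complex₄.Cochain i} →
      Complex₄.Homogeneous a ε v → Complex₄.Homogeneous a ε (Complex₄.∂ v)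
    -- The argument `refl` is the equation 12 · (1/12) = 1, checked by computing with rational
    -- numbers. The other argument classifies the edges of the cube of the blowup.
    ∂-homogeneous = CubeComplex.∂-homogeneous ℤ[1/12] 1/12 refl Γ♭ (BlowupStates.step Γ)

    ∂∂≈0 : ∀ {i} (v : Complex₄.Cochain i) g → proj₁ (Complex₄.∂ (Complex₄.∂ v) g) ≡ 0ℚ
    ∂∂≈0 v (Complex₄.generator α ∣α∣ L) =
      CubeComplex.∂∂≈0 ℤ[1/12] 1/12 refl Γ♭ (BlowupStates.step Γ) ℚ-2-cancel v α ∣α∣ L

  ranks : Ranks₄ Γ
  ranks = HomologyRanks.ranks ℤ[1/12] ℤ[1/12]-isDomain 1/12 4 Γ♭ ∂-homogeneous ∂∂≈0

  euler-characteristic : (ρ : Ranks₄ Γ) → evalAt1 (Q₄⁺ Γ ρ ⊖ Q₄⁻ Γ ρ) ≡ bracket (+ 4) Γ♭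
  euler-characteristic = EulerCharacteristic.euler-characteristic
    ℤ[1/12] ℤ[1/12]-isDomain 1/12 4 Γ♭ ∂-homogeneous ∂∂≈0

module _ (Γ : RibbonGraph) where
  open RibbonGraph Γ

  half-edge : HalfEdge
  half-edge = from (Finite.index finE) (first (Finite.size finE) nonempty) , false
    where
    open Inverse using (from)
    first : ∀ n → NonZero n → Fin n
    first (suc _) _ = zero

  >cw⇒positive : ∀ {n} (f g : Poly {n}) → f >cw g → 0ℤ < evalAt1 (f ⊖ g)
  >cw⇒positive f g (nonNegative , a , positive) = Σˡ-positive nonNegative (∈-allFin a) positive

  module _ (connected : Connected) (planar : Planar) where

    -- The single point through which (a) to (d) use planarity of Γ to evaluate the bracket. A
    -- half-edge exists because the edge set is nonempty, and it serves as root.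
    bracket≡count : ∀ d → bracket (+ d) (blowup Γ) ≡ + count (Admissibility.admissible? Γ d)
    bracket≡count d = Admissibility.bracket-count Γ d connected planar half-edge

    χ-≤-bracket : ∀ d → + χ dual d ≤ bracket (+ d) (blowup Γ)
    χ-≤-bracket d = ℤₚ.≤-trans (+≤+ (Admissibility.χ-≤-admissible Γ d)) (ℤₚ.≤-reflexive (sym (bracket≡count d)))

    bracket-eulerian : Eulerian → bracket (+ 2) (blowup Γ) ≡ + (2 ^ #V)
    bracket-eulerian eulerian = trans (bracket≡count 2)
      (trans (cong +_ (TwoColours.count-eulerian Γ connected half-edge eulerian))
        (trans (length-colourings 2 #V) (+-^ 2 #V)))

    bracket-¬eulerian : ¬ Eulerian → bracket (+ 2) (blowup Γ) ≡ 0ℤ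
    bracket-¬eulerian ¬eulerian = trans (bracket≡count 2) (cong +_ (ℕₚ.n≤0⇒n≡0 (ℕₚ.≮⇒≥ λ 0<count →
      let φ , adm = count-witness (Admissibility.admissible? Γ 2) 0<count in
      ¬eulerian (TwoColours.admissible⇒eulerian Γ connected half-edge φ adm))))

    bracket-trivalent : Trivalent → bracket (+ 3) (blowup Γ) ≡ + #edgeColourings graph 3
    bracket-trivalent trivalent = trans (bracket≡count 3) (cong +_ (ThreeColours.count-trivalent Γ trivalent))

    module _ (ρ : Ranks₄ Γ) where

      evaluation : evalAt1 (Q₄⁺ Γ ρ ⊖ Q₄⁻ Γ ρ) ≡ + count (Admissibility.admissible? Γ 4)
      evaluation = trans (Homology₄.euler-characteristic Γ ρ) (bracket≡count 4)

      -- The value at q = 1 is the number of admissible 4-colourings of the arcs, which is positive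
      -- exactly when Γ is 4-face colourable.
      colourable⇔positive : FaceColourable 4 ⇔ 0ℤ < evalAt1 (Q₄⁺ Γ ρ ⊖ Q₄⁻ Γ ρ)
      colourable⇔positive = mk⇔
        (λ colourable → subst (0ℤ <_) (sym evaluation) (+<+ (Equivalence.to equivalence colourable)))
        (λ positive → Equivalence.from equivalence (ℤₚ.drop‿+<+ (subst (0ℤ <_) evaluation positive)))
        where
        equivalence = FourColours.colourable⇔admissible Γ connected planar half-edge

      >cw⇒colourable : Q₄⁺ Γ ρ >cw Q₄⁻ Γ ρ → FaceColourable 4
      >cw⇒colourable = Equivalence.from colourable⇔positive ∘ >cw⇒positive (Q₄⁺ Γ ρ) (Q₄⁻ Γ ρ)

  -- There is at least one face, and it cannot be coloured with no colours. This matches the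
  -- convention that the 0-bracket is 0.
  χ-dual-0 : χ dual 0 ℕ.≤ 0
  χ-dual-0 = ℕₚ.≮⇒≥ λ 0<χ → ¬Fin0 (lookup (proj₁ (count-witness (properVertexColouring? dual) 0<χ)) (face half-edge))

theorem5p2p5 : (∀ (Γ : RibbonGraph) →
    let open RibbonGraph Γ in
    Connected → Planar →
    ((Eulerian → bracketEven (blowup Γ) 2 (+ 1) -[1+ 0 ] ≡ + (2 ^ #V)) ×
    (¬ Eulerian → bracketEven (blowup Γ) 2 (+ 1) -[1+ 0 ] ≡ + 0)) ×
    (Trivalent → bracketOdd (blowup Γ) 1 (+ 1) ≡ + #edgeColourings graph 3) ×
    (Ranks₄ Γ × (∀ (ρ : Ranks₄ Γ) →
    (FaceColourable 4 ⇔ + 0 < evalAt1 (Q₄⁺ Γ ρ ⊖ Q₄⁻ Γ ρ)) ×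
    (Q₄⁺ Γ ρ >cw Q₄⁻ Γ ρ → FaceColourable 4))) ×
    (∀ n → 2 ∣ n ⊎ 3 ∣ n →
    (n > 0 → 2 ∣ n →
    + χ dual (3 * n) ≤ bracketEven (blowup Γ) n (+ 1) (+ 1) ×
    + χ dual n ≤ bracketEven (blowup Γ) n (+ 1) -[1+ 0 ]) ×
    (¬ 2 ∣ n → + χ dual (3 * n) ≤ bracketOdd (blowup Γ) n (+ 1)) ×
    (n ≡ 0 → + χ dual 0 ≤ bracketEven (blowup Γ) n (+ 1) -[1+ 0 ]))) ×
    ((∀ (Γ : RibbonGraph) → let open RibbonGraph Γ in
    Connected → Planar → CoefficientwisePositive Γ) →
    FourColourTheorem) ×
    ((∀ (Γ : RibbonGraph) → let open RibbonGraph Γ in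
    Connected → Planar → Bridgeless → CoefficientwisePositive Γ) →
    FourColourTheorem)
theorem5p2p5 =
  (λ Γ connected planar →
    (bracket-eulerian Γ connected planar , bracket-¬eulerian Γ connected planar) ,
    bracket-trivalent Γ connected planar ,
    (Homology₄.ranks Γ , λ ρ →
      colourable⇔positive Γ connected planar ρ , >cw⇒colourable Γ connected planar ρ) ,
    λ n _ → χ-≤-even Γ connected planar n , χ-≤-odd Γ connected planar n , λ { refl → +≤+ (χ-dual-0 Γ) }) ,
  -- Positivity comes with its own system of ranks, and the criterion holds for every such system.
  (λ positive Γ connected planar _ →
    let ρ , >cw = positive Γ connected planar in >cw⇒colourable Γ connected planar ρ >cw) ,
  (λ positive Γ connected planar bridgeless →
    let ρ , >cw = positive Γ connected planar bridgeless in >cw⇒colourable Γ connected planar ρ >cw)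
  where
  module _ (Γ : RibbonGraph) (connected : RibbonGraph.Connected Γ) (planar : RibbonGraph.Planar Γ) where
    open RibbonGraph Γ

    at : ∀ {d} k → d ≡ + k → + χ dual k ≤ bracket d (blowup Γ)
    at k refl = χ-≤-bracket Γ connected planar k

    χ-≤-even : ∀ n → n > 0 → 2 ∣ n →
      + χ dual (3 * n) ≤ bracketEven (blowup Γ) n (+ 1) (+ 1) × + χ dual n ≤ bracketEven (blowup Γ) n (+ 1) -[1+ 0 ]
    χ-≤-even n@(suc _) _ 2∣n = at (3 * n) (circleEven-at-1,1 2∣n) , at n (circleEven-at-1,-1 2∣n)

    χ-≤-odd : ∀ n → ¬ 2 ∣ n → + χ dual (3 * n) ≤ bracketOdd (blowup Γ) n (+ 1)
    χ-≤-odd n _ = at (3 * n) (circleOdd-at-1 n)
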